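{- MB Dom Game is fixed-parameter tractable (FPT) when parameterized by the distance to cluster of the input graph.
   Context: All graphs are finite, simple and undirected. The Maker-Breaker domination game on a graph $G$ is played by Dominator and Staller, who alternately claim one unclaimed vertex of $G$. Dominator wins if the vertices she claims contain a dominating set of $G$; otherwise Staller wins. MB Dom Game is the problem: given a graph $G$ and the first player (Dominator or Staller), decide which player has a winning strategy in the Maker-Breaker domination game on $G$ with the given player moving first. FPT with parameter $p$ means solvable in time $f(p)\cdot |V(G)|^{O(1)}$ for some computable function $f$. A cluster is a disjoint union of cliques. The distance to cluster of $G$ is the minimum number of vertices to delete from $G$ to obtain a cluster. -}

module Defs where

open import Data.Bool using (Bool; true; false; T)
open import Data.Fin using (Fin)
open import Data.Fin.Subset using (Subset; _∈_; _∉_; _⊆_; _∪_; ⁅_⁆; ∣_∣) renaming (⊥ to ∅)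
open import Data.List using (List; []; _∷_; length; foldr; tabulate)
import Data.List.Membership.Propositional as List
open import Data.Nat using (ℕ; zero; suc; _+_; _*_; _^_; _≤_; _<_; _⊔_)
open import Data.Product using (Σ; ∃; ∃-syntax; _×_; _,_; proj₁)
open import Data.Sum using (_⊎_)
open import Data.Vec using (Vec; []; _∷_; lookup)
open import Function.Bundles using (_⇔_)
open import Relation.Binary.PropositionalEquality using (_≡_; _≢_)
open import Relation.Nullary using (¬_)

------------------------------------------------------------------------
-- Graphs

record Graph : Set where
  field
    order       : ℕ
    adjacent    : Fin order → Fin order → Bool
    symmetric   : ∀ u v → adjacent u v ≡ adjacent v u
    irreflexive : ∀ v → adjacent v v ≡ false

  Vertex : Set
  Vertex = Fin order

  Adj : Vertex → Vertex → Set
  Adj u v = T (adjacent u v)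

open Graph public

Dominating : (G : Graph) → Subset (order G) → Set
Dominating G D = ∀ v → v ∈ D ⊎ (∃[ u ] u ∈ D × Adj G u v)

-- G − X is a disjoint union of cliques: the remaining vertices are split into
-- parts, two distinct ones being adjacent exactly when they share a part.
ClusterAfterDeleting : (G : Graph) → Subset (order G) → Set
ClusterAfterDeleting G X =
  ∃[ m ] Σ (Vertex G → Fin m) λ part →
    ∀ u v → u ∉ X → v ∉ X → u ≢ v → Adj G u v ⇔ part u ≡ part v

DistanceToCluster : Graph → ℕ → Set
DistanceToCluster G k =
  (∃[ X ] ClusterAfterDeleting G X × ∣ X ∣ ≡ k) ×
  (∀ X → ClusterAfterDeleting G X → k ≤ ∣ X ∣)

------------------------------------------------------------------------
-- The Maker-Breaker domination game

data Player : Set where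
  Dominator Staller : Player

opponent : Player → Player
opponent Dominator = Staller
opponent Staller   = Dominator

-- The vertices claimed so far, most recent first.
History : Graph → Set
History G = List (Vertex G)

module _ (G : Graph) where

  Unclaimed : Vertex G → History G → Set
  Unclaimed v h = v List.∉ h

  turn : Player → History G → Player
  turn first []      = first
  turn first (_ ∷ h) = opponent (turn first h)

  claim : Player → Vertex G → Subset (order G) → Subset (order G)
  claim Dominator v D = ⁅ v ⁆ ∪ D
  claim Staller   v D = D

  dominatorSet : Player → History G → Subset (order G)
  dominatorSet first []      = ∅
  dominatorSet first (v ∷ h) = claim (turn first h) v (dominatorSet first h)

  -- The result of a finished play, in which every vertex has been claimed.
  WonBy : Player → Player → History G → Set
  WonBy first Dominator h = ∃[ D ] D ⊆ dominatorSet first h × Dominating G D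
  WonBy first Staller   h = ¬ WonBy first Dominator h

  Strategy : Set
  Strategy = (h : History G) → length h < order G → ∃[ v ] Unclaimed v h

  -- The histories that can arise when player p follows σ.
  data Consistent (first p : Player) (σ : Strategy) : History G → Set where
    start : Consistent first p σ []
    own   : ∀ {h} → Consistent first p σ h → turn first h ≡ p →
            (lt : length h < order G) →
            Consistent first p σ (proj₁ (σ h lt) ∷ h)
    other : ∀ {h v} → Consistent first p σ h → turn first h ≢ p →
            Unclaimed v h →
            Consistent first p σ (v ∷ h)

  Winning : (first p : Player) → Strategy → Set
  Winning first p σ =
    ∀ h → Consistent first p σ h → length h ≡ order G → WonBy first p h

  HasWinningStrategy : (first p : Player) → Set
  HasWinningStrategy first p = ∃[ σ ] Winning first p σ

------------------------------------------------------------------------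
-- Model of computation: first-order recursive programs over binary trees,
-- with unit cost for each evaluation step.  A tree can only be inspected by
-- looking at its root, so trees can be shared in memory and t steps take time
-- polynomial in t and the input size on a Turing machine.  Conversely, a
-- Turing machine step takes a constant number of steps here.

data Tree : Set where
  nil  : Tree
  cons : Tree → Tree → Tree

-- Expressions with n variables in scope that may call m unary functions.
data Exp (m n : ℕ) : Set where
  var  : Fin n → Exp m n
  nil  : Exp m n
  cons : Exp m n → Exp m n → Exp m n
  case : Exp m n → Exp m n → Exp m (2 + n) → Exp m n
  call : Fin m → Exp m n → Exp m n

record Program : Set where
  field
    {functions} : ℕ
    bodies      : Vec (Exp functions 1) functions
    main        : Exp functions 1

open Program public

-- bs , ρ ⊢ e ⇓ x [ t ]: under function bodies bs and environment ρ, the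
-- (call-by-value) evaluation of e yields x in t steps.
infix 4 _,_⊢_⇓_[_]
data _,_⊢_⇓_[_] {m : ℕ} (bs : Vec (Exp m 1) m) {n : ℕ} (ρ : Vec Tree n) :
                Exp m n → Tree → ℕ → Set where
  var⇓  : ∀ i → bs , ρ ⊢ var i ⇓ lookup ρ i [ 1 ]
  nil⇓  : bs , ρ ⊢ nil ⇓ nil [ 1 ]
  cons⇓ : ∀ {e₁ e₂ x₁ x₂ t₁ t₂} →
          bs , ρ ⊢ e₁ ⇓ x₁ [ t₁ ] →
          bs , ρ ⊢ e₂ ⇓ x₂ [ t₂ ] →
          bs , ρ ⊢ cons e₁ e₂ ⇓ cons x₁ x₂ [ suc (t₁ + t₂) ]
  case-nil⇓ :
          ∀ {e e₁ e₂ x t t₁} →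
          bs , ρ ⊢ e ⇓ nil [ t ] →
          bs , ρ ⊢ e₁ ⇓ x [ t₁ ] →
          bs , ρ ⊢ case e e₁ e₂ ⇓ x [ suc (t + t₁) ]
  case-cons⇓ :
          ∀ {e e₁ e₂ y z x t t₂} →
          bs , ρ ⊢ e ⇓ cons y z [ t ] →
          bs , y ∷ z ∷ ρ ⊢ e₂ ⇓ x [ t₂ ] →
          bs , ρ ⊢ case e e₁ e₂ ⇓ x [ suc (t + t₂) ]
  call⇓ : ∀ {g e y x t t′} →
          bs , ρ ⊢ e ⇓ y [ t ] →
          bs , y ∷ [] ⊢ lookup bs g ⇓ x [ t′ ] →
          bs , ρ ⊢ call g e ⇓ x [ suc (t + t′) ]

Runs : Program → Tree → Tree → ℕ → Set
Runs P input output t = bodies P , input ∷ [] ⊢ main P ⇓ output [ t ]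

------------------------------------------------------------------------
-- Encodings

encodeℕ : ℕ → Tree
encodeℕ zero    = nil
encodeℕ (suc n) = cons nil (encodeℕ n)

encodeBool : Bool → Tree
encodeBool false = nil
encodeBool true  = cons nil nil

encodeList : List Tree → Tree
encodeList = foldr cons nil

encodePlayer : Player → Tree
encodePlayer Dominator = cons nil nil
encodePlayer Staller   = nil

-- The adjacency matrix, row by row.
encodeGraph : Graph → Tree
encodeGraph G =
  encodeList (tabulate λ u → encodeList (tabulate λ v → encodeBool (adjacent G u v)))

------------------------------------------------------------------------
-- Fixed-parameter tractability

Computable : (ℕ → ℕ) → Set
Computable f = ∃[ P ] ∀ k → ∃[ t ] Runs P (encodeℕ k) (encodeℕ (f k)) t

-- Given a graph and the first player, find a player that is a correct answer.
GameProblem : Set₁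
GameProblem = (G : Graph) (first answer : Player) → Set

MBDomGame : GameProblem
MBDomGame = HasWinningStrategy

-- The parameter is given by its graph, as a functional relation.  It is not
-- part of the input.  The factor 1 ⊔ order G is |V(G)| except for the graph
-- without vertices, which must still be given a positive running time.
FixedParameterTractable : GameProblem → (Graph → ℕ → Set) → Set
FixedParameterTractable Answer Parameter =
  ∃[ P ] ∃[ f ] ∃[ c ] Computable f ×
    (∀ G first → ∃[ answer ] ∃[ t ]
      Runs P (cons (encodePlayer first) (encodeGraph G)) (encodePlayer answer) t ×
      Answer G first answer ×
      (∀ k → Parameter G k → t ≤ f k * (1 ⊔ order G) ^ c))

{-# OPTIONS --safe #-}
module Submission where

-- A set whose deletion leaves a cluster meets every induced path on three vertices,
-- so a maximal packing of such paths covers a set X of at most 3k vertices, and the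
-- remaining vertices form disjoint cliques.  Neither player profits from a third
-- vertex in the same clique with the same neighbours in X.  Cliques with the same
-- number of vertices of each type behave alike.  Six copies of a clique with at least
-- three vertices already let Dominator dominate all they can dominate by pairing
-- equal vertices of different copies, so further copies are redundant.  Copies of
-- a clique with one or two vertices become redundant when there are more of them than
-- there are states of the rest of the game: along a play that touches many copies
-- some state recurs, and the copies touched in between made no difference.
-- The size of the kernel that remains depends on k only, and the game on it is
-- solved by exhaustive search.
--
-- The algorithm is written in a small language with an interpreter among the
-- programs.  Every construct multiplies the running time by at most a power of a
-- number β that exceeds the lengths of all lists that are traversed, so for
-- each program there is an exponent that works for all inputs.

open import Data.Bool using (Bool; true; false; T; not; _∧_; _∨_; if_then_else_)
import Data.Bool.Properties as Bool
open import Data.Empty using (⊥; ⊥-elim)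
open import Data.Fin using (Fin; zero; suc; toℕ; #_; funToFin; finToFun)
import Data.Fin.Properties as Fin
import Data.Fin.Subset as Sub
import Data.Fin.Subset.Properties as SubP
open import Data.List using (List; []; _∷_; _++_; map; length; concatMap; replicate; cartesianProduct; tabulate; allFin; filterᵇ)
import Data.List as List using (lookup)
import Data.List.Properties as List
open import Data.List.Relation.Unary.All using (All; []; _∷_)
import Data.List.Relation.Unary.All as All
import Data.List.Relation.Unary.All.Properties as All
open import Data.List.Relation.Unary.Any using (Any; here; there)
import Data.List.Relation.Unary.Any as Any
import Data.List.Relation.Unary.Any.Properties as Any
open import Data.List.Relation.Binary.Pointwise using (Pointwise; []; _∷_)
import Data.List.Relation.Binary.Pointwise as Pointwise
open import Data.List.Relation.Binary.Permutation.Propositional using (_↭_; refl; prep; swap; ↭-sym; ↭-trans; ↭-reflexive) renaming (trans to transit)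
import Data.List.Relation.Binary.Permutation.Propositional.Properties as Perm
open import Data.List.Membership.Propositional using (_∈_; _∉_; find; lose)
import Data.List.Membership.Propositional.Properties as Mem
import Data.Nat using (_<ᵇ_)
import Data.Sum using (map)
open import Data.Maybe using (Maybe; just; nothing)
import Data.List.Relation.Unary.AllPairs.Properties as AllPairs
open import Data.List.Relation.Unary.AllPairs using (AllPairs; []; _∷_)
open import Data.Nat using (ℕ; zero; suc; _+_; _*_; _^_; _∸_; _≤_; _<_; _⊔_; z≤n; s≤s; s≤s⁻¹)
import Data.Nat.Properties as ℕ
open import Data.Product using (Σ; ∃; ∃-syntax; ∃₂; _×_; _,_; proj₁; proj₂)
open import Data.Sum using (_⊎_; inj₁; inj₂; [_,_]′)
open import Data.Unit using (⊤; tt)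
open import Data.Vec using (Vec; []; _∷_; lookup)
import Data.Vec.Properties as Vec
open import Function using (_∘_; _$_; id; case_of_)
open import Function.Bundles using (Equivalence)
open import Data.Nat.Tactic.RingSolver using (solve-∀)
open import Relation.Binary.Definitions using (DecidableEquality)
open import Relation.Binary.PropositionalEquality using (_≡_; _≢_; refl; sym; trans; cong; cong₂; subst; subst₂)
open import Data.Sum.Properties using () renaming (≡-dec to ⊎-≡-dec)
open import Data.Product.Properties using () renaming (≡-dec to ×-≡-dec)
open import Data.List.Relation.Unary.Unique.Propositional using (Unique)
import Data.List.Relation.Unary.Unique.Propositional.Properties as Uniq
open import Relation.Nullary using (¬_; ¬?; Dec; yes; no; does; _×-dec_)

open import Defs

-- A slot is a vertex seen from a position: claimed by Dominator, claimed by
-- Staller, or free.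
data Slot : Set where
  ● ○ □ : Slot

mark : Player → Slot
mark Dominator = ●
mark Staller   = ○

data Claimed : Slot → Set where
  ● : Claimed ●
  ○ : Claimed ○

-- A group of at most two vertices; a missing second vertex is an ○.
Item : Set → Set
Item A = A × Slot × Slot

Position : Set → Set
Position A = List (Item A)

data Step {A : Set} (c : Slot) : Item A → Item A → Set where
  fst : ∀ {a y} → Step c (a , □ , y) (a , c , y)
  snd : ∀ {a x} → Step c (a , x , □) (a , x , c)

data Move {A : Set} (c : Slot) : Position A → Position A → Set where
  here  : ∀ {x y L} → Step c x y → Move c (x ∷ L) (y ∷ L)
  there : ∀ {x L M} → Move c L M → Move c (x ∷ L) (x ∷ M)

FullItem : {A : Set} → Item A → Set
FullItem (_ , x , y) = Claimed x × Claimed y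

Full : {A : Set} → Position A → Set
Full = All FullItem

variable
  A B : Set
  L M N Z : Position A
  c : Slot
  p q : Player

full⊎move : (L : Position A) → Full L ⊎ (∀ c → ∃ (Move c L))
full⊎move [] = inj₁ []
full⊎move ((a , □ , y) ∷ L) = inj₂ λ c → _ , here fst
full⊎move ((a , ● , □) ∷ L) = inj₂ λ c → _ , here snd
full⊎move ((a , ○ , □) ∷ L) = inj₂ λ c → _ , here snd
full⊎move ((a , ● , ●) ∷ L) = [ (λ f → inj₁ ((● , ●) ∷ f)) , (λ m → inj₂ λ c → _ , there (proj₂ (m c))) ]′ (full⊎move L)
full⊎move ((a , ● , ○) ∷ L) = [ (λ f → inj₁ ((● , ○) ∷ f)) , (λ m → inj₂ λ c → _ , there (proj₂ (m c))) ]′ (full⊎move L)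
full⊎move ((a , ○ , ●) ∷ L) = [ (λ f → inj₁ ((○ , ●) ∷ f)) , (λ m → inj₂ λ c → _ , there (proj₂ (m c))) ]′ (full⊎move L)
full⊎move ((a , ○ , ○) ∷ L) = [ (λ f → inj₁ ((○ , ○) ∷ f)) , (λ m → inj₂ λ c → _ , there (proj₂ (m c))) ]′ (full⊎move L)

full-stuck : Full L → ¬ Move c L M
full-stuck ((() , _) ∷ _) (here fst)
full-stuck ((_ , ()) ∷ _) (here snd)
full-stuck (_ ∷ f) (there m) = full-stuck f m

freeSlot : Slot → ℕ
freeSlot □ = 1
freeSlot _ = 0

free : Position A → ℕ
free [] = 0
free ((_ , x , y) ∷ L) = freeSlot x + freeSlot y + free L

freeSlot-claimed : Claimed c → freeSlot c ≡ 0
freeSlot-claimed ● = refl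
freeSlot-claimed ○ = refl

free-move : Claimed c → Move c L M → free L ≡ suc (free M)
free-move cl (here fst) rewrite freeSlot-claimed cl = refl
free-move {c = c} cl (here (snd {x = x})) rewrite freeSlot-claimed cl | ℕ.+-identityʳ (freeSlot x) | ℕ.+-comm (freeSlot x) 1 = refl
free-move cl (there {x = _ , x , y} m) rewrite free-move cl m = ℕ.+-suc (freeSlot x + freeSlot y) _

-- W Ω p L: Dominator can force a full position satisfying Ω when p moves at L.
data W {A : Set} (Ω : Position A → Set) : Player → Position A → Set where
  over : Full L → Ω L → W Ω p L
  dom  : Move ● L M → W Ω Staller M → W Ω Dominator L
  sta  : ∃ (Move ○ L) → (∀ {M} → Move ○ L M → W Ω Dominator M) → W Ω Staller L

data SW {A : Set} (Ω : Position A → Set) : Player → Position A → Set where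
  over : Full L → ¬ Ω L → SW Ω p L
  sta  : Move ○ L M → SW Ω Dominator M → SW Ω Staller L
  dom  : ∃ (Move ● L) → (∀ {M} → Move ● L M → SW Ω Staller M) → SW Ω Dominator L

W-full : {Ω : Position A → Set} → Full L → W Ω p L → Ω L
W-full f (over _ ω)      = ω
W-full f (dom m _)       = ⊥-elim (full-stuck f m)
W-full f (sta (_ , m) _) = ⊥-elim (full-stuck f m)

SW-full : {Ω : Position A → Set} → Full L → SW Ω p L → ¬ Ω L
SW-full f (over _ ¬ω)     = ¬ω
SW-full f (sta m _)       = ⊥-elim (full-stuck f m)
SW-full f (dom (_ , m) _) = ⊥-elim (full-stuck f m)

not-both : {Ω : Position A → Set} → W Ω p L → SW Ω p L → ⊥
not-both (over _ ω) (over _ ¬ω)       = ¬ω ω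
not-both (over f _) (sta m _)         = full-stuck f m
not-both (over f _) (dom (_ , m) _)   = full-stuck f m
not-both (dom m _) (over f _)         = full-stuck f m
not-both (dom m w) (dom _ g)          = not-both w (g m)
not-both (sta (_ , m) _) (over f _)   = full-stuck f m
not-both (sta _ g) (sta m w)          = not-both (g m) w

any-move⊎all : {P Q : Position A → Set} → (∀ {M} → Move c L M → P M ⊎ Q M) →
               (∃[ M ] Move c L M × P M) ⊎ (∀ {M} → Move c L M → Q M)
any-move⊎all {L = []} d = inj₂ λ ()
any-move⊎all {c = c} {L = (a , x , y) ∷ L} {P} {Q} d = first x y d
  where
  rest : ∀ x y → (∀ {M} → Move c ((a , x , y) ∷ L) M → P M ⊎ Q M) →
         (∀ {z} → Step c (a , x , y) z → Q (z ∷ L)) →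
         (∃[ M ] Move c ((a , x , y) ∷ L) M × P M) ⊎ (∀ {M} → Move c ((a , x , y) ∷ L) M → Q M)
  rest x y d h with any-move⊎all {L = L} (λ m → d (there m))
  ... | inj₁ (M , m , π) = inj₁ (_ , there m , π)
  ... | inj₂ g = inj₂ λ { (here s) → h s ; (there m) → g m }
  first : ∀ x y → (∀ {M} → Move c ((a , x , y) ∷ L) M → P M ⊎ Q M) →
          (∃[ M ] Move c ((a , x , y) ∷ L) M × P M) ⊎ (∀ {M} → Move c ((a , x , y) ∷ L) M → Q M)
  first □ y d with d (here fst)
  first □ y d | inj₁ π = inj₁ (_ , here fst , π)
  first □ □ d | inj₂ κ with d (here snd)
  first □ □ d | inj₂ κ | inj₁ π = inj₁ (_ , here snd , π)
  first □ □ d | inj₂ κ | inj₂ κ′ = rest □ □ d λ { fst → κ ; snd → κ′ }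
  first □ ● d | inj₂ κ = rest □ ● d λ { fst → κ }
  first □ ○ d | inj₂ κ = rest □ ○ d λ { fst → κ }
  first ● □ d with d (here snd)
  ... | inj₁ π = inj₁ (_ , here snd , π)
  ... | inj₂ κ = rest ● □ d λ { snd → κ }
  first ○ □ d with d (here snd)
  ... | inj₁ π = inj₁ (_ , here snd , π)
  ... | inj₂ κ = rest ○ □ d λ { snd → κ }
  first ● ● d = rest ● ● d λ ()
  first ● ○ d = rest ● ○ d λ ()
  first ○ ● d = rest ○ ● d λ ()
  first ○ ○ d = rest ○ ○ d λ ()

flip⊎ : {P Q : Set} → P ⊎ Q → Q ⊎ P
flip⊎ (inj₁ x) = inj₂ x
flip⊎ (inj₂ x) = inj₁ x

determined : {Ω : Position A → Set} → (∀ L → Ω L ⊎ ¬ Ω L) → ∀ p L → W Ω p L ⊎ SW Ω p L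
determined {A} {Ω} Ω? p L = go (free L) p L refl
  where
  go : ∀ n p L → free L ≡ n → W Ω p L ⊎ SW Ω p L
  go n p L eq with full⊎move L
  go n p L eq | inj₁ f = [ (λ ω → inj₁ (over f ω)) , (λ ω → inj₂ (over f ω)) ]′ (Ω? L)
  go zero p L eq | inj₂ m with () ← trans (sym eq) (free-move ● (proj₂ (m ●)))
  go (suc n) Dominator L eq | inj₂ m
    with any-move⊎all (λ {M} mv → go n Staller M (ℕ.suc-injective (trans (sym (free-move ● mv)) eq)))
  ... | inj₁ (M , mv , w) = inj₁ (dom mv w)
  ... | inj₂ g = inj₂ (dom (m ●) g)
  go (suc n) Staller L eq | inj₂ m
    with any-move⊎all (λ {M} mv → flip⊎ (go n Dominator M (ℕ.suc-injective (trans (sym (free-move ○ mv)) eq))))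
  ... | inj₁ (M , mv , w) = inj₂ (sta mv w)
  ... | inj₂ g = inj₁ (sta (m ○) g)

data _≼_ : Slot → Slot → Set where
  bot : ∀ {t} → ○ ≼ t
  top : ∀ {s} → s ≼ ●
  mid : □ ≼ □

data _⊑_ {A : Set} : Item A → Item A → Set where
  _,_ : ∀ {a x y x′ y′} → x ≼ x′ → y ≼ y′ → (a , x , y) ⊑ (a , x′ , y′)

infix 4 _≼_ _⊑_ _⊑*_
_⊑*_ : Position A → Position A → Set
_⊑*_ = Pointwise _⊑_

≼-refl : ∀ {s} → s ≼ s
≼-refl {●} = top
≼-refl {○} = bot
≼-refl {□} = mid

⊑-refl : {x : Item A} → x ⊑ x
⊑-refl {x = _ , _ , _} = ≼-refl , ≼-refl

⊑*-refl : L ⊑* L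
⊑*-refl = Pointwise.refl ⊑-refl

Monotone : (Position A → Set) → Set
Monotone Ω = ∀ {L M} → L ⊑* M → Ω L → Ω M

⊑*-staller : L ⊑* M → Move ○ L N → N ⊑* M
⊑*-staller ((_ , y) ∷ r) (here fst) = (bot , y) ∷ r
⊑*-staller ((x , _) ∷ r) (here snd) = (x , bot) ∷ r
⊑*-staller (x ∷ r) (there m) = x ∷ ⊑*-staller r m

⊑*-dominator : L ⊑* M → Move ● M N → L ⊑* N
⊑*-dominator ((_ , y) ∷ r) (here fst) = (top , y) ∷ r
⊑*-dominator ((x , _) ∷ r) (here snd) = (x , top) ∷ r
⊑*-dominator (x ∷ r) (there m) = x ∷ ⊑*-dominator r m

mirror-staller : L ⊑* M → Move ○ M N → (∃[ K ] Move ○ L K × K ⊑* N) ⊎ L ⊑* N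
mirror-staller ((bot , y) ∷ r) (here fst) = inj₂ ((bot , y) ∷ r)
mirror-staller ((mid , y) ∷ r) (here fst) = inj₁ (_ , here fst , (bot , y) ∷ r)
mirror-staller ((x , bot) ∷ r) (here snd) = inj₂ ((x , bot) ∷ r)
mirror-staller ((x , mid) ∷ r) (here snd) = inj₁ (_ , here snd , (x , bot) ∷ r)
mirror-staller (x ∷ r) (there m) with mirror-staller r m
... | inj₁ (K , m′ , r′) = inj₁ (_ , there m′ , x ∷ r′)
... | inj₂ r′ = inj₂ (x ∷ r′)

mirror-dominator : L ⊑* M → Move ● L N → (∃[ K ] Move ● M K × N ⊑* K) ⊎ N ⊑* M
mirror-dominator ((top , y) ∷ r) (here fst) = inj₂ ((top , y) ∷ r)
mirror-dominator ((mid , y) ∷ r) (here fst) = inj₁ (_ , here fst , (top , y) ∷ r)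
mirror-dominator ((x , top) ∷ r) (here snd) = inj₂ ((x , top) ∷ r)
mirror-dominator ((x , mid) ∷ r) (here snd) = inj₁ (_ , here snd , (x , top) ∷ r)
mirror-dominator (x ∷ r) (there m) with mirror-dominator r m
... | inj₁ (K , m′ , r′) = inj₁ (_ , there m′ , x ∷ r′)
... | inj₂ r′ = inj₂ (x ∷ r′)

-- Being on the move never hurts Dominator.
data _⇝_ : Player → Player → Set where
  stay  : p ⇝ p
  tempo : Staller ⇝ Dominator

module _ {Ω : Position A → Set} (mono : Monotone Ω) where

  W-finished : L ⊑* M → Full M → W Ω p L → Ω M
  W-finished r f (over _ ω) = mono r ω
  W-finished r f (dom m w) with mirror-dominator r m
  ... | inj₁ (_ , m′ , _) = ⊥-elim (full-stuck f m′)
  ... | inj₂ r′ = W-finished r′ f w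
  W-finished r f (sta (_ , m) g) = W-finished (⊑*-staller r m) f (g m)

  W-won : ∀ n → free M ≡ n → Full L → Ω L → L ⊑* M → W Ω p M
  W-won {M = M} n eq f ω r with full⊎move M
  W-won n eq f ω r | inj₁ f′ = over f′ (mono r ω)
  W-won zero eq f ω r | inj₂ m with () ← trans (sym eq) (free-move ● (proj₂ (m ●)))
  W-won {p = Dominator} (suc n) eq f ω r | inj₂ m =
    dom (proj₂ (m ●)) (W-won n (ℕ.suc-injective (trans (sym (free-move ● (proj₂ (m ●)))) eq)) f ω (⊑*-dominator r (proj₂ (m ●))))
  W-won {p = Staller} (suc n) eq f ω r | inj₂ m = sta (m ○) λ mv →
    case mirror-staller r mv of λ
      { (inj₁ (_ , m′ , _)) → ⊥-elim (full-stuck f m′)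
      ; (inj₂ r′) → W-won n (ℕ.suc-injective (trans (sym (free-move ○ mv)) eq)) f ω r′ }

  MonoAt : ℕ → Set
  MonoAt n = ∀ {p q L M} → free M ≡ n → p ⇝ q → L ⊑* M → W Ω p L → W Ω q M

  mono-step : ∀ {n} → MonoAt n → MonoAt (suc n)
  mono-step {n} ih {M = M} eq t r w with full⊎move M
  ... | inj₁ f = over f (W-finished r f w)
  ... | inj₂ m = go t r w
    where
    fuel : ∀ {c N} → Claimed c → Move c M N → free N ≡ n
    fuel cl mv = ℕ.suc-injective (trans (sym (free-move cl mv)) eq)
    go : ∀ {p q L} → p ⇝ q → L ⊑* M → W Ω p L → W Ω q M
    go t r (over f ω) = W-won (suc n) eq f ω r
    go stay r (dom mv w) with mirror-dominator r mv
    ... | inj₁ (_ , m′ , r′) = dom m′ (ih (fuel ● m′) stay r′ w)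
    ... | inj₂ r′ = go tempo r′ w
    go tempo r (sta (_ , mv) g) = go stay (⊑*-staller r mv) (g mv)
    go stay r (sta e g) = sta (m ○) λ mv →
      case mirror-staller r mv of λ
        { (inj₁ (_ , m′ , r′)) → ih (fuel ○ mv) stay r′ (g m′)
        ; (inj₂ r′) → ih (fuel ○ mv) tempo r′ (sta e g) }

  mono-at : ∀ n → MonoAt n
  mono-at zero {M = M} eq t r w with full⊎move M
  ... | inj₁ f = over f (W-finished r f w)
  ... | inj₂ m with () ← trans (sym eq) (free-move ● (proj₂ (m ●)))
  mono-at (suc n) = mono-step (mono-at n)

  W-mono : L ⊑* M → W Ω p L → W Ω p M
  W-mono = mono-at _ refl stay

data _↝_ : Slot → Slot → Set where
  keep : ∀ {s} → s ↝ s
  fill : ∀ {s} → □ ↝ s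

Reach : Position A → Position A → Set
Reach = Pointwise λ (a , x , y) (a′ , x′ , y′) → a ≡ a′ × x ↝ x′ × y ↝ y′

Reach-refl : Reach L L
Reach-refl = Pointwise.refl (refl , keep , keep)

Reach-move : Move c L M → Reach M N → Reach L N
Reach-move (here fst) ((refl , _ , r) ∷ rs) = (refl , fill , r) ∷ rs
Reach-move (here snd) ((refl , r , _) ∷ rs) = (refl , r , fill) ∷ rs
Reach-move (there m) (r ∷ rs) = r ∷ Reach-move m rs

W-weaken : {Ω Ω′ : Position A → Set} → (∀ {M} → Reach L M → Full M → Ω M → Ω′ M) → W Ω p L → W Ω′ p L
W-weaken h (over f ω) = over f (h Reach-refl f ω)
W-weaken h (dom m w) = dom m (W-weaken (λ r → h (Reach-move m r)) w)
W-weaken h (sta e g) = sta e λ m → W-weaken (λ r → h (Reach-move m r)) (g m)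

Move-↭ : L ↭ M → Move c L N → ∃[ K ] Move c M K × N ↭ K
Move-↭ refl m = _ , m , refl
Move-↭ (prep x r) (here s) = _ , here s , prep _ r
Move-↭ (prep x r) (there m) with Move-↭ r m
... | _ , m′ , r′ = _ , there m′ , prep x r′
Move-↭ (swap x y r) (here s) = _ , there (here s) , swap _ y r
Move-↭ (swap x y r) (there (here s)) = _ , here s , swap x _ r
Move-↭ (swap x y r) (there (there m)) with Move-↭ r m
... | _ , m′ , r′ = _ , there (there m′) , swap x y r′
Move-↭ (transit r r₁) m with Move-↭ r m
... | _ , m′ , r′ with Move-↭ r₁ m′
... | _ , m″ , r″ = _ , m″ , ↭-trans r′ r″

Symmetric : (Position A → Set) → Set
Symmetric Ω = ∀ {L M} → L ↭ M → Ω L → Ω M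

W-↭ : {Ω : Position A → Set} → Symmetric Ω → L ↭ M → W Ω p L → W Ω p M
W-↭ s r (over f ω) = over (Perm.All-resp-↭ r f) (s r ω)
W-↭ s r (dom m w) with Move-↭ r m
... | _ , m′ , r′ = dom m′ (W-↭ s r′ w)
W-↭ s r (sta (_ , m) g) = sta (_ , proj₁ (proj₂ (Move-↭ r m))) λ m₁ →
  case Move-↭ (↭-sym r) m₁ of λ (_ , m′ , r′) → W-↭ s (↭-sym r′) (g m′)

Move-++ˡ : Move c L M → Move c (L ++ Z) (M ++ Z)
Move-++ˡ (here s) = here s
Move-++ˡ (there m) = there (Move-++ˡ m)

Move-++ʳ : ∀ (P : Position A) → Move c L M → Move c (P ++ L) (P ++ M)
Move-++ʳ [] m = m
Move-++ʳ (x ∷ P) m = there (Move-++ʳ P m)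

Move-++⁻ : ∀ (P : Position A) → Move c (P ++ L) N →
           (∃[ Q ] Move c P Q × N ≡ Q ++ L) ⊎ (∃[ M ] Move c L M × N ≡ P ++ M)
Move-++⁻ [] m = inj₂ (_ , m , refl)
Move-++⁻ (x ∷ P) (here s) = inj₁ (_ , here s , refl)
Move-++⁻ (x ∷ P) (there m) with Move-++⁻ P m
... | inj₁ (Q , m′ , refl) = inj₁ (_ , there m′ , refl)
... | inj₂ (M , m′ , refl) = inj₂ (_ , m′ , refl)

W-prefix : ∀ {Ω} (P : Position A) → Full P → W (λ L → Ω (P ++ L)) p L → W Ω p (P ++ L)
W-prefix P fp (over f ω) = over (All.++⁺ fp f) ω
W-prefix P fp (dom m w) = dom (Move-++ʳ P m) (W-prefix P fp w)
W-prefix P fp (sta (_ , m) g) = sta (_ , Move-++ʳ P m) λ m₁ → case Move-++⁻ P m₁ of λ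
  { (inj₁ (_ , m′ , _)) → ⊥-elim (full-stuck fp m′)
  ; (inj₂ (_ , m′ , refl)) → W-prefix P fp (g m′) }

W-unprefix : ∀ {Ω} (P : Position A) → Full P → W Ω p (P ++ L) → W (λ L → Ω (P ++ L)) p L
W-unprefix P fp (over f ω) = over (All.++⁻ʳ P f) ω
W-unprefix P fp (dom m w) with Move-++⁻ P m
... | inj₁ (_ , m′ , _) = ⊥-elim (full-stuck fp m′)
... | inj₂ (_ , m′ , refl) = dom m′ (W-unprefix P fp w)
W-unprefix {L = L} P fp (sta (_ , m) g) with Move-++⁻ P m
... | inj₁ (_ , m′ , _) = ⊥-elim (full-stuck fp m′)
... | inj₂ (_ , m′ , refl) = sta (_ , m′) λ m₁ → W-unprefix P fp (g (Move-++ʳ P m₁))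

-- Two vertices of a position, the others being fixed.
record Gadget (g : Slot → Slot → Position A) : Set where
  field
    left   : ∀ {c y} → Move c (g □ y) (g c y)
    right  : ∀ {c x} → Move c (g x □) (g x c)
    only   : ∀ {c x y} → Move c (g x y) N → (x ≡ □ × N ≡ g c y) ⊎ (y ≡ □ × N ≡ g x c)
    filled : ∀ {x y} → Claimed x → Claimed y → Full (g x y)

module _ {Ω : Position A → Set} (g : Slot → Slot → Position A) (G : Gadget g) where
  open Gadget G

  pair-D : W (λ L → Ω (g ● ○ ++ L) × Ω (g ○ ● ++ L)) p L → W Ω p (g □ □ ++ L)
  pair-D {p = Dominator} (over f (ω , _)) = dom (Move-++ˡ left) (sta (_ , Move-++ˡ right) λ m →
    case Move-++⁻ (g ● □) m of λ
      { (inj₁ (_ , m′ , refl)) → case only m′ of λ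
          { (inj₁ (() , _)) ; (inj₂ (_ , refl)) → over (All.++⁺ (filled ● ○) f) ω }
      ; (inj₂ (_ , m′ , _)) → ⊥-elim (full-stuck f m′) })
  pair-D {p = Staller} (over f (ω , ω′)) = sta (_ , Move-++ˡ left) λ m →
    case Move-++⁻ (g □ □) m of λ
      { (inj₁ (_ , m′ , refl)) → case only m′ of λ
          { (inj₁ (_ , refl)) → dom (Move-++ˡ right) (over (All.++⁺ (filled ○ ●) f) ω′)
          ; (inj₂ (_ , refl)) → dom (Move-++ˡ left) (over (All.++⁺ (filled ● ○) f) ω) }
      ; (inj₂ (_ , m′ , _)) → ⊥-elim (full-stuck f m′) }
  pair-D (dom m w) = dom (Move-++ʳ (g □ □) m) (pair-D w)
  pair-D w@(sta _ h) = sta (_ , Move-++ˡ left) λ m →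
    case Move-++⁻ (g □ □) m of λ
      { (inj₁ (_ , m′ , refl)) → case only m′ of λ
          { (inj₁ (_ , refl)) → dom (Move-++ˡ right) (W-prefix (g ○ ●) (filled ○ ●) (W-weaken (λ _ _ → proj₂) w))
          ; (inj₂ (_ , refl)) → dom (Move-++ˡ left) (W-prefix (g ● ○) (filled ● ○) (W-weaken (λ _ _ → proj₁) w)) }
      ; (inj₂ (_ , m′ , refl)) → pair-D (h m′) }

  pair-S : W Ω p (g □ □ ++ L) → W (λ L → Ω (g ● ○ ++ L) ⊎ Ω (g ○ ● ++ L)) p L
  pair-S (over f _) = ⊥-elim (full-stuck f (Move-++ˡ {c = ●} left))
  pair-S (dom m w) with Move-++⁻ (g □ □) m
  ... | inj₂ (_ , m′ , refl) = dom m′ (pair-S w)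
  ... | inj₁ (_ , m′ , refl) with only m′ | w
  ... | inj₁ (_ , refl) | over f _ = ⊥-elim (full-stuck f (Move-++ˡ {c = ●} right))
  ... | inj₂ (_ , refl) | over f _ = ⊥-elim (full-stuck f (Move-++ˡ {c = ●} left))
  ... | inj₁ (_ , refl) | sta _ h = W-weaken (λ _ _ → inj₁) (W-unprefix (g ● ○) (filled ● ○) (h (Move-++ˡ right)))
  ... | inj₂ (_ , refl) | sta _ h = W-weaken (λ _ _ → inj₂) (W-unprefix (g ○ ●) (filled ○ ●) (h (Move-++ˡ left)))
  pair-S {L = L} (sta _ h) with full⊎move L
  ... | inj₂ m = sta (m ○) λ m₁ → pair-S (h (Move-++ʳ (g □ □) m₁))
  ... | inj₁ f with h (Move-++ˡ {M = g □ ○} right)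
  ... | over f′ _ = ⊥-elim (full-stuck f′ (Move-++ˡ {c = ●} left))
  ... | dom m w with Move-++⁻ (g □ ○) m
  ... | inj₂ (_ , m′ , _) = ⊥-elim (full-stuck f m′)
  ... | inj₁ (_ , m′ , refl) with only m′ | w
  ... | inj₂ (() , _) | _
  ... | inj₁ (_ , refl) | over _ ω = over f (inj₁ ω)
  ... | inj₁ (_ , refl) | sta (_ , m″) _ = ⊥-elim (full-stuck (All.++⁺ (filled ● ○) f) m″)

record Hole (x : Slot → Item A) : Set where
  field
    claims : ∀ {c} → Step c (x □) (x c)
    only   : ∀ {c s i} → Step c (x s) i → s ≡ □ × i ≡ x c
    filled : ∀ {s} → Claimed s → FullItem (x s)

hole₁ : ∀ {a : A} {y} → Claimed y → Hole (λ s → a , s , y)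
hole₁ cl = record { claims = fst ; only = only cl ; filled = λ f → f , cl }
  where
  only : ∀ {a : A} {y c s i} → Claimed y → Step c (a , s , y) i → s ≡ □ × i ≡ (a , c , y)
  only cl fst = refl , refl
  only () snd

hole₂ : ∀ {a : A} {x} → Claimed x → Hole (λ s → a , x , s)
hole₂ cl = record { claims = snd ; only = only cl ; filled = λ f → cl , f }
  where
  only : ∀ {a : A} {x c s i} → Claimed x → Step c (a , x , s) i → s ≡ □ × i ≡ (a , x , c)
  only () fst
  only cl snd = refl , refl

two-holes : {x y : Slot → Item A} → Hole x → Hole y → Gadget (λ s t → x s ∷ y t ∷ [])
two-holes h k = record
  { left   = here (Hole.claims h)
  ; right  = there (here (Hole.claims k))
  ; only   = λ { (here s) → inj₁ (case Hole.only h s of λ { (refl , refl) → refl , refl })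
               ; (there (here s)) → inj₂ (case Hole.only k s of λ { (refl , refl) → refl , refl }) }
  ; filled = λ f f′ → Hole.filled h f ∷ Hole.filled k f′ ∷ [] }

free-item : ∀ {a : A} → Gadget (λ s t → (a , s , t) ∷ [])
free-item = record
  { left   = here fst
  ; right  = here snd
  ; only   = λ { (here fst) → inj₁ (refl , refl) ; (here snd) → inj₂ (refl , refl) }
  ; filled = λ f f′ → (f , f′) ∷ [] }

-- If each player can split a pair on one side, the positions compare as after the split.
exchange : {Ω : Position A → Set} {g g′ : Slot → Slot → Position A} → Gadget g → Gadget g′ →
           (P P′ : Position A) → Full P → Full P′ →
           (∀ {Z′} → Reach Z Z′ → Ω (g ● ○ ++ P ++ Z′) ⊎ Ω (g ○ ● ++ P ++ Z′) →
                     Ω (g′ ● ○ ++ P′ ++ Z′) × Ω (g′ ○ ● ++ P′ ++ Z′)) →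
           W Ω p (g □ □ ++ P ++ Z) → W Ω p (g′ □ □ ++ P′ ++ Z)
exchange {g = g} {g′} G G′ P P′ f f′ h w =
  pair-D g′ G′ (W-prefix P′ f′ (W-weaken (λ r _ → h r) (W-unprefix P f (pair-S g G w))))

-- Games are transferred along maps that preserve and reflect moves.
record Transfer (R : Position A → Position B → Set) : Set where
  field
    forth : ∀ {c L M K} → R L K → Move c L M → ∃[ N ] Move c K N × R M N
    back  : ∀ {c L K N} → R L K → Move c K N → ∃[ M ] Move c L M × R M N

module _ {R : Position A → Position B → Set} (T : Transfer R) {Ω : Position A → Set} {Ω′ : Position B → Set}
         (h : ∀ {L K} → R L K → Full L → Ω L → Ω′ K) where
  open Transfer T

  full-transfer : ∀ {K} → R L K → Full L → Full K
  full-transfer {K = K} r f with full⊎move K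
  ... | inj₁ f′ = f′
  ... | inj₂ m = ⊥-elim (full-stuck f (proj₁ (proj₂ (back r (proj₂ (m ●))))))

  transfer : ∀ {K} → R L K → W Ω p L → W Ω′ p K
  transfer r (over f ω) = over (full-transfer r f) (h r f ω)
  transfer r (dom m w) with forth r m
  ... | _ , m′ , r′ = dom m′ (transfer r′ w)
  transfer r (sta (_ , m) g) = sta (_ , proj₁ (proj₂ (forth r m))) λ m₁ →
    case back r m₁ of λ (_ , m′ , r′) → transfer r′ (g m′)

transfer-flip : {R : Position A → Position B → Set} → Transfer R → Transfer (λ K L → R L K)
transfer-flip T = record { forth = Transfer.back T ; back = Transfer.forth T }

-- Copies of a clique with two vertices: unlabelled copies and a pigeonhole argument.

_≟ˢ_ : DecidableEquality Slot
● ≟ˢ ● = yes refl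
● ≟ˢ ○ = no λ ()
● ≟ˢ □ = no λ ()
○ ≟ˢ ● = no λ ()
○ ≟ˢ ○ = yes refl
○ ≟ˢ □ = no λ ()
□ ≟ˢ ● = no λ ()
□ ≟ˢ ○ = no λ ()
□ ≟ˢ □ = yes refl

variable
  X : Set

-- Every vertex claimed by Dominator in the first position has a counterpart in
-- the second one, and every lost item of the second occurs in the first.
record Cover (L M : Position X) : Set where
  field
    first  : ∀ {a y} → (a , ● , y) ∈ L → ∃[ y′ ] (a , ● , y′) ∈ M
    second : ∀ {a x} → (a , x , ●) ∈ L → ∃[ x′ ] (a , x′ , ●) ∈ M
    lost   : ∀ {a} → (a , ○ , ○) ∈ M → (a , ○ , ○) ∈ L

cover-⊆ : {L M : Position X} → (∀ {i} → i ∈ L → i ∈ M) → (∀ {i} → i ∈ M → i ∈ L) → Cover L M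
cover-⊆ f g = record { first = λ i → _ , f i ; second = λ i → _ , f i ; lost = g }

cover-⊑* : {L M : Position X} → L ⊑* M → Cover L M
cover-⊑* r = record { first = first r ; second = second r ; lost = lost r }
  where
  first : ∀ {L M : Position X} {a y} → L ⊑* M → (a , ● , y) ∈ L → ∃[ y′ ] (a , ● , y′) ∈ M
  first ((top , _) ∷ _) (here refl) = _ , here refl
  first (_ ∷ r) (there i) = _ , there (proj₂ (first r i))
  second : ∀ {L M : Position X} {a x} → L ⊑* M → (a , x , ●) ∈ L → ∃[ x′ ] (a , x′ , ●) ∈ M
  second ((_ , top) ∷ _) (here refl) = _ , here refl
  second (_ ∷ r) (there i) = _ , there (proj₂ (second r i))
  lost : ∀ {L M : Position X} {a} → L ⊑* M → (a , ○ , ○) ∈ M → (a , ○ , ○) ∈ L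
  lost ((bot , bot) ∷ _) (here refl) = here refl
  lost (_ ∷ r) (there i) = there (lost r i)

unique-length : ∀ {n} {l : List (Fin n)} → Unique l → length l ≤ n
unique-length u = Fin.injective⇒≤ (injective u)
  where
  injective : ∀ {n} {l : List (Fin n)} → Unique l → ∀ {i j} → List.lookup l i ≡ List.lookup l j → i ≡ j
  injective (_ ∷ _) {zero} {zero} _ = refl
  injective {l = _ ∷ l} (ne ∷ _) {zero} {suc j} e = ⊥-elim (All.lookup ne (Mem.∈-lookup {xs = l} j) e)
  injective {l = _ ∷ l} (ne ∷ _) {suc i} {zero} e = ⊥-elim (All.lookup ne (Mem.∈-lookup {xs = l} i) (sym e))
  injective (_ ∷ u) {suc i} {suc j} e = cong suc (injective u e)

cap₃ : ℕ → Fin 3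
cap₃ 0 = # 0
cap₃ 1 = # 1
cap₃ (suc (suc _)) = # 2

module Unlabelled {A : Set} (_≟_ : DecidableEquality A)
                  {Ω : Position A → Set} (Ω? : ∀ L → Ω L ⊎ ¬ Ω L)
                  (Ω-cover : ∀ {L M} → Cover L M → Ω L → Ω M) where

  mono : Monotone Ω
  mono r = Ω-cover (cover-⊑* r)

  symm : Symmetric Ω
  symm r = Ω-cover (cover-⊆ (Perm.∈-resp-↭ r) (Perm.∈-resp-↭ (↭-sym r)))

  add-free : ∀ {a} → W Ω p L → W Ω p ((a , □ , □) ∷ L)
  add-free w = pair-D _ free-item (W-weaken (λ _ _ ω →
    Ω-cover (record { first = λ i → _ , there i ; second = λ i → _ , there i ; lost = λ { (here ()) ; (there i) → i } }) ω ,
    Ω-cover (record { first = λ i → _ , there i ; second = λ i → _ , there i ; lost = λ { (here ()) ; (there i) → i } }) ω) w)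

  data Shape : Item A → Set where
    unclaimed : ∀ {a} → Shape (a , □ , □)
    hole      : ∀ {x} → Hole x → Shape (x □)
    filled    : ∀ {i} → FullItem i → Shape i

  shape : ∀ i → Shape i
  shape (a , □ , □) = unclaimed
  shape (a , □ , ●) = hole (hole₁ ●)
  shape (a , □ , ○) = hole (hole₁ ○)
  shape (a , ● , □) = hole (hole₂ ●)
  shape (a , ○ , □) = hole (hole₂ ○)
  shape (a , ● , ●) = filled (● , ●)
  shape (a , ● , ○) = filled (● , ○)
  shape (a , ○ , ● ) = filled (○ , ●)
  shape (a , ○ , ○) = filled (○ , ○)

  Unclaimed² : Item A → Set
  Unclaimed² (_ , □ , □) = ⊤
  Unclaimed² _ = ⊥

  Ω-set : ∀ {P Q} → All (_∈ Q) P → All (_∈ P) Q → Ω (P ++ Z) → Ω (Q ++ Z)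
  Ω-set s t = Ω-cover (cover-⊆ (subset s) (subset t))
    where
    subset : ∀ {P Q i} → All (_∈ Q) P → i ∈ P ++ Z → i ∈ Q ++ Z
    subset {P = P} {Q = Q} s j with Mem.∈-++⁻ P j
    ... | inj₁ j′ = Mem.∈-++⁺ˡ (All.lookup s j′)
    ... | inj₂ j′ = Mem.∈-++⁺ʳ Q j′

  pattern 0th = here refl
  pattern 1st = there (here refl)
  pattern 2nd = there (there (here refl))

  hole-⊑ : ∀ {x s} → Hole x → □ ≼ s → x □ ⊑ x s
  hole-⊑ h = step-⊑ (Hole.claims h)
    where
    step-⊑ : ∀ {c} {i j : Item A} → Step c i j → □ ≼ c → i ⊑ j
    step-⊑ fst r = r , ≼-refl
    step-⊑ snd r = ≼-refl , r

  hole-⊒ : ∀ {x} → Hole x → x ○ ⊑ x □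
  hole-⊒ h = step-⊒ (Hole.claims h)
    where
    step-⊒ : ∀ {i j : Item A} → Step ○ i j → j ⊑ i
    step-⊒ fst = bot , ≼-refl
    step-⊒ snd = ≼-refl , bot

  -- Splitting two equal items leaves nothing for a third one to contribute.
  third⁻ : ∀ {i} → Shape i → ¬ Unclaimed² i → W Ω p (i ∷ i ∷ i ∷ L) → W Ω p (i ∷ i ∷ L)
  third⁻ unclaimed ¬u = ⊥-elim (¬u tt)
  third⁻ {i = i} (filled f) _ = W-prefix (i ∷ i ∷ []) (f ∷ f ∷ []) ∘
    W-weaken (λ _ _ → Ω-set {P = i ∷ i ∷ i ∷ []} {i ∷ i ∷ []} (0th ∷ 0th ∷ 0th ∷ []) (0th ∷ 0th ∷ [])) ∘
    W-unprefix (i ∷ i ∷ i ∷ []) (f ∷ f ∷ f ∷ [])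
  third⁻ (hole {x} h) _ w =
    exchange (two-holes h h) (two-holes h h) (x ● ∷ []) [] (Hole.filled h ● ∷ []) []
      (λ _ → [ (λ ω → Ω-set {P = x ● ∷ x ○ ∷ x ● ∷ []} (0th ∷ 1st ∷ 0th ∷ []) (0th ∷ 1st ∷ []) ω ,
                      Ω-set {P = x ● ∷ x ○ ∷ x ● ∷ []} (1st ∷ 0th ∷ 1st ∷ []) (1st ∷ 0th ∷ []) ω)
             , (λ ω → Ω-set {P = x ○ ∷ x ● ∷ x ● ∷ []} (1st ∷ 0th ∷ 0th ∷ []) (1st ∷ 0th ∷ []) ω ,
                      Ω-set {P = x ○ ∷ x ● ∷ x ● ∷ []} (0th ∷ 1st ∷ 1st ∷ []) (0th ∷ 1st ∷ []) ω) ]′)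
      (W-mono mono (⊑-refl ∷ ⊑-refl ∷ hole-⊑ h top ∷ ⊑*-refl) w)

  third⁺ : ∀ {i} → Shape i → ¬ Unclaimed² i → W Ω p (i ∷ i ∷ L) → W Ω p (i ∷ i ∷ i ∷ L)
  third⁺ unclaimed ¬u = ⊥-elim (¬u tt)
  third⁺ {i = i} (filled f) _ = W-prefix (i ∷ i ∷ i ∷ []) (f ∷ f ∷ f ∷ []) ∘
    W-weaken (λ _ _ → Ω-set {P = i ∷ i ∷ []} {i ∷ i ∷ i ∷ []} (0th ∷ 0th ∷ []) (0th ∷ 0th ∷ 0th ∷ [])) ∘
    W-unprefix (i ∷ i ∷ []) (f ∷ f ∷ [])
  third⁺ (hole {x} h) _ w = W-mono mono (⊑-refl ∷ ⊑-refl ∷ hole-⊒ h ∷ ⊑*-refl)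
    (exchange (two-holes h h) (two-holes h h) [] (x ○ ∷ []) [] (Hole.filled h ○ ∷ [])
      (λ _ → [ (λ ω → Ω-set {P = x ● ∷ x ○ ∷ []} {x ● ∷ x ○ ∷ x ○ ∷ []} (0th ∷ 1st ∷ []) (0th ∷ 1st ∷ 1st ∷ []) ω ,
                      Ω-set {P = x ● ∷ x ○ ∷ []} {x ○ ∷ x ● ∷ x ○ ∷ []} (1st ∷ 0th ∷ []) (1st ∷ 0th ∷ 1st ∷ []) ω)
             , (λ ω → Ω-set {P = x ○ ∷ x ● ∷ []} {x ● ∷ x ○ ∷ x ○ ∷ []} (1st ∷ 0th ∷ []) (1st ∷ 0th ∷ 0th ∷ []) ω ,
                      Ω-set {P = x ○ ∷ x ● ∷ []} {x ○ ∷ x ● ∷ x ○ ∷ []} (0th ∷ 1st ∷ []) (0th ∷ 1st ∷ 0th ∷ []) ω) ]′)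
      w)

  Comparable : Item A → ℕ → ℕ → Set
  Comparable (_ , □ , □) n n′ = n ≤ n′
  Comparable _ n n′ = cap₃ n ≡ cap₃ n′

  comparable-refl : ∀ i n → Comparable i n n
  comparable-refl (_ , □ , □) n = ℕ.≤-refl
  comparable-refl (_ , □ , ●) n = refl
  comparable-refl (_ , □ , ○) n = refl
  comparable-refl (_ , ● , _) n = refl
  comparable-refl (_ , ○ , _) n = refl

  more-free : ∀ {a n n′} → n ≤ n′ → W Ω p (replicate n (a , □ , □) ++ Z) → W Ω p (replicate n′ (a , □ , □) ++ Z)
  more-free {n′ = zero} z≤n w = w
  more-free {n′ = suc n′} z≤n w = add-free (more-free {n′ = n′} z≤n w)
  more-free {Z = Z} {a} {suc n} {suc n′} (s≤s r) w =
    W-↭ symm (Perm.shift _ (replicate n′ _) Z)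
      (more-free r (W-↭ symm (↭-sym (Perm.shift _ (replicate n _) Z)) w))

  to-two : ∀ {i} → ¬ Unclaimed² i → ∀ k → W Ω p (replicate (2 + k) i ++ Z) → W Ω p (i ∷ i ∷ Z)
  to-two ¬u zero w = w
  to-two {i = i} ¬u (suc k) w = to-two ¬u k (third⁻ (shape i) ¬u w)

  from-two : ∀ {i} → ¬ Unclaimed² i → ∀ k → W Ω p (i ∷ i ∷ Z) → W Ω p (replicate (2 + k) i ++ Z)
  from-two ¬u zero w = w
  from-two {i = i} ¬u (suc k) w = third⁺ (shape i) ¬u (from-two ¬u k w)

  same-cap : ∀ {i} → ¬ Unclaimed² i → ∀ n n′ → cap₃ n ≡ cap₃ n′ →
             W Ω p (replicate n i ++ Z) → W Ω p (replicate n′ i ++ Z)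
  same-cap ¬u 0 0 _ w = w
  same-cap ¬u 1 1 _ w = w
  same-cap ¬u (suc (suc k)) (suc (suc k′)) _ w = from-two ¬u k′ (to-two ¬u k w)
  same-cap ¬u 0 1 ()
  same-cap ¬u 0 (suc (suc _)) ()
  same-cap ¬u 1 0 ()
  same-cap ¬u 1 (suc (suc _)) ()
  same-cap ¬u (suc (suc _)) 0 ()
  same-cap ¬u (suc (suc _)) 1 ()

  block : ∀ i {n n′} → Comparable i n n′ → W Ω p (replicate n i ++ Z) → W Ω p (replicate n′ i ++ Z)
  block (_ , □ , □) = more-free
  block (a , □ , ●) {n} {n′} = same-cap {i = a , □ , ●} (λ ()) n n′
  block (a , □ , ○) {n} {n′} = same-cap {i = a , □ , ○} (λ ()) n n′
  block (a , ● , y) {n} {n′} = same-cap {i = a , ● , y} (λ ()) n n′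
  block (a , ○ , y) {n} {n′} = same-cap {i = a , ○ , y} (λ ()) n n′

  _≟ⁱ_ : DecidableEquality (Item A)
  _≟ⁱ_ = ×-≡-dec _≟_ (×-≡-dec _≟ˢ_ _≟ˢ_)

  count : Item A → Position A → ℕ
  count i [] = 0
  count i (j ∷ L) with i ≟ⁱ j
  ... | yes _ = suc (count i L)
  ... | no  _ = count i L

  remove : Item A → Position A → Position A
  remove i [] = []
  remove i (j ∷ L) with i ≟ⁱ j
  ... | yes _ = remove i L
  ... | no  _ = j ∷ remove i L

  split-count : ∀ i L → L ↭ replicate (count i L) i ++ remove i L
  split-count i [] = refl
  split-count i (j ∷ L) with i ≟ⁱ j
  ... | yes refl = prep i (split-count i L)
  ... | no  _ = ↭-trans (prep j (split-count i L)) (↭-sym (Perm.shift j (replicate (count i L) i) (remove i L)))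

  remove-∈ : ∀ i L {j} → j ∈ remove i L → j ∈ L × i ≢ j
  remove-∈ i (k ∷ L) j∈ with i ≟ⁱ k
  ... | yes _ = let j∈L , ne = remove-∈ i L j∈ in there j∈L , ne
  remove-∈ i (k ∷ L) (here refl) | no ne = here refl , ne
  remove-∈ i (k ∷ L) (there j∈)  | no _  = let j∈L , ne = remove-∈ i L j∈ in there j∈L , ne

  count-removed : ∀ i L → count i (remove i L) ≡ 0
  count-removed i [] = refl
  count-removed i (k ∷ L) with i ≟ⁱ k
  ... | yes _ = count-removed i L
  ... | no ne with i ≟ⁱ k
  ... | yes e = ⊥-elim (ne e)
  ... | no _ = count-removed i L

  count-kept : ∀ {i j} L → i ≢ j → count j (remove i L) ≡ count j L
  count-kept [] ne = refl
  count-kept {i} {j} (k ∷ L) ne with i ≟ⁱ k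
  count-kept {i} {j} (k ∷ L) ne | yes refl with j ≟ⁱ k
  ... | yes refl = ⊥-elim (ne refl)
  ... | no _ = count-kept L ne
  count-kept {i} {j} (k ∷ L) ne | no _ with j ≟ⁱ k
  ... | yes _ = cong suc (count-kept L ne)
  ... | no _ = count-kept L ne

  compare : ∀ Y P {q r} → (∀ {i} → i ∈ q → i ∈ Y) → (∀ {i} → i ∈ r → i ∈ Y) →
            (∀ i → i ∈ Y → Comparable i (count i q) (count i r)) → W Ω p (P ++ q) → W Ω p (P ++ r)
  compare [] P {[]} {[]} _ _ _ w = w
  compare [] P {i ∷ _} q⊆ _ _ w with () ← q⊆ (here refl)
  compare [] P {[]} {i ∷ _} _ r⊆ _ w with () ← r⊆ (here refl)
  compare (y ∷ Y) P {q} {r} q⊆ r⊆ c w =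
    W-↭ symm (↭-trans (↭-reflexive (List.++-assoc P _ _)) (Perm.++⁺ˡ P (↭-sym (split-count y r))))
      (compare Y (P ++ replicate (count y r) y) (tail q q⊆) (tail r r⊆) rest
        (W-↭ symm (move P (count y r))
          (block y (c y (here refl))
            (W-↭ symm (↭-trans (Perm.++⁺ˡ P (split-count y q))
                               (↭-trans (↭-reflexive (sym (List.++-assoc P _ _))) (↭-sym (move P (count y q))))) w))))
    where
    move : ∀ P n {K} → replicate n y ++ P ++ K ↭ (P ++ replicate n y) ++ K
    move P n {K} = ↭-trans (↭-reflexive (sym (List.++-assoc (replicate n y) P K)))
                           (Perm.++⁺ʳ K (Perm.++-comm (replicate n y) P))
    tail : ∀ L → (∀ {i} → i ∈ L → i ∈ y ∷ Y) → ∀ {i} → i ∈ remove y L → i ∈ Y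
    tail L L⊆ i∈ with remove-∈ y L i∈
    ... | i∈L , ne with L⊆ i∈L
    ... | here e = ⊥-elim (ne (sym e))
    ... | there i∈Y = i∈Y
    rest : ∀ i → i ∈ Y → Comparable i (count i (remove y q)) (count i (remove y r))
    rest i i∈ with y ≟ⁱ i
    ... | yes refl rewrite count-removed i q | count-removed i r = comparable-refl i 0
    ... | no ne rewrite count-kept q ne | count-kept r ne = c i (there i∈)

  count⇒∈ : ∀ {i} L → 0 < count i L → i ∈ L
  count⇒∈ {i} (j ∷ L) pos with i ≟ⁱ j
  ... | yes refl = here refl
  ... | no _ = there (count⇒∈ L pos)

  -- Moves only ever decrease the number of untouched copies, by at most one.
  count-move : ∀ {a} → Claimed c → Move c L M →
               count (a , □ , □) M ≤ count (a , □ , □) L × count (a , □ , □) L ≤ suc (count (a , □ , □) M)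
  count-move {L = x ∷ L} {y ∷ L} {a} cl (here s) with (a , □ , □) ≟ⁱ y
  ... | yes refl = ⊥-elim (touched cl s)
    where
    touched : ∀ {c x a} → Claimed c → ¬ Step {A} c x (a , □ , □)
    touched () fst
    touched () snd
  ... | no _ with (a , □ , □) ≟ⁱ x
  ... | yes _ = ℕ.n≤1+n _ , ℕ.≤-refl
  ... | no _ = ℕ.≤-refl , ℕ.n≤1+n _
  count-move {L = x ∷ L} {a = a} cl (there m) with (a , □ , □) ≟ⁱ x
  ... | yes _ = s≤s (proj₁ (count-move cl m)) , s≤s (proj₂ (count-move cl m))
  ... | no _ = count-move cl m

  move-item : ∀ {i j} → i ∈ L → Step c i j → ∃[ M ] Move c L M × j ∷ L ↭ i ∷ M
  move-item (here refl) s = _ , here s , swap _ _ refl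
  move-item {L = x ∷ L} {i = i} {j} (there i∈) s with move-item i∈ s
  ... | M , m , r = _ , there m , ↭-trans (swap j x refl) (↭-trans (prep x r) (swap x i refl))

  Labels : List A → Position A → Set
  Labels Λ = All λ i → proj₁ i ∈ Λ

  labels-move : ∀ {Λ} → Labels Λ L → Move c L M → Labels Λ M
  labels-move (l ∷ ls) (here fst) = l ∷ ls
  labels-move (l ∷ ls) (here snd) = l ∷ ls
  labels-move (l ∷ ls) (there m) = l ∷ labels-move ls m

  slots : List Slot
  slots = ● ∷ ○ ∷ □ ∷ []

  ∈-slots : ∀ s → s ∈ slots
  ∈-slots ● = 0th
  ∈-slots ○ = 1st
  ∈-slots □ = 2nd

  items : List A → List (Item A)
  items Λ = cartesianProduct Λ (cartesianProduct slots slots)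

  ∈-items : ∀ {Λ i} → proj₁ i ∈ Λ → i ∈ items Λ
  ∈-items {i = a , x , y} a∈ = Mem.∈-cartesianProduct⁺ a∈ (Mem.∈-cartesianProduct⁺ (∈-slots x) (∈-slots y))

  length-items : ∀ Λ → length (items Λ) ≡ length Λ * 9
  length-items [] = refl
  length-items (a ∷ Λ) = trans (List.length-++ (map (a ,_) (cartesianProduct slots slots)) {items Λ}) (cong (9 +_) (length-items Λ))

  module Pigeonhole (Λ : List A) (ℓ : A) (ℓ∈ : ℓ ∈ Λ) where

    r : Item A
    r = ℓ , □ , □

    ♯ : A → Position A → ℕ
    ♯ a = count (a , □ , □)

    capOf : Item A → ℕ → Fin 3
    capOf (_ , □ , □) n = # 0
    capOf _ n = cap₃ n

    size : ℕ
    size = 3 ^ length (items Λ)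

    code : Position A → Fin size
    code L = funToFin λ j → capOf (List.lookup (items Λ) j) (count (List.lookup (items Λ) j) L)

    code-cap : ∀ {L M i} → code L ≡ code M → i ∈ items Λ → capOf i (count i L) ≡ capOf i (count i M)
    code-cap {L} {M} e i∈ = subst (λ i → capOf i (count i L) ≡ capOf i (count i M)) (sym (Any.lookup-index i∈))
      (trans (sym (Fin.finToFun-funToFin (f L) (Any.index i∈)))
        (trans (cong (λ z → finToFun z (Any.index i∈)) e) (Fin.finToFun-funToFin (f M) (Any.index i∈))))
      where
      f : Position A → Fin (length (items Λ)) → Fin 3
      f L j = capOf (List.lookup (items Λ) j) (count (List.lookup (items Λ) j) L)

    comparable : ∀ i {m n k l} → capOf i m ≡ capOf i n → (∀ a → i ≡ (a , □ , □) → k ≤ l) →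
                 (¬ Unclaimed² i → k ≡ m × l ≡ n) → Comparable i k l
    comparable (a , □ , □) e h g = h a refl
    comparable (a , □ , ●) e h g with g (λ ())
    ... | refl , refl = e
    comparable (a , □ , ○) e h g with g (λ ())
    ... | refl , refl = e
    comparable (a , ● , y) e h g with g (λ ())
    ... | refl , refl = e
    comparable (a , ○ , y) e h g with g (λ ())
    ... | refl , refl = e

    count-r : ∀ L {i} → ¬ Unclaimed² i → count i (r ∷ L) ≡ count i L
    count-r L {i} ¬u with i ≟ⁱ r
    ... | yes refl = ⊥-elim (¬u tt)
    ... | no _ = refl

    ♯-r : ∀ L a → ♯ a (r ∷ L) ≡ ♯ a L ⊎ (a ≡ ℓ × ♯ a (r ∷ L) ≡ suc (♯ a L))
    ♯-r L a with (a , □ , □) ≟ⁱ r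
    ... | yes refl = inj₂ (refl , refl)
    ... | no _ = inj₁ refl

    -- A position with one more copy wins if it did so at an earlier time with the same code.
    revisit : ∀ {q L} → Labels Λ q → Labels Λ L → code q ≡ code L →
              (∀ a → ♯ a q ≤ ♯ a L) → ♯ ℓ q < ♯ ℓ L → W Ω p (r ∷ q) → W Ω p L
    revisit {q = q} {L} lq lL e h h′ = compare (items Λ) [] (labelled (ℓ∈ ∷ lq)) (labelled lL) λ i i∈ →
      comparable i (code-cap {q} {L} e i∈) (more i) λ ¬u → count-r q ¬u , refl
      where
      labelled : ∀ {K i} → Labels Λ K → i ∈ K → i ∈ items Λ
      labelled l i∈ = ∈-items (All.lookup l i∈)
      more : ∀ i a → i ≡ (a , □ , □) → count i (r ∷ q) ≤ count i L
      more _ a refl with ♯-r q a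
      ... | inj₁ e′ = subst (_≤ ♯ a L) (sym e′) (h a)
      ... | inj₂ (refl , e′) = subst (_≤ ♯ ℓ L) (sym e′) h′

    record Next (L : Position A) : Set where
      field
        {next}   : Position A
        wins     : W Ω Staller (r ∷ next)
        loses    : SW Ω Staller next
        labels   : Labels Λ next
        smaller  : free next < free L
        fewer    : ∀ a → ♯ a next ≤ ♯ a L
        not-much : ♯ ℓ L ≤ 2 + ♯ ℓ next

    not-full : 0 < ♯ ℓ L → ¬ Full L
    not-full {L} pos f = full-stuck {L = r ∷ []} {c = ●} (All.lookup f (count⇒∈ L pos) ∷ []) (here fst)

    answer : W Ω Dominator (r ∷ L) → 0 < ♯ ℓ L → ∃[ M ] Move ● L M × W Ω Staller (r ∷ M)
    answer (over f _) pos = ⊥-elim (full-stuck f (here {c = ●} fst))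
    answer (dom (there m) w) pos = _ , m , w
    answer {L} (dom (here s) w) pos with move-item (count⇒∈ L pos) s
    ... | M , m , e = M , m , W-↭ symm e w

    round : 2 ≤ ♯ ℓ L → Labels Λ L → W Ω Staller (r ∷ L) → SW Ω Staller L → Next L
    round pos l w (over f _) = ⊥-elim (not-full (ℕ.<-trans (s≤s z≤n) pos) f)
    round pos l (over f _) (sta m sw) = ⊥-elim (full-stuck f (here {c = ●} fst))
    round {L} pos l (sta _ g) (sta {M = L₁} m sw) = go (answer (g (there m)) pos₁) sw
      where
      pos₁ : 0 < ♯ ℓ L₁
      pos₁ = s≤s⁻¹ (ℕ.≤-trans pos (proj₂ (count-move ○ m)))
      go : (∃[ M ] Move ● L₁ M × W Ω Staller (r ∷ M)) → SW Ω Dominator L₁ → Next L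
      go (_ , m₂ , w₂) (over f _) = ⊥-elim (full-stuck f m₂)
      go (M₂ , m₂ , w₂) (dom _ h) = record
        { wins     = w₂
        ; loses    = h m₂
        ; labels   = labels-move (labels-move l m) m₂
        ; smaller  = subst (suc (free M₂) ≤_) (sym (trans (free-move ○ m) (cong suc (free-move ● m₂)))) (s≤s (ℕ.n≤1+n (free M₂)))
        ; fewer    = λ a → ℕ.≤-trans (proj₁ (count-move ● m₂)) (proj₁ (count-move ○ m))
        ; not-much = ℕ.≤-trans (proj₂ (count-move ○ m)) (s≤s (proj₂ (count-move ● m₂))) }

    -- l lists the codes of the positions at which an untouched copy was claimed so far.
    separated : ∀ n {L} → free L < n → ∀ b l → length l + b ≡ size → Unique l → 2 + b * 2 ≤ ♯ ℓ L →
                Labels Λ L →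
                (∀ {c} → c ∈ l → ∀ {q} → Labels Λ q → code q ≡ c → (∀ a → ♯ a q ≤ ♯ a L) → ¬ W Ω Staller (r ∷ q)) →
                W Ω Staller (r ∷ L) → SW Ω Staller L → ⊥
    separated (suc n) {L} (s≤s bound) b l eq u many lab old w sw
      with round (ℕ.≤-trans (s≤s (s≤s z≤n)) many) lab w sw
    ... | nx with ♯ ℓ L ℕ.≤? ♯ ℓ (Next.next nx)
    ... | yes same = separated n (ℕ.<-≤-trans smaller bound) b l eq u (ℕ.≤-trans many same) labels
                       (λ c∈ lq e h → old c∈ lq e (λ a → ℕ.≤-trans (h a) (fewer a))) wins loses
      where open Next nx
    ... | no less = change b eq many
      where
      open Next nx
      fresh : All (code L ≢_) l
      fresh = All.tabulate λ c∈ e → old c∈ lab e (λ a → ℕ.≤-refl) w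
      change : ∀ b → length l + b ≡ size → 2 + b * 2 ≤ ♯ ℓ L → ⊥
      change zero eq many = ℕ.<-irrefl (trans (sym (ℕ.+-identityʳ _)) eq) (unique-length (fresh ∷ u))
      change (suc b) eq many = separated n (ℕ.<-≤-trans smaller bound) b (code L ∷ l)
        (trans (sym (ℕ.+-suc (length l) b)) eq) (fresh ∷ u)
        (s≤s⁻¹ (s≤s⁻¹ (ℕ.≤-trans many not-much))) labels
        (λ { (here refl) lq e h w′ → not-both (revisit lq lab e (λ a → ℕ.≤-trans (h a) (fewer a))
                                                (ℕ.≤-<-trans (h ℓ) (ℕ.≰⇒> less)) w′) sw
           ; (there c∈) lq e h → old c∈ lq e (λ a → ℕ.≤-trans (h a) (fewer a)) }) wins loses

    drop-staller : Labels Λ L → 2 + size * 2 ≤ ♯ ℓ L → W Ω Staller (r ∷ L) → W Ω Staller L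
    drop-staller {L} lab many w with determined Ω? Staller L
    ... | inj₁ w′ = w′
    ... | inj₂ sw = ⊥-elim (separated (suc (free L)) ℕ.≤-refl size [] refl [] many lab (λ ()) w sw)

    drop-copy : Labels Λ L → 3 + size * 2 ≤ ♯ ℓ L → W Ω p (r ∷ L) → W Ω p L
    drop-copy {p = Staller} lab many w = drop-staller lab (ℕ.<⇒≤ many) w
    drop-copy {p = Dominator} lab many w with answer w (ℕ.<-≤-trans (s≤s z≤n) many)
    ... | M , m , w′ = dom m (drop-staller (labels-move lab m) (s≤s⁻¹ (ℕ.≤-trans many (proj₂ (count-move ● m)))) w′)

-- The domination game on a list of vertices, one vertex per item.

module Named {V : Set} (nb : V → V → Bool)
             (nb-refl : ∀ v → T (nb v v)) (nb-sym : ∀ u v → nb u v ≡ nb v u) where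

  infix 4 _~_ _∈●_
  _~_ : V → V → Set
  u ~ v = T (nb u v)

  ~-sym : ∀ {u v} → u ~ v → v ~ u
  ~-sym {u} {v} = subst T (nb-sym u v)

  one : Slot → V → Item V
  one s v = v , s , ○

  all● all○ all□ : List V → Position V
  all● = map (one ●)
  all○ = map (one ○)
  all□ = map (one □)

  _∈●_ : V → Position V → Set
  u ∈● L = ∃[ y ] (u , ● , y) ∈ L

  vertices : Position V → List V
  vertices = map proj₁

  Dominated : Position V → Set
  Dominated L = ∀ v → v ∈ vertices L → ∃[ u ] u ∈● L × u ~ v

  Game : Player → List V → Set
  Game p K = W Dominated p (all□ K)

  ∈●-⊑* : {L M : Position V} {u : V} → L ⊑* M → u ∈● L → u ∈● M
  ∈●-⊑* ((top , _) ∷ _) (_ , here refl) = _ , here refl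
  ∈●-⊑* (_ ∷ r) (y , there i) with ∈●-⊑* r (y , i)
  ... | y′ , i′ = y′ , there i′

  vertices-⊑* : {L M : Position V} → L ⊑* M → vertices L ≡ vertices M
  vertices-⊑* [] = refl
  vertices-⊑* ((_ , _) ∷ r) = cong (_ ∷_) (vertices-⊑* r)

  vertices-reach : {L M : Position V} → Reach L M → vertices L ≡ vertices M
  vertices-reach [] = refl
  vertices-reach ((refl , _) ∷ r) = cong (_ ∷_) (vertices-reach r)

  vertices-one : ∀ s K → vertices (map (one s) K) ≡ K
  vertices-one s [] = refl
  vertices-one s (v ∷ K) = cong (v ∷_) (vertices-one s K)

  dominated-mono : Monotone Dominated
  dominated-mono r d v v∈ with d v (subst (_ ∈_) (sym (vertices-⊑* r)) v∈)
  ... | u , u∈ , e = u , ∈●-⊑* r u∈ , e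

  dominated-symm : Symmetric Dominated
  dominated-symm r d v v∈ with d v (Perm.∈-resp-↭ (Perm.map⁺ proj₁ (↭-sym r)) v∈)
  ... | u , (y , u∈) , e = u , (y , Perm.∈-resp-↭ r u∈) , e

  Game-↭ : ∀ {K K′} → K ↭ K′ → Game p K → Game p K′
  Game-↭ r = W-↭ dominated-symm (Perm.map⁺ (one □) r)

  ∈●-++⁻ : ∀ L {M u} → u ∈● L ++ M → u ∈● L ⊎ u ∈● M
  ∈●-++⁻ L (y , i) = [ (λ j → inj₁ (y , j)) , (λ j → inj₂ (y , j)) ]′ (Mem.∈-++⁻ L i)

  ∈●-++⁺ˡ : ∀ {L M u} → u ∈● L → u ∈● L ++ M
  ∈●-++⁺ˡ (y , i) = y , Mem.∈-++⁺ˡ i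

  ∈●-++⁺ʳ : ∀ L {M u} → u ∈● M → u ∈● L ++ M
  ∈●-++⁺ʳ L (y , i) = y , Mem.∈-++⁺ʳ L i

  ∈●⇒∈ : ∀ {L u} → u ∈● L → u ∈ vertices L
  ∈●⇒∈ (_ , i) = Mem.∈-map⁺ proj₁ i

  vertices-++⁻ : ∀ L {M v} → v ∈ vertices (L ++ M) → v ∈ vertices L ⊎ v ∈ vertices M
  vertices-++⁻ L {M} v∈ = Mem.∈-++⁻ (vertices L) (subst (_ ∈_) (List.map-++ proj₁ L M) v∈)

  vertices-++⁺ : ∀ L {M v} → v ∈ vertices L ⊎ v ∈ vertices M → v ∈ vertices (L ++ M)
  vertices-++⁺ L {M} v∈ = subst (_ ∈_) (sym (List.map-++ proj₁ L M))
    ([ Mem.∈-++⁺ˡ , Mem.∈-++⁺ʳ (vertices L) ]′ v∈)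

  full-one : ∀ {s} → Claimed s → ∀ K → Full (map (one s) K)
  full-one c [] = []
  full-one c (v ∷ K) = (c , ○) ∷ full-one c K

  one-⊑* : ∀ {s t} → s ≼ t → ∀ K → map (one s) K ⊑* map (one t) K
  one-⊑* r [] = []
  one-⊑* r (v ∷ K) = (r , bot) ∷ one-⊑* r K

  pair : V → V → Slot → Slot → Position V
  pair u v s t = one s u ∷ one t v ∷ []

  pair-gadget : ∀ u v → Gadget (pair u v)
  pair-gadget u v = two-holes (hole₁ ○) (hole₁ ○)

  -- Only whether some of the twins of t are claimed by Dominator matters.
  twins-dominated : ∀ {t} (H H′ : Position V) {Z} →
    (∀ {a} → a ∈ vertices H ⊎ a ∈ vertices H′ →
       a ~ t × (∀ {y} → y ∈ vertices H ⊎ y ∈ vertices H′ ⊎ y ∈ vertices Z → nb a y ≡ nb t y)) →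
    ∃[ a ] a ∈ vertices H → ∃[ a ] a ∈● H′ →
    Dominated (H ++ Z) → Dominated (H′ ++ Z)
  twins-dominated {t} H H′ {Z} twin (a₀ , a₀∈) (a₁ , a₁∈) d v v∈ with vertices-++⁻ H′ v∈
  ... | inj₂ v∈Z with d v (vertices-++⁺ H (inj₂ v∈Z))
  ... | u , u∈ , e with ∈●-++⁻ H u∈
  ... | inj₂ u∈Z = u , ∈●-++⁺ʳ H′ u∈Z , e
  ... | inj₁ u∈H = a₁ , ∈●-++⁺ˡ a₁∈ , subst T
    (trans (proj₂ (twin (inj₁ (∈●⇒∈ u∈H))) (inj₂ (inj₂ v∈Z))) (sym (proj₂ (twin (inj₂ (∈●⇒∈ a₁∈))) (inj₂ (inj₂ v∈Z))))) e
  twins-dominated {t} H H′ {Z} twin (a₀ , a₀∈) (a₁ , a₁∈) d v v∈ | inj₁ v∈H′ with d a₀ (vertices-++⁺ H (inj₁ a₀∈))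
  ... | u , u∈ , e with ∈●-++⁻ H u∈
  ... | inj₁ u∈H = a₁ , ∈●-++⁺ˡ a₁∈ ,
    subst T (sym (proj₂ (twin (inj₂ (∈●⇒∈ a₁∈))) (inj₂ (inj₁ v∈H′)))) (~-sym (proj₁ (twin (inj₂ v∈H′))))
  ... | inj₂ u∈Z = u , ∈●-++⁺ʳ H′ u∈Z , ~-sym (subst T
    (trans (proj₂ (twin (inj₁ a₀∈)) (inj₂ (inj₂ (∈●⇒∈ u∈Z)))) (sym (proj₂ (twin (inj₂ v∈H′)) (inj₂ (inj₂ (∈●⇒∈ u∈Z))))))
    (~-sym e))

  record Twins (u v w : V) (Y : List V) : Set where
    field
      v≗u : ∀ {y} → y ∈ u ∷ v ∷ w ∷ Y → nb v y ≡ nb u y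
      w≗u : ∀ {y} → y ∈ u ∷ v ∷ w ∷ Y → nb w y ≡ nb u y

  module _ {u v w Y} (tw : Twins u v w Y) where

    private
      class : ∀ {y} → y ∈ u ∷ v ∷ w ∷ [] → y ~ u × (∀ {z} → z ∈ u ∷ v ∷ w ∷ Y → nb y z ≡ nb u z)
      class (here refl) = nb-refl u , λ _ → refl
      class (there (here refl)) = subst T (sym (Twins.v≗u tw (here refl))) (nb-refl u) , Twins.v≗u tw
      class (there (there (here refl))) = subst T (sym (Twins.w≗u tw (here refl))) (nb-refl u) , Twins.w≗u tw

      step : ∀ H H′ {Z} → Reach (all□ Y) Z → All (_∈ u ∷ v ∷ w ∷ []) (vertices H) → All (_∈ u ∷ v ∷ w ∷ []) (vertices H′) →
             ∃[ a ] a ∈ vertices H → ∃[ a ] a ∈● H′ → Dominated (H ++ Z) → Dominated (H′ ++ Z)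
      step H H′ {Z} r h h′ = twins-dominated H H′ λ a∈ → proj₁ (class (among a∈)) , λ y∈ → proj₂ (class (among a∈)) (all y∈)
        where
        among : ∀ {a} → a ∈ vertices H ⊎ a ∈ vertices H′ → a ∈ u ∷ v ∷ w ∷ []
        among = [ All.lookup h , All.lookup h′ ]′
        all : ∀ {y} → y ∈ vertices H ⊎ y ∈ vertices H′ ⊎ y ∈ vertices Z → y ∈ u ∷ v ∷ w ∷ Y
        all (inj₁ i) = Mem.∈-++⁺ˡ (among (inj₁ i))
        all (inj₂ (inj₁ i)) = Mem.∈-++⁺ˡ (among (inj₂ i))
        all (inj₂ (inj₂ i)) = there (there (there (subst (_ ∈_) (trans (sym (vertices-reach r)) (vertices-one □ Y)) i)))

      U : u ∈ u ∷ v ∷ w ∷ []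
      U = here refl
      V′ : v ∈ u ∷ v ∷ w ∷ []
      V′ = there (here refl)
      W′ : w ∈ u ∷ v ∷ w ∷ []
      W′ = there (there (here refl))

    drop-twin : Game p (u ∷ v ∷ w ∷ Y) → Game p (u ∷ v ∷ Y)
    drop-twin g = exchange (pair-gadget u v) (pair-gadget u v) (one ● w ∷ []) [] ((● , ○) ∷ []) []
      (λ r → [ (λ d → step _ (pair u v ● ○) r (U ∷ V′ ∷ W′ ∷ []) (U ∷ V′ ∷ []) (_ , here refl) (_ , _ , here refl) d ,
                      step (pair u v ● ○ ++ one ● w ∷ []) (pair u v ○ ●) r (U ∷ V′ ∷ W′ ∷ []) (U ∷ V′ ∷ []) (_ , here refl) (_ , _ , there (here refl)) d)
             , (λ d → step (pair u v ○ ● ++ one ● w ∷ []) (pair u v ● ○) r (U ∷ V′ ∷ W′ ∷ []) (U ∷ V′ ∷ []) (_ , here refl) (_ , _ , here refl) d ,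
                      step (pair u v ○ ● ++ one ● w ∷ []) (pair u v ○ ●) r (U ∷ V′ ∷ W′ ∷ []) (U ∷ V′ ∷ []) (_ , here refl) (_ , _ , there (here refl)) d) ]′)
      (W-mono dominated-mono (⊑-refl ∷ ⊑-refl ∷ (top , bot) ∷ ⊑*-refl) g)

    add-twin : Game p (u ∷ v ∷ Y) → Game p (u ∷ v ∷ w ∷ Y)
    add-twin g = W-mono dominated-mono (⊑-refl ∷ ⊑-refl ∷ (bot , bot) ∷ ⊑*-refl)
      (exchange (pair-gadget u v) (pair-gadget u v) [] (one ○ w ∷ []) [] ((○ , ○) ∷ [])
        (λ r → [ (λ d → step (pair u v ● ○) (pair u v ● ○ ++ one ○ w ∷ []) r (U ∷ V′ ∷ []) (U ∷ V′ ∷ W′ ∷ []) (_ , here refl) (_ , _ , here refl) d ,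
                        step (pair u v ● ○) (pair u v ○ ● ++ one ○ w ∷ []) r (U ∷ V′ ∷ []) (U ∷ V′ ∷ W′ ∷ []) (_ , here refl) (_ , _ , there (here refl)) d)
               , (λ d → step (pair u v ○ ●) (pair u v ● ○ ++ one ○ w ∷ []) r (U ∷ V′ ∷ []) (U ∷ V′ ∷ W′ ∷ []) (_ , here refl) (_ , _ , here refl) d ,
                        step (pair u v ○ ●) (pair u v ○ ● ++ one ○ w ∷ []) r (U ∷ V′ ∷ []) (U ∷ V′ ∷ W′ ∷ []) (_ , here refl) (_ , _ , there (here refl)) d) ]′)
        g)

  add-clique : ∀ {a b C Y} → (∀ {v} → v ∈ a ∷ b ∷ C → a ~ v × b ~ v) → Game p Y → Game p (a ∷ b ∷ C ++ Y)
  add-clique {a = a} {b} {C} {Y} adj g = W-mono dominated-mono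
    (⊑-refl ∷ ⊑-refl ∷ subst (all○ C ++ all□ Y ⊑*_) (sym (List.map-++ (one □) C Y)) (Pointwise.++⁺ (one-⊑* bot C) ⊑*-refl))
    (pair-D (pair a b) (pair-gadget a b) (W-prefix (all○ C) (full-one ○ C) (W-weaken
      (λ {M} _ _ d → covered {M} {pair a b ● ○} refl (_ , here refl) (λ v∈ → proj₁ (adj v∈)) d ,
                     covered {M} {pair a b ○ ●} refl (_ , there (here refl)) (λ v∈ → proj₂ (adj v∈)) d) g)))
    where
    covered : ∀ {M P u} → vertices P ≡ a ∷ b ∷ [] → u ∈● P → (∀ {v} → v ∈ a ∷ b ∷ C → u ~ v) →
              Dominated M → Dominated (P ++ all○ C ++ M)
    covered {M} {P} e u∈ adj d v v∈ with vertices-++⁻ P v∈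
    ... | inj₁ v∈P = _ , ∈●-++⁺ˡ u∈ , adj (Mem.∈-++⁺ˡ (subst (_ ∈_) e v∈P))
    ... | inj₂ v∈CM with vertices-++⁻ (all○ C) v∈CM
    ... | inj₁ v∈C = _ , ∈●-++⁺ˡ u∈ , adj (there (there (subst (_ ∈_) (vertices-one ○ C) v∈C)))
    ... | inj₂ v∈M with d v v∈M
    ... | u , u∈M , e′ = u , ∈●-++⁺ʳ P (∈●-++⁺ʳ (all○ C) u∈M) , e′

  flatten : List (V × V) → List V
  flatten [] = []
  flatten ((u , v) ∷ ps) = u ∷ v ∷ flatten ps

  data Choice : List (V × V) → Position V → Set where
    []    : Choice [] []
    left  : ∀ {u v ps cs} → Choice ps cs → Choice ((u , v) ∷ ps) (one ● u ∷ one ○ v ∷ cs)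
    right : ∀ {u v ps cs} → Choice ps cs → Choice ((u , v) ∷ ps) (one ○ u ∷ one ● v ∷ cs)

  choice-vertices : ∀ {ps cs} → Choice ps cs → vertices cs ≡ flatten ps
  choice-vertices [] = refl
  choice-vertices (left c) = cong (λ l → _ ∷ _ ∷ l) (choice-vertices c)
  choice-vertices (right c) = cong (λ l → _ ∷ _ ∷ l) (choice-vertices c)

  choice-∈ : ∀ {ps cs u v} → Choice ps cs → (u , v) ∈ ps → u ∈● cs ⊎ v ∈● cs
  choice-∈ (left c) (here refl) = inj₁ (_ , here refl)
  choice-∈ (right c) (here refl) = inj₂ (_ , there (here refl))
  choice-∈ (left c) (there i) = [ (λ (y , j) → inj₁ (y , there (there j))) , (λ (y , j) → inj₂ (y , there (there j))) ]′ (choice-∈ c i)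
  choice-∈ (right c) (there i) = [ (λ (y , j) → inj₁ (y , there (there j))) , (λ (y , j) → inj₂ (y , there (there j))) ]′ (choice-∈ c i)

  pairs-D : ∀ {Ω L} ps → W (λ L → ∀ {cs} → Choice ps cs → Ω (cs ++ L)) p L → W Ω p (all□ (flatten ps) ++ L)
  pairs-D [] w = W-weaken (λ _ _ ω → ω []) w
  pairs-D ((u , v) ∷ ps) w = pair-D (pair u v) (pair-gadget u v)
    (pairs-D ps (W-weaken (λ _ _ ω c → ω (left c) , ω (right c)) w))

  -- Dominator answers within the pairs ps, which makes everything that the
  -- pairs and the vertices of C and E can dominate in Y dominated.
  kill : ∀ {C ps E Y} →
         (∀ {u} → u ∈ C ++ flatten ps ++ E → ∃₂ λ a b → (a , b) ∈ ps × (∀ {y} → y ∈ Y → u ~ y → a ~ y × b ~ y)) →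
         (∀ {v} → v ∈ flatten ps ++ E → ∃₂ λ a b → (a , b) ∈ ps × a ~ v × b ~ v) →
         Game p (C ++ flatten ps ++ E ++ Y) → Game p (flatten ps ++ E ++ Y)
  kill {C = C} {ps} {E} {Y} cross inner g =
    subst (W Dominated _) (sym (List.map-++ (one □) (flatten ps) (E ++ Y)))
      (W-mono dominated-mono
        (Pointwise.++⁺ ⊑*-refl (subst (all○ E ++ all□ Y ⊑*_) (sym (List.map-++ (one □) E Y)) (Pointwise.++⁺ (one-⊑* bot E) ⊑*-refl)))
        (pairs-D ps (W-prefix (all○ E) (full-one ○ E) (W-weaken (λ {M} r f d c → answered {M} r c d)
          (W-unprefix (all● D) (full-one ● D) (W-mono dominated-mono
            (Pointwise.++⁺ (one-⊑* top D) ⊑*-refl) (subst (W Dominated _) regroup g)))))))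
    where
    D : List V
    D = C ++ flatten ps ++ E
    regroup : all□ (C ++ flatten ps ++ E ++ Y) ≡ all□ D ++ all□ Y
    regroup = trans (cong all□ (trans (cong (C ++_) (sym (List.++-assoc (flatten ps) E Y))) (sym (List.++-assoc C (flatten ps ++ E) Y))))
                    (List.map-++ (one □) D Y)
    answered : ∀ {M cs} → Reach (all□ Y) M → Choice ps cs → Dominated (all● D ++ M) → Dominated (cs ++ all○ E ++ M)
    answered {M} {cs} r c d v v∈ = go (vertices-++⁻ cs v∈)
      where
      use : ∀ {a b} → (a , b) ∈ ps → a ~ v × b ~ v → ∃[ u ] u ∈● cs ++ all○ E ++ M × u ~ v
      use i (e , e′) = [ (λ j → _ , ∈●-++⁺ˡ j , e) , (λ j → _ , ∈●-++⁺ˡ j , e′) ]′ (choice-∈ c i)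
      local : v ∈ flatten ps ++ E → ∃[ u ] u ∈● cs ++ all○ E ++ M × u ~ v
      local v∈ with inner v∈
      ... | _ , _ , i , e = use i e
      outer : v ∈ vertices M → ∃[ u ] u ∈● cs ++ all○ E ++ M × u ~ v
      outer v∈M with d v (vertices-++⁺ (all● D) (inj₂ v∈M))
      ... | u , u∈ , e with ∈●-++⁻ (all● D) u∈
      ... | inj₂ u∈M = u , ∈●-++⁺ʳ cs (∈●-++⁺ʳ (all○ E) u∈M) , e
      ... | inj₁ u∈D with cross (subst (_ ∈_) (vertices-one ● D) (∈●⇒∈ u∈D))
      ... | _ , _ , i , h = use i (h (subst (_ ∈_) (trans (sym (vertices-reach r)) (vertices-one □ Y)) v∈M) e)
      go : v ∈ vertices cs ⊎ v ∈ vertices (all○ E ++ M) → ∃[ u ] u ∈● cs ++ all○ E ++ M × u ~ v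
      go (inj₁ v∈cs) = local (Mem.∈-++⁺ˡ (subst (_ ∈_) (choice-vertices c) v∈cs))
      go (inj₂ v∈EM) with vertices-++⁻ (all○ E) v∈EM
      ... | inj₁ v∈E = local (Mem.∈-++⁺ʳ (flatten ps) (subst (_ ∈_) (vertices-one ○ E) v∈E))
      ... | inj₂ v∈M = outer v∈M

-- Lists

_⟷_ : Set → Set → Set
P ⟷ Q = (P → Q) × (Q → P)
infix 1 _⟷_

⟷-trans : ∀ {P Q R : Set} → P ⟷ Q → Q ⟷ R → P ⟷ R
⟷-trans (f , g) (h , k) = h ∘ f , g ∘ k

⟷-sym : ∀ {P Q : Set} → P ⟷ Q → Q ⟷ P
⟷-sym (f , g) = g , f

_==_ : Bool → Bool → Bool
true  == b = b
false == b = not b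

==-sound : ∀ {a b} → T (a == b) → a ≡ b
==-sound {true} {true} _ = refl
==-sound {false} {false} _ = refl

==-complete : ∀ {a b} → a ≡ b → T (a == b)
==-complete {true} refl = tt
==-complete {false} refl = tt

T-∧⁺ : ∀ {a b} → T a → T b → T (a ∧ b)
T-∧⁺ {true} _ y = y

T-∧⁻ : ∀ {a b} → T (a ∧ b) → T a × T b
T-∧⁻ {true} y = tt , y

T-∨⁻ : ∀ {a b} → T (a ∨ b) → T a ⊎ T b
T-∨⁻ {true} _ = inj₁ tt
T-∨⁻ {false} y = inj₂ y

T-∨⁺ : ∀ {a b} → T a ⊎ T b → T (a ∨ b)
T-∨⁺ {true} _ = tt
T-∨⁺ {false} (inj₂ y) = y

T-not⁻ : ∀ {a} → T (not a) → ¬ T a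
T-not⁻ {false} _ ()

T-not⁺ : ∀ {a} → ¬ T a → T (not a)
T-not⁺ {true} f = f tt
T-not⁺ {false} _ = tt

allᵇ : (A → Bool) → List A → Bool
allᵇ P [] = true
allᵇ P (x ∷ xs) = P x ∧ allᵇ P xs

anyᵇ : (A → Bool) → List A → Bool
anyᵇ P [] = false
anyᵇ P (x ∷ xs) = P x ∨ anyᵇ P xs

allᵇ⁻ : ∀ {P : A → Bool} {xs x} → T (allᵇ P xs) → x ∈ xs → T (P x)
allᵇ⁻ t (here refl) = proj₁ (T-∧⁻ t)
allᵇ⁻ {P = P} {y ∷ xs} t (there i) = allᵇ⁻ {P = P} {xs} (proj₂ (T-∧⁻ {P y} t)) i

allᵇ⁺ : ∀ {P : A → Bool} xs → (∀ {x} → x ∈ xs → T (P x)) → T (allᵇ P xs)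
allᵇ⁺ [] h = tt
allᵇ⁺ (x ∷ xs) h = T-∧⁺ (h (here refl)) (allᵇ⁺ xs (h ∘ there))

anyᵇ⁻ : ∀ {P : A → Bool} xs → T (anyᵇ P xs) → ∃[ x ] x ∈ xs × T (P x)
anyᵇ⁻ {P = P} (x ∷ xs) t with T-∨⁻ {P x} t
... | inj₁ h = x , here refl , h
... | inj₂ h = let y , i , h′ = anyᵇ⁻ xs h in y , there i , h′

anyᵇ⁺ : ∀ {P : A → Bool} {xs x} → x ∈ xs → T (P x) → T (anyᵇ P xs)
anyᵇ⁺ (here refl) h = T-∨⁺ (inj₁ h)
anyᵇ⁺ {P = P} {y ∷ _} (there i) h = T-∨⁺ {P y} (inj₂ (anyᵇ⁺ i h))

filterᵇ-∈⁺ : ∀ (P : A → Bool) {xs x} → x ∈ xs → T (P x) → x ∈ filterᵇ P xs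
filterᵇ-∈⁺ P = Mem.∈-filter⁺ (Bool.T? ∘ P)

filterᵇ-∈⁻ : ∀ (P : A → Bool) xs {x} → x ∈ filterᵇ P xs → x ∈ xs × T (P x)
filterᵇ-∈⁻ P xs = Mem.∈-filter⁻ (Bool.T? ∘ P) {xs = xs}

filterᵇ-↭ : ∀ (P : A → Bool) {xs ys} → xs ↭ ys → filterᵇ P xs ↭ filterᵇ P ys
filterᵇ-↭ P = Perm.filter-↭ (Bool.T? ∘ P)

filterᵇ-complement : ∀ (P : A → Bool) xs → xs ↭ filterᵇ P xs ++ filterᵇ (not ∘ P) xs
filterᵇ-complement P [] = refl
filterᵇ-complement P (x ∷ xs) with P x
... | true = prep x (filterᵇ-complement P xs)
... | false = ↭-trans (prep x (filterᵇ-complement P xs)) (↭-sym (Perm.shift x (filterᵇ P xs) _))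

filterᵇ-∨ : ∀ (P Q : A → Bool) xs → (∀ {x} → x ∈ xs → ¬ (T (P x) × T (Q x))) →
            filterᵇ (λ x → P x ∨ Q x) xs ↭ filterᵇ P xs ++ filterᵇ Q xs
filterᵇ-∨ P Q [] _ = refl
filterᵇ-∨ P Q (x ∷ xs) h with P x in e | Q x in e′
... | true | true = ⊥-elim (h (here refl) (subst T (sym e) tt , subst T (sym e′) tt))
... | true | false = prep x (filterᵇ-∨ P Q xs (h ∘ there))
... | false | true = ↭-trans (prep x (filterᵇ-∨ P Q xs (h ∘ there))) (↭-sym (Perm.shift x (filterᵇ P xs) _))
... | false | false = filterᵇ-∨ P Q xs (h ∘ there)

filterᵇ-cong : ∀ {P Q : A → Bool} xs → (∀ {x} → x ∈ xs → P x ≡ Q x) → filterᵇ P xs ≡ filterᵇ Q xs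
filterᵇ-cong [] h = refl
filterᵇ-cong {P = P} {Q} (x ∷ xs) h with P x | Q x | h (here refl)
... | true | true | _ = cong (x ∷_) (filterᵇ-cong xs (h ∘ there))
... | false | false | _ = filterᵇ-cong xs (h ∘ there)

filterᵇ-all : ∀ {P : A → Bool} xs → (∀ {x} → x ∈ xs → T (P x)) → filterᵇ P xs ≡ xs
filterᵇ-all [] h = refl
filterᵇ-all {P = P} (x ∷ xs) h with P x | h (here refl)
... | true | _ = cong (x ∷_) (filterᵇ-all xs (h ∘ there))

-- A member of xs is kept if fewer than c members kept before are related to it.
capBy : (A → A → Bool) → ℕ → List A → List A
capBy R c [] = []
capBy R c (v ∷ xs) = if length (filterᵇ (R v) (capBy R c xs)) Data.Nat.<ᵇ c then v ∷ capBy R c xs else capBy R c xs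

module _ {R : A → A → Bool} {c : ℕ} where

  capBy-cases : (P : List A → Set) → ∀ v xs →
    (length (filterᵇ (R v) (capBy R c xs)) < c → P (v ∷ capBy R c xs)) →
    (c ≤ length (filterᵇ (R v) (capBy R c xs)) → P (capBy R c xs)) → P (capBy R c (v ∷ xs))
  capBy-cases P v xs f g with length (filterᵇ (R v) (capBy R c xs)) Data.Nat.<ᵇ c in e
  ... | true = f (ℕ.<ᵇ⇒< _ c (subst T (sym e) tt))
  ... | false = g (ℕ.≮⇒≥ λ lt → subst T e (ℕ.<⇒<ᵇ lt))

  capBy-∈ : ∀ xs {x} → x ∈ capBy R c xs → x ∈ xs
  capBy-∈ (v ∷ xs) {x} = capBy-cases (λ l → x ∈ l → x ∈ v ∷ xs) v xs
    (λ _ → λ { (here e) → here e ; (there i) → there (capBy-∈ xs i) }) (λ _ i → there (capBy-∈ xs i))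

  capBy-related : (∀ x → T (R x x)) → 0 < c → ∀ xs {x} → x ∈ xs → ∃[ y ] y ∈ capBy R c xs × T (R x y)
  capBy-related r pos (v ∷ xs) (here refl) = capBy-cases (λ l → ∃[ y ] y ∈ l × T (R v y)) v xs
    (λ _ → v , here refl , r v)
    (λ le → witness _ refl (ℕ.<-≤-trans pos le))
    where
    witness : ∀ l → l ≡ filterᵇ (R v) (capBy R c xs) → 0 < length l → ∃[ y ] y ∈ capBy R c xs × T (R v y)
    witness (y ∷ l) e _ = y , filterᵇ-∈⁻ (R v) _ (subst (y ∈_) e (here refl))
  capBy-related r pos (v ∷ xs) {x} (there i) with capBy-related r pos xs i
  ... | y , j , h = capBy-cases (λ l → ∃[ y ] y ∈ l × T (R x y)) v xs (λ _ → y , there j , h) (λ _ → y , j , h)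

  -- Capping preserves what each single omission of a superfluous member preserves.
  capBy-chain : (I f : List A → Set) →
    (∀ P v acc → I (P ++ v ∷ acc) → I (P ++ acc)) →
    (∀ P v acc → I (P ++ v ∷ acc) → c ≤ length (filterᵇ (R v) acc) → f (P ++ v ∷ acc) ⟷ f (P ++ acc)) →
    ∀ P xs → I (P ++ xs) → (f (P ++ xs) ⟷ f (P ++ capBy R c xs)) × I (P ++ capBy R c xs)
  capBy-chain I f del drop P [] i = (id , id) , i
  capBy-chain I f del drop P (v ∷ xs) i with capBy-chain I f del drop (P ++ v ∷ []) xs (subst I (sym (List.++-assoc P _ _)) i)
  ... | e , i′ = capBy-cases (λ l → (f (P ++ v ∷ xs) ⟷ f (P ++ l)) × I (P ++ l)) v xs
      (λ _ → e′ , i″) (λ le → ⟷-trans e′ (drop P v _ i″ le) , del P v _ i″)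
    where
    e′ : f (P ++ v ∷ xs) ⟷ f (P ++ v ∷ capBy R c xs)
    e′ = subst₂ (λ l m → f l ⟷ f m) (List.++-assoc P _ _) (List.++-assoc P _ _) e
    i″ : I (P ++ v ∷ capBy R c xs)
    i″ = subst I (List.++-assoc P _ _) i′

concatMap-↭ : ∀ (f : A → List B) {xs ys} → xs ↭ ys → concatMap f xs ↭ concatMap f ys
concatMap-↭ f refl = refl
concatMap-↭ f (prep x r) = Perm.++⁺ˡ (f x) (concatMap-↭ f r)
concatMap-↭ f {x ∷ y ∷ xs} (swap x y r) = ↭-trans (↭-reflexive (sym (List.++-assoc (f x) (f y) _)))
  (↭-trans (Perm.++⁺ (Perm.++-comm (f x) (f y)) (concatMap-↭ f r)) (↭-reflexive (List.++-assoc (f y) (f x) _)))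
concatMap-↭ f (transit r s) = ↭-trans (concatMap-↭ f r) (concatMap-↭ f s)

shifts : ∀ (xs ys zs : List A) → xs ++ ys ++ zs ↭ ys ++ xs ++ zs
shifts xs ys zs = ↭-trans (↭-reflexive (sym (List.++-assoc xs ys zs)))
  (↭-trans (Perm.++⁺ʳ zs (Perm.++-comm xs ys)) (↭-reflexive (List.++-assoc ys xs zs)))

-- Lists in which equivalent elements occur equally often can be aligned.
module Align (_∼_ : A → A → Bool) (∼-refl : ∀ x → T (x ∼ x))
             (∼-sym : ∀ x y → T (x ∼ y) → T (y ∼ x)) (∼-trans : ∀ x y z → T (x ∼ y) → T (y ∼ z) → T (x ∼ z)) where

  number : A → List A → ℕ
  number t xs = length (filterᵇ (t ∼_) xs)

  number-↭ : ∀ t {xs ys} → xs ↭ ys → number t xs ≡ number t ys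
  number-↭ t r = Perm.↭-length (filterᵇ-↭ (t ∼_) r)

  number-∷ : ∀ {x y} t xs ys → T (x ∼ y) → number t (x ∷ xs) ≡ number t (y ∷ ys) → number t xs ≡ number t ys
  number-∷ {x} {y} t xs ys e h with t ∼ x in p | t ∼ y in q
  ... | true | true = ℕ.suc-injective h
  ... | false | false = h
  ... | true | false = ⊥-elim (subst T q (∼-trans t x y (subst T (sym p) tt) e))
  ... | false | true = ⊥-elim (subst T p (∼-trans t y x (subst T (sym q) tt) (∼-sym x y e)))

  align : ∀ xs ys → (∀ t → t ∈ xs ⊎ t ∈ ys → number t xs ≡ number t ys) →
          ∃[ zs ] zs ↭ ys × Pointwise (λ x y → T (x ∼ y)) xs zs
  align [] [] h = [] , refl , []
  align [] (y ∷ ys) h with h y (inj₂ (here refl))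
  ... | e with y ∼ y | ∼-refl y
  align [] (y ∷ ys) h | () | true | _
  align (x ∷ xs) ys h with filterᵇ (x ∼_) ys in eq | trans (sym (h x (inj₁ (here refl)))) (first x xs)
    where
    first : ∀ x xs → number x (x ∷ xs) ≡ suc (number x xs)
    first x xs with x ∼ x | ∼-refl x
    ... | true | _ = refl
  ... | y ∷ l | _ with filterᵇ-∈⁻ (x ∼_) ys (subst (y ∈_) (sym eq) (here refl))
  ... | y∈ , e with Mem.∈-∃++ y∈
  ... | us , vs , refl = y ∷ proj₁ rest , ↭-trans (prep y (proj₁ (proj₂ rest))) (↭-sym r) , e ∷ proj₂ (proj₂ rest)
    where
    r : us ++ y ∷ vs ↭ y ∷ us ++ vs
    r = Perm.shift y us vs
    rest : ∃[ zs ] zs ↭ us ++ vs × Pointwise (λ x y → T (x ∼ y)) xs zs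
    rest = align xs (us ++ vs) λ t t∈ →
      number-∷ t xs (us ++ vs) e (trans (h t (Data.Sum.map there (Perm.∈-resp-↭ (↭-sym r) ∘ there) t∈)) (number-↭ t r))

capBy-length : ∀ (R : A → A → Bool) c xs → length (capBy R c xs) ≤ length xs
capBy-length R c [] = z≤n
capBy-length R c (v ∷ xs) with length (filterᵇ (R v) (capBy R c xs)) Data.Nat.<ᵇ c
... | true = s≤s (capBy-length R c xs)
... | false = ℕ.m≤n⇒m≤1+n (capBy-length R c xs)

filterᵇ-length : ∀ (P : A → Bool) xs → length (filterᵇ P xs) ≤ length xs
filterᵇ-length P xs = List.length-filter (Bool.T? ∘ P) xs

-- Small cliques as copies of labels

module Matching {V : Set} (_≟_ : DecidableEquality V) (nb : V → V → Bool)
                (nb-refl : ∀ v → T (nb v v)) (nb-sym : ∀ u v → nb u v ≡ nb v u)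
                (Core : List V) (fstV sndV : V → V) where

  open Named nb nb-refl nb-sym

  -- A label is a vertex of the core or the kind of a small clique, whose
  -- vertices behave towards the core like fstV ℓ and sndV ℓ.
  Label : Set
  Label = V ⊎ V

  Cell : Set
  Cell = Label × V × Maybe V

  is● : Slot → Bool
  is● ● = true
  is● _ = false

  hit : V → Item Label → Bool
  hit c (inj₁ u , x , _) = is● x ∧ nb u c
  hit c (inj₂ ℓ , x , y) = (is● x ∧ nb (fstV ℓ) c) ∨ (is● y ∧ nb (sndV ℓ) c)

  coreHit : V → Item Label → Bool
  coreHit c (inj₁ u , x , _) = is● x ∧ nb u c
  coreHit c (inj₂ _ , _) = false

  Saved : Position Label → Item Label → Set
  Saved L (inj₂ ℓ , ○ , ○) = Any (T ∘ coreHit (fstV ℓ)) L × Any (T ∘ coreHit (sndV ℓ)) L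
  Saved L _ = ⊤

  Dominatedˡ : Position Label → Set
  Dominatedˡ L = All (λ c → Any (T ∘ hit c) L) Core × All (Saved L) L

  saved? : ∀ L i → Dec (Saved L i)
  saved? L (inj₂ ℓ , ○ , ○) = Any.any? (Bool.T? ∘ coreHit (fstV ℓ)) L ×-dec Any.any? (Bool.T? ∘ coreHit (sndV ℓ)) L
  saved? L (inj₂ ℓ , ○ , ●) = yes tt
  saved? L (inj₂ ℓ , ○ , □) = yes tt
  saved? L (inj₂ ℓ , ● , _) = yes tt
  saved? L (inj₂ ℓ , □ , _) = yes tt
  saved? L (inj₁ _ , _) = yes tt

  dominatedˡ? : ∀ L → Dominatedˡ L ⊎ ¬ Dominatedˡ L
  dominatedˡ? L with All.all? (λ c → Any.any? (Bool.T? ∘ hit c) L) Core ×-dec All.all? (saved? L) L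
  ... | yes d = inj₁ d
  ... | no n = inj₂ n

  is●⁻ : ∀ {x} → T (is● x) → x ≡ ●
  is●⁻ {●} _ = refl

  module _ {L M : Position Label} (cov : Cover L M) where

    hit-cover : ∀ {c} → Any (T ∘ hit c) L → Any (T ∘ hit c) M
    hit-cover {c} a with find∈ a
      where
      find∈ : Any (T ∘ hit c) L → ∃[ i ] i ∈ L × T (hit c i)
      find∈ = find
    ... | (inj₁ u , x , _) , i∈ , h with is●⁻ {x} (proj₁ (T-∧⁻ h))
    ... | refl = lose (proj₂ (Cover.first cov i∈)) h
    hit-cover {c} a | (inj₂ ℓ , x , y) , i∈ , h with T-∨⁻ {is● x ∧ nb (fstV ℓ) c} h
    ... | inj₁ h′ with is●⁻ {x} (proj₁ (T-∧⁻ h′))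
    ... | refl = lose (proj₂ (Cover.first cov i∈)) (T-∨⁺ (inj₁ h′))
    hit-cover {c} a | (inj₂ ℓ , x , y) , i∈ , h | inj₂ h′ with is●⁻ {y} (proj₁ (T-∧⁻ h′))
    ... | refl = lose (proj₂ (Cover.second cov i∈)) (T-∨⁺ {is● _ ∧ nb (fstV ℓ) c} (inj₂ h′))

    coreHit-cover : ∀ {c} → Any (T ∘ coreHit c) L → Any (T ∘ coreHit c) M
    coreHit-cover {c} a with find∈ a
      where
      find∈ : Any (T ∘ coreHit c) L → ∃[ i ] i ∈ L × T (coreHit c i)
      find∈ = find
    ... | (inj₁ u , x , _) , i∈ , h with is●⁻ {x} (proj₁ (T-∧⁻ h))
    ... | refl = lose (proj₂ (Cover.first cov i∈)) h

    dominatedˡ-cover : Dominatedˡ L → Dominatedˡ M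
    dominatedˡ-cover (d , s) = All.map hit-cover d , All.tabulate λ {i} → saved i
      where
      saved : ∀ i → i ∈ M → Saved M i
      saved (inj₂ ℓ , ○ , ○) i∈ with All.lookup s (Cover.lost cov i∈)
      ... | a , b = coreHit-cover a , coreHit-cover b
      saved (inj₂ ℓ , ○ , ●) _ = tt
      saved (inj₂ ℓ , ○ , □) _ = tt
      saved (inj₂ ℓ , ● , _) _ = tt
      saved (inj₂ ℓ , □ , _) _ = tt
      saved (inj₁ _ , _) _ = tt

  -- A position of cells, as seen by labels and by vertices.
  data Match : Position Cell → Position Label → Position V → Set where
    []     : Match [] [] []
    single : ∀ {P L N ℓ a s} → Match P L N → Match (((ℓ , a , nothing) , s , ○) ∷ P) ((ℓ , s , ○) ∷ L) (one s a ∷ N)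
    double : ∀ {P L N ℓ a b s t} → Match P L N →
             Match (((ℓ , a , just b) , s , t) ∷ P) ((ℓ , s , t) ∷ L) (one s a ∷ one t b ∷ N)

  Matched : List Cell → Position Label → Position V → Set
  Matched cs L N = ∃[ P ] Match P L N × map proj₁ P ≡ cs

  matching : ∀ {cs} → Transfer (Matched cs)
  matching = record { forth = λ (_ , m , e) mv → forth m e mv ; back = λ (_ , m , e) mv → back m e mv }
    where
    forth : ∀ {P L N cs c L′} → Match P L N → map proj₁ P ≡ cs → Move c L L′ → ∃[ N′ ] Move c N N′ × Matched cs L′ N′
    forth (single m) refl (here fst) = _ , here fst , _ , single m , refl
    forth (double m) refl (here fst) = _ , here fst , _ , double m , refl
    forth (double m) refl (here snd) = _ , there (here fst) , _ , double m , refl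
    forth (single m) refl (there mv) with forth m refl mv
    ... | _ , mv′ , _ , m′ , e = _ , there mv′ , _ , single m′ , cong (_ ∷_) e
    forth (double m) refl (there mv) with forth m refl mv
    ... | _ , mv′ , _ , m′ , e = _ , there (there mv′) , _ , double m′ , cong (_ ∷_) e
    back : ∀ {P L N cs c N′} → Match P L N → map proj₁ P ≡ cs → Move c N N′ → ∃[ L′ ] Move c L L′ × Matched cs L′ N′
    back (single m) refl (here fst) = _ , here fst , _ , single m , refl
    back (double m) refl (here fst) = _ , here fst , _ , double m , refl
    back (double m) refl (there (here fst)) = _ , here snd , _ , double m , refl
    back (single m) refl (there mv) with back m refl mv
    ... | _ , mv′ , _ , m′ , e = _ , there mv′ , _ , single m′ , cong (_ ∷_) e
    back (double m) refl (there (there mv)) with back m refl mv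
    ... | _ , mv′ , _ , m′ , e = _ , there mv′ , _ , double m′ , cong (_ ∷_) e

  Like : V → V → Set
  Like a x = ∀ {c} → c ∈ Core → nb a c ≡ nb x c

  Proper : Cell → Set
  Proper (inj₁ c , a , nothing) = c ≡ a × c ∈ Core
  Proper (inj₁ _ , _ , just _)  = ⊥
  Proper (inj₂ ℓ , a , nothing) = Like a (fstV ℓ) × sndV ℓ ≡ fstV ℓ
  Proper (inj₂ ℓ , a , just b)  = Like a (fstV ℓ) × Like b (sndV ℓ) × a ~ b

  vertexOf : V → Cell → Set
  vertexOf v (_ , a , nothing) = v ≡ a
  vertexOf v (_ , a , just b)  = v ≡ a ⊎ v ≡ b

  Apart : Cell → Cell → Set
  Apart k@(inj₂ _ , _) k′@(inj₂ _ , _) = ∀ {u v} → vertexOf u k → vertexOf v k′ → ¬ u ~ v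
  Apart _ _ = ⊤

  record Wellformed (cs : List Cell) : Set where
    field
      proper : ∀ {k} → k ∈ cs → Proper k
      apart  : AllPairs Apart cs
      core   : ∀ {c} → c ∈ Core → (inj₁ c , c , nothing) ∈ cs

  module _ {P L N} (m : Match P L N) where

    private
      cells : List Cell
      cells = map proj₁ P

    label-∈ : ∀ {P L N ℓ v s t} → Match P L N → ((ℓ , v) , s , t) ∈ P → (ℓ , s , t) ∈ L
    label-∈ (single m) (here refl) = here refl
    label-∈ (double m) (here refl) = here refl
    label-∈ (single m) (there i) = there (label-∈ m i)
    label-∈ (double m) (there i) = there (label-∈ m i)

    first-∈ : ∀ {P L N ℓ a b s t} → Match P L N → ((ℓ , a , b) , s , t) ∈ P → one s a ∈ N
    first-∈ (single m) (here refl) = here refl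
    first-∈ (double m) (here refl) = here refl
    first-∈ (single m) (there i) = there (first-∈ m i)
    first-∈ (double m) (there i) = there (there (first-∈ m i))

    second-∈ : ∀ {P L N ℓ a b s t} → Match P L N → ((ℓ , a , just b) , s , t) ∈ P → one t b ∈ N
    second-∈ (double m) (here refl) = there (here refl)
    second-∈ (single m) (there i) = there (second-∈ m i)
    second-∈ (double m) (there i) = there (there (second-∈ m i))

    single-○ : ∀ {P L N ℓ a s t} → Match P L N → ((ℓ , a , nothing) , s , t) ∈ P → t ≡ ○
    single-○ (single m) (here refl) = refl
    single-○ (single m) (there i) = single-○ m i
    single-○ (double m) (there i) = single-○ m i

    cell-∈ : ∀ {P L N ℓ s t} → Match P L N → (ℓ , s , t) ∈ L → ∃[ v ] ((ℓ , v) , s , t) ∈ P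
    cell-∈ (single m) (here refl) = _ , here refl
    cell-∈ (double m) (here refl) = _ , here refl
    cell-∈ (single m) (there i) = let v , j = cell-∈ m i in v , there j
    cell-∈ (double m) (there i) = let v , j = cell-∈ m i in v , there j

    data Occurs (P : Position Cell) (u : V) (s : Slot) : Set where
      as-first  : ∀ {ℓ b t} → ((ℓ , u , b) , s , t) ∈ P → Occurs P u s
      as-second : ∀ {ℓ a t} → ((ℓ , a , just u) , t , s) ∈ P → Occurs P u s

    occurs-there : ∀ {P u s k} → Occurs P u s → Occurs (k ∷ P) u s
    occurs-there (as-first i) = as-first (there i)
    occurs-there (as-second i) = as-second (there i)

    vertex-∈ : ∀ {P L N u s y} → Match P L N → (u , s , y) ∈ N → Occurs P u s
    vertex-∈ (single m) (here refl) = as-first (here refl)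
    vertex-∈ (double m) (here refl) = as-first (here refl)
    vertex-∈ (double m) (there (here refl)) = as-second (here refl)
    vertex-∈ (single m) (there i) = occurs-there (vertex-∈ m i)
    vertex-∈ (double m) (there (there i)) = occurs-there (vertex-∈ m i)

    module _ (wf : Wellformed cells) where
      open Wellformed wf

      proper-∈ : ∀ {k s t} → (k , s , t) ∈ P → Proper k
      proper-∈ i = proper (Mem.∈-map⁺ proj₁ i)

      same⊎apart : ∀ {P} → AllPairs Apart (map proj₁ P) → ∀ {k k′ : Item Cell} → k ∈ P → k′ ∈ P →
                   k ≡ k′ ⊎ Apart (proj₁ k) (proj₁ k′) ⊎ Apart (proj₁ k′) (proj₁ k)
      same⊎apart (_ ∷ _) (here refl) (here refl) = inj₁ refl
      same⊎apart (h ∷ _) (here refl) (there j) = inj₂ (inj₁ (All.lookup h (Mem.∈-map⁺ proj₁ j)))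
      same⊎apart (h ∷ _) (there i) (here refl) = inj₂ (inj₂ (All.lookup h (Mem.∈-map⁺ proj₁ i)))
      same⊎apart (_ ∷ h) (there i) (there j) = same⊎apart h i j

      -- A vertex of a lost small clique is dominated from the core.
      from-core : ∀ {ℓ a b u v} → ((inj₂ ℓ , a , b) , ○ , ○) ∈ P → vertexOf v (inj₂ ℓ , a , b) → Occurs P u ● → u ~ v →
                  (inj₁ u , ● , ○) ∈ L × u ∈ Core
      from-core {ℓ} {a} {b} {u} {v} i v∈ (as-first {ℓ = inj₁ c} {b = nothing} j) e with proper-∈ j | single-○ m j
      ... | refl , c∈ | refl = label-∈ m j , c∈
      from-core i v∈ (as-first {ℓ = inj₁ c} {b = just _} j) e with () ← proper-∈ j
      from-core i v∈ (as-second {ℓ = inj₁ c} j) e with () ← proper-∈ j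
      from-core i v∈ (as-first {ℓ = inj₂ _} {b = nothing} j) e with same⊎apart apart i j
      ... | inj₂ (inj₁ h) = ⊥-elim (h v∈ refl (~-sym e))
      ... | inj₂ (inj₂ h) = ⊥-elim (h refl v∈ e)
      from-core i v∈ (as-first {ℓ = inj₂ _} {b = just _} j) e with same⊎apart apart i j
      ... | inj₂ (inj₁ h) = ⊥-elim (h v∈ (inj₁ refl) (~-sym e))
      ... | inj₂ (inj₂ h) = ⊥-elim (h (inj₁ refl) v∈ e)
      from-core i v∈ (as-second {ℓ = inj₂ _} j) e with same⊎apart apart i j
      ... | inj₂ (inj₁ h) = ⊥-elim (h v∈ (inj₂ refl) (~-sym e))
      ... | inj₂ (inj₂ h) = ⊥-elim (h (inj₂ refl) v∈ e)

      labelled : Dominated N → Dominatedˡ L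
      labelled d = All.tabulate core-hit , All.tabulate λ {i} → saved i
        where
        core-hit : ∀ {c} → c ∈ Core → Any (T ∘ hit c) L
        core-hit {c} c∈ with d c (Mem.∈-map⁺ proj₁ (first-∈ m (proj₂ (cell (core c∈)))))
          where
          cell : ∀ {k} → k ∈ cells → ∃[ s ] (k , s) ∈ P
          cell k∈ with Mem.∈-map⁻ proj₁ k∈
          ... | (_ , s) , j , refl = s , j
        ... | u , (y , u∈) , e with vertex-∈ m u∈
        ... | as-first {ℓ = inj₁ _} {b = just _} j with () ← proper-∈ j
        core-hit c∈ | u , _ , e | as-first {ℓ = inj₁ _} {b = nothing} j with proper-∈ j
        ... | refl , _ = lose (label-∈ m j) e
        core-hit c∈ | u , _ , e | as-first {ℓ = inj₂ ℓ} {b = nothing} j =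
          lose (label-∈ m j) (T-∨⁺ (inj₁ (subst T (proj₁ (proper-∈ j) c∈) e)))
        core-hit c∈ | u , _ , e | as-first {ℓ = inj₂ ℓ} {b = just _} j =
          lose (label-∈ m j) (T-∨⁺ (inj₁ (subst T (proj₁ (proper-∈ j) c∈) e)))
        core-hit c∈ | u , _ , e | as-second {ℓ = inj₁ _} j with () ← proper-∈ j
        core-hit {c} c∈ | u , _ , e | as-second {ℓ = inj₂ ℓ} {t = t} j =
          lose (label-∈ m j) (T-∨⁺ {is● t ∧ nb (fstV ℓ) c} (inj₂ (subst T (proj₁ (proj₂ (proper-∈ j)) c∈) e)))
        needs : ∀ {ℓ a b v x} → ((inj₂ ℓ , a , b) , ○ , ○) ∈ P → vertexOf v (inj₂ ℓ , a , b) →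
                one ○ v ∈ N → Like v x → Any (T ∘ coreHit x) L
        needs i v∈ v∈N like with d _ (Mem.∈-map⁺ proj₁ v∈N)
        ... | u , (_ , u∈) , e with from-core i v∈ (vertex-∈ m u∈) e
        ... | u∈L , u∈C = lose u∈L (subst T (trans (nb-sym _ _) (trans (like u∈C) (nb-sym _ _))) e)
        saved : ∀ i → i ∈ L → Saved L i
        saved (inj₁ _ , _) _ = tt
        saved (inj₂ ℓ , ● , _) _ = tt
        saved (inj₂ ℓ , □ , _) _ = tt
        saved (inj₂ ℓ , ○ , ●) _ = tt
        saved (inj₂ ℓ , ○ , □) _ = tt
        saved (inj₂ ℓ , ○ , ○) i with cell-∈ m i
        ... | (a , nothing) , j with proper-∈ j
        ... | like , e = needs j refl (first-∈ m j) like ,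
                         subst (λ x → Any (T ∘ coreHit x) L) (sym e) (needs j refl (first-∈ m j) like)
        saved (inj₂ ℓ , ○ , ○) i | (a , just b) , j with proper-∈ j
        ... | like , like′ , _ = needs j (inj₁ refl) (first-∈ m j) like , needs j (inj₂ refl) (second-∈ m j) like′

      named : Full L → Dominatedˡ L → Dominated N
      named f (hits , saves) v v∈ with Mem.∈-map⁻ proj₁ v∈
      ... | (_ , s , _) , v∈N , refl = by-occurrence (vertex-∈ m v∈N)
        where
        Answer : V → Set
        Answer v = ∃[ u ] u ∈● N × u ~ v
        from-hit : ∀ {c} → c ∈ Core → Any (T ∘ hit c) L → Answer c
        from-hit {c} c∈ h with find h
        ... | (ℓ , x , y) , i∈ , t with cell-∈ m i∈
        from-hit {c} c∈ h | (inj₁ u , x , y) , i∈ , t | (a , just _) , j with () ← proper-∈ j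
        from-hit {c} c∈ h | (inj₁ u , x , y) , i∈ , t | (a , nothing) , j with proper-∈ j | is●⁻ {x} (proj₁ (T-∧⁻ t))
        ... | refl , _ | refl = u , (_ , first-∈ m j) , t
        from-hit {c} c∈ h | (inj₂ ℓ , x , y) , i∈ , t | (a , b) , j with T-∨⁻ {is● x ∧ nb (fstV ℓ) c} t
        from-hit {c} c∈ h | (inj₂ ℓ , x , y) , i∈ , t | (a , b) , j | inj₁ t′ with is●⁻ {x} (proj₁ (T-∧⁻ t′))
        ... | refl = a , (_ , first-∈ m j) , subst T (sym (like b (proper-∈ j) c∈)) t′
          where
          like : ∀ b → Proper (inj₂ ℓ , a , b) → Like a (fstV ℓ)
          like nothing (h , _) = h
          like (just _) (h , _) = h
        from-hit {c} c∈ h | (inj₂ ℓ , x , y) , i∈ , t | (a , b) , j | inj₂ t′ with is●⁻ {y} (proj₁ (T-∧⁻ t′))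
        from-hit {c} c∈ h | (inj₂ ℓ , x , y) , i∈ , t | (a , just b) , j | inj₂ t′ | refl =
          b , (_ , second-∈ m j) , subst T (sym (proj₁ (proj₂ (proper-∈ j)) c∈)) t′
        from-hit {c} c∈ h | (inj₂ ℓ , x , y) , i∈ , t | (a , nothing) , j | inj₂ t′ | refl with () ← single-○ m j
        from-saved : ∀ {v x} → Like v x → Any (T ∘ coreHit x) L → Answer v
        from-saved {v} like h with find h
        ... | (inj₁ u , x , y) , i∈ , t with cell-∈ m i∈
        ... | (a , just _) , j with () ← proper-∈ j
        from-saved {v} like h | (inj₁ u , x , y) , i∈ , t | (a , nothing) , j with proper-∈ j | is●⁻ {x} (proj₁ (T-∧⁻ t))
        ... | refl , u∈C | refl = u , (_ , first-∈ m j) , subst T (trans (nb-sym _ _) (trans (sym (like u∈C)) (nb-sym _ _))) t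
        from-saved {v} like h | (inj₂ u , x , y) , i∈ , ()
        lost : ∀ {ℓ a b} → ((inj₂ ℓ , a , b) , ○ , ○) ∈ P → Saved L (inj₂ ℓ , ○ , ○)
        lost j = All.lookup saves (label-∈ m j)
        by-occurrence : ∀ {v s} → Occurs P v s → Answer v
        by-occurrence (as-first {ℓ = inj₁ c} {b = just _} j) with () ← proper-∈ j
        by-occurrence (as-first {ℓ = inj₁ c} {b = nothing} j) with proper-∈ j
        ... | refl , c∈ = from-hit c∈ (All.lookup hits c∈)
        by-occurrence (as-second {ℓ = inj₁ c} j) with () ← proper-∈ j
        by-occurrence {v} {●} (as-first {ℓ = inj₂ _} j) = v , (_ , first-∈ m j) , nb-refl v
        by-occurrence {v} {●} (as-second {ℓ = inj₂ _} j) = v , (_ , second-∈ m j) , nb-refl v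
        by-occurrence {v} {○} (as-first {ℓ = inj₂ _} {nothing} j) with proper-∈ j | single-○ m j
        ... | like , _ | refl = from-saved like (proj₁ (lost j))
        by-occurrence {v} {○} (as-first {ℓ = inj₂ _} {just b} {●} j) = b , (_ , second-∈ m j) , ~-sym (proj₂ (proj₂ (proper-∈ j)))
        by-occurrence {v} {○} (as-first {ℓ = inj₂ _} {just b} {○} j) = from-saved (proj₁ (proper-∈ j)) (proj₁ (lost j))
        by-occurrence {v} {○} (as-first {ℓ = inj₂ _} {just b} {□} j) with () ← proj₂ (All.lookup f (label-∈ m j))
        by-occurrence {v} {○} (as-second {ℓ = inj₂ _} {a} {●} j) = a , (_ , first-∈ m j) , proj₂ (proj₂ (proper-∈ j))
        by-occurrence {v} {○} (as-second {ℓ = inj₂ _} {a} {○} j) = from-saved (proj₁ (proj₂ (proper-∈ j))) (proj₂ (lost j))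
        by-occurrence {v} {○} (as-second {ℓ = inj₂ _} {a} {□} j) with () ← proj₁ (All.lookup f (label-∈ m j))
        by-occurrence {v} {□} (as-first {ℓ = inj₂ _} j) with () ← proj₁ (All.lookup f (label-∈ m j))
        by-occurrence {v} {□} (as-second {ℓ = inj₂ _} j) with () ← proj₂ (All.lookup f (label-∈ m j))

  module _ {cs : List Cell} (wf : Wellformed cs) where

    to-names : ∀ {L N} → Matched cs L N → W Dominatedˡ p L → W Dominated p N
    to-names = transfer matching λ { (_ , m , refl) f d → named m wf f d }

    to-labels : ∀ {L N} → Matched cs L N → W Dominated p N → W Dominatedˡ p L
    to-labels = transfer (transfer-flip matching) λ { (_ , m , refl) f d → labelled m wf d }

-- The kernel

AllPairs-↭ : ∀ {R : A → A → Set} → (∀ {x y} → R x y → R y x) → ∀ {xs ys} → xs ↭ ys → AllPairs R xs → AllPairs R ys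
AllPairs-↭ s refl h = h
AllPairs-↭ s (prep x r) (h ∷ hs) = Perm.All-resp-↭ r h ∷ AllPairs-↭ s r hs
AllPairs-↭ s (swap x y r) ((xy ∷ hx) ∷ hy ∷ hs) = (s xy ∷ Perm.All-resp-↭ r hy) ∷ Perm.All-resp-↭ r hx ∷ AllPairs-↭ s r hs
AllPairs-↭ s (transit r r′) h = AllPairs-↭ s r′ (AllPairs-↭ s r h)

T-ext : ∀ {a b} → (T a → T b) → (T b → T a) → a ≡ b
T-ext {true} {true} _ _ = refl
T-ext {false} {false} _ _ = refl
T-ext {true} {false} f _ = ⊥-elim (f tt)
T-ext {false} {true} _ g = ⊥-elim (g tt)

find-↭ : ∀ (P : A → Bool) xs → xs ↭ filterᵇ P xs ++ filterᵇ (not ∘ P) xs × (∀ {x} → x ∈ filterᵇ P xs → T (P x))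
find-↭ P xs = filterᵇ-complement P xs , λ x∈ → proj₂ (filterᵇ-∈⁻ P xs x∈)

head-or : A → List A → A
head-or d [] = d
head-or d (x ∷ _) = x

module Kernel {V : Set} (_≟_ : DecidableEquality V) (nb : V → V → Bool)
              (nb-refl : ∀ v → T (nb v v)) (nb-sym : ∀ u v → nb u v ≡ nb v u)
              (X L : List V) where

  open Named nb nb-refl nb-sym

  -- Same neighbours in X.
  τ : V → V → Bool
  τ u v = allᵇ (λ x → nb u x == nb v x) X

  twin : V → V → Bool
  twin u v = nb u v ∧ τ u v

  L₂ : List V
  L₂ = capBy twin 2 L

  C : V → List V
  C v = filterᵇ (nb v) L₂

  reps : List V
  reps = capBy nb 1 L₂

  number : V → List V → ℕ
  number t xs = length (filterᵇ (τ t) xs)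

  kind : V → V → Bool
  kind v w = allᵇ (λ t → number t (C v) Data.Nat.≡ᵇ number t (C w)) L₂

  big : V → Bool
  big v = 2 Data.Nat.<ᵇ length (C v)

  bigs smalls R₁ lbl : List V
  bigs = filterᵇ big reps
  smalls = filterᵇ (not ∘ big) reps
  R₁ = capBy kind 6 bigs
  lbl = capBy kind 1 smalls

  inC : List V → V → Bool
  inC R u = anyᵇ (λ v → nb v u) R

  labelList : List V
  labelList = X ++ lbl ++ filterᵇ (inC R₁) L₂

  threshold : ℕ
  threshold = 3 + 3 ^ (length labelList * 9) * 2

  R₂ K : List V
  R₂ = capBy kind threshold smalls
  K = X ++ filterᵇ (inC (R₁ ++ R₂)) L₂

  τ-sound : ∀ {u v x} → T (τ u v) → x ∈ X → nb u x ≡ nb v x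
  τ-sound t x∈ = ==-sound (allᵇ⁻ t x∈)

  τ-complete : ∀ {u v} → (∀ {x} → x ∈ X → nb u x ≡ nb v x) → T (τ u v)
  τ-complete h = allᵇ⁺ X λ x∈ → ==-complete (h x∈)

  τ-refl : ∀ u → T (τ u u)
  τ-refl u = τ-complete λ _ → refl

  τ-sym : ∀ u v → T (τ u v) → T (τ v u)
  τ-sym u v t = τ-complete λ x∈ → sym (τ-sound {u} {v} t x∈)

  τ-trans : ∀ u v w → T (τ u v) → T (τ v w) → T (τ u w)
  τ-trans u v w t t′ = τ-complete λ x∈ → trans (τ-sound {u} {v} t x∈) (τ-sound {v} {w} t′ x∈)

  kind-sound : ∀ {v w t} → T (kind v w) → t ∈ L₂ → number t (C v) ≡ number t (C w)
  kind-sound k t∈ = ℕ.≡ᵇ⇒≡ _ _ (allᵇ⁻ k t∈)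

  kind-complete : ∀ {v w} → (∀ {t} → t ∈ L₂ → number t (C v) ≡ number t (C w)) → T (kind v w)
  kind-complete h = allᵇ⁺ L₂ λ t∈ → ℕ.≡⇒≡ᵇ _ _ (h t∈)

  kind-refl : ∀ v → T (kind v v)
  kind-refl v = kind-complete λ _ → refl

  kind-sym : ∀ {v w} → T (kind v w) → T (kind w v)
  kind-sym {v} {w} k = kind-complete {w} {v} λ t∈ → sym (kind-sound {v} {w} k t∈)

  kind-cong : ∀ {u v w} → T (kind u v) → kind u w ≡ kind v w
  kind-cong {u} {v} {w} k = T-ext
    (λ k′ → kind-complete {v} {w} λ t∈ → trans (sym (kind-sound {u} {v} k t∈)) (kind-sound {u} {w} k′ t∈))
    (λ k′ → kind-complete {u} {w} λ t∈ → trans (kind-sound {u} {v} k t∈) (kind-sound {v} {w} k′ t∈))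

  L₂⊆L : ∀ {v} → v ∈ L₂ → v ∈ L
  L₂⊆L = capBy-∈ L

  module _ (L-trans : ∀ {u v w} → u ∈ L → v ∈ L → w ∈ L → u ~ v → v ~ w → u ~ w) where

    same-nb : ∀ {a b y} → a ∈ L → b ∈ L → y ∈ L → a ~ b → nb a y ≡ nb b y
    same-nb a∈ b∈ y∈ e = T-ext (L-trans b∈ a∈ y∈ (~-sym e)) (L-trans a∈ b∈ y∈ e)

    twin-stage : Game p (X ++ L) ⟷ Game p (X ++ L₂)
    twin-stage {p} = proj₁ (capBy-chain I (λ l → Game p (X ++ l)) del drop [] L id)
      where
      I : List V → Set
      I l = ∀ {u} → u ∈ l → u ∈ L
      del : ∀ P v acc → I (P ++ v ∷ acc) → I (P ++ acc)
      del P v acc i u∈ = [ (λ j → i (Mem.∈-++⁺ˡ j)) , (λ j → i (Mem.∈-++⁺ʳ P (there j))) ]′ (Mem.∈-++⁻ P u∈)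
      drop : ∀ P v acc → I (P ++ v ∷ acc) → 2 ≤ length (filterᵇ (twin v) acc) →
             Game p (X ++ P ++ v ∷ acc) ⟷ Game p (X ++ P ++ acc)
      drop P v acc i le with filterᵇ (twin v) acc | find-↭ (twin v) acc
      drop P v acc i () | [] | _
      drop P v acc i (s≤s ()) | _ ∷ [] | _
      ... | u ∷ w ∷ us | r , h = (λ g → Game-↭ (↭-sym with-uw) (drop-twin tw (Game-↭ with-v g))) ,
                                 (λ g → Game-↭ (↭-sym with-v) (add-twin tw (Game-↭ with-uw g)))
        where
        Y rest : List V
        rest = us ++ filterᵇ (not ∘ twin v) acc
        Y = X ++ P ++ rest
        with-uw : X ++ P ++ acc ↭ u ∷ w ∷ Y
        with-uw = ↭-trans (Perm.++⁺ˡ X (Perm.++⁺ˡ P r)) (↭-trans (Perm.++⁺ˡ X (shifts P (u ∷ w ∷ []) rest)) (shifts X (u ∷ w ∷ []) (P ++ rest)))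
        with-v : X ++ P ++ v ∷ acc ↭ u ∷ w ∷ v ∷ Y
        with-v = ↭-trans (Perm.++⁺ˡ X (shifts P (v ∷ []) acc)) (↭-trans (shifts X (v ∷ []) (P ++ acc))
          (↭-trans (prep v with-uw) (shifts (v ∷ []) (u ∷ w ∷ []) Y)))
        inL : ∀ {y} → y ∈ u ∷ w ∷ v ∷ Y → y ∈ X ⊎ y ∈ L
        inL y∈ = [ inj₁ , inj₂ ∘ i ]′ (Mem.∈-++⁻ X (Perm.∈-resp-↭ (↭-sym with-v) y∈))
        v∈L : v ∈ L
        v∈L = i (Mem.∈-++⁺ʳ P (here refl))
        acc∈L : ∀ {y} → y ∈ u ∷ w ∷ us → y ∈ L
        acc∈L y∈ = i (Mem.∈-++⁺ʳ P (there (Perm.∈-resp-↭ (↭-sym r) (Mem.∈-++⁺ˡ y∈))))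
        v≗ : ∀ {t y} → t ∈ u ∷ w ∷ us → y ∈ u ∷ w ∷ v ∷ Y → nb v y ≡ nb t y
        v≗ {t} t∈ y∈ with inL y∈
        ... | inj₁ y∈X = τ-sound {v} {t} (proj₂ (T-∧⁻ {nb v t} (h t∈))) y∈X
        ... | inj₂ y∈L = same-nb v∈L (acc∈L t∈) y∈L (proj₁ (T-∧⁻ (h t∈)))
        tw : Twins u w v Y
        tw = record { v≗u = λ y∈ → trans (sym (v≗ (there (here refl)) y∈)) (v≗ (here refl) y∈) ; w≗u = v≗ (here refl) }

    _≁_ : V → V → Set
    u ≁ v = ¬ u ~ v

    Separate : List V → Set
    Separate R = (∀ {v} → v ∈ R → v ∈ L₂) × AllPairs _≁_ R

    separate-↭ : ∀ {R R′} → R ↭ R′ → Separate R → Separate R′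
    separate-↭ r (i , a) = i ∘ Perm.∈-resp-↭ (↭-sym r) , AllPairs-↭ (λ ne e → ne (~-sym e)) r a

    separate-tail : ∀ {v R} → Separate (v ∷ R) → Separate R
    separate-tail (i , _ ∷ a) = i ∘ there , a

    separate-head : ∀ {v w R} → Separate (v ∷ R) → w ∈ R → v ≁ w
    separate-head (_ , h ∷ _) w∈ = All.lookup h w∈

    C-∈ : ∀ {v u} → u ∈ C v → u ∈ L₂ × v ~ u
    C-∈ {v} = filterᵇ-∈⁻ (nb v) L₂

    C-clique : ∀ {v a b} → v ∈ L₂ → a ∈ C v → b ∈ C v → a ~ b
    C-clique v∈ a∈ b∈ with C-∈ a∈ | C-∈ b∈
    ... | a∈L , e | b∈L , e′ = L-trans (L₂⊆L a∈L) (L₂⊆L v∈) (L₂⊆L b∈L) (~-sym e) e′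

    C-apart : ∀ {v w a b} → v ∈ L₂ → w ∈ L₂ → v ≁ w → a ∈ C v → b ∈ C w → a ≁ b
    C-apart v∈ w∈ ne a∈ b∈ ab with C-∈ a∈ | C-∈ b∈
    ... | a∈L , e | b∈L , e′ = ne (L-trans (L₂⊆L v∈) (L₂⊆L b∈L) (L₂⊆L w∈)
      (L-trans (L₂⊆L v∈) (L₂⊆L a∈L) (L₂⊆L b∈L) e ab) (~-sym e′))

    cliques : List V → List V
    cliques = concatMap C

    cliques-∈ : ∀ R {u} → u ∈ cliques R → ∃[ v ] v ∈ R × u ∈ C v
    cliques-∈ R u∈ = find (Mem.∈-concatMap⁻ C {xs = R} u∈)

    filterᵇ-none : ∀ (xs : List V) → filterᵇ (λ _ → false) xs ≡ []
    filterᵇ-none [] = refl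
    filterᵇ-none (x ∷ xs) = filterᵇ-none xs

    inC-cliques : ∀ R → Separate R → filterᵇ (inC R) L₂ ↭ cliques R
    inC-cliques [] _ = ↭-reflexive (filterᵇ-none L₂)
    inC-cliques (v ∷ R) s@(i , ne ∷ _) = ↭-trans (filterᵇ-∨ (nb v) (inC R) L₂ disjoint) (Perm.++⁺ˡ (C v) (inC-cliques R (separate-tail s)))
      where
      disjoint : ∀ {u} → u ∈ L₂ → ¬ (v ~ u × T (inC R u))
      disjoint u∈ (e , t) with anyᵇ⁻ R t
      ... | w , w∈ , e′ = All.lookup ne w∈ (L-trans (L₂⊆L (i (here refl))) (L₂⊆L u∈) (L₂⊆L (i (there w∈))) e (~-sym e′))

    reps-separate : Separate reps
    reps-separate = capBy-∈ L₂ , go L₂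
      where
      go : ∀ xs → AllPairs _≁_ (capBy nb 1 xs)
      go [] = []
      go (v ∷ xs) = capBy-cases (AllPairs _≁_) v xs
        (λ lt → All.tabulate (λ {u} u∈ e → empty (filterᵇ-∈⁺ (nb v) u∈ e) lt) ∷ go xs) (λ _ → go xs)
        where
        empty : ∀ {u} {l : List V} → u ∈ l → ¬ length l < 1
        empty {l = _ ∷ _} _ (s≤s ())

    all-cliques : L₂ ↭ cliques reps
    all-cliques = ↭-trans (↭-reflexive (sym (filterᵇ-all L₂ λ {u} u∈ →
      let v , v∈ , e = capBy-related {R = nb} nb-refl (s≤s z≤n) L₂ u∈ in anyᵇ⁺ v∈ (~-sym e)))) (inC-cliques reps reps-separate)

    split-reps : reps ↭ bigs ++ smalls
    split-reps = filterᵇ-complement big reps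

    module τ-align = Align τ τ-refl τ-sym τ-trans

    aligned : ∀ {v w} → T (kind v w) → ∃[ zs ] zs ↭ C w × Pointwise (λ x y → T (τ x y)) (C v) zs
    aligned {v} {w} k = τ-align.align (C v) (C w) λ t t∈ → kind-sound {v} {w} k ([ proj₁ ∘ C-∈ {v} , proj₁ ∘ C-∈ {w} ]′ t∈)

    -- Six copies of a clique a ∷ b ∷ c ∷ t with at least three vertices.
    record Copy (a b c : V) (t : List V) (w : V) : Set where
      field
        a′ b′ c′ : V
        t′       : List V
        perm     : a′ ∷ b′ ∷ c′ ∷ t′ ↭ C w
        a≈       : T (τ a a′)
        b≈       : T (τ b b′)
        c≈       : T (τ c c′)
        t≈       : Pointwise (λ x y → T (τ x y)) t t′
      vs : List V
      vs = a′ ∷ b′ ∷ c′ ∷ t′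

    copy : ∀ {v w a b c t} → C v ≡ a ∷ b ∷ c ∷ t → T (kind v w) → Copy a b c t w
    copy {v} {w} e k with aligned {v} {w} k
    ... | zs , r , pw with subst (λ l → Pointwise (λ x y → T (τ x y)) l zs) e pw
    ... | p₁ ∷ p₂ ∷ p₃ ∷ ps = record { perm = r ; a≈ = p₁ ; b≈ = p₂ ; c≈ = p₃ ; t≈ = ps }

    copy-type : ∀ {a b c t w u} (Q : Copy a b c t w) → u ∈ Copy.vs Q → ∃[ u₀ ] u₀ ∈ a ∷ b ∷ c ∷ t × T (τ u₀ u)
    copy-type Q (here refl) = _ , here refl , Copy.a≈ Q
    copy-type Q (there (here refl)) = _ , there (here refl) , Copy.b≈ Q
    copy-type Q (there (there (here refl))) = _ , there (there (here refl)) , Copy.c≈ Q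
    copy-type Q (there (there (there i))) = let u₀ , j , e = go (Copy.t≈ Q) i in u₀ , there (there (there j)) , e
      where
      go : ∀ {xs ys u} → Pointwise (λ x y → T (τ x y)) xs ys → u ∈ ys → ∃[ u₀ ] u₀ ∈ xs × T (τ u₀ u)
      go (e ∷ _) (here refl) = _ , here refl , e
      go (_ ∷ pw) (there i) = let u₀ , j , e = go pw i in u₀ , there j , e

    zips : ∀ {t t₁ t₂} → Pointwise (λ x y → T (τ x y)) t t₁ → Pointwise (λ x y → T (τ x y)) t t₂ →
           ∃[ ps ] flatten ps ↭ t₁ ++ t₂ × (∀ {u} → u ∈ t → ∃₂ λ a b → (a , b) ∈ ps × T (τ u a) × T (τ u b))
    zips [] [] = [] , refl , λ ()
    zips {t₂ = y ∷ ys} (_∷_ {y = x} {ys = xs} e es) (e′ ∷ es′) with zips es es′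
    ... | ps , r , h = (x , y) ∷ ps , prep x (↭-trans (prep y r) (↭-sym (Perm.shift y xs ys))) ,
      λ { (here refl) → x , y , here refl , e , e′ ; (there i) → let a , b , j , q = h i in a , b , there j , q }

    module _ {v r₁ r₂ r₃ r₄ r₅ r₆ R a b c t} (eq : C v ≡ a ∷ b ∷ c ∷ t)
             (Q₁ : Copy a b c t r₁) (Q₂ : Copy a b c t r₂) (Q₃ : Copy a b c t r₃)
             (Q₄ : Copy a b c t r₄) (Q₅ : Copy a b c t r₅) (Q₆ : Copy a b c t r₆)
             {zp} (zperm : flatten zp ↭ Copy.t′ Q₁ ++ Copy.t′ Q₂)
             (zpair : ∀ {u} → u ∈ t → ∃₂ λ a b → (a , b) ∈ zp × T (τ u a) × T (τ u b))
             (separate : Separate (v ∷ r₁ ∷ r₂ ∷ r₃ ∷ r₄ ∷ r₅ ∷ r₆ ∷ R)) where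

      private
        sub : ∀ {w} → w ∈ v ∷ r₁ ∷ r₂ ∷ r₃ ∷ r₄ ∷ r₅ ∷ r₆ ∷ R → w ∈ L₂
        sub = proj₁ separate
        ap : AllPairs _≁_ (v ∷ r₁ ∷ r₂ ∷ r₃ ∷ r₄ ∷ r₅ ∷ r₆ ∷ R)
        ap = proj₂ separate
      open Copy

      Q₀ Y E six : List V
      Q₀ = a ∷ b ∷ c ∷ t
      Y = X ++ cliques R
      six = r₁ ∷ r₂ ∷ r₃ ∷ r₄ ∷ r₅ ∷ r₆ ∷ []
      ps : List (V × V)
      ps = (a′ Q₁ , b′ Q₁) ∷ (a′ Q₂ , b′ Q₂) ∷ (c′ Q₁ , c′ Q₂) ∷
           (b′ Q₃ , c′ Q₃) ∷ (b′ Q₄ , c′ Q₄) ∷ (a′ Q₃ , a′ Q₄) ∷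
           (a′ Q₅ , c′ Q₅) ∷ (a′ Q₆ , c′ Q₆) ∷ (b′ Q₅ , b′ Q₆) ∷ zp
      E = t′ Q₃ ++ t′ Q₄ ++ t′ Q₅ ++ t′ Q₆
      group₁ : vs Q₁ ++ vs Q₂ ↭ (a′ Q₁ ∷ b′ Q₁ ∷ a′ Q₂ ∷ b′ Q₂ ∷ c′ Q₁ ∷ c′ Q₂ ∷ []) ++ flatten zp
      group₁ = ↭-trans (prep (a′ Q₁) (prep (b′ Q₁) (gather (c′ Q₁) (a′ Q₂ ∷ b′ Q₂ ∷ []) (c′ Q₂) (t′ Q₁) (t′ Q₂))))
        (Perm.++⁺ˡ (a′ Q₁ ∷ b′ Q₁ ∷ a′ Q₂ ∷ b′ Q₂ ∷ c′ Q₁ ∷ c′ Q₂ ∷ []) (↭-sym (zperm)))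
        where
        gather : ∀ c ab c₂ t t₂ → c ∷ t ++ (ab ++ c₂ ∷ t₂) ↭ ab ++ c ∷ c₂ ∷ t ++ t₂
        gather c ab c₂ t t₂ = ↭-trans (prep c (↭-trans (shifts t ab (c₂ ∷ t₂)) (Perm.++⁺ˡ ab (Perm.shift c₂ t t₂))))
          (↭-sym (Perm.shift c ab (c₂ ∷ t ++ t₂)))
      group₂ : vs Q₃ ++ vs Q₄ ↭ (b′ Q₃ ∷ c′ Q₃ ∷ b′ Q₄ ∷ c′ Q₄ ∷ a′ Q₃ ∷ a′ Q₄ ∷ []) ++ (t′ Q₃ ++ t′ Q₄)
      group₂ = ↭-trans (prep _ (prep _ (prep _ (shifts (t′ Q₃) (a′ Q₄ ∷ b′ Q₄ ∷ c′ Q₄ ∷ []) (t′ Q₄)))))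
        (↭-trans (shifts (a′ Q₃ ∷ []) (b′ Q₃ ∷ c′ Q₃ ∷ []) (a′ Q₄ ∷ b′ Q₄ ∷ c′ Q₄ ∷ t′ Q₃ ++ t′ Q₄))
          (prep _ (prep _ (shifts (a′ Q₃ ∷ a′ Q₄ ∷ []) (b′ Q₄ ∷ c′ Q₄ ∷ []) (t′ Q₃ ++ t′ Q₄)))))
      group₃ : vs Q₅ ++ vs Q₆ ↭ (a′ Q₅ ∷ c′ Q₅ ∷ a′ Q₆ ∷ c′ Q₆ ∷ b′ Q₅ ∷ b′ Q₆ ∷ []) ++ (t′ Q₅ ++ t′ Q₆)
      group₃ = ↭-trans (prep _ (prep _ (prep _ (shifts (t′ Q₅) (a′ Q₆ ∷ b′ Q₆ ∷ c′ Q₆ ∷ []) (t′ Q₆)))))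
        (prep _ (↭-trans (swap _ _ refl) (prep _ (↭-trans (swap _ _ refl)
          (prep _ (shifts (b′ Q₅ ∷ b′ Q₆ ∷ []) (c′ Q₆ ∷ []) (t′ Q₅ ++ t′ Q₆)))))))
      regroup : ∀ (h₁ z h₂ s h₃ u : List V) → (h₁ ++ z) ++ ((h₂ ++ s) ++ (h₃ ++ u)) ↭ (h₁ ++ h₂ ++ h₃ ++ z) ++ (s ++ u)
      regroup h₁ z h₂ s h₃ u = ↭-trans (↭-reflexive (trans (List.++-assoc h₁ z _) (cong (λ l → h₁ ++ z ++ l) (List.++-assoc h₂ s _))))
        (↭-trans (Perm.++⁺ˡ h₁ (↭-trans (shifts z h₂ (s ++ h₃ ++ u)) (Perm.++⁺ˡ h₂
            (↭-trans (Perm.++⁺ˡ z (shifts s h₃ u)) (shifts z h₃ (s ++ u))))))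
          (↭-reflexive (sym (trans (List.++-assoc h₁ (h₂ ++ h₃ ++ z) _) (cong (h₁ ++_)
            (trans (List.++-assoc h₂ (h₃ ++ z) _) (cong (h₂ ++_) (List.++-assoc h₃ z _))))))))
      copies : cliques six ↭ flatten ps ++ E
      copies = ↭-trans (↭-sym (Perm.++⁺ (perm Q₁) (Perm.++⁺ (perm Q₂) (Perm.++⁺ (perm Q₃) (Perm.++⁺ (perm Q₄) (Perm.++⁺ (perm Q₅)
          (↭-trans (↭-reflexive (sym (List.++-identityʳ _))) (Perm.++⁺ (perm Q₆) refl))))))))
        (↭-trans (↭-reflexive (sym (trans (List.++-assoc (vs Q₁) (vs Q₂) _) (cong (λ l → vs Q₁ ++ vs Q₂ ++ l) (List.++-assoc (vs Q₃) (vs Q₄) _)))))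
        (↭-trans (Perm.++⁺ group₁ (Perm.++⁺ group₂ group₃))
        (↭-trans (regroup (a′ Q₁ ∷ b′ Q₁ ∷ a′ Q₂ ∷ b′ Q₂ ∷ c′ Q₁ ∷ c′ Q₂ ∷ []) (flatten zp)
            (b′ Q₃ ∷ c′ Q₃ ∷ b′ Q₄ ∷ c′ Q₄ ∷ a′ Q₃ ∷ a′ Q₄ ∷ []) (t′ Q₃ ++ t′ Q₄)
            (a′ Q₅ ∷ c′ Q₅ ∷ a′ Q₆ ∷ c′ Q₆ ∷ b′ Q₅ ∷ b′ Q₆ ∷ []) (t′ Q₅ ++ t′ Q₆))
          (Perm.++⁺ˡ (flatten ps) (↭-reflexive (List.++-assoc (t′ Q₃) (t′ Q₄) _))))))
      six-perm : X ++ cliques (r₁ ∷ r₂ ∷ r₃ ∷ r₄ ∷ r₅ ∷ r₆ ∷ R) ↭ flatten ps ++ E ++ Y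
      six-perm = ↭-trans (Perm.++⁺ˡ X (↭-reflexive (List.concatMap-++ C six R)))
        (↭-trans (shifts X (cliques six) (cliques R)) (↭-trans (Perm.++⁺ʳ Y copies) (↭-reflexive (List.++-assoc (flatten ps) E Y))))
      all-perm : X ++ Q₀ ++ cliques (r₁ ∷ r₂ ∷ r₃ ∷ r₄ ∷ r₅ ∷ r₆ ∷ R) ↭ Q₀ ++ flatten ps ++ E ++ Y
      all-perm = ↭-trans (shifts X Q₀ _) (Perm.++⁺ˡ Q₀ six-perm)
      copy-pair : ∀ {u} → u ∈ Q₀ → ∃₂ λ x y → (x , y) ∈ ps × T (τ u x) × T (τ u y)
      copy-pair (here refl) = _ , _ , there (there (there (there (there (here refl))))) , a≈ Q₃ , a≈ Q₄
      copy-pair (there (here refl)) = _ , _ , there (there (there (there (there (there (there (there (here refl)))))))) , b≈ Q₅ , b≈ Q₆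
      copy-pair (there (there (here refl))) = _ , _ , there (there (here refl)) , c≈ Q₁ , c≈ Q₂
      copy-pair (there (there (there i))) = let x , y , j , e = zpair i in
        x , y , there (there (there (there (there (there (there (there (there j)))))))) , e
      data Member (u : V) : Set where
        member : ∀ {w u₀} → w ∈ v ∷ six → u ∈ C w → u₀ ∈ Q₀ → T (τ u₀ u) → Member u
      from-copy : ∀ {w u} → w ∈ six → (Q : Copy a b c t w) → u ∈ vs Q → Member u
      from-copy w∈ Q u∈ = let _ , i , e = copy-type Q u∈ in member (there w∈) (Perm.∈-resp-↭ (perm Q) u∈) i e
      in-six : ∀ {u} → u ∈ flatten ps ++ E → ∃[ w ] w ∈ six × Σ (Copy a b c t w) λ Q → u ∈ vs Q
      in-six {u} u∈ with cliques-∈ six (Perm.∈-resp-↭ (↭-sym copies) u∈)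
      ... | _ , here refl , i = _ , here refl , Q₁ , Perm.∈-resp-↭ (↭-sym (perm Q₁)) i
      ... | _ , there (here refl) , i = _ , there (here refl) , Q₂ , Perm.∈-resp-↭ (↭-sym (perm Q₂)) i
      ... | _ , there (there (here refl)) , i = _ , there (there (here refl)) , Q₃ , Perm.∈-resp-↭ (↭-sym (perm Q₃)) i
      ... | _ , there (there (there (here refl))) , i = _ , there (there (there (here refl))) , Q₄ , Perm.∈-resp-↭ (↭-sym (perm Q₄)) i
      ... | _ , there (there (there (there (here refl)))) , i = _ , there (there (there (there (here refl)))) , Q₅ , Perm.∈-resp-↭ (↭-sym (perm Q₅)) i
      ... | _ , there (there (there (there (there (here refl))))) , i = _ , there (there (there (there (there (here refl))))) , Q₆ , Perm.∈-resp-↭ (↭-sym (perm Q₆)) i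
      apart-R : ∀ {w w′} → w ∈ v ∷ six → w′ ∈ R → w ≁ w′
      apart-R w∈ w′∈ = All.lookup (AllPairs-++ (v ∷ six) ap w∈) w′∈
        where
        AllPairs-++ : ∀ P {w} → AllPairs _≁_ (P ++ R) → w ∈ P → All (w ≁_) R
        AllPairs-++ (_ ∷ P) (h ∷ _) (here refl) = All.++⁻ʳ P h
        AllPairs-++ (_ ∷ P) (_ ∷ h) (there i) = AllPairs-++ P h i
      cross : ∀ {u} → u ∈ Q₀ ++ flatten ps ++ E → ∃₂ λ x y → (x , y) ∈ ps × (∀ {z} → z ∈ Y → u ~ z → x ~ z × y ~ z)
      cross {u} u∈ with [ (λ i → member (here refl) (subst (u ∈_) (sym eq) i) i (τ-refl u)) ,
                          (λ i → let _ , w∈ , Q , j = in-six i in from-copy w∈ Q j) ]′ (Mem.∈-++⁻ Q₀ u∈)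
      ... | member {w} {u₀} w∈ u∈C u₀∈ e with copy-pair u₀∈
      ... | x , y , i , ex , ey = x , y , i , λ {z} z∈ → go z (Mem.∈-++⁻ X z∈)
        where
        go : ∀ z → z ∈ X ⊎ z ∈ cliques R → u ~ z → x ~ z × y ~ z
        go z (inj₁ z∈X) uz = subst T (trans (sym (τ-sound {u₀} {u} e z∈X)) (τ-sound {u₀} {x} ex z∈X)) uz ,
                             subst T (trans (sym (τ-sound {u₀} {u} e z∈X)) (τ-sound {u₀} {y} ey z∈X)) uz
        go z (inj₂ z∈R) uz with cliques-∈ R z∈R
        ... | w′ , w′∈ , z∈C = ⊥-elim (C-apart (sub (Mem.∈-++⁺ˡ w∈)) (sub (Mem.∈-++⁺ʳ (v ∷ six) w′∈)) (apart-R w∈ w′∈) u∈C z∈C uz)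
      inside : ∀ {w x y u} → w ∈ six → (Q : Copy a b c t w) → x ∈ vs Q → y ∈ vs Q → u ∈ vs Q → x ~ u × y ~ u
      inside w∈ Q x∈ y∈ u∈ = C-clique (sub (there (Mem.∈-++⁺ˡ w∈))) (Perm.∈-resp-↭ (perm Q) x∈) (Perm.∈-resp-↭ (perm Q) u∈) ,
                             C-clique (sub (there (Mem.∈-++⁺ˡ w∈))) (Perm.∈-resp-↭ (perm Q) y∈) (Perm.∈-resp-↭ (perm Q) u∈)
      inner : ∀ {u} → u ∈ flatten ps ++ E → ∃₂ λ x y → (x , y) ∈ ps × x ~ u × y ~ u
      inner {u} u∈ with cliques-∈ six (Perm.∈-resp-↭ (↭-sym copies) u∈)
      ... | _ , w∈@(here refl) , i = _ , _ , here refl ,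
        inside w∈ Q₁ (here refl) (there (here refl)) (Perm.∈-resp-↭ (↭-sym (perm Q₁)) i)
      ... | _ , w∈@(there (here refl)) , i = _ , _ , there (here refl) ,
        inside w∈ Q₂ (here refl) (there (here refl)) (Perm.∈-resp-↭ (↭-sym (perm Q₂)) i)
      ... | _ , w∈@(there (there (here refl))) , i = _ , _ , there (there (there (here refl))) ,
        inside w∈ Q₃ (there (here refl)) (there (there (here refl))) (Perm.∈-resp-↭ (↭-sym (perm Q₃)) i)
      ... | _ , w∈@(there (there (there (here refl)))) , i = _ , _ , there (there (there (there (here refl)))) ,
        inside w∈ Q₄ (there (here refl)) (there (there (here refl))) (Perm.∈-resp-↭ (↭-sym (perm Q₄)) i)
      ... | _ , w∈@(there (there (there (there (here refl))))) , i = _ , _ , there (there (there (there (there (there (here refl)))))) ,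
        inside w∈ Q₅ (here refl) (there (there (here refl))) (Perm.∈-resp-↭ (↭-sym (perm Q₅)) i)
      ... | _ , w∈@(there (there (there (there (there (here refl)))))) , i = _ , _ , there (there (there (there (there (there (there (here refl))))))) ,
        inside w∈ Q₆ (here refl) (there (there (here refl))) (Perm.∈-resp-↭ (↭-sym (perm Q₆)) i)

      drop-sixth : Game p (X ++ cliques (v ∷ r₁ ∷ r₂ ∷ r₃ ∷ r₄ ∷ r₅ ∷ r₆ ∷ R)) →
                   Game p (X ++ cliques (r₁ ∷ r₂ ∷ r₃ ∷ r₄ ∷ r₅ ∷ r₆ ∷ R))
      drop-sixth {p} g = Game-↭ (↭-sym six-perm) (kill {C = Q₀} cross inner
        (Game-↭ all-perm (subst (λ l → Game p (X ++ l ++ cliques (r₁ ∷ r₂ ∷ r₃ ∷ r₄ ∷ r₅ ∷ r₆ ∷ R))) eq g)))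

    drop-big : ∀ {v r₁ r₂ r₃ r₄ r₅ r₆ R a b c t} → C v ≡ a ∷ b ∷ c ∷ t →
               All (λ w → T (kind v w)) (r₁ ∷ r₂ ∷ r₃ ∷ r₄ ∷ r₅ ∷ r₆ ∷ []) →
               Separate (v ∷ r₁ ∷ r₂ ∷ r₃ ∷ r₄ ∷ r₅ ∷ r₆ ∷ R) →
               Game p (X ++ cliques (v ∷ r₁ ∷ r₂ ∷ r₃ ∷ r₄ ∷ r₅ ∷ r₆ ∷ R)) →
               Game p (X ++ cliques (r₁ ∷ r₂ ∷ r₃ ∷ r₄ ∷ r₅ ∷ r₆ ∷ R))
    drop-big eq (k₁ ∷ k₂ ∷ k₃ ∷ k₄ ∷ k₅ ∷ k₆ ∷ []) s =
      let Q₁ = copy eq k₁ ; Q₂ = copy eq k₂ ; _ , r , h = zips (Copy.t≈ Q₁) (Copy.t≈ Q₂)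
      in drop-sixth eq Q₁ Q₂ (copy eq k₃) (copy eq k₄) (copy eq k₅) (copy eq k₆) r h s

    big-shape : ∀ {v} → T (big v) → ∃[ a ] ∃[ b ] ∃[ c ] ∃[ t ] C v ≡ a ∷ b ∷ c ∷ t
    big-shape {v} bv with C v
    big-shape () | []
    big-shape () | _ ∷ []
    big-shape () | _ ∷ _ ∷ []
    ... | a ∷ b ∷ c ∷ t = a , b , c , t , refl

    add-big : ∀ {v R} → v ∈ L₂ → T (big v) → Game p (X ++ cliques R) → Game p (X ++ cliques (v ∷ R))
    add-big {p} {v} {R} v∈ bv g with big-shape bv
    ... | a , b , c , t , eq = subst (λ l → Game p (X ++ l ++ cliques R)) (sym eq)
      (Game-↭ (shifts (a ∷ b ∷ c ∷ t) X (cliques R))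
        (add-clique (λ i → C-clique v∈ (in-C (here refl)) (in-C i) , C-clique v∈ (in-C (there (here refl))) (in-C i)) g))
      where
      in-C : ∀ {u} → u ∈ a ∷ b ∷ c ∷ t → u ∈ C v
      in-C = subst (_ ∈_) (sym eq)

    six-members : ∀ (l : List V) → 6 ≤ length l → ∃[ r₁ ] ∃[ r₂ ] ∃[ r₃ ] ∃[ r₄ ] ∃[ r₅ ] ∃[ r₆ ] ∃[ rs ]
                  l ≡ r₁ ∷ r₂ ∷ r₃ ∷ r₄ ∷ r₅ ∷ r₆ ∷ rs
    six-members (_ ∷ []) (s≤s ())
    six-members (_ ∷ _ ∷ []) (s≤s (s≤s ()))
    six-members (_ ∷ _ ∷ _ ∷ []) (s≤s (s≤s (s≤s ())))
    six-members (_ ∷ _ ∷ _ ∷ _ ∷ []) (s≤s (s≤s (s≤s (s≤s ()))))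
    six-members (_ ∷ _ ∷ _ ∷ _ ∷ _ ∷ []) (s≤s (s≤s (s≤s (s≤s (s≤s ())))))
    six-members (_ ∷ _ ∷ _ ∷ _ ∷ _ ∷ _ ∷ _) _ = _ , _ , _ , _ , _ , _ , _ , refl

    big-stage : (Game p (X ++ cliques (bigs ++ smalls)) ⟷ Game p (X ++ cliques (R₁ ++ smalls))) × Separate (R₁ ++ smalls)
    big-stage {p} = proj₁ big-chain , proj₁ (proj₂ big-chain)
      where
      I f : List V → Set
      I B = Separate (B ++ smalls) × (∀ {v} → v ∈ B → T (big v))
      f B = Game p (X ++ cliques (B ++ smalls))
      to-front : ∀ P v acc → (P ++ v ∷ acc) ++ smalls ↭ v ∷ (P ++ acc) ++ smalls
      to-front P v acc = Perm.++⁺ʳ smalls (Perm.shift v P acc)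
      del : ∀ P v acc → I (P ++ v ∷ acc) → I (P ++ acc)
      del P v acc (s , b) = separate-tail (separate-↭ (to-front P v acc) s) , λ i → b (Perm.∈-resp-↭ (↭-sym (Perm.shift v P acc)) (there i))
      drop : ∀ P v acc → I (P ++ v ∷ acc) → 6 ≤ length (filterᵇ (kind v) acc) → f (P ++ v ∷ acc) ⟷ f (P ++ acc)
      drop P v acc (s , b) le = to , from
        where
        bv : T (big v)
        bv = b (Mem.∈-++⁺ʳ P (here refl))
        from : f (P ++ acc) → f (P ++ v ∷ acc)
        from g = Game-↭ (Perm.++⁺ˡ X (concatMap-↭ C (↭-sym (to-front P v acc))))
          (add-big {R = (P ++ acc) ++ smalls} (proj₁ s (Perm.∈-resp-↭ (↭-sym (to-front P v acc)) (here refl))) bv g)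
        to : f (P ++ v ∷ acc) → f (P ++ acc)
        to g with filterᵇ (kind v) acc | find-↭ (kind v) acc | six-members (filterᵇ (kind v) acc) le
        ... | _ | r , h | r₁ , r₂ , r₃ , r₄ , r₅ , r₆ , rs , refl =
          Game-↭ (Perm.++⁺ˡ X (concatMap-↭ C (↭-sym front-first)))
            (drop-big (proj₂ (proj₂ (proj₂ (proj₂ (big-shape bv))))) (All.tabulate λ i → h (Mem.∈-++⁺ˡ i))
              (separate-↭ (↭-trans (to-front P v acc) (prep v front-first)) s)
              (Game-↭ (Perm.++⁺ˡ X (concatMap-↭ C (↭-trans (to-front P v acc) (prep v front-first)))) g))
          where
          front rest : List V
          front = r₁ ∷ r₂ ∷ r₃ ∷ r₄ ∷ r₅ ∷ r₆ ∷ []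
          rest = rs ++ filterᵇ (not ∘ kind v) acc
          front-first : (P ++ acc) ++ smalls ↭ front ++ ((P ++ rest) ++ smalls)
          front-first = Perm.++⁺ʳ smalls (↭-trans (Perm.++⁺ˡ P r) (shifts P front rest))
      big-chain : (f bigs ⟷ f (capBy kind 6 bigs)) × I (capBy kind 6 bigs)
      big-chain = capBy-chain I f del drop [] bigs (separate-↭ split-reps reps-separate , λ i → proj₂ (filterᵇ-∈⁻ big reps i))

-- Small cliques of the kernel

second-slot : {A : Set} → List A → Slot
second-slot (_ ∷ []) = ○
second-slot _        = □

second-or : {A : Set} → A → List A → A
second-or d (_ ∷ y ∷ _) = y
second-or d (x ∷ [])    = x
second-or d []          = d

module SmallCliques {V : Set} (_≟_ : DecidableEquality V) (nb : V → V → Bool)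
                    (nb-refl : ∀ v → T (nb v v)) (nb-sym : ∀ u v → nb u v ≡ nb v u) (X L : List V)
                    (L-trans : ∀ {u v w} → u ∈ L → v ∈ L → w ∈ L → T (nb u v) → T (nb v w) → T (nb u w)) where

  open Named nb nb-refl nb-sym
  module Ker = Kernel _≟_ nb nb-refl nb-sym X L
  open Ker using (τ; twin; L₂; C; reps; number; kind; big; bigs; smalls; R₁; R₂; lbl; inC; labelList; threshold; K;
                  τ-sound; kind-refl; kind-sym; kind-cong; L₂⊆L)

  same-nb = Ker.same-nb L-trans
  _≁_ = Ker._≁_ L-trans
  Separate = Ker.Separate L-trans
  cliques = Ker.cliques L-trans

  Core : List V
  Core = X ++ cliques R₁

  fstV sndV : V → V
  fstV ℓ = head-or ℓ (C ℓ)
  sndV ℓ = second-or ℓ (C ℓ)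

  module Mat = Matching _≟_ nb nb-refl nb-sym Core fstV sndV
  open Mat using (Label; Cell; Dominatedˡ; dominatedˡ?; dominatedˡ-cover; Matched; Match; []; single; double; Proper; Wellformed; Apart; vertexOf)
  open Unlabelled (⊎-≡-dec _≟_ _≟_) {Ω = Dominatedˡ} dominatedˡ? dominatedˡ-cover

  lab : V → V
  lab v = head-or v (filterᵇ (kind v) lbl)

  item : V → Item Label
  item v = inj₂ (lab v) , □ , second-slot (C (lab v))

  core-item : V → Item Label
  core-item c = inj₁ c , □ , ○

  initial : List V → Position Label
  initial S = map core-item Core ++ map item S

  Small : List V → Set
  Small S = ∀ {v} → v ∈ S → v ∈ smalls

  small-reps : ∀ {v} → v ∈ smalls → v ∈ L₂
  small-reps v∈ = capBy-∈ L₂ (proj₁ (filterᵇ-∈⁻ (not ∘ big) reps v∈))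

  lab-∈ : ∀ {v} → v ∈ smalls → lab v ∈ lbl × T (kind v (lab v))
  lab-∈ {v} v∈ with capBy-related {R = kind} kind-refl (s≤s z≤n) smalls v∈
  ... | y , y∈ , k = filterᵇ-∈⁻ (kind v) lbl (head-∈ (filterᵇ-∈⁺ (kind v) y∈ k))
    where
    head-∈ : ∀ {l : List V} {y d} → y ∈ l → head-or d l ∈ l
    head-∈ {l = _ ∷ _} _ = here refl

  lab-kind : ∀ {v w} → v ∈ smalls → T (kind v w) → lab v ≡ lab w
  lab-kind {v} {w} v∈ k = same (filterᵇ-∈⁺ (kind v) (proj₁ (lab-∈ v∈)) (proj₂ (lab-∈ v∈)))
                               (filterᵇ-cong lbl λ {t} _ → kind-cong {v} {w} {t} k)
    where
    same : ∀ {l l′ : List V} {y d d′} → y ∈ l → l ≡ l′ → head-or d l ≡ head-or d′ l′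
    same {_ ∷ _} _ refl = refl

  data SmallShape (l : List V) : Set where
    one-vertex   : ∀ a → l ≡ a ∷ [] → SmallShape l
    two-vertices : ∀ a b → l ≡ a ∷ b ∷ [] → SmallShape l

  small-shape : ∀ {v} → v ∈ smalls → SmallShape (C v)
  small-shape {v} v∈ = go (C v) (filterᵇ-∈⁺ (nb v) (small-reps v∈) (nb-refl v)) (proj₂ (filterᵇ-∈⁻ (not ∘ big) reps v∈))
    where
    go : ∀ l {u} → u ∈ l → T (not (2 Data.Nat.<ᵇ length l)) → SmallShape l
    go (a ∷ []) _ _ = one-vertex a refl
    go (a ∷ b ∷ []) _ _ = two-vertices a b refl

  cell-item : Cell → Item Label
  cell-item (ℓ , _ , nothing) = ℓ , □ , ○
  cell-item (ℓ , _ , just _)  = ℓ , □ , □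

  members : Cell → List V
  members (_ , a , nothing) = a ∷ []
  members (_ , a , just b)  = a ∷ b ∷ []

  vertexOf-∈ : ∀ {u} k → vertexOf u k → u ∈ members k
  vertexOf-∈ (_ , a , nothing) refl = here refl
  vertexOf-∈ (_ , a , just b) (inj₁ refl) = here refl
  vertexOf-∈ (_ , a , just b) (inj₂ refl) = there (here refl)

  all-matched : ∀ ks → Matched ks (map cell-item ks) (all□ (concatMap members ks))
  all-matched [] = [] , [] , refl
  all-matched ((ℓ , a , nothing) ∷ ks) with all-matched ks
  ... | _ , m , refl = _ , single m , refl
  all-matched ((ℓ , a , just b) ∷ ks) with all-matched ks
  ... | _ , m , refl = _ , double m , refl

  ∼-core : ∀ {a x} → a ∈ L₂ → (∀ {w} → w ∈ R₁ → a ∈ C w → ⊥) → T (τ x a) → x ∈ L₂ → (∀ {w} → w ∈ R₁ → x ∈ C w → ⊥) →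
           ∀ {c} → c ∈ Core → nb a c ≡ nb x c
  ∼-core {a} {x} a∈ a∉ t x∈ x∉ {c} c∈ with Mem.∈-++⁻ X c∈
  ... | inj₁ c∈X = sym (τ-sound {x} {a} t c∈X)
  ... | inj₂ c∈R with Ker.cliques-∈ L-trans R₁ c∈R
  ... | w , w∈ , c∈C = trans (none a∈ a∉) (sym (none x∈ x∉))
    where
    none : ∀ {y} → y ∈ L₂ → (∀ {w} → w ∈ R₁ → y ∈ C w → ⊥) → nb y c ≡ false
    none {y} y∈ y∉ with nb y c in e
    ... | false = refl
    ... | true = ⊥-elim (y∉ w∈ (filterᵇ-∈⁺ (nb w) y∈ (L-trans w∈L (L₂⊆L c∈L) (L₂⊆L y∈) wc (~-sym (subst T (sym e) tt)))))
      where
      w∈L : w ∈ L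
      w∈L = L₂⊆L (capBy-∈ L₂ (proj₁ (filterᵇ-∈⁻ big reps (capBy-∈ bigs w∈))))
      c∈L : c ∈ L₂
      c∈L = proj₁ (Ker.C-∈ L-trans {w} c∈C)
      wc : w ~ c
      wc = proj₂ (Ker.C-∈ L-trans {w} c∈C)

  big-small : ∀ {v w a} → v ∈ smalls → w ∈ R₁ → a ∈ C v → a ∈ C w → ⊥
  big-small {v} {w} v∈ w∈ a∈ a∈′ = T-not⁻ (proj₂ (filterᵇ-∈⁻ (not ∘ big) reps v∈)) (subst (λ l → T (2 Data.Nat.<ᵇ length l)) (sym same) bigw)
    where
    bigw : T (big w)
    bigw = proj₂ (filterᵇ-∈⁻ big reps (capBy-∈ bigs w∈))
    w∈₂ : w ∈ L₂
    w∈₂ = capBy-∈ L₂ (proj₁ (filterᵇ-∈⁻ big reps (capBy-∈ bigs w∈)))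
    vw : v ~ w
    vw with Ker.C-∈ L-trans {v} a∈ | Ker.C-∈ L-trans {w} a∈′
    ... | a∈L , e | _ , e′ = L-trans (L₂⊆L (small-reps v∈)) (L₂⊆L a∈L) (L₂⊆L w∈₂) e (~-sym e′)
    same : C v ≡ C w
    same = filterᵇ-cong L₂ λ u∈ → same-nb (L₂⊆L (small-reps v∈)) (L₂⊆L w∈₂) (L₂⊆L u∈) vw

  record CellOf (v : V) : Set where
    field
      cell    : Cell
      small   : ∃[ ℓ ] proj₁ cell ≡ inj₂ ℓ
      item≡   : cell-item cell ≡ item v
      perm    : members cell ↭ C v
      proper  : Proper cell

  cellOf : ∀ {v} → v ∈ smalls → CellOf v
  cellOf {v} v∈ with lab-∈ v∈
  ... | ℓ∈ , k with small-shape (capBy-∈ smalls ℓ∈) | Ker.aligned L-trans {lab v} {v} (kind-sym {v} {lab v} k)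
  ... | one-vertex a e | zs , r , pw with subst (λ l → Pointwise (λ x y → T (τ x y)) l zs) e pw
  cellOf {v} v∈ | ℓ∈ , k | one-vertex a e | y ∷ [] , r , pw | t ∷ [] = record
    { cell   = inj₂ (lab v) , y , nothing
    ; small  = _ , refl
    ; item≡  = cong (λ l → inj₂ (lab v) , □ , second-slot l) (sym e)
    ; perm   = r
    ; proper = (λ {c} → like) , trans (cong (second-or (lab v)) e) (sym (cong (head-or (lab v)) e)) }
    where
    in-y : y ∈ C v
    in-y = Perm.∈-resp-↭ r (here refl)
    in-a : a ∈ C (lab v)
    in-a = subst (a ∈_) (sym e) (here refl)
    like : ∀ {c} → c ∈ Core → nb y c ≡ nb (fstV (lab v)) c
    like {c} c∈ = subst (λ x → nb y c ≡ nb x c) (sym (cong (head-or (lab v)) e))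
      (∼-core (proj₁ (Ker.C-∈ L-trans {v} in-y)) (λ w∈ → big-small v∈ w∈ in-y) t
              (proj₁ (Ker.C-∈ L-trans {lab v} in-a)) (λ w∈ → big-small (capBy-∈ smalls ℓ∈) w∈ in-a) c∈)
  cellOf {v} v∈ | ℓ∈ , k | two-vertices a b e | zs , r , pw with subst (λ l → Pointwise (λ x y → T (τ x y)) l zs) e pw
  cellOf {v} v∈ | ℓ∈ , k | two-vertices a b e | y ∷ z ∷ [] , r , pw | t ∷ t′ ∷ [] = record
    { cell   = inj₂ (lab v) , y , just z
    ; small  = _ , refl
    ; item≡  = cong (λ l → inj₂ (lab v) , □ , second-slot l) (sym e)
    ; perm   = r
    ; proper = (λ {c} → like in-y (subst (a ∈_) (sym e) (here refl)) t (cong (head-or (lab v)) e)) ,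
               (λ {c} → like in-z (subst (b ∈_) (sym e) (there (here refl))) t′ (cong (second-or (lab v)) e)) ,
               Ker.C-clique L-trans (small-reps v∈) in-y in-z }
    where
    in-y : y ∈ C v
    in-y = Perm.∈-resp-↭ r (here refl)
    in-z : z ∈ C v
    in-z = Perm.∈-resp-↭ r (there (here refl))
    like : ∀ {x y x′ c} → y ∈ C v → x ∈ C (lab v) → T (τ x y) → x′ ≡ x → c ∈ Core → nb y c ≡ nb x′ c
    like in-y in-x t refl = ∼-core (proj₁ (Ker.C-∈ L-trans {v} in-y)) (λ w∈ → big-small v∈ w∈ in-y) t
      (proj₁ (Ker.C-∈ L-trans {lab v} in-x)) (λ w∈ → big-small (capBy-∈ smalls ℓ∈) w∈ in-x)

  core-cell : V → Cell
  core-cell c = inj₁ c , c , nothing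

  record CellsOf (S : List V) : Set where
    field
      cells  : List Cell
      items≡ : map cell-item cells ≡ map item S
      perm   : concatMap members cells ↭ cliques S
      proper : ∀ {k} → k ∈ cells → Proper k
      source : ∀ {k u} → k ∈ cells → u ∈ members k → ∃[ v ] v ∈ S × u ∈ C v
      apart  : AllPairs Apart cells

  cellsOf : ∀ {S} → Separate S → Small S → CellsOf S
  cellsOf {[]} _ _ = record { cells = [] ; items≡ = refl ; perm = refl ; proper = λ () ; source = λ () ; apart = [] }
  cellsOf {v ∷ S} sep sm = record
    { cells  = cell ∷ cells
    ; items≡ = cong₂ _∷_ item≡ items≡
    ; perm   = Perm.++⁺ (CellOf.perm k) perm
    ; proper = λ { (here refl) → CellOf.proper k ; (there i) → proper i }
    ; source = λ { (here refl) u∈ → v , here refl , Perm.∈-resp-↭ (CellOf.perm k) u∈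
                 ; (there i) u∈ → let w , w∈ , u∈C = source i u∈ in w , there w∈ , u∈C }
    ; apart  = All.tabulate (λ {k′} i → is-apart k′ i) ∷ apart }
    where
    k : CellOf v
    k = cellOf (sm (here refl))
    ks : CellsOf S
    ks = cellsOf (Ker.separate-tail L-trans sep) (sm ∘ there)
    open CellOf k using (cell; item≡)
    open CellsOf ks
    far : ∀ {k′} → k′ ∈ cells → ∀ {u u′} → vertexOf u cell → vertexOf u′ k′ → u ≁ u′
    far {k′} i {u} {u′} u∈ u′∈ with source i (vertexOf-∈ k′ u′∈)
    ... | w , w∈ , u′∈C = Ker.C-apart L-trans (proj₁ sep (here refl)) (proj₁ sep (there w∈)) (Ker.separate-head L-trans sep w∈)
                            (Perm.∈-resp-↭ (CellOf.perm k) (vertexOf-∈ cell u∈)) u′∈C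
    apart⁺ : ∀ k k′ → (∀ {u u′} → vertexOf u k → vertexOf u′ k′ → u ≁ u′) → Apart k k′
    apart⁺ (inj₁ _ , _) _ _ = tt
    apart⁺ (inj₂ _ , _) (inj₁ _ , _) _ = tt
    apart⁺ (inj₂ _ , _) (inj₂ _ , _) h = h
    is-apart : ∀ k′ → k′ ∈ cells → Apart cell k′
    is-apart k′ i = apart⁺ cell k′ (far i)

  module _ {S} (sep : Separate S) (sm : Small S) where
    private
      ks : CellsOf S
      ks = cellsOf sep sm
      open CellsOf ks
      all-cells : List Cell
      all-cells = map core-cell Core ++ cells

      wellformed : Wellformed all-cells
      wellformed = record
        { proper = λ {k} i → [ (λ j → core-proper (Mem.∈-map⁻ core-cell j)) , proper ]′ (Mem.∈-++⁻ (map core-cell Core) i)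
        ; apart  = core-apart Core
        ; core   = λ c∈ → Mem.∈-++⁺ˡ (Mem.∈-map⁺ core-cell c∈) }
        where
        core-proper : ∀ {k} → ∃[ c ] c ∈ Core × k ≡ core-cell c → Proper k
        core-proper (c , c∈ , refl) = refl , c∈
        core-apart : ∀ cs → AllPairs Apart (map core-cell cs ++ cells)
        core-apart [] = apart
        core-apart (c ∷ cs) = All.tabulate (λ _ → tt) ∷ core-apart cs

      labels≡ : map cell-item all-cells ≡ initial S
      labels≡ = trans (List.map-++ cell-item (map core-cell Core) cells)
                      (cong₂ _++_ (sym (List.map-∘ Core)) items≡)

      names↭ : concatMap members all-cells ↭ X ++ cliques R₁ ++ cliques S
      names↭ = ↭-trans (↭-reflexive (List.concatMap-++ members (map core-cell Core) cells))
        (↭-trans (Perm.++⁺ (↭-reflexive (core-names Core)) perm) (↭-reflexive (List.++-assoc X (cliques R₁) (cliques S))))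
        where
        core-names : ∀ cs → concatMap members (map core-cell cs) ≡ cs
        core-names [] = refl
        core-names (c ∷ cs) = cong (c ∷_) (core-names cs)

      matched : Matched all-cells (initial S) (all□ (concatMap members all-cells))
      matched = subst (λ l → Matched all-cells l (all□ (concatMap members all-cells))) labels≡ (all-matched all-cells)

    relabel : Game p (X ++ cliques R₁ ++ cliques S) ⟷ W Dominatedˡ p (initial S)
    relabel = (λ g → Mat.to-labels wellformed matched (Game-↭ (↭-sym names↭) g)) ,
              (λ w → Game-↭ names↭ (Mat.to-names wellformed matched w))

  Λ : List Label
  Λ = map inj₁ Core ++ map inj₂ lbl

  length-items-Λ : length (items Λ) ≡ length labelList * 9
  length-items-Λ = trans (length-items Λ) (cong (_* 9) (trans
    (trans (List.length-++ (map inj₁ Core)) (cong₂ _+_ (List.length-map inj₁ Core) (List.length-map inj₂ lbl)))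
    (trans (cong (_+ length lbl) (trans (List.length-++ X) (cong (length X +_) core-length)))
      (trans (ℕ.+-assoc (length X) _ _) (trans (cong (length X +_) (ℕ.+-comm _ (length lbl)))
        (sym (trans (List.length-++ X) (cong (length X +_) (List.length-++ lbl)))))))))
    where
    separate-R₁ : Separate R₁
    separate-R₁ = (λ v∈ → capBy-∈ L₂ (proj₁ (filterᵇ-∈⁻ big reps (capBy-∈ bigs v∈)))) ,
      go bigs (AllPairs.filter⁺ (Bool.T? ∘ big) (proj₂ (Ker.reps-separate L-trans)))
      where
      go : ∀ xs → AllPairs _≁_ xs → AllPairs _≁_ (capBy kind 6 xs)
      go [] [] = []
      go (v ∷ xs) (h ∷ hs) = capBy-cases (AllPairs _≁_) v xs
        (λ _ → All.tabulate (λ i → All.lookup h (capBy-∈ xs i)) ∷ go xs hs) (λ _ → go xs hs)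
    core-length : length (cliques R₁) ≡ length (filterᵇ (inC R₁) L₂)
    core-length = sym (Perm.↭-length (Ker.inC-cliques L-trans R₁ separate-R₁))

  small-stage : Separate (R₁ ++ smalls) →
    (Game p (X ++ cliques R₁ ++ cliques smalls) ⟷ Game p (X ++ cliques R₁ ++ cliques R₂)) × Separate (R₁ ++ R₂)
  small-stage {p} sep = ⟷-trans (relabel (tail sep) id) (⟷-trans (proj₁ chain)
    (⟷-sym (relabel (tail (proj₁ (proj₂ chain))) (proj₂ (proj₂ chain))))) , proj₁ (proj₂ chain)
    where
    tail : ∀ {S} → Separate (R₁ ++ S) → Separate S
    tail {S} = go R₁
      where
      go : ∀ R → Separate (R ++ S) → Separate S
      go [] s = s
      go (_ ∷ R) s = go R (Ker.separate-tail L-trans s)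
    I f : List V → Set
    I S = Separate (R₁ ++ S) × Small S
    f S = W Dominatedˡ p (initial S)
    del : ∀ P v acc → I (P ++ v ∷ acc) → I (P ++ acc)
    del P v acc (s , m) = Ker.separate-tail L-trans (Ker.separate-↭ L-trans
        (↭-trans (Perm.++⁺ˡ R₁ (Perm.shift v P acc)) (Perm.shift v R₁ (P ++ acc))) s) ,
      λ i → m (Perm.∈-resp-↭ (↭-sym (Perm.shift v P acc)) (there i))
    initial-labels : ∀ {S} → Small S → Labels Λ (initial S)
    initial-labels {S} m = All.++⁺ (All.map⁺ (All.tabulate λ c∈ → Mem.∈-++⁺ˡ (Mem.∈-map⁺ inj₁ c∈)))
      (All.map⁺ (All.tabulate λ v∈ → Mem.∈-++⁺ʳ (map inj₁ Core) (Mem.∈-map⁺ inj₂ (proj₁ (lab-∈ (m v∈))))))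
    drop : ∀ P v acc → I (P ++ v ∷ acc) → threshold ≤ length (filterᵇ (kind v) acc) → f (P ++ v ∷ acc) ⟷ f (P ++ acc)
    drop P v acc (s , m) le = remove-copy , add-copy
      where
      n : ℕ
      n = length (filterᵇ (kind v) acc)
      others : Position Label
      others = map core-item Core ++ map item P ++ map item (filterᵇ (not ∘ kind v) acc)
      v∈ : v ∈ smalls
      v∈ = m (Mem.∈-++⁺ʳ P (here refl))
      copies : ∀ xs → (∀ {w} → w ∈ xs → T (kind v w)) → map item xs ≡ replicate (length xs) (item v)
      copies [] h = refl
      copies (w ∷ xs) h = cong₂ _∷_ (cong (λ ℓ → inj₂ ℓ , □ , second-slot (C ℓ)) (sym (lab-kind v∈ (h (here refl))))) (copies xs (h ∘ there))
      without : initial (P ++ acc) ↭ replicate n (item v) ++ others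
      without = ↭-trans (Perm.++⁺ˡ (map core-item Core) (↭-trans (↭-reflexive (List.map-++ item P acc))
          (↭-trans (Perm.++⁺ˡ (map item P) (↭-trans (Perm.map⁺ item (filterᵇ-complement (kind v) acc))
            (↭-trans (↭-reflexive (List.map-++ item (filterᵇ (kind v) acc) _))
              (Perm.++⁺ʳ _ (↭-reflexive (copies (filterᵇ (kind v) acc) λ {w} i → proj₂ (filterᵇ-∈⁻ (kind v) acc i)))))))
            (shifts (map item P) (replicate n (item v)) _))))
        (shifts (map core-item Core) (replicate n (item v)) _)
      with-v : initial (P ++ v ∷ acc) ↭ item v ∷ replicate n (item v) ++ others
      with-v = ↭-trans (Perm.++⁺ˡ (map core-item Core) (Perm.map⁺ item (Perm.shift v P acc)))
        (↭-trans (Perm.shift (item v) (map core-item Core) (map item (P ++ acc))) (prep (item v) without))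
      without-labels : Labels Λ (replicate n (item v) ++ others)
      without-labels = Perm.All-resp-↭ without (initial-labels λ i → m (Perm.∈-resp-↭ (↭-sym (Perm.shift v P acc)) (there i)))
      count-copies : ∀ n i Z → n ≤ count i (replicate n i ++ Z)
      count-copies zero i Z = z≤n
      count-copies (suc n) i Z with i ≟ⁱ i
      ... | yes _ = s≤s (count-copies n i Z)
      ... | no ne = ⊥-elim (ne refl)
      many : ∀ {i} → 3 + 3 ^ length (items Λ) * 2 ≤ count i (replicate n i ++ others)
      many {i} = ℕ.≤-trans (subst (λ z → 3 + 3 ^ z * 2 ≤ n) (sym length-items-Λ) le) (count-copies n i others)
      third : ∀ {i n Z} → 2 ≤ n → ¬ Unclaimed² i →
              (W Dominatedˡ p (i ∷ replicate n i ++ Z) → W Dominatedˡ p (replicate n i ++ Z)) ×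
              (W Dominatedˡ p (replicate n i ++ Z) → W Dominatedˡ p (i ∷ replicate n i ++ Z))
      third {i} {suc (suc n)} (s≤s (s≤s z≤n)) ¬u = third⁻ (shape i) ¬u , third⁺ (shape i) ¬u
      drop-item : ∀ {s} → (∃[ ℓ ] ℓ ∈ lbl × (inj₂ ℓ , □ , s) ≡ item v) → s ≡ ○ ⊎ s ≡ □ →
                  W Dominatedˡ p (item v ∷ replicate n (item v) ++ others) ⟷ W Dominatedˡ p (replicate n (item v) ++ others)
      drop-item (ℓ , ℓ∈ , e) (inj₁ refl) rewrite sym e = third (ℕ.≤-trans (s≤s (s≤s z≤n)) le) (λ ())
      drop-item (ℓ , ℓ∈ , e) (inj₂ refl) with without-labels
      ... | wl rewrite sym e =
        Pigeonhole.drop-copy Λ (inj₂ ℓ) (Mem.∈-++⁺ʳ (map inj₁ Core) (Mem.∈-map⁺ inj₂ ℓ∈)) wl many , add-free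
      slot-cases : ∀ (l : List V) → second-slot l ≡ ○ ⊎ second-slot l ≡ □
      slot-cases [] = inj₂ refl
      slot-cases (_ ∷ []) = inj₁ refl
      slot-cases (_ ∷ _ ∷ _) = inj₂ refl
      dropped : W Dominatedˡ p (item v ∷ replicate n (item v) ++ others) ⟷ W Dominatedˡ p (replicate n (item v) ++ others)
      dropped = drop-item (lab v , proj₁ (lab-∈ v∈) , refl) (slot-cases (C (lab v)))
      remove-copy : f (P ++ v ∷ acc) → f (P ++ acc)
      remove-copy w = W-↭ symm (↭-sym without) (proj₁ dropped (W-↭ symm with-v w))
      add-copy : f (P ++ acc) → f (P ++ v ∷ acc)
      add-copy w = W-↭ symm (↭-sym with-v) (proj₂ dropped (W-↭ symm without w))
    chain : (f smalls ⟷ f (capBy kind threshold smalls)) × I (capBy kind threshold smalls)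
    chain = capBy-chain I f del drop [] smalls (sep , id)

  kernel-correct : Game p (X ++ L) ⟷ Game p K
  kernel-correct {p} = ⟷-trans (Ker.twin-stage L-trans)
    (⟷-trans (Game-⟷ (Perm.++⁺ˡ X (↭-trans (Ker.all-cliques L-trans) (concatMap-↭ C (Ker.split-reps L-trans)))))
    (⟷-trans (proj₁ bigs-done)
    (⟷-trans (Game-⟷ (Perm.++⁺ˡ X (↭-reflexive (List.concatMap-++ C R₁ smalls))))
    (⟷-trans (proj₁ smalls-done)
      (Game-⟷ (Perm.++⁺ˡ X (↭-trans (↭-reflexive (sym (List.concatMap-++ C R₁ R₂))) (↭-sym (Ker.inC-cliques L-trans (R₁ ++ R₂) (proj₂ smalls-done))))))))))
    where
    Game-⟷ : ∀ {K K′} → K ↭ K′ → Game p K ⟷ Game p K′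
    Game-⟷ r = Game-↭ r , Game-↭ (↭-sym r)
    bigs-done : (Game p (X ++ cliques (bigs ++ smalls)) ⟷ Game p (X ++ cliques (R₁ ++ smalls))) × Separate (R₁ ++ smalls)
    bigs-done = Ker.big-stage L-trans
    smalls-done : (Game p (X ++ cliques R₁ ++ cliques smalls) ⟷ Game p (X ++ cliques R₁ ++ cliques R₂)) × Separate (R₁ ++ R₂)
    smalls-done = small-stage (proj₂ bigs-done)

-- A packing of induced paths on three vertices

module Packing {V : Set} (_≟_ : DecidableEquality V) (nb : V → V → Bool)
               (nb-refl : ∀ v → T (nb v v)) (nb-sym : ∀ u v → nb u v ≡ nb v u) where

  same : V → V → Bool
  same u v = does (u ≟ v)

  same-sound : ∀ {u v} → T (same u v) → u ≡ v
  same-sound {u} {v} t with u ≟ v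
  ... | yes e = e

  conflict : V → V → V → Bool
  conflict v a b = (nb v a ∧ (nb v b ∧ not (nb a b))) ∨ (nb a v ∧ (nb a b ∧ not (nb v b)))

  find₂ : V → V → List V → List V
  find₂ v a [] = []
  find₂ v a (b ∷ L) = if conflict v a b then a ∷ b ∷ [] else find₂ v a L

  orElse : List V → List V → List V
  orElse [] l = l
  orElse (x ∷ xs) _ = x ∷ xs

  find₁ : V → List V → List V → List V
  find₁ v L₀ [] = []
  find₁ v L₀ (a ∷ L) = orElse (find₂ v a L₀) (find₁ v L₀ L)

  outside : List V → V → Bool
  outside l u = not (anyᵇ (λ x → same x u) l)

  insert : V → List V → List V × List V → List V × List V
  insert v [] (X , L) = X , v ∷ L
  insert v (a ∷ l) (X , L) = v ∷ (a ∷ l) ++ X , filterᵇ (outside (a ∷ l)) L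

  pack : List V → List V × List V
  pack [] = [] , []
  pack (v ∷ vs) = insert v (find₁ v (proj₂ (pack vs)) (proj₂ (pack vs))) (pack vs)

  data Found (v : V) (L₀ L : List V) : List V → Set where
    none : (∀ {a b} → a ∈ L → b ∈ L₀ → ¬ T (conflict v a b)) → Found v L₀ L []
    some : ∀ {a b} → a ∈ L → b ∈ L₀ → T (conflict v a b) → Found v L₀ L (a ∷ b ∷ [])

  found₂ : ∀ v a L → Found v L (a ∷ []) (find₂ v a L)
  found₂ v a [] = none λ _ ()
  found₂ v a (b ∷ L) with conflict v a b in e | found₂ v a L
  ... | true | _ = some (here refl) (here refl) (subst T (sym e) tt)
  ... | false | f with find₂ v a L | f
  ... | _ | none h = none λ { (here refl) (here refl) t → subst T e t ; (here refl) (there i) t → h (here refl) i t }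
  ... | _ | some i j t = some i (there j) t

  found₁ : ∀ v L₀ L → Found v L₀ L (find₁ v L₀ L)
  found₁ v L₀ [] = none λ ()
  found₁ v L₀ (a ∷ L) with find₂ v a L₀ | found₂ v a L₀ | find₁ v L₀ L | found₁ v L₀ L
  ... | _ | some (here refl) j t | _ | _ = some (here refl) j t
  ... | _ | none h | _ | some i j t = some (there i) j t
  ... | _ | none h | _ | none h′ = none λ { (here refl) j t → h (here refl) j t ; (there i) j t → h′ i j t }

  Transitive : List V → Set
  Transitive L = ∀ {u v w} → u ∈ L → v ∈ L → w ∈ L → T (nb u v) → T (nb v w) → T (nb u w)

  conflict⁻ : ∀ {v a b} → ¬ T (conflict v a b) →
              (T (nb v a) → T (nb v b) → T (nb a b)) × (T (nb a v) → T (nb a b) → T (nb v b))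
  conflict⁻ {v} {a} {b} h with nb v a | nb v b | nb a b | nb a v
  ... | true | true | true | _ = (λ _ _ → tt) , λ _ _ → tt
  ... | true | true | false | _ = ⊥-elim (h tt)
  ... | true | false | true | true = ⊥-elim (h tt)
  ... | true | false | true | false = (λ _ ()) , λ ()
  ... | true | false | false | _ = (λ _ ()) , λ _ ()
  ... | false | true | _ | _ = (λ ()) , λ _ _ → tt
  ... | false | false | true | true = ⊥-elim (h tt)
  ... | false | false | true | false = (λ ()) , λ ()
  ... | false | false | false | _ = (λ ()) , λ _ ()

  extend : ∀ {v L} → (∀ {a b} → a ∈ L → b ∈ L → ¬ T (conflict v a b)) → Transitive L → Transitive (v ∷ L)
  extend {v} h tr (here refl) (here refl) _ _ e = e
  extend {v} h tr (here refl) (there i) (here refl) _ _ = nb-refl v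
  extend {v} h tr (here refl) (there i) (there j) e e′ = proj₂ (conflict⁻ (h i j)) (subst T (nb-sym _ _) e) e′
  extend {v} h tr (there i) (here refl) (here refl) e _ = e
  extend {v} h tr (there i) (here refl) (there j) e e′ = proj₁ (conflict⁻ (h i j)) (subst T (nb-sym _ _) e) e′
  extend {v} h tr (there i) (there j) (here refl) e e′ =
    subst T (nb-sym _ _) (proj₂ (conflict⁻ (h j i)) e′ (subst T (nb-sym _ _) e))
  extend {v} h tr (there i) (there j) (there k) = tr i j k

  pack-transitive : ∀ vs → Transitive (proj₂ (pack vs))
  pack-transitive [] ()
  pack-transitive (v ∷ vs) with find₁ v (proj₂ (pack vs)) (proj₂ (pack vs)) | found₁ v (proj₂ (pack vs)) (proj₂ (pack vs))
  ... | [] | none h = extend h (pack-transitive vs)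
  ... | a ∷ b ∷ [] | some _ _ _ = λ i j k → pack-transitive vs (inside i) (inside j) (inside k)
    where
    inside : ∀ {u} → u ∈ filterᵇ (outside (a ∷ b ∷ [])) (proj₂ (pack vs)) → u ∈ proj₂ (pack vs)
    inside i = proj₁ (filterᵇ-∈⁻ (outside (a ∷ b ∷ [])) _ i)

  distinct : ∀ {v a b} → T (conflict v a b) → a ≢ b
  distinct {v} {a} t refl with nb v a | nb a v | nb-sym v a | nb a a | nb-refl a
  distinct () refl | true | .true | refl | true | _
  distinct () refl | false | .false | refl | true | _

  take-out : ∀ {a L} → Unique L → a ∈ L → L ↭ a ∷ filterᵇ (λ u → not (same a u)) L
  take-out {a} {x ∷ L} (h ∷ u) (here refl) with a ≟ a
  ... | no ne = ⊥-elim (ne refl)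
  ... | yes _ = prep a (↭-reflexive (sym (filterᵇ-all L λ {y} i → T-not⁺ λ t → All.lookup h i (same-sound t))))
  take-out {a} {x ∷ L} (h ∷ u) (there i) with a ≟ x
  ... | yes refl = ⊥-elim (All.lookup h i refl)
  ... | no _ = ↭-trans (prep x (take-out u i)) (swap x a refl)

  filterᵇ-filterᵇ : ∀ (P Q : V → Bool) xs → filterᵇ Q (filterᵇ P xs) ≡ filterᵇ (λ x → P x ∧ Q x) xs
  filterᵇ-filterᵇ P Q [] = refl
  filterᵇ-filterᵇ P Q (x ∷ xs) with P x
  ... | false = filterᵇ-filterᵇ P Q xs
  ... | true with Q x
  ... | true = cong (x ∷_) (filterᵇ-filterᵇ P Q xs)
  ... | false = filterᵇ-filterᵇ P Q xs

  take-out₂ : ∀ {a b L} → Unique L → a ∈ L → b ∈ L → a ≢ b → L ↭ a ∷ b ∷ filterᵇ (outside (a ∷ b ∷ [])) L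
  take-out₂ {a} {b} {L} u a∈ b∈ ne = ↭-trans (take-out u a∈) (prep a (↭-trans
    (take-out (Uniq.filter⁺ _ u) (filterᵇ-∈⁺ _ b∈ (T-not⁺ (ne ∘ same-sound))))
    (prep b (↭-reflexive (trans (filterᵇ-filterᵇ _ _ L) (filterᵇ-cong L λ {x} _ → de-morgan (same a x) (same b x)))))))
    where
    de-morgan : ∀ p q → not p ∧ not q ≡ not (p ∨ (q ∨ false))
    de-morgan true q = refl
    de-morgan false true = refl
    de-morgan false false = refl

  pack-↭ : ∀ {vs} → Unique vs → proj₁ (pack vs) ++ proj₂ (pack vs) ↭ vs
  pack-unique : ∀ {vs} → Unique vs → Unique (proj₂ (pack vs))

  pack-↭ {[]} _ = refl
  pack-↭ {v ∷ vs} (h ∷ u) with find₁ v (proj₂ (pack vs)) (proj₂ (pack vs)) | found₁ v (proj₂ (pack vs)) (proj₂ (pack vs))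
  ... | [] | none _ = ↭-trans (Perm.shift v (proj₁ (pack vs)) _) (prep v (pack-↭ u))
  ... | a ∷ b ∷ [] | some a∈ b∈ t = prep v (↭-trans (shifts (a ∷ b ∷ []) (proj₁ (pack vs)) _)
      (↭-trans (Perm.++⁺ˡ (proj₁ (pack vs)) (↭-sym (take-out₂ (pack-unique u) a∈ b∈ (distinct t)))) (pack-↭ u)))

  pack-unique {[]} _ = []
  pack-unique {v ∷ vs} (h ∷ u) with find₁ v (proj₂ (pack vs)) (proj₂ (pack vs)) | found₁ v (proj₂ (pack vs)) (proj₂ (pack vs))
  ... | [] | none _ = All.tabulate (λ i → All.lookup h (Perm.∈-resp-↭ (pack-↭ u) (Mem.∈-++⁺ʳ (proj₁ (pack vs)) i))) ∷ pack-unique u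
  ... | a ∷ b ∷ [] | some _ _ _ = Uniq.filter⁺ _ (pack-unique u)

  -- Every path of the packing meets each set of vertices without which there are no such paths.
  pack-bound : (Y : V → Bool) → (∀ {v a b} → ¬ T (Y v) → ¬ T (Y a) → ¬ T (Y b) → ¬ T (conflict v a b)) →
               ∀ vs → length (proj₁ (pack vs)) ≤ 3 * length (filterᵇ Y (proj₁ (pack vs)))
  pack-bound Y h [] = z≤n
  pack-bound Y h (v ∷ vs) with find₁ v (proj₂ (pack vs)) (proj₂ (pack vs)) | found₁ v (proj₂ (pack vs)) (proj₂ (pack vs)) | pack-bound Y h vs
  ... | [] | none _ | ih = ih
  ... | a ∷ b ∷ [] | some _ _ t | ih = ℕ.≤-trans (ℕ.+-monoʳ-≤ 3 ih)
    (ℕ.≤-trans (ℕ.≤-reflexive (sym (ℕ.*-suc 3 (length (filterᵇ Y (proj₁ (pack vs))))))) (ℕ.*-monoʳ-≤ 3 hits))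
    where
    grow : ∀ x l → length (filterᵇ Y l) ≤ length (filterᵇ Y (x ∷ l))
    grow x l with Y x
    ... | true = ℕ.n≤1+n _
    ... | false = ℕ.≤-refl
    hit : ∀ x → T (Y x) → ∀ l {n} → n ≤ length (filterᵇ Y l) → suc n ≤ length (filterᵇ Y (x ∷ l))
    hit x y l le with Y x
    ... | true = s≤s le
    hits : suc (length (filterᵇ Y (proj₁ (pack vs)))) ≤ length (filterᵇ Y (v ∷ a ∷ b ∷ proj₁ (pack vs)))
    hits with Bool.T? (Y v) | Bool.T? (Y a) | Bool.T? (Y b)
    ... | yes y | _ | _ = hit v y _ (ℕ.≤-trans (grow b _) (grow a _))
    ... | no _ | yes y | _ = ℕ.≤-trans (hit a y _ (grow b _)) (grow v _)
    ... | no _ | no _ | yes y = ℕ.≤-trans (hit b y _ ℕ.≤-refl) (ℕ.≤-trans (grow a _) (grow v _))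
    ... | no ¬v | no ¬a | no ¬b = ⊥-elim (h ¬v ¬a ¬b t)

-- Sizes

capBy-class : ∀ {R : A → A → Bool} {c} (P : A → Bool) xs →
  (∀ {u w} → u ∈ xs → w ∈ xs → T (P u) → T (P w) → T (R u w)) → length (filterᵇ P (capBy R c xs)) ≤ c
capBy-class P [] h = z≤n
capBy-class {R = R} {c} P (v ∷ xs) h = capBy-cases (λ l → length (filterᵇ P l) ≤ c) v xs new (λ _ → ih)
  where
  ih : length (filterᵇ P (capBy R c xs)) ≤ c
  ih = capBy-class P xs λ i j → h (there i) (there j)
  new : length (filterᵇ (R v) (capBy R c xs)) < c → length (filterᵇ P (v ∷ capBy R c xs)) ≤ c
  new lt with P v in e
  ... | false = ih
  ... | true = ℕ.≤-trans (s≤s (sub (capBy R c xs) λ i t → h (here refl) (there (capBy-∈ xs i)) (subst T (sym e) tt) t)) lt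
    where
    sub : ∀ l → (∀ {x} → x ∈ l → T (P x) → T (R v x)) → length (filterᵇ P l) ≤ length (filterᵇ (R v) l)
    sub [] _ = z≤n
    sub (x ∷ l) g with P x | R v x | g (here refl)
    ... | true | true | _ = s≤s (sub l (g ∘ there))
    ... | true | false | f = ⊥-elim (f tt)
    ... | false | true | _ = ℕ.m≤n⇒m≤1+n (sub l (g ∘ there))
    ... | false | false | _ = sub l (g ∘ there)

classes-bound : ∀ {c} (code : A → ℕ) B l → (∀ {x} → x ∈ l → code x < B) →
  (∀ i → length (filterᵇ (λ x → code x Data.Nat.≡ᵇ i) l) ≤ c) → length l ≤ B * c
classes-bound code zero [] lt h = z≤n
classes-bound code zero (x ∷ l) lt h with () ← lt (here refl)
classes-bound {c = c} code (suc B) l lt h = ℕ.≤-trans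
  (ℕ.≤-reflexive (trans (Perm.↭-length (filterᵇ-complement isB l)) (List.length-++ (filterᵇ isB l))))
  (ℕ.+-mono-≤ (h B) (classes-bound code B rest smaller λ i → ℕ.≤-trans (thin i l) (h i)))
  where
  isB : _ → Bool
  isB x = code x Data.Nat.≡ᵇ B
  rest : List _
  rest = filterᵇ (not ∘ isB) l
  smaller : ∀ {x} → x ∈ rest → code x < B
  smaller {x} i with filterᵇ-∈⁻ (not ∘ isB) l i
  ... | j , t = ℕ.≤∧≢⇒< (s≤s⁻¹ (lt j)) λ e → T-not⁻ t (ℕ.≡⇒≡ᵇ _ _ e)
  thin : ∀ i l → length (filterᵇ (λ x → code x Data.Nat.≡ᵇ i) (filterᵇ (not ∘ isB) l)) ≤ length (filterᵇ (λ x → code x Data.Nat.≡ᵇ i) l)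
  thin i [] = z≤n
  thin i (x ∷ l) with not (isB x)
  thin i (x ∷ l) | true with code x Data.Nat.≡ᵇ i
  ... | true = s≤s (thin i l)
  ... | false = thin i l
  thin i (x ∷ l) | false with code x Data.Nat.≡ᵇ i
  ... | true = ℕ.m≤n⇒m≤1+n (thin i l)
  ... | false = thin i l

filterᵇ-length-∨ : ∀ (P Q : A → Bool) xs → length (filterᵇ (λ x → P x ∨ Q x) xs) ≤ length (filterᵇ P xs) + length (filterᵇ Q xs)
filterᵇ-length-∨ P Q [] = z≤n
filterᵇ-length-∨ P Q (x ∷ xs) with P x | Q x
... | true | true = s≤s (ℕ.≤-trans (filterᵇ-length-∨ P Q xs) (ℕ.+-monoʳ-≤ (length (filterᵇ P xs)) (ℕ.n≤1+n _)))
... | true | false = s≤s (filterᵇ-length-∨ P Q xs)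
... | false | true = ℕ.≤-trans (s≤s (filterᵇ-length-∨ P Q xs)) (ℕ.≤-reflexive (sym (ℕ.+-suc (length (filterᵇ P xs)) _)))
... | false | false = filterᵇ-length-∨ P Q xs

-- Bounds on the kernel in terms of the number x of vertices in X.
cliqueBound kindBound labelBound thresholdBound kernelBound : ℕ → ℕ
cliqueBound x = 2 ^ x * 2
kindBound x = 3 ^ (2 ^ x)
labelBound x = x + (kindBound x + (kindBound x * 6) * cliqueBound x)
thresholdBound x = 3 + 3 ^ (labelBound x * 9) * 2
kernelBound x = x + (kindBound x * 6 + kindBound x * thresholdBound x) * cliqueBound x

module Sizes {V : Set} (_≟_ : DecidableEquality V) (nb : V → V → Bool)
             (nb-refl : ∀ v → T (nb v v)) (nb-sym : ∀ u v → nb u v ≡ nb v u) (X L : List V)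
             (L-trans : ∀ {u v w} → u ∈ L → v ∈ L → w ∈ L → T (nb u v) → T (nb v w) → T (nb u w)) where

  open Kernel _≟_ nb nb-refl nb-sym X L

  bit : Bool → Fin 2
  bit true = # 1
  bit false = # 0

  bit-injective : ∀ {a b} → bit a ≡ bit b → a ≡ b
  bit-injective {true} {true} _ = refl
  bit-injective {false} {false} _ = refl

  typeCode : V → ℕ
  typeCode v = toℕ (funToFin (λ i → bit (nb v (List.lookup X i))))

  typeCode-τ : ∀ {u v} → typeCode u ≡ typeCode v → T (τ u v)
  typeCode-τ {u} {v} e = τ-complete λ x∈ → bit-injective (subst (λ x → bit (nb u x) ≡ bit (nb v x)) (sym (Any.lookup-index x∈))
    (trans (sym (Fin.finToFun-funToFin (λ i → bit (nb u (List.lookup X i))) (Any.index x∈)))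
      (trans (cong (λ z → finToFun z (Any.index x∈)) (Fin.toℕ-injective e)) (Fin.finToFun-funToFin _ (Any.index x∈)))))

  τ-typeCode : ∀ {u v} → T (τ u v) → typeCode u ≡ typeCode v
  τ-typeCode {u} {v} t = cong toℕ (funToFin-cong λ i → cong bit (τ-sound {u} {v} t (Mem.∈-lookup i)))
    where
    funToFin-cong : ∀ {m n} {f g : Fin m → Fin n} → (∀ i → f i ≡ g i) → funToFin f ≡ funToFin g
    funToFin-cong {zero} h = refl
    funToFin-cong {suc m} h = cong₂ Data.Fin.combine (h zero) (funToFin-cong (h ∘ suc))

  typeCode-< : ∀ v → typeCode v < 2 ^ length X
  typeCode-< v = Fin.toℕ<n (funToFin (λ i → bit (nb v (List.lookup X i))))

  ofType : ℕ → V → Bool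
  ofType i u = typeCode u Data.Nat.≡ᵇ i

  ofType-sound : ∀ {i u} → T (ofType i u) → typeCode u ≡ i
  ofType-sound {i} {u} = ℕ.≡ᵇ⇒≡ (typeCode u) i

  C-class : ∀ {v} → v ∈ L → ∀ i → length (filterᵇ (ofType i) (C v)) ≤ 2
  C-class {v} v∈ i = subst (λ l → length l ≤ 2) (sym (both L₂)) (capBy-class {R = twin} {2} (λ u → nb v u ∧ ofType i u) L
    λ {u} {w} u∈ w∈ p q → T-∧⁺ (L-trans u∈ v∈ w∈ (subst T (nb-sym v u) (proj₁ (T-∧⁻ {nb v u} p))) (proj₁ (T-∧⁻ {nb v w} q)))
      (typeCode-τ {u} {w} (trans (ofType-sound {i} {u} (proj₂ (T-∧⁻ {nb v u} p))) (sym (ofType-sound {i} {w} (proj₂ (T-∧⁻ {nb v w} q)))))))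
    where
    both : ∀ xs → filterᵇ (ofType i) (filterᵇ (nb v) xs) ≡ filterᵇ (λ u → nb v u ∧ ofType i u) xs
    both [] = refl
    both (x ∷ xs) with nb v x
    ... | false = both xs
    ... | true with ofType i x
    ... | true = cong (x ∷_) (both xs)
    ... | false = both xs

  C-bound : ∀ {v} → v ∈ L → length (C v) ≤ cliqueBound (length X)
  C-bound {v} v∈ = classes-bound typeCode (2 ^ length X) (C v) (λ {u} _ → typeCode-< u) (C-class v∈)

  small₃ : ℕ → Fin 3
  small₃ = cap₃

  small₃-injective : ∀ {m n} → m ≤ 2 → n ≤ 2 → small₃ m ≡ small₃ n → m ≡ n
  small₃-injective {0} {0} _ _ _ = refl
  small₃-injective {1} {1} _ _ _ = refl
  small₃-injective {2} {2} _ _ _ = refl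
  small₃-injective {0} {1} _ _ ()
  small₃-injective {0} {2} _ _ ()
  small₃-injective {1} {0} _ _ ()
  small₃-injective {1} {2} _ _ ()
  small₃-injective {2} {0} _ _ ()
  small₃-injective {2} {1} _ _ ()
  small₃-injective {suc (suc (suc _))} (s≤s (s≤s ()))
  small₃-injective {_} {suc (suc (suc _))} _ (s≤s (s≤s ()))

  kindFun : V → Fin (2 ^ length X) → Fin 3
  kindFun v i = small₃ (length (filterᵇ (ofType (toℕ i)) (C v)))

  kindCode : V → ℕ
  kindCode v = toℕ (funToFin (kindFun v))

  kindCode-kind : ∀ {v w} → v ∈ L → w ∈ L → kindCode v ≡ kindCode w → T (kind v w)
  kindCode-kind {v} {w} v∈ w∈ e = kind-complete {v} {w} λ {t} _ →
    trans (cong length (by-code t v)) (trans (equal t) (sym (cong length (by-code t w))))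
    where
    by-code : ∀ t v → filterᵇ (τ t) (C v) ≡ filterᵇ (ofType (typeCode t)) (C v)
    by-code t v = filterᵇ-cong (C v) λ {u} _ → T-ext
      (λ p → ℕ.≡⇒≡ᵇ _ _ (sym (τ-typeCode {t} {u} p))) (λ p → typeCode-τ {t} {u} (sym (ofType-sound {typeCode t} {u} p)))
    equal : ∀ t → length (filterᵇ (ofType (typeCode t)) (C v)) ≡ length (filterᵇ (ofType (typeCode t)) (C w))
    equal t = small₃-injective (C-class v∈ _) (C-class w∈ _)
      (subst (λ i → small₃ (length (filterᵇ (ofType i) (C v))) ≡ small₃ (length (filterᵇ (ofType i) (C w)))) (Fin.toℕ-fromℕ< (typeCode-< t))
        (trans (sym (Fin.finToFun-funToFin (kindFun v) (Data.Fin.fromℕ< (typeCode-< t))))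
          (trans (cong (λ z → finToFun z (Data.Fin.fromℕ< (typeCode-< t))) (Fin.toℕ-injective e)) (Fin.finToFun-funToFin (kindFun w) _))))

  reps-L : ∀ {v} → v ∈ reps → v ∈ L
  reps-L i = L₂⊆L (capBy-∈ L₂ i)

  kinds-bound : ∀ c (xs : List V) → (∀ {v} → v ∈ xs → v ∈ L) → length (capBy kind c xs) ≤ kindBound (length X) * c
  kinds-bound c xs sub = classes-bound kindCode (kindBound (length X)) (capBy kind c xs) (λ {v} _ → Fin.toℕ<n (funToFin (kindFun v)))
    λ i → capBy-class (λ x → kindCode x Data.Nat.≡ᵇ i) xs λ {u} {w} u∈ w∈ p q →
      kindCode-kind (sub u∈) (sub w∈) (trans (ℕ.≡ᵇ⇒≡ (kindCode u) i p) (sym (ℕ.≡ᵇ⇒≡ (kindCode w) i q)))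

  inC-bound : ∀ R → (∀ {v} → v ∈ R → v ∈ L) → length (filterᵇ (inC R) L₂) ≤ length R * cliqueBound (length X)
  inC-bound [] sub = ℕ.≤-reflexive (cong length (none L₂))
    where
    none : ∀ (xs : List V) → filterᵇ (λ _ → false) xs ≡ []
    none [] = refl
    none (x ∷ xs) = none xs
  inC-bound (v ∷ R) sub = ℕ.≤-trans (filterᵇ-length-∨ (nb v) (inC R) L₂)
    (ℕ.+-mono-≤ (C-bound (sub (here refl))) (inC-bound R (sub ∘ there)))

  bigs-L : ∀ {v} → v ∈ bigs → v ∈ L
  bigs-L i = reps-L (proj₁ (filterᵇ-∈⁻ big reps i))

  smalls-L : ∀ {v} → v ∈ smalls → v ∈ L
  smalls-L i = reps-L (proj₁ (filterᵇ-∈⁻ (not ∘ big) reps i))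

  labels-bound : length labelList ≤ labelBound (length X)
  labels-bound = ℕ.≤-trans (ℕ.≤-reflexive (trans (List.length-++ X) (cong (length X +_) (List.length-++ lbl))))
    (ℕ.+-monoʳ-≤ (length X) (ℕ.+-mono-≤ (ℕ.≤-trans (kinds-bound 1 smalls smalls-L) (ℕ.≤-reflexive (ℕ.*-identityʳ _)))
      (ℕ.≤-trans (inC-bound R₁ (bigs-L ∘ capBy-∈ bigs)) (ℕ.*-monoˡ-≤ (cliqueBound (length X)) (kinds-bound 6 bigs bigs-L)))))

  threshold-bound : threshold ≤ thresholdBound (length X)
  threshold-bound = ℕ.+-monoʳ-≤ 3 (ℕ.*-monoˡ-≤ 2 (ℕ.^-monoʳ-≤ 3 (ℕ.*-monoˡ-≤ 9 labels-bound)))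

  kernel-bound : length K ≤ kernelBound (length X)
  kernel-bound = ℕ.≤-trans (ℕ.≤-reflexive (List.length-++ X)) (ℕ.+-monoʳ-≤ (length X)
    (ℕ.≤-trans (inC-bound (R₁ ++ R₂) λ i → [ bigs-L ∘ capBy-∈ bigs , smalls-L ∘ capBy-∈ smalls ]′ (Mem.∈-++⁻ R₁ i))
      (ℕ.*-monoˡ-≤ (cliqueBound (length X)) (ℕ.≤-trans (ℕ.≤-reflexive (List.length-++ R₁))
        (ℕ.+-mono-≤ (kinds-bound 6 bigs bigs-L)
          (ℕ.≤-trans (kinds-bound threshold smalls smalls-L) (ℕ.*-monoʳ-≤ (kindBound (length X)) threshold-bound)))))))

-- Strategies

ClosedNb : (G : Graph) → Vertex G → Vertex G → Bool
ClosedNb G u v = does (u Fin.≟ v) ∨ adjacent G u v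

closedNb-refl : ∀ G v → T (ClosedNb G v v)
closedNb-refl G v with v Fin.≟ v
... | yes _ = tt
... | no ne = ⊥-elim (ne refl)

closedNb-sym : ∀ G u v → ClosedNb G u v ≡ ClosedNb G v u
closedNb-sym G u v with u Fin.≟ v | v Fin.≟ u
... | yes _ | yes _ = refl
... | no _ | no _ = symmetric G u v
... | yes e | no ne = ⊥-elim (ne (sym e))
... | no ne | yes e = ⊥-elim (ne (sym e))

module Strategies (G : Graph) (first : Player) where

  open Named (ClosedNb G) (closedNb-refl G) (closedNb-sym G)

  n : ℕ
  n = order G

  status : History G → Vertex G → Slot
  status [] v = □
  status (u ∷ h) v = if does (u Fin.≟ v) then mark (turn G first h) else status h v

  onFree : History G → List (Vertex G) → Position (Vertex G)
  onFree h = map λ v → one (status h v) v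

  position : History G → Position (Vertex G)
  position h = onFree h (allFin n)

  status-free : ∀ {h v} → v ∉ h → status h v ≡ □
  status-free {[]} _ = refl
  status-free {u ∷ h} {v} v∉ with u Fin.≟ v
  ... | yes e = ⊥-elim (v∉ (here (sym e)))
  ... | no _ = status-free {h} (v∉ ∘ there)

  mark≢□ : ∀ p → mark p ≢ □
  mark≢□ Dominator ()
  mark≢□ Staller ()

  free-unclaimed : ∀ {h v} → status h v ≡ □ → v ∉ h
  free-unclaimed {u ∷ h} {v} e (here refl) with u Fin.≟ u
  ... | no ne = ne refl
  ... | yes _ = mark≢□ (turn G first h) e
  free-unclaimed {u ∷ h} {v} e (there i) with u Fin.≟ v
  ... | no _ = free-unclaimed {h} e i
  ... | yes _ = mark≢□ (turn G first h) e

  status-other : ∀ {h u v} → u ≢ v → status (u ∷ h) v ≡ status h v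
  status-other {h} {u} {v} ne with u Fin.≟ v
  ... | yes e = ⊥-elim (ne e)
  ... | no _ = refl

  status-claim : ∀ {h u} → status (u ∷ h) u ≡ mark (turn G first h)
  status-claim {h} {u} with u Fin.≟ u
  ... | yes _ = refl
  ... | no ne = ⊥-elim (ne refl)

  onFree-other : ∀ {h u} l → u ∉ l → onFree (u ∷ h) l ≡ onFree h l
  onFree-other [] _ = refl
  onFree-other {h} {u} (v ∷ l) u∉ = cong₂ _∷_ (cong (λ s → one s v) (status-other {h} λ e → u∉ (here e))) (onFree-other {h} l (u∉ ∘ there))

  claim-move : ∀ {h v} l → Unique l → v ∈ l → v ∉ h → Move (mark (turn G first h)) (onFree h l) (onFree (v ∷ h) l)
  claim-move {h} {v} (_ ∷ l) (ne ∷ u) (here refl) v∉ = subst₂ (Move _)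
    (cong (λ s → one s v ∷ onFree h l) (sym (status-free {h} v∉)))
    (cong₂ (λ s m → one s v ∷ m) (sym (status-claim {h} {v})) (sym (onFree-other {h} {v} l (λ i → All.lookup ne i refl))))
    (here fst)
  claim-move {h} {v} (x ∷ l) (ne ∷ u) (there i) v∉ =
    subst (λ s → Move (mark (turn G first h)) (onFree h (x ∷ l)) (one s x ∷ onFree (v ∷ h) l))
      (sym (status-other {h} λ e → All.lookup ne i (sym e))) (there (claim-move l u i v∉))

  move-claim : ∀ {h M} l → Unique l → Move (mark (turn G first h)) (onFree h l) M → ∃[ v ] v ∈ l × v ∉ h × M ≡ onFree (v ∷ h) l
  move-claim {h} (x ∷ l) (ne ∷ u) (here s) with Hole.only (hole₁ {a = x} ○) s
  ... | e , refl = x , here refl , free-unclaimed {h} e ,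
    cong₂ _∷_ (cong (λ s → one s x) (sym (status-claim {h} {x}))) (sym (onFree-other {h} {x} l λ i → All.lookup ne i refl))
  move-claim {h} (x ∷ l) (ne ∷ u) (there m) with move-claim {h} l u m
  ... | v , i , v∉ , refl = v , there i , v∉ , cong (_∷ onFree (v ∷ h) l) (cong (λ s → one s x) (sym (status-other {h} λ e → All.lookup ne i (sym e))))

  unique-all : Unique (allFin n)
  unique-all = Uniq.allFin⁺ n

  claims : ∀ {h v} → v ∉ h → Move (mark (turn G first h)) (position h) (position (v ∷ h))
  claims = claim-move (allFin n) unique-all (Mem.∈-allFin _)

  claimed : ∀ {h M} → Move (mark (turn G first h)) (position h) M → ∃[ v ] v ∉ h × M ≡ position (v ∷ h)
  claimed {h} m with move-claim {h} (allFin n) unique-all m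
  ... | v , _ , v∉ , e = v , v∉ , e

  some-unclaimed : ∀ h → length h < n → ∃[ v ] v ∉ h
  some-unclaimed h lt with Fin.any? (λ v → ¬? (Any.any? (v Fin.≟_) h))
  ... | yes p = p
  ... | no ¬p = ⊥-elim (ℕ.<-irrefl refl (ℕ.<-≤-trans lt (Fin.injective⇒≤ {f = Any.index ∘ member} index-injective)))
    where
    member : ∀ v → v ∈ h
    member v with Any.any? (v Fin.≟_) h
    ... | yes i = i
    ... | no v∉ = ⊥-elim (¬p (v , v∉))
    index-injective : ∀ {u v} → Any.index (member u) ≡ Any.index (member v) → u ≡ v
    index-injective {u} {v} e = trans (Any.lookup-index (member u)) (trans (cong (List.lookup h) e) (sym (Any.lookup-index (member v))))

  all-claimed : ∀ {h} → Unique h → length h ≡ n → ∀ v → v ∈ h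
  all-claimed {h} u e v with Any.any? (v Fin.≟_) h
  ... | yes i = i
  ... | no v∉ = ⊥-elim (ℕ.<-irrefl refl (ℕ.≤-trans (s≤s (ℕ.≤-reflexive (sym e)))
    (unique-length (All.tabulate (λ {x} i e → v∉ (subst (_∈ h) (sym e) i)) ∷ u))))

  ∈-dominatorSet : ∀ {h v} → Unique h → status h v ≡ ● → v Sub.∈ dominatorSet G first h
  ∈-dominatorSet {u ∷ h} {v} (ne ∷ uq) e with u Fin.≟ v | turn G first h
  ... | yes refl | Dominator = SubP.x∈p∪q⁺ (inj₁ (SubP.x∈⁅x⁆ u))
  ... | no _ | Dominator = SubP.x∈p∪q⁺ {p = Sub.⁅ u ⁆} (inj₂ (∈-dominatorSet uq e))
  ... | no _ | Staller = ∈-dominatorSet uq e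

  dominatorSet-∈ : ∀ {h v} → Unique h → v Sub.∈ dominatorSet G first h → status h v ≡ ●
  dominatorSet-∈ {[]} _ i = ⊥-elim (SubP.∉⊥ i)
  dominatorSet-∈ {u ∷ h} {v} (ne ∷ uq) i with u Fin.≟ v | turn G first h
  ... | yes refl | Dominator = refl
  ... | yes refl | Staller = ⊥-elim (All.lookup ne (in-history h (dominatorSet-∈ uq i)) refl)
    where
    in-history : ∀ h {v} → status h v ≡ ● → v ∈ h
    in-history (x ∷ h) {v} e with x Fin.≟ v
    ... | yes e′ = here (sym e′)
    ... | no _ = there (in-history h e)
  ... | no _ | Staller = dominatorSet-∈ uq i
  ... | no ne′ | Dominator with SubP.x∈p∪q⁻ Sub.⁅ u ⁆ _ i
  ... | inj₁ j = ⊥-elim (ne′ (sym (SubP.x∈⁅y⁆⇒x≡y u j)))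
  ... | inj₂ j = dominatorSet-∈ uq j

  ∈●-position : ∀ {h u} → u ∈● position h → status h u ≡ ●
  ∈●-position {h} (y , i) with Mem.∈-map⁻ (λ v → one (status h v) v) i
  ... | v , _ , e with cong proj₁ e
  ... | refl = sym (cong (proj₁ ∘ proj₂) e)

  vertices-position : ∀ h → vertices (position h) ≡ allFin n
  vertices-position h = go (allFin n)
    where
    go : ∀ l → vertices (onFree h l) ≡ l
    go [] = refl
    go (v ∷ l) = cong (v ∷_) (go l)

  dominated⇒won : ∀ {h} → Unique h → Dominated (position h) → WonBy G first Dominator h
  dominated⇒won {h} uq d = dominatorSet G first h , id , λ v → answer (d v (subst (v ∈_) (sym (vertices-position h)) (Mem.∈-allFin v)))
    where
    answer : ∀ {v} → ∃[ u ] u ∈● position h × u ~ v → v Sub.∈ dominatorSet G first h ⊎ (∃[ u ] u Sub.∈ dominatorSet G first h × Adj G u v)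
    answer {v} (u , u∈ , e) with u Fin.≟ v
    ... | yes refl = inj₁ (∈-dominatorSet uq (∈●-position {h} u∈))
    ... | no _ = inj₂ (u , ∈-dominatorSet uq (∈●-position {h} u∈) , e)

  won⇒dominated : ∀ {h} → Unique h → WonBy G first Dominator h → Dominated (position h)
  won⇒dominated {h} uq (D , D⊆ , doms) v _ with doms v
  ... | inj₁ v∈ = v , there● v (dominatorSet-∈ uq (D⊆ v∈)) , closedNb-refl G v
    where
    there● : ∀ v → status h v ≡ ● → v ∈● position h
    there● v e = ○ , subst (λ s → one s v ∈ position h) e (Mem.∈-map⁺ _ (Mem.∈-allFin v))
  ... | inj₂ (u , u∈ , e) = u , (○ , subst (λ s → one s u ∈ position h) (dominatorSet-∈ uq (D⊆ u∈)) (Mem.∈-map⁺ _ (Mem.∈-allFin u))) ,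
    T-∨⁺ {does (u Fin.≟ v)} (inj₂ e)

  position-full : ∀ {h} → Unique h → length h ≡ n → Full (position h)
  position-full {h} uq e = All.map⁺ (All.tabulate λ {v} _ → claimed-slot (λ f → free-unclaimed {h} f (all-claimed uq e v)) , ○)
    where
    claimed-slot : ∀ {s} → s ≢ □ → Claimed s
    claimed-slot {●} _ = ●
    claimed-slot {○} _ = ○
    claimed-slot {□} ne = ⊥-elim (ne refl)

  dominated? : ∀ L → Dominated L ⊎ ¬ Dominated L
  dominated? L with All.all? (λ v → Any.any? (λ (u , s , _) → (s ≟ˢ ●) ×-dec Bool.T? (ClosedNb G u v)) L) (vertices L)
  ... | yes d = inj₁ λ v v∈ → case find (All.lookup d v∈) of λ { ((u , _ , y) , i , refl , e) → u , (y , i) , e }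
  ... | no ¬d = inj₂ λ d → ¬d (All.tabulate λ {v} v∈ → let u , (y , i) , e = d v v∈ in lose i (refl , e))

  consistent-unique : ∀ {p σ h} → Consistent G first p σ h → Unique h
  consistent-unique start = []
  consistent-unique {σ = σ} (own {h} c _ lt) = All.tabulate (λ i e → proj₂ (σ h lt) (subst (_∈ h) (sym e) i)) ∷ consistent-unique c
  consistent-unique (other {h} c _ v∉) = All.tabulate (λ i e → v∉ (subst (_∈ h) (sym e) i)) ∷ consistent-unique c

  opponent-turn : ∀ p q → q ≢ p → q ≡ opponent p
  opponent-turn Dominator Dominator ne = ⊥-elim (ne refl)
  opponent-turn Dominator Staller   ne = refl
  opponent-turn Staller   Dominator ne = refl
  opponent-turn Staller   Staller   ne = ⊥-elim (ne refl)

  opponent² : ∀ p → opponent (opponent p) ≡ p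
  opponent² Dominator = refl
  opponent² Staller = refl

  module Follow (p : Player) (Good : Player → Position (Vertex G) → Set)
                (good? : ∀ q L → Good q L ⊎ ¬ Good q L)
                (mine : ∀ {L} → Good p L → ¬ Full L → ∃[ M ] Move (mark p) L M × Good (opponent p) M)
                (theirs : ∀ {L M} → Good (opponent p) L → Move (mark (opponent p)) L M → Good p M) where

    Stays : History G → Vertex G → Set
    Stays h v = v ∉ h × Good (opponent (turn G first h)) (position (v ∷ h))

    stays? : ∀ h v → Dec (Stays h v)
    stays? h v with Any.any? (v Fin.≟_) h | good? (opponent (turn G first h)) (position (v ∷ h))
    ... | no v∉ | inj₁ g = yes (v∉ , g)
    ... | yes i | _ = no λ (v∉ , _) → v∉ i
    ... | no _ | inj₂ ¬g = no (¬g ∘ proj₂)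

    choose : ∀ h → length h < n → (∃[ v ] Stays h v) ⊎ (¬ (∃[ v ] Stays h v) × (∃[ v ] v ∉ h))
    choose h lt with Fin.any? (stays? h)
    ... | yes s = inj₁ s
    ... | no ¬s = inj₂ (¬s , some-unclaimed h lt)

    σ : Strategy G
    σ h lt with choose h lt
    ... | inj₁ (v , v∉ , _) = v , v∉
    ... | inj₂ (_ , v , v∉) = v , v∉

    not-full : ∀ {h} → length h < n → ¬ Full (position h)
    not-full {h} lt f with some-unclaimed h lt
    ... | v , v∉ = full-stuck f (claims {h} v∉)

    stays-good : Good first (position []) → ∀ {h} → Consistent G first p σ h → Good (turn G first h) (position h)
    stays-good g start = g
    stays-good g (own {h} c e lt) with choose h lt
    ... | inj₁ (v , _ , good) = good
    ... | inj₂ (¬s , _) with mine (subst (λ q → Good q (position h)) e (stays-good g c)) (not-full {h} lt)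
    ... | M , m , good with claimed {h} (subst (λ q → Move (mark q) (position h) M) (sym e) m)
    ... | v , v∉ , refl = ⊥-elim (¬s (v , v∉ , subst (λ q → Good (opponent q) (position (v ∷ h))) (sym e) good))
    stays-good g (other {h} {v} c ne v∉) = subst (λ q → Good q (position (v ∷ h))) (sym (trans (cong opponent e) (opponent² p)))
        (theirs (subst (λ q → Good q (position h)) e (stays-good g c)) (subst (λ q → Move (mark q) (position h) (position (v ∷ h))) e (claims {h} v∉)))
      where
      e : turn G first h ≡ opponent p
      e = opponent-turn p _ ne

  private
    no⊎ : {P Q : Set} → P ⊎ Q → (Q → ¬ P) → P ⊎ ¬ P
    no⊎ (inj₁ p) _ = inj₁ p
    no⊎ (inj₂ q) f = inj₂ (f q)

  dominator-strategy : Game first (allFin n) → HasWinningStrategy G first Dominator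
  dominator-strategy w = σ , λ h c e →
      dominated⇒won {h} (consistent-unique c) (W-full (position-full {h} (consistent-unique c) e) (stays-good w c))
    where
    mine : ∀ {L} → W Dominated Dominator L → ¬ Full L → ∃[ M ] Move ● L M × W Dominated Staller M
    mine (over f _) ¬f = ⊥-elim (¬f f)
    mine (dom m w) _ = _ , m , w
    theirs : ∀ {L M} → W Dominated Staller L → Move ○ L M → W Dominated Dominator M
    theirs (over f _) m = ⊥-elim (full-stuck f m)
    theirs (sta _ g) m = g m
    open Follow Dominator (W Dominated) (λ q L → no⊎ (determined dominated? q L) (λ s w → not-both w s)) mine theirs

  staller-strategy : SW Dominated first (all□ (allFin n)) → HasWinningStrategy G first Staller
  staller-strategy w = σ , λ h c e won →
      SW-full (position-full {h} (consistent-unique c) e) (stays-good w c) (won⇒dominated {h} (consistent-unique c) won)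
    where
    mine : ∀ {L} → SW Dominated Staller L → ¬ Full L → ∃[ M ] Move ○ L M × SW Dominated Dominator M
    mine (over f _) ¬f = ⊥-elim (¬f f)
    mine (sta m w) _ = _ , m , w
    theirs : ∀ {L M} → SW Dominated Dominator L → Move ● L M → SW Dominated Staller M
    theirs (over f _) m = ⊥-elim (full-stuck f m)
    theirs (dom _ g) m = g m
    open Follow Staller (SW Dominated) (λ q L → no⊎ (flip⊎ (determined dominated? q L)) (λ w s → not-both w s)) mine theirs

-- An interpreter for expressions with folds over lists and one level of recursion

data Expr : ℕ → Set where
  ν     : ∀ {n} → Fin n → Expr n
  ∅     : ∀ {n} → Expr n
  _∙_   : ∀ {n} → Expr n → Expr n → Expr n
  match : ∀ {n} → Expr n → Expr n → Expr (2 + n) → Expr n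
  -- The step of a fold sees the value for the tail, the head and the tail.
  fold  : ∀ {n} → Expr n → Expr n → Expr (3 + n) → Expr n
  sub   : ∀ {n k} → Expr k → Vec (Expr n) k → Expr n
  -- rec z s l p applies to p the function defined by recursion on l in which
  -- ask calls the function for the tail.
  ask   : ∀ {n} → Expr n → Expr n
  rec   : ∀ {n} → Expr 1 → Expr 3 → Expr n → Expr n → Expr n

infixr 5 _∙_

tag : ℕ → Tree → Tree
tag i x = cons (encodeℕ i) x

code : ∀ {n} → Expr n → Tree
codes : ∀ {n k} → Vec (Expr n) k → Tree
code (ν i)         = tag 0 (encodeℕ (toℕ i))
code ∅             = tag 1 nil
code (a ∙ b)       = tag 2 (cons (code a) (code b))
code (match e a b) = tag 3 (cons (code e) (cons (code a) (code b)))
code (fold l z s)  = tag 4 (cons (code l) (cons (code z) (code s)))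
code (sub e as)    = tag 5 (cons (code e) (codes as))
code (ask e)       = tag 6 (code e)
code (rec z s l p) = tag 7 (cons (cons (code z) (code s)) (cons (code l) (code p)))
codes []       = tag 1 nil
codes (e ∷ es) = tag 2 (cons (code e) (codes es))

env : ∀ {n} → Vec Tree n → Tree
env []      = nil
env (x ∷ ρ) = cons x (env ρ)

private
  eval′ : ∀ {n} → Exp 4 n → Exp 4 n → Exp 4 n → Exp 4 n
  eval′ c e f = call (# 0) (cons c (cons e f))

  evalBody foldBody applyBody nthBody : Exp 4 1
  evalBody =
    case (var (# 0)) nil (case (var (# 1)) nil (case (var (# 2)) nil
      (case (var (# 0)) (call (# 3) (cons (var (# 1)) (var (# 2))))
      (case (var (# 1)) nil
      (case (var (# 1)) (case (var (# 5)) nil (cons (eval′ (var (# 0)) (var (# 8)) (var (# 9))) (eval′ (var (# 1)) (var (# 8)) (var (# 9)))))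
      (case (var (# 1)) (case (var (# 7)) nil (case (var (# 1)) nil
          (case (eval′ (var (# 2)) (var (# 12)) (var (# 13))) (eval′ (var (# 0)) (var (# 12)) (var (# 13)))
            (eval′ (var (# 3)) (cons (var (# 0)) (cons (var (# 1)) (var (# 14)))) (var (# 15))))))
      (case (var (# 1)) (case (var (# 9)) nil
          (call (# 1) (cons (eval′ (var (# 0)) (var (# 12)) (var (# 13))) (cons (var (# 1)) (cons (var (# 12)) (var (# 13)))))))
      (case (var (# 1)) (case (var (# 11)) nil (eval′ (var (# 0)) (eval′ (var (# 1)) (var (# 14)) (var (# 15))) (var (# 15))))
      (case (var (# 1)) (case (var (# 15)) nil
          (call (# 2) (cons (var (# 0)) (cons (eval′ (var (# 15)) (var (# 16)) (var (# 17))) (var (# 1))))))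
      (case (var (# 15)) nil (case (var (# 1)) nil
          (call (# 2) (cons (eval′ (var (# 0)) (var (# 20)) (var (# 21))) (cons (eval′ (var (# 1)) (var (# 20)) (var (# 21))) (var (# 2))))))))))))))))
  foldBody =
    case (var (# 0)) nil (case (var (# 1)) nil (case (var (# 0)) nil (case (var (# 3)) nil
      (case (var (# 6)) (eval′ (var (# 2)) (var (# 0)) (var (# 1)))
        (eval′ (var (# 5)) (cons (call (# 1) (cons (var (# 1)) (var (# 9)))) (cons (var (# 0)) (cons (var (# 1)) (var (# 2))))) (var (# 3)))))))
  applyBody =
    case (var (# 0)) nil (case (var (# 1)) nil (case (var (# 1)) nil
      (case (var (# 4)) (eval′ (var (# 0)) (cons (var (# 2)) nil) nil)
        (eval′ (var (# 3)) (cons (var (# 0)) (cons (var (# 1)) (cons (var (# 4)) nil))) (cons (var (# 1)) (var (# 5)))))))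
  nthBody =
    case (var (# 0)) nil (case (var (# 0)) (case (var (# 1)) nil (var (# 0)))
      (case (var (# 3)) nil (call (# 3) (cons (var (# 3)) (var (# 1))))))

table : Vec (Exp 4 1) 4
table = evalBody ∷ foldBody ∷ applyBody ∷ nthBody ∷ []

record Within (N : ℕ) {n : ℕ} (ρ : Vec Tree n) (e : Exp 4 n) (x : Tree) (m : ℕ) : Set where
  constructor within
  field
    {steps}  : ℕ
    bounded  : steps ≤ N ^ m
    evaluates : table , ρ ⊢ e ⇓ x [ steps ]

-- f is the closure that ask calls.
record Ev {n : ℕ} (N : ℕ) (f : Tree) (e : Expr n) (ρ : Vec Tree n) (x : Tree) (m : ℕ) : Set where
  constructor ev
  field
    run : Within N (cons (code e) (cons (env ρ) f) ∷ []) evalBody x m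

record Evs {n k : ℕ} (N : ℕ) (f : Tree) (es : Vec (Expr n) k) (ρ : Vec Tree n) (xs : Vec Tree k) (m : ℕ) : Set where
  constructor evs
  field
    runs : Within N (cons (codes es) (cons (env ρ) f) ∷ []) evalBody (env xs) m

open Ev
open Evs

Apply : ℕ → Expr 1 → Expr 3 → Tree → Tree → Tree → ℕ → Set
Apply N z s t v x m = Within N (cons t (cons v (cons (code z) (code s))) ∷ []) applyBody x m

module Rules {N : ℕ} (N≥3 : 3 ≤ N) where

  private
    variable
      n m i j k : ℕ
      ρ : Vec Tree n
      e e₁ e₂ : Exp 4 n
      x y z f : Tree

    pos : ∀ m → 1 ≤ N ^ m
    pos m = ℕ.m^n>0 N {{Data.Nat.>-nonZero (ℕ.≤-trans (s≤s z≤n) N≥3)}} m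

    grow : i ≤ j → N ^ i ≤ N ^ j
    grow = ℕ.^-monoʳ-≤ N {{Data.Nat.>-nonZero (ℕ.≤-trans (s≤s z≤n) N≥3)}}

    join : ∀ {s t} m → s ≤ N ^ m → t ≤ N ^ m → suc (s + t) ≤ N ^ suc m
    join m p q = ℕ.≤-trans (ℕ.+-mono-≤ (pos m) (ℕ.+-mono-≤ p (ℕ.≤-trans q (ℕ.≤-reflexive (sym (ℕ.+-identityʳ _))))))
      (ℕ.*-monoˡ-≤ (N ^ m) N≥3)

    d-var : ∀ {i} → Within N ρ (var i) (lookup ρ i) m
    d-var {m = m} = within (pos m) (var⇓ _)
    d-nil : Within N ρ nil nil m
    d-nil {m = m} = within (pos m) nil⇓
    d-cons : Within N ρ e₁ x m → Within N ρ e₂ y m → Within N ρ (cons e₁ e₂) (cons x y) (suc m)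
    d-cons {m = m} (within p d) (within q d′) = within (join m p q) (cons⇓ d d′)
    d-nil-case : ∀ {e₂} → Within N ρ e nil m → Within N ρ e₁ x m → Within N ρ (case e e₁ e₂) x (suc m)
    d-nil-case {m = m} (within p d) (within q d′) = within (join m p q) (case-nil⇓ d d′)
    d-cons-case : ∀ {e₂} → Within N ρ e (cons y z) m → Within N (y ∷ z ∷ ρ) e₂ x m → Within N ρ (case e e₁ e₂) x (suc m)
    d-cons-case {m = m} (within p d) (within q d′) = within (join m p q) (case-cons⇓ d d′)
    d-call : ∀ {g} → Within N ρ e y m → Within N (y ∷ []) (lookup table g) x m → Within N ρ (call g e) x (suc m)
    d-call {m = m} (within p d) (within q d′) = within (join m p q) (call⇓ d d′)

  lift : i ≤ j → Within N ρ e x i → Within N ρ e x j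
  lift le (within p d) = within (ℕ.≤-trans p (grow le)) d

  lift-ev : ∀ {e : Expr n} {f} → i ≤ j → Ev N f e ρ x i → Ev N f e ρ x j
  lift-ev le (ev p) = ev (lift le p)

  private
    lift+ : ∀ k → Within N ρ e x m → Within N ρ e x (k + m)
    lift+ {m = m} k = lift (ℕ.m≤n+m m k)

    d-eval : ∀ {e₁ e₂ e₃ : Exp 4 n} → Within N ρ e₁ x m → Within N ρ e₂ y m → Within N ρ e₃ z m →
             Within N (cons x (cons y z) ∷ []) evalBody f (2 + m) → Within N ρ (eval′ e₁ e₂ e₃) f (3 + m)
    d-eval p q r d = d-call (d-cons (lift+ 1 p) (d-cons q r)) d

    d-nth : ∀ {n} (i : Fin n) (ρ : Vec Tree n) → Within N (cons (encodeℕ (toℕ i)) (env ρ) ∷ []) nthBody (lookup ρ i) (3 + toℕ i * 4)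
    d-nth zero (x ∷ ρ) = d-cons-case d-var $ d-nil-case d-var $ d-cons-case d-var d-var
    d-nth (suc i) (x ∷ ρ) = d-cons-case d-var $ d-cons-case d-var $ d-cons-case d-var
      (d-call (lift+ 2 (d-cons {m = toℕ i * 4} d-var d-var)) (d-nth i ρ))

  module _ {n} {ρ : Vec Tree n} {f : Tree} where

    ev-ν : ∀ i → Ev N f (ν i) ρ (lookup ρ i) (8 + toℕ i * 4)
    ev-ν i = ev $ d-cons-case d-var $ d-cons-case d-var $ d-cons-case d-var $ d-nil-case d-var
      (d-call (lift+ 2 (d-cons {m = toℕ i * 4} d-var d-var)) (d-nth i ρ))

    ev-∅ : Ev N f ∅ ρ nil 5
    ev-∅ = ev $ d-cons-case d-var $ d-cons-case d-var $ d-cons-case d-var $ d-cons-case d-var $ d-nil-case d-var d-nil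

    ev-∙ : ∀ {a b} → Ev N f a ρ x i → Ev N f b ρ y j → Ev N f (a ∙ b) ρ (cons x y) (13 + (i ⊔ j))
    ev-∙ {i = i} {j = j} p q = ev $ d-cons-case d-var $ d-cons-case d-var $ d-cons-case d-var $ d-cons-case d-var $ d-cons-case d-var $ d-nil-case d-var
      (d-cons-case d-var $ d-cons (lift+ 2 (d-eval d-var d-var d-var (lift (ℕ.≤-trans (ℕ.m≤m⊔n i j) (ℕ.m≤n+m (i ⊔ j) 2)) (run p))))
                                 (lift+ 2 (d-eval d-var d-var d-var (lift (ℕ.≤-trans (ℕ.m≤n⊔m i j) (ℕ.m≤n+m (i ⊔ j) 2)) (run q)))))

    ev-match-nil : ∀ {e a b} → Ev N f e ρ nil i → Ev N f a ρ x j → Ev N f (match e a b) ρ x (13 + (i ⊔ j))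
    ev-match-nil {i = i} {j = j} p q = ev $ d-cons-case d-var $ d-cons-case d-var $ d-cons-case d-var $ d-cons-case d-var $ d-cons-case d-var $ d-cons-case d-var
      (d-nil-case d-var $ d-cons-case d-var $ d-cons-case d-var
        (d-nil-case (d-eval d-var d-var d-var (lift (ℕ.≤-trans (ℕ.m≤m⊔n i j) (ℕ.m≤n+m (i ⊔ j) 2)) (run p)))
                    (d-eval d-var d-var d-var (lift (ℕ.≤-trans (ℕ.m≤n⊔m i j) (ℕ.m≤n+m (i ⊔ j) 2)) (run q)))))

    ev-match-cons : ∀ {e a b} → Ev N f e ρ (cons y z) i → Ev N f b (y ∷ z ∷ ρ) x j → Ev N f (match e a b) ρ x (15 + (i ⊔ j))
    ev-match-cons {i = i} {j = j} p q = ev $ d-cons-case d-var $ d-cons-case d-var $ d-cons-case d-var $ d-cons-case d-var $ d-cons-case d-var $ d-cons-case d-var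
      (d-nil-case d-var $ d-cons-case d-var $ d-cons-case d-var
        (d-cons-case (lift+ 2 (d-eval d-var d-var d-var (lift (ℕ.≤-trans (ℕ.m≤m⊔n i j) (ℕ.m≤n+m (i ⊔ j) 2)) (run p))))
          (d-eval d-var (d-cons d-var (d-cons d-var d-var)) d-var (lift (ℕ.≤-trans (ℕ.m≤n⊔m i j) (ℕ.m≤n+m (i ⊔ j) 4)) (run q)))))

    ev-sub : ∀ {k} {b : Expr k} {as : Vec (Expr n) k} {xs : Vec Tree k} →
             Evs N f as ρ xs i → Ev N f b xs x j →
             Ev N f (sub b as) ρ x (16 + (i ⊔ j))
    ev-sub {i = i} {j = j} p q = ev $ d-cons-case d-var $ d-cons-case d-var $ d-cons-case d-var $ d-cons-case d-var $ d-cons-case d-var $ d-cons-case d-var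
      (d-cons-case d-var $ d-cons-case d-var $ d-nil-case d-var $ d-cons-case d-var
        (d-eval d-var (d-eval d-var d-var d-var (lift (ℕ.≤-trans (ℕ.m≤m⊔n i j) (ℕ.m≤n+m (i ⊔ j) 2)) (runs p))) d-var
          (lift (ℕ.≤-trans (ℕ.m≤n⊔m i j) (ℕ.m≤n+m (i ⊔ j) 5)) (run q))))

    args-[] : Evs N f [] ρ [] 5
    args-[] = evs (run ev-∅)

    args-∷ : ∀ {k} {a} {as : Vec (Expr n) k} {xs : Vec Tree k} → Ev N f a ρ x i →
             Evs N f as ρ xs j →
             Evs N f (a ∷ as) ρ (x ∷ xs) (13 + (i ⊔ j))
    args-∷ {i = i} {j = j} p q = evs $ d-cons-case d-var $ d-cons-case d-var $ d-cons-case d-var $ d-cons-case d-var $ d-cons-case d-var $ d-nil-case d-var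
      (d-cons-case d-var $ d-cons (lift+ 2 (d-eval d-var d-var d-var (lift (ℕ.≤-trans (ℕ.m≤m⊔n i j) (ℕ.m≤n+m (i ⊔ j) 2)) (run p))))
                                 (lift+ 2 (d-eval d-var d-var d-var (lift (ℕ.≤-trans (ℕ.m≤n⊔m i j) (ℕ.m≤n+m (i ⊔ j) 2)) (runs q)))))

    ev-rec : ∀ {b s l p} → Ev N f l ρ x i → Ev N f p ρ y j → Apply N b s x y z k → Ev N f (rec b s l p) ρ z (20 + (i ⊔ j ⊔ k))
    ev-rec {i = i} {j = j} {k = k} p q r = ev $ d-cons-case d-var $ d-cons-case d-var $ d-cons-case d-var $ d-cons-case d-var $ d-cons-case d-var $ d-cons-case d-var
      (d-cons-case d-var $ d-cons-case d-var $ d-cons-case d-var $ d-cons-case d-var $ d-cons-case d-var $ d-cons-case d-var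
        (lift+ 2 (d-call (d-cons (lift+ 1 (d-eval d-var d-var d-var (lift (ℕ.≤-trans (ℕ.≤-trans (ℕ.m≤m⊔n i j) (ℕ.m≤m⊔n (i ⊔ j) k)) (ℕ.m≤n+m (i ⊔ j ⊔ k) 2)) (run p))))
                       (d-cons (d-eval d-var d-var d-var (lift (ℕ.≤-trans (ℕ.≤-trans (ℕ.m≤n⊔m i j) (ℕ.m≤m⊔n (i ⊔ j) k)) (ℕ.m≤n+m (i ⊔ j ⊔ k) 2)) (run q))) d-var))
          (lift (ℕ.≤-trans (ℕ.m≤n⊔m (i ⊔ j) k) (ℕ.m≤n+m (i ⊔ j ⊔ k) 5)) r))))

  ev-ask : ∀ {n} {ρ : Vec Tree n} {b s t e} → Ev N (cons t (cons (code b) (code s))) e ρ y i → Apply N b s t y z j →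
           Ev N (cons t (cons (code b) (code s))) (ask e) ρ z (17 + (i ⊔ j))
  ev-ask {i = i} {j = j} p r = ev $ d-cons-case d-var $ d-cons-case d-var $ d-cons-case d-var $ d-cons-case d-var $ d-cons-case d-var $ d-cons-case d-var
      (d-cons-case d-var $ d-cons-case d-var $ d-cons-case d-var $ d-nil-case d-var $ d-cons-case d-var
        (d-call (d-cons d-var (d-cons (d-eval d-var d-var d-var (lift (ℕ.≤-trans (ℕ.m≤m⊔n i j) (ℕ.m≤n+m (i ⊔ j) 2)) (run p))) d-var))
          (lift (ℕ.≤-trans (ℕ.m≤n⊔m i j) (ℕ.m≤n+m (i ⊔ j) 5)) r)))

  apply-nil : ∀ {b s} → Ev N nil b (y ∷ []) x i → Apply N b s nil y x (8 + i)
  apply-nil {i = i} p = d-cons-case d-var $ d-cons-case d-var $ d-cons-case d-var $ d-nil-case d-var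
    (d-eval d-var (d-cons d-var d-nil) d-nil (lift (ℕ.m≤n+m i 3) (run p)))

  apply-cons : ∀ {b s h t} → Ev N (cons t (cons (code b) (code s))) s (h ∷ t ∷ y ∷ []) x i → Apply N b s (cons h t) y x (10 + i)
  apply-cons {i = i} p = d-cons-case d-var $ d-cons-case d-var $ d-cons-case d-var $ d-cons-case d-var
    (d-eval d-var (d-cons d-var (d-cons d-var (d-cons d-var d-nil))) (lift+ 2 (d-cons d-var d-var)) (lift (ℕ.m≤n+m i 5) (run p)))
  private
    record Steps {n} (ρ : Vec Tree n) (e : Exp 4 n) (x : Tree) (b : ℕ) : Set where
      constructor steps
      field
        {count}   : ℕ
        bounded   : count ≤ b
        evaluates : table , ρ ⊢ e ⇓ x [ count ]

    foldArg : ∀ {n} → Expr n → Expr (3 + n) → Vec Tree n → Tree → Tree → Tree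
    foldArg z s ρ f l = cons l (cons (cons (code z) (code s)) (cons (env ρ) f))

    31≤ : 31 ≤ N ^ 4
    31≤ = ℕ.≤-trans (ℕ.m≤m+n 31 50) (ℕ.^-monoˡ-≤ 4 N≥3)

    absorb : ∀ {t m} → t ≤ N ^ m → 30 + t ≤ N ^ (4 + m)
    absorb {t} {m} p = ℕ.≤-trans (ℕ.+-mono-≤ (ℕ.≤-trans (ℕ.≤-reflexive (sym (ℕ.*-identityʳ 30))) (ℕ.*-monoʳ-≤ 30 (pos m))) p)
      (ℕ.≤-trans (ℕ.≤-reflexive (ℕ.+-comm (30 * N ^ m) (N ^ m))) (ℕ.≤-trans (ℕ.*-monoˡ-≤ (N ^ m) 31≤)
        (ℕ.≤-reflexive (sym (ℕ.^-distribˡ-+-* N 4 m)))))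

    -- Each element of the list costs a constant number of steps besides its own evaluation.
    run-fold : ∀ {A : Set} {n} {ρ : Vec Tree n} {f z s} (enc : A → Tree) (F : List A → Tree) (xs : List A) →
               Ev N f z ρ (F []) m →
               (∀ ys h t → ys ++ h ∷ t ≡ xs → Ev N f s (F t ∷ enc h ∷ encodeList (map enc t) ∷ ρ) (F (h ∷ t)) m) →
               Steps (foldArg z s ρ f (encodeList (map enc xs)) ∷ []) foldBody (F xs) (suc (length xs) * N ^ (4 + m))
    run-fold {m = m} enc F [] (ev (within p d)) _ = steps
      (ℕ.≤-trans (ℕ.≤-trans (ℕ.m≤n+m _ 14) (ℕ.≤-trans (ℕ.≤-reflexive (assoc _)) (absorb {m = m} p))) (ℕ.≤-reflexive (sym (ℕ.+-identityʳ _))))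
      (case-cons⇓ (var⇓ _) (case-cons⇓ (var⇓ _) (case-cons⇓ (var⇓ _) (case-cons⇓ (var⇓ _) (case-nil⇓ (var⇓ _)
        (call⇓ (cons⇓ (var⇓ _) (cons⇓ (var⇓ _) (var⇓ _))) d))))))
      where
      assoc : ∀ t → 14 + (16 + t) ≡ 30 + t
      assoc t = refl
    run-fold {m = m} {ρ = ρ} {f} {z} {s} enc F (h ∷ t) base step with run-fold enc F t base (λ ys h′ t′ e → step (h ∷ ys) h′ t′ (cong (h ∷_) e)) | step [] h t refl
    ... | steps {tIH} q dIH | ev (within {tS} p d) = steps {count = 25 + (tIH + tS)}
      (ℕ.≤-trans (ℕ.m≤n+m _ 5) $ ℕ.≤-trans (ℕ.≤-reflexive (rearrange tIH tS)) (ℕ.+-mono-≤ (absorb {m = m} p) q))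
      (subst (λ k → table , foldArg z s ρ f (encodeList (map enc (h ∷ t))) ∷ [] ⊢ foldBody ⇓ F (h ∷ t) [ k ]) (exact tIH tS)
        (case-cons⇓ (var⇓ _) (case-cons⇓ (var⇓ _) (case-cons⇓ (var⇓ _) (case-cons⇓ (var⇓ _) (case-cons⇓ (var⇓ _)
          (call⇓ (cons⇓ (var⇓ _) (cons⇓ (cons⇓ (call⇓ (cons⇓ (var⇓ _) (var⇓ _)) dIH) (cons⇓ (var⇓ _) (cons⇓ (var⇓ _) (var⇓ _)))) (var⇓ _))) d)))))))
      where
      rearrange : ∀ a b → 30 + (a + b) ≡ 30 + b + a
      rearrange = solve-∀
      exact : ∀ a b → 19 + (a + 5 + 1 + b) ≡ 25 + (a + b)
      exact = solve-∀

  ev-fold : ∀ {A : Set} {n} {ρ : Vec Tree n} {f l z s} (enc : A → Tree) (F : List A → Tree) (xs : List A) → length xs < N →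
            Ev N f l ρ (encodeList (map enc xs)) i → Ev N f z ρ (F []) j →
            (∀ ys h t → ys ++ h ∷ t ≡ xs → Ev N f s (F t ∷ enc h ∷ encodeList (map enc t) ∷ ρ) (F (h ∷ t)) k) →
            Ev N f (fold l z s) ρ (F xs) (17 + (i ⊔ (j ⊔ k)))
  ev-fold {i = i} {j = j} {k = k} {ρ = ρ} {f} {l} {z} {s} enc F xs lt p q r
    with run-fold enc F xs (lift-ev (ℕ.m≤m⊔n j k) q) (λ ys h t e → lift-ev (ℕ.m≤n⊔m j k) (r ys h t e))
  ... | steps b d = ev $ d-cons-case d-var $ d-cons-case d-var $ d-cons-case d-var $ d-cons-case d-var $ d-cons-case d-var $ d-cons-case d-var $
      d-cons-case d-var $ d-nil-case d-var $ d-cons-case d-var $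
      d-call (d-cons (d-eval d-var d-var d-var (lift (ℕ.≤-trans (ℕ.m≤m⊔n i (j ⊔ k)) (ℕ.m≤n+m (i ⊔ (j ⊔ k)) 5)) (run p)))
                     (lift+ 1 (d-cons d-var (d-cons d-var d-var))))
             (within (ℕ.≤-trans b (ℕ.≤-trans (ℕ.*-monoˡ-≤ (N ^ (4 + (j ⊔ k))) lt)
               (grow (ℕ.≤-trans (ℕ.+-monoʳ-≤ 5 (ℕ.m≤n⊔m i (j ⊔ k))) (ℕ.m≤n+m (5 + (i ⊔ (j ⊔ k))) 2))))) d)

-- Basic programs

record Ctx : Set where
  field
    β n    : ℕ
    m      : Fin n → Fin n → Bool
    m-sym  : ∀ u v → m u v ≡ m v u
    β≥3    : 3 ≤ β
    n<β    : n < β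
    oracle : Tree

  row : Fin n → Tree
  row i = encodeList (map (encodeBool ∘ m i) (allFin n))

  rows : List Tree
  rows = map row (allFin n)

  -- A vertex is represented by a list whose length is its number, and its row.
  vt : Fin n → Tree
  vt i = cons (encodeList (List.drop (n ∸ toℕ i) rows)) (row i)

  vts : List (Fin n) → Tree
  vts xs = encodeList (map vt xs)

  same : Fin n → Fin n → Bool
  same u v = does (u Fin.≟ v)

  nb : Fin n → Fin n → Bool
  nb u v = same u v ∨ m u v

  nb-refl : ∀ v → T (nb v v)
  nb-refl v with v Fin.≟ v
  ... | yes _ = tt
  ... | no ne = ⊥-elim (ne refl)

  nb-sym : ∀ u v → nb u v ≡ nb v u
  nb-sym u v with u Fin.≟ v | v Fin.≟ u
  ... | yes _ | yes _ = refl
  ... | no _ | no _ = m-sym u v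
  ... | yes e | no ne = ⊥-elim (ne (sym e))
  ... | no ne | yes e = ⊥-elim (ne (sym e))

  _⊢_⇒_^_ : ∀ {k} → Vec Tree k → Expr k → Tree → ℕ → Set
  ρ ⊢ e ⇒ x ^ j = Ev β oracle e ρ x j

open Ctx using (vt; vts) public

variable
  k : ℕ

hd tl : Tree → Tree
hd nil = nil
hd (cons x _) = x
tl nil = nil
tl (cons _ y) = y

module Derived (Γ : Ctx) where
  open Ctx Γ public hiding (vt; vts)
  open Rules β≥3 public

  private
    variable
      ρ : Vec Tree k
      i j l : ℕ
      x y : Tree

  recast : ∀ {e : Expr k} → x ≡ y → ρ ⊢ e ⇒ x ^ i → ρ ⊢ e ⇒ y ^ i
  recast refl p = p

  recast-bool : ∀ {e : Expr k} {a b} → a ≡ b → ρ ⊢ e ⇒ encodeBool a ^ i → ρ ⊢ e ⇒ encodeBool b ^ i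
  recast-bool refl p = p

  recast-env : ∀ {e : Expr k} {ρ σ : Vec Tree k} → ρ ≡ σ → ρ ⊢ e ⇒ x ^ i → σ ⊢ e ⇒ x ^ i
  recast-env refl p = p

  ev-match : ∀ {e : Expr k} {a b} v → ρ ⊢ e ⇒ v ^ i → (v ≡ nil → ρ ⊢ a ⇒ x ^ j) →
             (∀ y z → v ≡ cons y z → (y ∷ z ∷ ρ) ⊢ b ⇒ x ^ l) → ρ ⊢ match e a b ⇒ x ^ (15 + (i ⊔ (j ⊔ l)))
  ev-match {i = i} {j = j} {l = l} nil p q r = lift-ev (ℕ.≤-trans (ℕ.+-monoʳ-≤ 13 (ℕ.⊔-monoʳ-≤ i (ℕ.m≤m⊔n j l))) (ℕ.m≤n+m _ 2)) (ev-match-nil p (q refl))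
  ev-match {i = i} {j = j} {l = l} (cons y z) p q r = lift-ev (ℕ.+-monoʳ-≤ 15 (ℕ.⊔-monoʳ-≤ i (ℕ.m≤n⊔m j l))) (ev-match-cons p (r y z refl))

  -- The else branch comes first.
  ev-if : ∀ {e : Expr k} {a b} v → ρ ⊢ e ⇒ encodeBool v ^ i → (v ≡ false → ρ ⊢ a ⇒ x ^ j) →
          (v ≡ true → (nil ∷ nil ∷ ρ) ⊢ b ⇒ x ^ l) → ρ ⊢ match e a b ⇒ x ^ (15 + (i ⊔ (j ⊔ l)))
  ev-if false p q r = ev-match nil p (λ _ → q refl) λ _ _ ()
  ev-if true p q r = ev-match (cons nil nil) p (λ ()) λ { _ _ refl → r refl }

  ev-hd : ∀ {e : Expr k} v → ρ ⊢ e ⇒ v ^ i → ρ ⊢ match e ∅ (ν (# 0)) ⇒ hd v ^ (15 + (i ⊔ 8))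
  ev-hd v p = ev-match {j = 5} {l = 8} v p (λ { refl → ev-∅ }) λ { y z refl → ev-ν (# 0) }

  ev-tl : ∀ {e : Expr k} v → ρ ⊢ e ⇒ v ^ i → ρ ⊢ match e ∅ (ν (# 1)) ⇒ tl v ^ (15 + (i ⊔ 12))
  ev-tl v p = ev-match {j = 5} {l = 12} v p (λ { refl → ev-∅ }) λ { y z refl → ev-ν (# 1) }

  ev-true : ρ ⊢ ∅ ∙ ∅ ⇒ encodeBool true ^ _
  ev-true = ev-∙ ev-∅ ev-∅

  ev-false : ρ ⊢ ∅ ⇒ encodeBool false ^ _
  ev-false = ev-∅

hdE tlE : Expr k → Expr k
hdE e = match e ∅ (ν (# 0))
tlE e = match e ∅ (ν (# 1))

trueE : Expr k
trueE = ∅ ∙ ∅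

dropE : Expr 2
dropE = fold (ν (# 1)) (ν (# 0)) (tlE (ν (# 0)))

drop-suc : ∀ n (xs : List Tree) → encodeList (List.drop (suc n) xs) ≡ tl (encodeList (List.drop n xs))
drop-suc zero [] = refl
drop-suc zero (x ∷ xs) = refl
drop-suc (suc n) [] = refl
drop-suc (suc n) (x ∷ xs) = drop-suc n xs

opaque
  ev-drop : Σ ℕ λ j → ∀ Γ → let open Derived Γ in ∀ {B : Set} (enc : B → Tree) as bs → length bs < β →
            (encodeList as ∷ encodeList (map enc bs) ∷ []) ⊢ dropE ⇒ encodeList (List.drop (length bs) as) ^ j
  ev-drop = _ , λ Γ enc as bs lt → let open Derived Γ in
    ev-fold enc (λ t → encodeList (List.drop (length t) as)) bs lt (ev-ν (# 1)) (ev-ν (# 0)) λ ys h t e →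
      recast (sym (drop-suc (length t) as)) (ev-tl _ (ev-ν (# 0)))

eqLen : List A → List B → Bool
eqLen [] [] = true
eqLen (_ ∷ _) [] = false
eqLen [] (_ ∷ _) = false
eqLen (_ ∷ xs) (_ ∷ ys) = eqLen xs ys

eqLen-≡ᵇ : ∀ (xs : List A) (ys : List B) → eqLen xs ys ≡ (length xs Data.Nat.≡ᵇ length ys)
eqLen-≡ᵇ [] [] = refl
eqLen-≡ᵇ (_ ∷ _) [] = refl
eqLen-≡ᵇ [] (_ ∷ _) = refl
eqLen-≡ᵇ (_ ∷ xs) (_ ∷ ys) = eqLen-≡ᵇ xs ys

isNil : List A → Bool
isNil [] = true
isNil (_ ∷ _) = false

eqLen-drop : ∀ (xs : List A) (ys : List B) → isNil (List.drop (length ys) xs) ∧ isNil (List.drop (length xs) ys) ≡ eqLen xs ys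
eqLen-drop [] [] = refl
eqLen-drop (_ ∷ _) [] = refl
eqLen-drop [] (_ ∷ _) = refl
eqLen-drop (_ ∷ xs) (_ ∷ ys) = eqLen-drop xs ys

eqLenE : Expr 2
eqLenE = match (sub dropE (ν (# 0) ∷ ν (# 1) ∷ [])) (match (sub dropE (ν (# 1) ∷ ν (# 0) ∷ [])) trueE ∅) ∅

opaque
  ev-eqLen : Σ ℕ λ j → ∀ Γ → let open Derived Γ in ∀ {B C : Set} (enc : B → Tree) (enc′ : C → Tree) xs ys → length xs < β → length ys < β →
             (encodeList (map enc xs) ∷ encodeList (map enc′ ys) ∷ []) ⊢ eqLenE ⇒ encodeBool (eqLen xs ys) ^ j
  ev-eqLen = _ , λ Γ enc enc′ xs ys lx ly → let open Derived Γ in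
    recast-bool (eqLen-drop xs ys)
      (ev-match _ (ev-sub (args-∷ (ev-ν (# 0)) (args-∷ (ev-ν (# 1)) args-[])) (proj₂ ev-drop Γ enc′ (map enc xs) ys ly))
        (λ e → recast-bool (cong (_∧ isNil (List.drop (length xs) ys)) (sym (is-nil enc xs (length ys) e)))
          (ev-match _ (ev-sub (args-∷ (ev-ν (# 1)) (args-∷ (ev-ν (# 0)) args-[])) (proj₂ ev-drop Γ enc (map enc′ ys) xs lx))
            (λ e → recast-bool (sym (is-nil enc′ ys (length xs) e)) ev-true)
            (λ _ _ e → recast-bool (sym (is-cons enc′ ys (length xs) e)) ev-false)))
        (λ _ _ e → recast-bool (cong (_∧ isNil (List.drop (length xs) ys)) (sym (is-cons enc xs (length ys) e))) ev-false))
    where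
    is-nil : ∀ {B : Set} (enc : B → Tree) xs n → encodeList (List.drop n (map enc xs)) ≡ nil → isNil (List.drop n xs) ≡ true
    is-nil enc [] zero e = refl
    is-nil enc [] (suc n) e = refl
    is-nil enc (x ∷ xs) (suc n) e = is-nil enc xs n e
    is-cons : ∀ {B : Set} (enc : B → Tree) xs n {y z} → encodeList (List.drop n (map enc xs)) ≡ cons y z → isNil (List.drop n xs) ≡ false
    is-cons enc (x ∷ xs) zero e = refl
    is-cons enc [] zero ()
    is-cons enc [] (suc n) ()
    is-cons enc (x ∷ xs) (suc n) e = is-cons enc xs n e

vertsE : Expr 1
vertsE = fold (ν (# 0)) ∅ ((sub dropE (ν (# 3) ∷ (ν (# 1) ∙ ν (# 2)) ∷ []) ∙ ν (# 1)) ∙ ν (# 0))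

prefix-length : ∀ {n} (g : Fin n → A) ys {h t} → ys ++ h ∷ t ≡ tabulate g → ∃[ i ] h ≡ g i × length ys ≡ toℕ i
prefix-length {n = suc n} g [] refl = zero , refl , refl
prefix-length {n = suc n} g (y ∷ ys) e with prefix-length (g ∘ suc) ys (List.∷-injectiveʳ e)
... | i , e′ , l = suc i , e′ , cong suc l

suffix-length : ∀ {n} ys {h t} → ys ++ h ∷ t ≡ allFin n → suc (length t) ≡ n ∸ toℕ h
suffix-length {n} ys {h} {t} e with prefix-length id ys e
... | i , refl , l = trans (sym (ℕ.m+n∸m≡n (toℕ i) (suc (length t)))) (cong (_∸ toℕ i)
  (trans (cong (_+ suc (length t)) (sym l)) (trans (sym (List.length-++ ys)) (trans (cong length e) (List.length-tabulate id)))))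

length-allFin : ∀ n → length (allFin n) ≡ n
length-allFin n = List.length-tabulate id

opaque
  ev-verts : Σ ℕ λ j → ∀ Γ → let open Derived Γ in (encodeList rows ∷ []) ⊢ vertsE ⇒ vts Γ (allFin n) ^ j
  ev-verts = _ , λ Γ → let open Derived Γ in
    ev-fold row (vts Γ) (allFin n) (subst (_< β) (sym (length-allFin n)) n<β) (ev-ν (# 0)) ev-∅ λ ys h t e →
      ev-∙ (ev-∙ (ev-sub (args-∷ (ev-ν (# 3)) (args-∷ (ev-∙ (ev-ν (# 1)) (ev-ν (# 2))) args-[]))
        (recast (cong (λ d → encodeList (List.drop d rows)) (suffix-length ys e))
          (proj₂ ev-drop Γ row rows (h ∷ t) (subst (_< β) (sym (suffix-length ys e)) (ℕ.≤-<-trans (ℕ.m∸n≤m n (toℕ h)) n<β)))))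
        (ev-ν (# 1))) (ev-ν (# 0))

index-length : ∀ Γ → let open Derived Γ in ∀ i → length (List.drop (n ∸ toℕ i) rows) ≡ toℕ i
index-length Γ i = trans (List.length-drop (n ∸ toℕ i) rows)
  (trans (cong (_∸ (n ∸ toℕ i)) (trans (List.length-map row (allFin n)) (length-allFin n))) (ℕ.m∸[m∸n]≡n (ℕ.<⇒≤ (Fin.toℕ<n i))))
  where open Derived Γ

index-< : ∀ Γ → let open Derived Γ in ∀ i → length (List.drop (n ∸ toℕ i) rows) < β
index-< Γ i = subst (_< β) (sym (index-length Γ i)) (ℕ.<-trans (Fin.toℕ<n i) n<β)
  where open Derived Γ

lookupE sameE nbE : Expr 2
lookupE = hdE (sub dropE (tlE (ν (# 0)) ∷ hdE (ν (# 1)) ∷ []))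
sameE = sub eqLenE (hdE (ν (# 0)) ∷ hdE (ν (# 1)) ∷ [])
nbE = match (sub sameE (ν (# 0) ∷ ν (# 1) ∷ [])) (sub lookupE (ν (# 0) ∷ ν (# 1) ∷ [])) trueE

hd-drop : ∀ {n} (g : A → Tree) (f : Fin n → A) i → hd (encodeList (List.drop (toℕ i) (map g (tabulate f)))) ≡ g (f i)
hd-drop g f zero = refl
hd-drop g f (suc i) = hd-drop g (f ∘ suc) i

encodeList-id : ∀ (xs : List Tree) → encodeList (map id xs) ≡ encodeList xs
encodeList-id xs = cong encodeList (List.map-id xs)

opaque
  ev-lookup : Σ ℕ λ j → ∀ Γ → let open Derived Γ in ∀ u v → (vt Γ u ∷ vt Γ v ∷ []) ⊢ lookupE ⇒ encodeBool (m u v) ^ j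
  ev-lookup = _ , λ Γ u v → let open Derived Γ in
    recast (hd-drop (encodeBool ∘ m u) id v) (ev-hd _
      (recast (cong (λ d → encodeList (List.drop d (map (encodeBool ∘ m u) (allFin n)))) (index-length Γ v))
        (ev-sub (args-∷ (ev-tl _ (ev-ν (# 0))) (args-∷ (ev-hd _ (ev-ν (# 1))) args-[]))
          (recast-env (cong (λ x → row u ∷ x ∷ []) (encodeList-id (List.drop (n ∸ toℕ v) rows)))
            (proj₂ ev-drop Γ id (map (encodeBool ∘ m u) (allFin n)) (List.drop (n ∸ toℕ v) rows) (index-< Γ v))))))

opaque
  ev-same : Σ ℕ λ j → ∀ Γ → let open Derived Γ in ∀ u v → (vt Γ u ∷ vt Γ v ∷ []) ⊢ sameE ⇒ encodeBool (same u v) ^ j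
  ev-same = _ , λ Γ u v → let open Derived Γ in
    recast-bool (correct Γ u v)
      (ev-sub (args-∷ (ev-hd _ (ev-ν (# 0))) (args-∷ (ev-hd _ (ev-ν (# 1))) args-[]))
        (recast-env (cong₂ (λ x y → x ∷ y ∷ []) (encodeList-id (List.drop (n ∸ toℕ u) rows)) (encodeList-id (List.drop (n ∸ toℕ v) rows)))
          (proj₂ ev-eqLen Γ id id (List.drop (n ∸ toℕ u) rows) (List.drop (n ∸ toℕ v) rows) (index-< Γ u) (index-< Γ v))))
    where
    same-toℕ : ∀ {n} (u v : Fin n) → (toℕ u Data.Nat.≡ᵇ toℕ v) ≡ does (u Fin.≟ v)
    same-toℕ zero zero = refl
    same-toℕ zero (suc v) = refl
    same-toℕ (suc u) zero = refl
    same-toℕ (suc u) (suc v) = same-toℕ u v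
    correct : ∀ Γ → let open Derived Γ in ∀ u v → eqLen (List.drop (n ∸ toℕ u) rows) (List.drop (n ∸ toℕ v) rows) ≡ same u v
    correct Γ u v = trans (eqLen-≡ᵇ (List.drop (Ctx.n Γ ∸ toℕ u) (Ctx.rows Γ)) (List.drop (Ctx.n Γ ∸ toℕ v) (Ctx.rows Γ)))
      (trans (cong₂ Data.Nat._≡ᵇ_ (index-length Γ u) (index-length Γ v)) (same-toℕ u v))

opaque
  ev-nb : Σ ℕ λ j → ∀ Γ → let open Derived Γ in ∀ u v → (vt Γ u ∷ vt Γ v ∷ []) ⊢ nbE ⇒ encodeBool (nb u v) ^ j
  ev-nb = _ , λ Γ u v → let open Derived Γ in
    ev-if (same u v) (ev-sub (args-∷ (ev-ν (# 0)) (args-∷ (ev-ν (# 1)) args-[])) (proj₂ ev-same Γ u v))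
      (λ e → recast-bool (cong (_∨ m u v) (sym e))
        (ev-sub (args-∷ (ev-ν (# 0)) (args-∷ (ev-ν (# 1)) args-[])) (proj₂ ev-lookup Γ u v)))
      (λ e → recast-bool (cong (_∨ m u v) (sym e)) ev-true)

-- The kernelization program

opaque
  ev-app₂ : ∀ {Γ} → let open Derived Γ in ∀ {k} {ρ : Vec Tree k} {b : Expr 2} {e₁ e₂ x y z i j l} →
            (x ∷ y ∷ []) ⊢ b ⇒ z ^ l → ρ ⊢ e₁ ⇒ x ^ i → ρ ⊢ e₂ ⇒ y ^ j → ρ ⊢ sub b (e₁ ∷ e₂ ∷ []) ⇒ z ^ (16 + ((13 + (i ⊔ (13 + (j ⊔ 5)))) ⊔ l))
  ev-app₂ {Γ} r p q = let open Derived Γ in ev-sub (args-∷ p (args-∷ q args-[])) r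

opaque
  ev-app₃ : ∀ {Γ} → let open Derived Γ in ∀ {k} {ρ : Vec Tree k} {b : Expr 3} {e₁ e₂ e₃ x y w z i j h l} →
            (x ∷ y ∷ w ∷ []) ⊢ b ⇒ z ^ l → ρ ⊢ e₁ ⇒ x ^ i → ρ ⊢ e₂ ⇒ y ^ j → ρ ⊢ e₃ ⇒ w ^ h →
            ρ ⊢ sub b (e₁ ∷ e₂ ∷ e₃ ∷ []) ⇒ z ^ (16 + ((13 + (i ⊔ (13 + (j ⊔ (13 + (h ⊔ 5)))))) ⊔ l))
  ev-app₃ {Γ} r p q o = let open Derived Γ in ev-sub (args-∷ p (args-∷ q (args-∷ o args-[]))) r

opaque
  ev-app₄ : ∀ {Γ} → let open Derived Γ in ∀ {k} {ρ : Vec Tree k} {b : Expr 4} {e₁ e₂ e₃ e₄ x y w v z i j h g l} →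
            (x ∷ y ∷ w ∷ v ∷ []) ⊢ b ⇒ z ^ l → ρ ⊢ e₁ ⇒ x ^ i → ρ ⊢ e₂ ⇒ y ^ j → ρ ⊢ e₃ ⇒ w ^ h → ρ ⊢ e₄ ⇒ v ^ g →
            ρ ⊢ sub b (e₁ ∷ e₂ ∷ e₃ ∷ e₄ ∷ []) ⇒ z ^ (16 + ((13 + (i ⊔ (13 + (j ⊔ (13 + (h ⊔ (13 + (g ⊔ 5)))))))) ⊔ l))
  ev-app₄ {Γ} r p q o s = let open Derived Γ in ev-sub (args-∷ p (args-∷ q (args-∷ o (args-∷ s args-[])))) r

appendE : Expr 2
appendE = fold (ν (# 0)) (ν (# 1)) (ν (# 1) ∙ ν (# 0))

opaque
  ev-append : Σ ℕ λ j → ∀ Γ → let open Derived Γ in ∀ {B : Set} (enc : B → Tree) xs ys → length xs < β →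
              (encodeList (map enc xs) ∷ encodeList (map enc ys) ∷ []) ⊢ appendE ⇒ encodeList (map enc (xs ++ ys)) ^ j
  ev-append = _ , λ Γ enc xs ys lt → let open Derived Γ in
    ev-fold enc (λ t → encodeList (map enc (t ++ ys))) xs lt (ev-ν (# 0)) (ev-ν (# 1)) λ _ _ _ _ → ev-∙ (ev-ν (# 1)) (ev-ν (# 0))

-- Filters and quantifiers with a body that sees one parameter.

filterE : Expr 2 → Expr 2
filterE r = fold (ν (# 1)) ∅ (match (sub r (ν (# 3) ∷ ν (# 1) ∷ [])) (ν (# 0)) (ν (# 3) ∙ ν (# 2)))

opaque
  ev-filter : ∀ i → Σ ℕ λ j → ∀ Γ → let open Derived Γ in ∀ {r} {y} (P : Fin n → Bool) xs → length xs < β →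
              (∀ x → (y ∷ vt Γ x ∷ []) ⊢ r ⇒ encodeBool (P x) ^ i) →
              (y ∷ vts Γ xs ∷ []) ⊢ filterE r ⇒ vts Γ (filterᵇ P xs) ^ j
  ev-filter i = _ , λ Γ P xs lt h → let open Derived Γ in
    ev-fold (vt Γ) (λ t → vts Γ (filterᵇ P t)) xs lt (ev-ν (# 1)) ev-∅ λ _ x t _ →
      ev-if (P x) (ev-app₂ {Γ} (h x) (ev-ν (# 3)) (ev-ν (# 1)))
        (λ e → recast (sym (reject Γ P e)) (ev-ν (# 0))) (λ e → recast (sym (accept Γ P e)) (ev-∙ (ev-ν (# 3)) (ev-ν (# 2))))
    where
    reject : ∀ Γ → let open Derived Γ in ∀ (P : Fin n → Bool) {x t} → P x ≡ false → vts Γ (filterᵇ P (x ∷ t)) ≡ vts Γ (filterᵇ P t)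
    reject Γ P {x} e with P x
    reject Γ P refl | false = refl
    accept : ∀ Γ → let open Derived Γ in ∀ (P : Fin n → Bool) {x t} → P x ≡ true → vts Γ (filterᵇ P (x ∷ t)) ≡ cons (vt Γ x) (vts Γ (filterᵇ P t))
    accept Γ P {x} e with P x
    accept Γ P refl | true = refl

anyE : Expr 2 → Expr 2
anyE r = fold (ν (# 0)) ∅ (match (sub r (ν (# 1) ∷ ν (# 4) ∷ [])) (ν (# 0)) trueE)

opaque
  ev-any : ∀ i → Σ ℕ λ j → ∀ Γ → let open Derived Γ in ∀ {r} {y} (P : Fin n → Bool) xs → length xs < β →
           (∀ x → (vt Γ x ∷ y ∷ []) ⊢ r ⇒ encodeBool (P x) ^ i) →
           (vts Γ xs ∷ y ∷ []) ⊢ anyE r ⇒ encodeBool (anyᵇ P xs) ^ j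
  ev-any i = _ , λ Γ P xs lt h → let open Derived Γ in
    ev-fold (vt Γ) (λ t → encodeBool (anyᵇ P t)) xs lt (ev-ν (# 0)) ev-∅ λ _ x t _ →
      ev-if (P x) (ev-app₂ {Γ} (h x) (ev-ν (# 1)) (ev-ν (# 4)))
        (λ e → recast-bool (cong (_∨ anyᵇ P t) (sym e)) (ev-ν (# 0))) (λ e → recast-bool (cong (_∨ anyᵇ P t) (sym e)) ev-true)

conflict₁E conflict₂E conflictE find₂E find₁E insertE : Expr 3
conflict₁E = match (sub nbE (ν (# 0) ∷ ν (# 1) ∷ [])) ∅ (match (sub nbE (ν (# 2) ∷ ν (# 4) ∷ [])) ∅ (match (sub nbE (ν (# 5) ∷ ν (# 6) ∷ [])) trueE ∅))
conflict₂E = match (sub nbE (ν (# 1) ∷ ν (# 0) ∷ [])) ∅ (match (sub nbE (ν (# 3) ∷ ν (# 4) ∷ [])) ∅ (match (sub nbE (ν (# 4) ∷ ν (# 6) ∷ [])) trueE ∅))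
conflictE = match conflict₁E conflict₂E trueE
find₂E = fold (ν (# 2)) ∅ (match (sub conflictE (ν (# 3) ∷ ν (# 4) ∷ ν (# 1) ∷ [])) (ν (# 0)) (ν (# 6) ∙ ν (# 3) ∙ ∅))
find₁E = fold (ν (# 2)) ∅ (match (sub find₂E (ν (# 3) ∷ ν (# 1) ∷ ν (# 4) ∷ [])) (ν (# 0)) (ν (# 0) ∙ ν (# 1)))
insertE = match (ν (# 1)) (hdE (ν (# 2)) ∙ ν (# 0) ∙ tlE (ν (# 2)))
  ((ν (# 2) ∙ sub appendE (ν (# 3) ∷ hdE (ν (# 4)) ∷ [])) ∙ sub (filterE (match (sub (anyE sameE) (ν (# 0) ∷ ν (# 1) ∷ [])) trueE ∅)) (ν (# 3) ∷ tlE (ν (# 4)) ∷ []))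

packE : Expr 1
packE = fold (ν (# 0)) (∅ ∙ ∅) (sub insertE (ν (# 1) ∷ sub find₁E (ν (# 1) ∷ tlE (ν (# 0)) ∷ tlE (ν (# 0)) ∷ []) ∷ ν (# 0) ∷ []))

module Pack (Γ : Ctx) = Packing (Fin._≟_ {Ctx.n Γ}) (Ctx.nb Γ) (Ctx.nb-refl Γ) (Ctx.nb-sym Γ)

opaque
  ev-conflict : Σ ℕ λ j → ∀ Γ → let open Derived Γ in ∀ v a b →
                (vt Γ v ∷ vt Γ a ∷ vt Γ b ∷ []) ⊢ conflictE ⇒ encodeBool (Pack.conflict Γ v a b) ^ j
  ev-conflict = _ , λ Γ v a b → let open Derived Γ in
    ev-if (nb v a ∧ (nb v b ∧ not (nb a b)))
      (ev-if (nb v a) (ev-app₂ {Γ} (proj₂ ev-nb Γ v a) (ev-ν (# 0)) (ev-ν (# 1))) (λ e → recast-bool (cong (_∧ (nb v b ∧ not (nb a b))) (sym e)) ev-∅) λ e →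
       recast-bool (cong (_∧ (nb v b ∧ not (nb a b))) (sym e))
      (ev-if (nb v b) (ev-app₂ {Γ} (proj₂ ev-nb Γ v b) (ev-ν (# 2)) (ev-ν (# 4))) (λ e → recast-bool (cong (_∧ not (nb a b)) (sym e)) ev-∅) λ e →
       recast-bool (cong (_∧ not (nb a b)) (sym e))
      (ev-if (nb a b) (ev-app₂ {Γ} (proj₂ ev-nb Γ a b) (ev-ν (# 5)) (ev-ν (# 6))) (λ e → recast-bool (cong not (sym e)) ev-true) (λ e → recast-bool (cong not (sym e)) ev-false))))
      (λ e → recast-bool (cong (_∨ (nb a v ∧ (nb a b ∧ not (nb v b)))) (sym e))
      (ev-if (nb a v) (ev-app₂ {Γ} (proj₂ ev-nb Γ a v) (ev-ν (# 1)) (ev-ν (# 0))) (λ e → recast-bool (cong (_∧ (nb a b ∧ not (nb v b))) (sym e)) ev-∅) λ e →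
       recast-bool (cong (_∧ (nb a b ∧ not (nb v b))) (sym e))
      (ev-if (nb a b) (ev-app₂ {Γ} (proj₂ ev-nb Γ a b) (ev-ν (# 3)) (ev-ν (# 4))) (λ e → recast-bool (cong (_∧ not (nb v b)) (sym e)) ev-∅) λ e →
       recast-bool (cong (_∧ not (nb v b)) (sym e))
      (ev-if (nb v b) (ev-app₂ {Γ} (proj₂ ev-nb Γ v b) (ev-ν (# 4)) (ev-ν (# 6))) (λ e → recast-bool (cong not (sym e)) ev-true) (λ e → recast-bool (cong not (sym e)) ev-false)))))
      (λ e → recast-bool (cong (_∨ (nb a v ∧ (nb a b ∧ not (nb v b)))) (sym e)) ev-true)

opaque
  ev-find₂ : Σ ℕ λ j → ∀ Γ → let open Derived Γ in ∀ v a L → length L < β →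
             (vt Γ v ∷ vt Γ a ∷ vts Γ L ∷ []) ⊢ find₂E ⇒ vts Γ (Pack.find₂ Γ v a L) ^ j
  ev-find₂ = _ , λ Γ v a L lt → let open Derived Γ in
    ev-fold (vt Γ) (λ t → vts Γ (Pack.find₂ Γ v a t)) L lt (ev-ν (# 2)) ev-∅ λ _ b t _ →
      ev-if (Pack.conflict Γ v a b) (ev-app₃ {Γ} (proj₂ ev-conflict Γ v a b) (ev-ν (# 3)) (ev-ν (# 4)) (ev-ν (# 1)))
        (λ e → recast (cong (λ c → vts Γ (if c then a ∷ b ∷ [] else Pack.find₂ Γ v a t)) (sym e)) (ev-ν (# 0)))
        (λ e → recast (cong (λ c → vts Γ (if c then a ∷ b ∷ [] else Pack.find₂ Γ v a t)) (sym e)) (ev-∙ (ev-ν (# 6)) (ev-∙ (ev-ν (# 3)) ev-∅)))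

opaque
  ev-find₁ : Σ ℕ λ j → ∀ Γ → let open Derived Γ in ∀ v L₀ L → length L₀ < β → length L < β →
             (vt Γ v ∷ vts Γ L₀ ∷ vts Γ L ∷ []) ⊢ find₁E ⇒ vts Γ (Pack.find₁ Γ v L₀ L) ^ j
  ev-find₁ = _ , λ Γ v L₀ L lt₀ lt → let open Derived Γ in
    ev-fold (vt Γ) (λ t → vts Γ (Pack.find₁ Γ v L₀ t)) L lt (ev-ν (# 2)) ev-∅ λ _ a t _ →
      ev-match _ (ev-app₃ {Γ} (proj₂ ev-find₂ Γ v a L₀ lt₀) (ev-ν (# 3)) (ev-ν (# 1)) (ev-ν (# 4)))
        (λ e → recast (sym (empty Γ (Pack.find₂ Γ v a L₀) e)) (ev-ν (# 0)))
        (λ _ _ e → recast (sym (nonempty Γ (Pack.find₂ Γ v a L₀) e)) (ev-∙ (ev-ν (# 0)) (ev-ν (# 1))))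
    where
    empty : ∀ Γ → let open Derived Γ in ∀ (l : List (Fin n)) {l′} → vts Γ l ≡ nil → vts Γ (Pack.orElse Γ l l′) ≡ vts Γ l′
    empty Γ [] _ = refl
    nonempty : ∀ Γ → let open Derived Γ in ∀ (l : List (Fin n)) {l′ y z} → vts Γ l ≡ cons y z → vts Γ (Pack.orElse Γ l l′) ≡ cons y z
    nonempty Γ (_ ∷ _) e = e

opaque
  ev-outside : Σ ℕ λ j → ∀ Γ → let open Derived Γ in ∀ l L → length l < β → length L < β →
               (vts Γ l ∷ vts Γ L ∷ []) ⊢ filterE (match (sub (anyE sameE) (ν (# 0) ∷ ν (# 1) ∷ [])) trueE ∅) ⇒ vts Γ (filterᵇ (Pack.outside Γ l) L) ^ j
  ev-outside = _ , λ Γ l L ll lL → let open Derived Γ in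
    proj₂ (ev-filter _) Γ (Pack.outside Γ l) L lL λ u →
      ev-if (anyᵇ (λ x → same x u) l) (ev-app₂ {Γ} (proj₂ (ev-any _) Γ (λ x → same x u) l ll λ x → proj₂ ev-same Γ x u) (ev-ν (# 0)) (ev-ν (# 1)))
        (λ e → recast-bool (cong not (sym e)) ev-true) (λ e → recast-bool (cong not (sym e)) ev-false)

opaque
  ev-insert : Σ ℕ λ j → ∀ Γ → let open Derived Γ in ∀ v l X L → length l < β → length L < β →
              (vt Γ v ∷ vts Γ l ∷ cons (vts Γ X) (vts Γ L) ∷ []) ⊢ insertE ⇒
              cons (vts Γ (proj₁ (Pack.insert Γ v l (X , L)))) (vts Γ (proj₂ (Pack.insert Γ v l (X , L)))) ^ j
  ev-insert = _ , λ Γ v l X L ll lL → let open Derived Γ in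
    ev-match (vts Γ l) (ev-ν (# 1))
      (λ e → recast (sym (empty Γ v l X L e)) (ev-∙ (ev-hd _ (ev-ν (# 2))) (ev-∙ (ev-ν (# 0)) (ev-tl _ (ev-ν (# 2))))))
      (λ _ _ e → recast (sym (nonempty Γ v l X L e))
        (ev-∙ (ev-∙ (ev-ν (# 2)) (ev-app₂ {Γ} (proj₂ ev-append Γ (vt Γ) l X ll) (ev-ν (# 3)) (ev-hd _ (ev-ν (# 4)))))
              (ev-app₂ {Γ} (proj₂ ev-outside Γ l L ll lL) (ev-ν (# 3)) (ev-tl _ (ev-ν (# 4))))))
    where
    result : ∀ Γ → let open Derived Γ in Fin n → (l X L : List (Fin n)) → Tree
    result Γ v l X L = cons (vts Γ (proj₁ (Pack.insert Γ v l (X , L)))) (vts Γ (proj₂ (Pack.insert Γ v l (X , L))))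
    empty : ∀ Γ → let open Derived Γ in ∀ (v : Fin n) l X L → vts Γ l ≡ nil → result Γ v l X L ≡ cons (vts Γ X) (cons (vt Γ v) (vts Γ L))
    empty Γ v [] X L _ = refl
    nonempty : ∀ Γ → let open Derived Γ in ∀ (v : Fin n) l X L {y z} → vts Γ l ≡ cons y z →
               result Γ v l X L ≡ cons (cons (vt Γ v) (vts Γ (l ++ X))) (vts Γ (filterᵇ (Pack.outside Γ l) L))
    nonempty Γ v (_ ∷ _) X L _ = refl

pack-length : ∀ Γ vs → length (proj₂ (Pack.pack Γ vs)) ≤ length vs
pack-length Γ [] = z≤n
pack-length Γ (v ∷ vs) with Pack.find₁ Γ v (proj₂ (Pack.pack Γ vs)) (proj₂ (Pack.pack Γ vs))
... | [] = s≤s (pack-length Γ vs)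
... | a ∷ l = ℕ.≤-trans (filterᵇ-length (Pack.outside Γ (a ∷ l)) (proj₂ (Pack.pack Γ vs))) (ℕ.m≤n⇒m≤1+n (pack-length Γ vs))

find-length : ∀ Γ v L₀ L → length (Pack.find₁ Γ v L₀ L) ≤ 2
find-length Γ v L₀ L with Pack.find₁ Γ v L₀ L | Pack.found₁ Γ v L₀ L
... | _ | Packing.none _ = z≤n
... | _ | Packing.some _ _ _ = ℕ.≤-refl

suffix-≤ : ∀ (ys : List A) {h t xs} → ys ++ h ∷ t ≡ xs → length t ≤ length xs
suffix-≤ ys {h} {t} refl = ℕ.≤-trans (ℕ.≤-trans (ℕ.n≤1+n _) (ℕ.m≤n+m _ (length ys))) (ℕ.≤-reflexive (sym (List.length-++ ys)))

opaque
  ev-pack : Σ ℕ λ j → ∀ Γ → let open Derived Γ in ∀ vs → length vs < β →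
            (vts Γ vs ∷ []) ⊢ packE ⇒ cons (vts Γ (proj₁ (Pack.pack Γ vs))) (vts Γ (proj₂ (Pack.pack Γ vs))) ^ j
  ev-pack = _ , λ Γ vs lt → let open Derived Γ in
    ev-fold (vt Γ) (λ t → cons (vts Γ (proj₁ (Pack.pack Γ t))) (vts Γ (proj₂ (Pack.pack Γ t)))) vs lt (ev-ν (# 0)) (ev-∙ ev-∅ ev-∅) λ ys h t e →
      let X = proj₁ (Pack.pack Γ t) ; L = proj₂ (Pack.pack Γ t) in
      ev-app₃ {Γ} (proj₂ ev-insert Γ h (Pack.find₁ Γ h L L) X L (ℕ.≤-<-trans (find-length Γ h L L) β≥3) (short Γ ys e lt)) (ev-ν (# 1))
        (ev-app₃ {Γ} (proj₂ ev-find₁ Γ h L L (short Γ ys e lt) (short Γ ys e lt)) (ev-ν (# 1)) (ev-tl _ (ev-ν (# 0))) (ev-tl _ (ev-ν (# 0)))) (ev-ν (# 0))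
    where
    short : ∀ Γ → let open Derived Γ in ∀ ys {h t vs} → ys ++ h ∷ t ≡ vs → length vs < β → length (proj₂ (Pack.pack Γ t)) < β
    short Γ ys {t = t} e lt = ℕ.≤-<-trans (ℕ.≤-trans (pack-length Γ t) (suffix-≤ ys e)) lt

-- Relations on vertices with two parameters, in practice X and L₂.

twinE kindE nb₄E countE : Expr 4
tauE : Expr 3
tauE = fold (ν (# 0)) trueE (match (sub nbE (ν (# 4) ∷ ν (# 1) ∷ []))
  (match (sub nbE (ν (# 5) ∷ ν (# 1) ∷ [])) (ν (# 0)) ∅)
  (match (sub nbE (ν (# 7) ∷ ν (# 3) ∷ [])) ∅ (ν (# 4))))
nb₄E = sub nbE (ν (# 0) ∷ ν (# 1) ∷ [])
twinE = match nb₄E ∅ (sub tauE (ν (# 4) ∷ ν (# 2) ∷ ν (# 3) ∷ []))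
countE = fold (ν (# 3)) ∅ (match (sub nbE (ν (# 4) ∷ ν (# 1) ∷ [])) (ν (# 0))
  (match (sub tauE (ν (# 7) ∷ ν (# 5) ∷ ν (# 3) ∷ [])) (ν (# 2)) (∅ ∙ ν (# 4))))
kindE = fold (ν (# 3)) trueE (match (sub eqLenE
  (sub countE (ν (# 1) ∷ ν (# 3) ∷ ν (# 5) ∷ ν (# 6) ∷ []) ∷ sub countE (ν (# 1) ∷ ν (# 4) ∷ ν (# 5) ∷ ν (# 6) ∷ []) ∷ [])) ∅ (ν (# 2)))

-- capE r keeps the elements for which fewer elements related by r were kept
-- than there are in the second list.
roomE : Expr 4 → Expr 5
roomE r = fold (ν (# 0)) (ν (# 2)) (match (sub r (ν (# 4) ∷ ν (# 1) ∷ ν (# 6) ∷ ν (# 7) ∷ [])) (ν (# 0)) (tlE (ν (# 2))))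

capE : Expr 4 → Expr 4
capE r = fold (ν (# 0)) ∅ (match (sub (roomE r) (ν (# 0) ∷ ν (# 1) ∷ ν (# 4) ∷ ν (# 5) ∷ ν (# 6) ∷ [])) (ν (# 0)) (ν (# 3) ∙ ν (# 2)))

module Ker′ (Γ : Ctx) (X L : List (Fin (Ctx.n Γ))) = Kernel Fin._≟_ (Ctx.nb Γ) (Ctx.nb-refl Γ) (Ctx.nb-sym Γ) X L

opaque
  ev-room : ∀ i → Σ ℕ λ j → ∀ Γ → let open Derived Γ in ∀ {r x y} (R : Fin n → Fin n → Bool) v us cs → length us < β →
            (∀ u w → (vt Γ u ∷ vt Γ w ∷ x ∷ y ∷ []) ⊢ r ⇒ encodeBool (R u w) ^ i) →
            (vts Γ us ∷ vt Γ v ∷ encodeList cs ∷ x ∷ y ∷ []) ⊢ roomE r ⇒ encodeList (List.drop (length (filterᵇ (R v) us)) cs) ^ j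
  ev-room i = _ , λ Γ R v us cs lt h → let open Derived Γ in
    ev-fold (vt Γ) (λ t → encodeList (List.drop (length (filterᵇ (R v) t)) cs)) us lt (ev-ν (# 0)) (ev-ν (# 2)) λ _ u t _ →
      ev-if (R v u) (ev-app₄ {Γ} (h v u) (ev-ν (# 4)) (ev-ν (# 1)) (ev-ν (# 6)) (ev-ν (# 7)))
        (λ e → recast (sym (reject Γ (R v) cs {u} {t} e)) (ev-ν (# 0)))
        (λ e → recast (sym (accept Γ (R v) cs {u} {t} e)) (ev-tl _ (ev-ν (# 2))))
    where
    reject : ∀ Γ → let open Derived Γ in ∀ (P : Fin n → Bool) cs {x t} → P x ≡ false →
             encodeList (List.drop (length (filterᵇ P (x ∷ t))) cs) ≡ encodeList (List.drop (length (filterᵇ P t)) cs)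
    reject Γ P cs {x} e with P x
    reject Γ P cs refl | false = refl
    accept : ∀ Γ → let open Derived Γ in ∀ (P : Fin n → Bool) cs {x t} → P x ≡ true →
             encodeList (List.drop (length (filterᵇ P (x ∷ t))) cs) ≡ tl (encodeList (List.drop (length (filterᵇ P t)) cs))
    accept Γ P cs {x} {t} e with P x
    accept Γ P cs {x} {t} refl | true = drop-suc (length (filterᵇ P t)) cs

opaque
  ev-cap : ∀ i → Σ ℕ λ j → ∀ Γ → let open Derived Γ in ∀ {r x y} (R : Fin n → Fin n → Bool) xs cs → length xs < β →
           (∀ u w → (vt Γ u ∷ vt Γ w ∷ x ∷ y ∷ []) ⊢ r ⇒ encodeBool (R u w) ^ i) →
           (vts Γ xs ∷ encodeList cs ∷ x ∷ y ∷ []) ⊢ capE r ⇒ vts Γ (capBy R (length cs) xs) ^ j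
  ev-cap i = _ , λ Γ R xs cs lt h → let open Derived Γ in
    ev-fold (vt Γ) (λ t → vts Γ (capBy R (length cs) t)) xs lt (ev-ν (# 0)) ev-∅ λ ys v t e →
      ev-match (encodeList (List.drop (length (filterᵇ (R v) (capBy R (length cs) t))) cs))
        (ev-sub (args-∷ (ev-ν (# 0)) (args-∷ (ev-ν (# 1)) (args-∷ (ev-ν (# 4)) (args-∷ (ev-ν (# 5)) (args-∷ (ev-ν (# 6)) args-[])))))
          (proj₂ (ev-room i) Γ R v (capBy R (length cs) t) cs (ℕ.≤-<-trans (ℕ.≤-trans (capBy-length R (length cs) t) (suffix-≤ ys e)) lt) h))
        (λ e′ → recast (cong (λ b → vts Γ (if b then v ∷ capBy R (length cs) t else capBy R (length cs) t)) (sym (no-room _ cs e′))) (ev-ν (# 0)))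
        (λ _ _ e′ → recast (cong (λ b → vts Γ (if b then v ∷ capBy R (length cs) t else capBy R (length cs) t)) (sym (has-room _ cs e′))) (ev-∙ (ev-ν (# 3)) (ev-ν (# 2))))
    where
    no-room : ∀ k cs → encodeList (List.drop k cs) ≡ nil → (k Data.Nat.<ᵇ length cs) ≡ false
    no-room k [] e = refl
    no-room (suc k) (_ ∷ cs) e = no-room k cs e
    has-room : ∀ k cs {y z} → encodeList (List.drop k cs) ≡ cons y z → (k Data.Nat.<ᵇ length cs) ≡ true
    has-room zero (_ ∷ cs) e = refl
    has-room zero [] ()
    has-room (suc k) [] ()
    has-room (suc k) (_ ∷ cs) e = has-room k cs e

opaque
  ev-tau : Σ ℕ λ j → ∀ Γ → let open Derived Γ in ∀ X u v → length X < β →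
           (vts Γ X ∷ vt Γ u ∷ vt Γ v ∷ []) ⊢ tauE ⇒ encodeBool (allᵇ (λ x → nb u x == nb v x) X) ^ j
  ev-tau = _ , λ Γ X u v lt → let open Derived Γ in
    ev-fold (vt Γ) (λ t → encodeBool (allᵇ (λ x → nb u x == nb v x) t)) X lt (ev-ν (# 0)) ev-true λ _ x t _ →
      let all = allᵇ (λ x → nb u x == nb v x) t in
      ev-if (nb u x) (ev-app₂ {Γ} (proj₂ ev-nb Γ u x) (ev-ν (# 4)) (ev-ν (# 1)))
        (λ e → ev-if (nb v x) (ev-app₂ {Γ} (proj₂ ev-nb Γ v x) (ev-ν (# 5)) (ev-ν (# 1)))
          (λ e′ → recast-bool (cong₂ (λ a b → (a == b) ∧ all) (sym e) (sym e′)) (ev-ν (# 0)))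
          (λ e′ → recast-bool (cong₂ (λ a b → (a == b) ∧ all) (sym e) (sym e′)) ev-∅))
        (λ e → ev-if (nb v x) (ev-app₂ {Γ} (proj₂ ev-nb Γ v x) (ev-ν (# 7)) (ev-ν (# 3)))
          (λ e′ → recast-bool (cong₂ (λ a b → (a == b) ∧ all) (sym e) (sym e′)) ev-∅)
          (λ e′ → recast-bool (cong₂ (λ a b → (a == b) ∧ all) (sym e) (sym e′)) (ev-ν (# 4))))

opaque
  ev-nb₄ : Σ ℕ λ j → ∀ Γ → let open Derived Γ in ∀ {x y} u v → (vt Γ u ∷ vt Γ v ∷ x ∷ y ∷ []) ⊢ nb₄E ⇒ encodeBool (nb u v) ^ j
  ev-nb₄ = _ , λ Γ u v → let open Derived Γ in ev-app₂ {Γ} (proj₂ ev-nb Γ u v) (ev-ν (# 0)) (ev-ν (# 1))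

opaque
  ev-twin : Σ ℕ λ j → ∀ Γ → let open Derived Γ in ∀ {y} X L u v → length X < β →
            (vt Γ u ∷ vt Γ v ∷ vts Γ X ∷ y ∷ []) ⊢ twinE ⇒ encodeBool (Ker′.twin Γ X L u v) ^ j
  ev-twin = _ , λ Γ X L u v lt → let open Derived Γ in
    ev-if (nb u v) (proj₂ ev-nb₄ Γ u v) (λ e → recast-bool (cong (_∧ Ker′.τ Γ X L u v) (sym e)) ev-∅)
      (λ e → recast-bool (cong (_∧ Ker′.τ Γ X L u v) (sym e)) (ev-app₃ {Γ} (proj₂ ev-tau Γ X u v lt) (ev-ν (# 4)) (ev-ν (# 2)) (ev-ν (# 3))))

opaque
  ev-count : Σ ℕ λ j → ∀ Γ → let open Derived Γ in ∀ X L t v → length X < β → length (Ker′.L₂ Γ X L) < β →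
             (vt Γ t ∷ vt Γ v ∷ vts Γ X ∷ vts Γ (Ker′.L₂ Γ X L) ∷ []) ⊢ countE ⇒
             encodeList (map (λ _ → nil) (filterᵇ (Ker′.τ Γ X L t) (Ker′.C Γ X L v))) ^ j
  ev-count = _ , λ Γ X L t v lX lL → let open Derived Γ in
    ev-fold (vt Γ) (λ us → encodeList (map (λ _ → nil) (filterᵇ (Ker′.τ Γ X L t) (filterᵇ (nb v) us)))) (Ker′.L₂ Γ X L) lL (ev-ν (# 3)) ev-∅ λ _ u us _ →
      ev-if (nb v u) (ev-app₂ {Γ} (proj₂ ev-nb Γ v u) (ev-ν (# 4)) (ev-ν (# 1)))
        (λ e → recast (sym (far Γ (Ker′.τ Γ X L t) (nb v) {u} {us} e)) (ev-ν (# 0)))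
        (λ e → ev-if (Ker′.τ Γ X L t u) (ev-app₃ {Γ} (proj₂ ev-tau Γ X t u lX) (ev-ν (# 7)) (ev-ν (# 5)) (ev-ν (# 3)))
          (λ e′ → recast (sym (unlike Γ (Ker′.τ Γ X L t) (nb v) {u} {us} e e′)) (ev-ν (# 2)))
          (λ e′ → recast (sym (hits Γ (Ker′.τ Γ X L t) (nb v) {u} {us} e e′)) (ev-∙ ev-∅ (ev-ν (# 4)))))
    where
    numeral : ∀ Γ → let open Derived Γ in (P Q : Fin n → Bool) → List (Fin n) → Tree
    numeral Γ P Q us = encodeList (map (λ _ → nil) (filterᵇ P (filterᵇ Q us)))
    far : ∀ Γ → let open Derived Γ in ∀ (P Q : Fin n → Bool) {u us} → Q u ≡ false → numeral Γ P Q (u ∷ us) ≡ numeral Γ P Q us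
    far Γ P Q {u} e with Q u
    far Γ P Q refl | false = refl
    unlike : ∀ Γ → let open Derived Γ in ∀ (P Q : Fin n → Bool) {u us} → Q u ≡ true → P u ≡ false → numeral Γ P Q (u ∷ us) ≡ numeral Γ P Q us
    unlike Γ P Q {u} e e′ with Q u
    unlike Γ P Q {u} refl e′ | true with P u
    unlike Γ P Q refl refl | true | false = refl
    hits : ∀ Γ → let open Derived Γ in ∀ (P Q : Fin n → Bool) {u us} → Q u ≡ true → P u ≡ true → numeral Γ P Q (u ∷ us) ≡ cons nil (numeral Γ P Q us)
    hits Γ P Q {u} e e′ with Q u
    hits Γ P Q {u} refl e′ | true with P u
    hits Γ P Q refl refl | true | true = refl

opaque
  ev-kind : Σ ℕ λ j → ∀ Γ → let open Derived Γ in ∀ X L v w → length X < β → length (Ker′.L₂ Γ X L) < β →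
            (vt Γ v ∷ vt Γ w ∷ vts Γ X ∷ vts Γ (Ker′.L₂ Γ X L) ∷ []) ⊢ kindE ⇒ encodeBool (Ker′.kind Γ X L v w) ^ j
  ev-kind = _ , λ Γ X L v w lX lL → let open Derived Γ in let open Ker′ Γ X L using (τ; C; L₂; number) in
    ev-fold (vt Γ) (λ ts → encodeBool (allᵇ (λ t → number t (C v) Data.Nat.≡ᵇ number t (C w)) ts)) L₂ lL (ev-ν (# 3)) ev-true λ _ t ts _ →
      ev-if (number t (C v) Data.Nat.≡ᵇ number t (C w))
        (ev-app₂ {Γ} (recast-bool (eqLen-≡ᵇ (filterᵇ (τ t) (C v)) (filterᵇ (τ t) (C w)))
            (proj₂ ev-eqLen Γ (λ _ → nil) (λ _ → nil) (filterᵇ (τ t) (C v)) (filterᵇ (τ t) (C w)) (short Γ X L t v lL) (short Γ X L t w lL)))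
          (ev-app₄ {Γ} (proj₂ ev-count Γ X L t v lX lL) (ev-ν (# 1)) (ev-ν (# 3)) (ev-ν (# 5)) (ev-ν (# 6)))
          (ev-app₄ {Γ} (proj₂ ev-count Γ X L t w lX lL) (ev-ν (# 1)) (ev-ν (# 4)) (ev-ν (# 5)) (ev-ν (# 6))))
        (λ e → recast-bool (cong (_∧ allᵇ (λ t → number t (C v) Data.Nat.≡ᵇ number t (C w)) ts) (sym e)) ev-∅)
        (λ e → recast-bool (cong (_∧ allᵇ (λ t → number t (C v) Data.Nat.≡ᵇ number t (C w)) ts) (sym e)) (ev-ν (# 2)))
    where
    short : ∀ Γ → let open Derived Γ in ∀ X L t v → length (Ker′.L₂ Γ X L) < β → length (filterᵇ (Ker′.τ Γ X L t) (Ker′.C Γ X L v)) < β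
    short Γ X L t v lt = ℕ.≤-<-trans (ℕ.≤-trans (filterᵇ-length (Ker′.τ Γ X L t) (Ker′.C Γ X L v))
      (filterᵇ-length (Ctx.nb Γ v) (Ker′.L₂ Γ X L))) lt

-- Unary arithmetic

units : ℕ → List ⊤
units n = replicate n tt

encodeUnits : ∀ n → encodeList (map (λ _ → nil) (units n)) ≡ encodeℕ n
encodeUnits zero = refl
encodeUnits (suc n) = cong (cons nil) (encodeUnits n)

length-units : ∀ n → length (units n) ≡ n
length-units n = List.length-replicate n

addE mulE powE : Expr 2
addE = fold (ν (# 0)) (ν (# 1)) (∅ ∙ ν (# 0))
mulE = fold (ν (# 0)) ∅ (sub addE (ν (# 4) ∷ ν (# 0) ∷ []))
powE = fold (ν (# 1)) (∅ ∙ ∅) (sub mulE (ν (# 3) ∷ ν (# 0) ∷ []))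

numeralE : ∀ {k} → ℕ → Expr k
numeralE zero = ∅
numeralE (suc n) = ∅ ∙ numeralE n

opaque
  ev-numeral : ∀ a → Σ ℕ λ j → ∀ Γ → let open Derived Γ in ∀ {k} {ρ : Vec Tree k} → ρ ⊢ numeralE a ⇒ encodeℕ a ^ j
  ev-numeral zero = _ , λ Γ → let open Derived Γ in ev-∅
  ev-numeral (suc a) = _ , λ Γ → let open Derived Γ in ev-∙ ev-∅ (proj₂ (ev-numeral a) Γ)

opaque
  ev-add : Σ ℕ λ j → ∀ Γ → let open Derived Γ in ∀ a b → a < β → (encodeℕ a ∷ encodeℕ b ∷ []) ⊢ addE ⇒ encodeℕ (a + b) ^ j
  ev-add = _ , λ Γ a b lt → let open Derived Γ in recast (cong (λ z → encodeℕ (z + b)) (length-units a))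
    (ev-fold (λ _ → nil) (λ t → encodeℕ (length t + b)) (units a) (subst (_< β) (sym (length-units a)) lt)
      (recast (sym (encodeUnits a)) (ev-ν (# 0))) (ev-ν (# 1)) λ _ _ _ _ → ev-∙ ev-∅ (ev-ν (# 0)))

opaque
  ev-mul : Σ ℕ λ j → ∀ Γ → let open Derived Γ in ∀ {B : Set} (enc : B → Tree) as b → length as < β → b < β →
           (encodeList (map enc as) ∷ encodeℕ b ∷ []) ⊢ mulE ⇒ encodeℕ (length as * b) ^ j
  ev-mul = _ , λ Γ enc as b la lb → let open Derived Γ in
    ev-fold enc (λ t → encodeℕ (length t * b)) as la (ev-ν (# 0)) ev-∅ λ _ _ t _ →
      ev-app₂ {Γ} (proj₂ ev-add Γ b (length t * b) lb) (ev-ν (# 4)) (ev-ν (# 0))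

opaque
  ev-mulℕ : Σ ℕ λ j → ∀ Γ → let open Derived Γ in ∀ a b → a < β → b < β → (encodeℕ a ∷ encodeℕ b ∷ []) ⊢ mulE ⇒ encodeℕ (a * b) ^ j
  ev-mulℕ = _ , λ Γ a b la lb → let open Derived Γ in recast (cong (λ z → encodeℕ (z * b)) (length-units a))
    (recast-env (cong (λ x → x ∷ encodeℕ b ∷ []) (encodeUnits a)) (proj₂ ev-mul Γ (λ _ → nil) (units a) b (subst (_< β) (sym (length-units a)) la) lb))

opaque
  ev-pow : Σ ℕ λ j → ∀ Γ → let open Derived Γ in ∀ b e → b < β → e < β → b ^ e < β → 0 < b → (encodeℕ b ∷ encodeℕ e ∷ []) ⊢ powE ⇒ encodeℕ (b ^ e) ^ j
  ev-pow = _ , λ Γ b e lb le lp pos → let open Derived Γ in recast (cong (λ z → encodeℕ (b ^ z)) (length-units e))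
    (ev-fold (λ _ → nil) (λ t → encodeℕ (b ^ length t)) (units e) (subst (_< β) (sym (length-units e)) le)
      (recast (sym (encodeUnits e)) (ev-ν (# 1))) (ev-∙ ev-∅ ev-∅) λ ys _ t e′ →
      ev-app₂ {Γ} (proj₂ ev-mulℕ Γ b (b ^ length t) lb (ℕ.≤-<-trans (ℕ.^-monoʳ-≤ b {{Data.Nat.>-nonZero pos}}
        (ℕ.≤-trans (suffix-≤ ys e′) (ℕ.≤-reflexive (length-units e)))) lp)) (ev-ν (# 3)) (ev-ν (# 0)))

thresholdE : Expr 1
thresholdE = sub addE (numeralE 3 ∷ sub mulE (sub powE (numeralE 3 ∷ sub mulE (ν (# 0) ∷ numeralE 9 ∷ []) ∷ []) ∷ numeralE 2 ∷ []) ∷ [])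

n<3^n : ∀ n → n < 3 ^ n
n<3^n zero = s≤s z≤n
n<3^n (suc n) = ℕ.≤-trans (s≤s (n<3^n n)) (ℕ.≤-trans (ℕ.+-monoˡ-≤ (3 ^ n) (ℕ.m^n>0 3 n))
  (ℕ.+-monoʳ-≤ (3 ^ n) (ℕ.m≤m+n (3 ^ n) (3 ^ n + 0))))

opaque
  ev-threshold : Σ ℕ λ j → ∀ Γ → let open Derived Γ in ∀ xs → 9 < β → 3 + 3 ^ (length xs * 9) * 2 < β →
                 (vts Γ xs ∷ []) ⊢ thresholdE ⇒ encodeℕ (3 + 3 ^ (length xs * 9) * 2) ^ j
  ev-threshold = _ , λ Γ xs l9 lt → let open Derived Γ
                                        lp = power< Γ xs lt
                                        l3 = ℕ.<-trans (ℕ.m≤m+n 4 5) l9 in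
    ev-app₂ {Γ} (proj₂ ev-add Γ 3 (3 ^ (length xs * 9) * 2) l3) (proj₂ (ev-numeral 3) Γ)
      (ev-app₂ {Γ} (proj₂ ev-mulℕ Γ (3 ^ (length xs * 9)) 2 lp (ℕ.<-trans (ℕ.m≤m+n 3 6) l9))
        (ev-app₂ {Γ} (proj₂ ev-pow Γ 3 (length xs * 9) l3 (ℕ.<-trans (n<3^n (length xs * 9)) lp) lp (s≤s z≤n)) (proj₂ (ev-numeral 3) Γ)
          (ev-app₂ {Γ} (proj₂ ev-mul Γ (vt Γ) xs 9 (ℕ.≤-<-trans (ℕ.m≤m*n (length xs) 9) (ℕ.<-trans (n<3^n (length xs * 9)) lp)) l9) (ev-ν (# 0)) (proj₂ (ev-numeral 9) Γ)))
        (proj₂ (ev-numeral 2) Γ))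
    where
    power< : ∀ Γ → let open Derived Γ in ∀ (xs : List (Fin n)) → 3 + 3 ^ (length xs * 9) * 2 < β → 3 ^ (length xs * 9) < β
    power< Γ xs lt = ℕ.≤-<-trans (ℕ.≤-trans (ℕ.m≤m*n (3 ^ (length xs * 9)) 2) (ℕ.m≤n+m _ 3)) lt

cliqueE inCE : Expr 2
cliqueE = filterE nbE
inCE = filterE (sub (anyE nbE) (ν (# 0) ∷ ν (# 1) ∷ []))

bigE : Expr 2
bigE = match (tlE (tlE (sub cliqueE (ν (# 1) ∷ ν (# 0) ∷ [])))) ∅ trueE

kernel₅E : Expr 5
kernel₅E = sub appendE (ν (# 0) ∷ sub inCE (sub appendE (ν (# 2) ∷ sub (capE kindE) (ν (# 3) ∷ ν (# 4) ∷ ν (# 0) ∷ ν (# 1) ∷ []) ∷ []) ∷ ν (# 1) ∷ []) ∷ [])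

kernel₄E : Expr 4
kernel₄E = sub kernel₅E (ν (# 0) ∷ ν (# 1) ∷ ν (# 2) ∷ ν (# 3) ∷
  sub thresholdE (sub appendE (ν (# 0) ∷ sub appendE (sub (capE kindE) (ν (# 3) ∷ numeralE 1 ∷ ν (# 0) ∷ ν (# 1) ∷ []) ∷ sub inCE (ν (# 2) ∷ ν (# 1) ∷ []) ∷ []) ∷ []) ∷ []) ∷ [])

kernel₃E : Expr 3
kernel₃E = sub kernel₄E (ν (# 0) ∷ ν (# 1) ∷
  sub (capE kindE) (sub (filterE bigE) (ν (# 1) ∷ ν (# 2) ∷ []) ∷ numeralE 6 ∷ ν (# 0) ∷ ν (# 1) ∷ []) ∷
  sub (filterE (match bigE trueE ∅)) (ν (# 1) ∷ ν (# 2) ∷ []) ∷ [])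

kernel₂E : Expr 2
kernel₂E = sub kernel₃E (ν (# 0) ∷ ν (# 1) ∷ sub (capE nb₄E) (ν (# 1) ∷ numeralE 1 ∷ ∅ ∷ ∅ ∷ []) ∷ [])

kernelE : Expr 1
kernelE = sub kernel₂E (hdE (ν (# 0)) ∷ sub (capE twinE) (tlE (ν (# 0)) ∷ numeralE 2 ∷ hdE (ν (# 0)) ∷ ∅ ∷ []) ∷ [])

matrixE : Expr 1
matrixE = fold (ν (# 0)) ∅ (sub (fold (ν (# 1)) ∅ (sub nbE (ν (# 3) ∷ ν (# 1) ∷ []) ∙ ν (# 0))) (ν (# 1) ∷ ν (# 3) ∷ []) ∙ ν (# 0))

encodeℕ-list : ∀ c → encodeList (replicate c nil) ≡ encodeℕ c
encodeℕ-list zero = refl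
encodeℕ-list (suc c) = cong (cons nil) (encodeℕ-list c)

opaque
  ev-capℕ : ∀ i → Σ ℕ λ j → ∀ Γ → let open Derived Γ in ∀ {r x y} (R : Fin n → Fin n → Bool) xs c → length xs < β →
            (∀ u w → (vt Γ u ∷ vt Γ w ∷ x ∷ y ∷ []) ⊢ r ⇒ encodeBool (R u w) ^ i) →
            (vts Γ xs ∷ encodeℕ c ∷ x ∷ y ∷ []) ⊢ capE r ⇒ vts Γ (capBy R c xs) ^ j
  ev-capℕ i = _ , λ Γ R xs c lt h → let open Derived Γ in
    recast (cong (λ z → vts Γ (capBy R z xs)) (List.length-replicate c))
      (recast-env (cong (λ z → vts Γ xs ∷ z ∷ _ ∷ _ ∷ []) (encodeℕ-list c)) (proj₂ (ev-cap i) Γ R xs (replicate c nil) lt h))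

opaque
  ev-inC : Σ ℕ λ j → ∀ Γ → let open Derived Γ in ∀ R xs → length R < β → length xs < β →
           (vts Γ R ∷ vts Γ xs ∷ []) ⊢ inCE ⇒ vts Γ (filterᵇ (λ u → anyᵇ (λ v → nb v u) R) xs) ^ j
  ev-inC = _ , λ Γ R xs lR lx → let open Derived Γ in
    proj₂ (ev-filter _) Γ (λ u → anyᵇ (λ v → nb v u) R) xs lx λ u →
      ev-app₂ {Γ} (proj₂ (ev-any _) Γ (λ v → nb v u) R lR λ v → proj₂ ev-nb Γ v u) (ev-ν (# 0)) (ev-ν (# 1))

opaque
  ev-big : Σ ℕ λ j → ∀ Γ → let open Derived Γ in ∀ X L v → length (Ker′.L₂ Γ X L) < β →
           (vts Γ (Ker′.L₂ Γ X L) ∷ vt Γ v ∷ []) ⊢ bigE ⇒ encodeBool (Ker′.big Γ X L v) ^ j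
  ev-big = _ , λ Γ X L v lt → let open Derived Γ in let open Ker′ Γ X L using (C; L₂) in
    ev-match (tl (tl (vts Γ (C v)))) (ev-tl _ (ev-tl _ (ev-app₂ {Γ} (proj₂ (ev-filter _) Γ (nb v) L₂ lt λ u → proj₂ ev-nb Γ v u) (ev-ν (# 1)) (ev-ν (# 0)))))
      (λ e → recast-bool (sym (few Γ (C v) e)) ev-false) (λ _ _ e → recast-bool (sym (many Γ (C v) e)) ev-true)
    where
    few : ∀ Γ → let open Derived Γ in ∀ (l : List (Fin n)) → tl (tl (vts Γ l)) ≡ nil → (2 Data.Nat.<ᵇ length l) ≡ false
    few Γ [] _ = refl
    few Γ (_ ∷ []) _ = refl
    few Γ (_ ∷ _ ∷ []) _ = refl
    many : ∀ Γ → let open Derived Γ in ∀ (l : List (Fin n)) {y z} → tl (tl (vts Γ l)) ≡ cons y z → (2 Data.Nat.<ᵇ length l) ≡ true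
    many Γ (_ ∷ _ ∷ _ ∷ _) _ = refl

module KernelLengths (Γ : Ctx) (X L : List (Fin (Ctx.n Γ))) where
  open Ker′ Γ X L

  L₂≤ : length L₂ ≤ length L
  L₂≤ = capBy-length twin 2 L
  reps≤ : length reps ≤ length L
  reps≤ = ℕ.≤-trans (capBy-length nb′ 1 L₂) L₂≤
    where
    nb′ : Fin (Ctx.n Γ) → Fin (Ctx.n Γ) → Bool
    nb′ = Ctx.nb Γ
  bigs≤ : length bigs ≤ length L
  bigs≤ = ℕ.≤-trans (filterᵇ-length big reps) reps≤
  smalls≤ : length smalls ≤ length L
  smalls≤ = ℕ.≤-trans (filterᵇ-length (not ∘ big) reps) reps≤
  R₁≤ : length R₁ ≤ length L
  R₁≤ = ℕ.≤-trans (capBy-length kind 6 bigs) bigs≤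
  lbl≤ : length lbl ≤ length L
  lbl≤ = ℕ.≤-trans (capBy-length kind 1 smalls) smalls≤

opaque
  ev-kernel : Σ ℕ λ j → ∀ Γ → let open Derived Γ in ∀ X L → length X < β → length L < β → 9 < β → Ker′.threshold Γ X L < β →
              (cons (vts Γ X) (vts Γ L) ∷ []) ⊢ kernelE ⇒ vts Γ (Ker′.K Γ X L) ^ j
  ev-kernel = _ , λ Γ X L lX lL l9 lth →
    let open Derived Γ
        open Ker′ Γ X L
        open KernelLengths Γ X L
        lL₂ = ℕ.≤-<-trans L₂≤ lL
        lsmalls = ℕ.≤-<-trans smalls≤ lL
        lR₁ = ℕ.≤-<-trans R₁≤ lL
        llbl = ℕ.≤-<-trans lbl≤ lL
        kind-ev = λ u w → proj₂ ev-kind Γ X L u w lX lL₂ in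
    ev-app₂ {Γ}
      (ev-app₃ {Γ}
        (ev-app₄ {Γ}
          (ev-sub (args-∷ (ev-ν (# 0)) (args-∷ (ev-ν (# 1)) (args-∷ (ev-ν (# 2)) (args-∷ (ev-ν (# 3)) (args-∷
            (ev-sub (args-∷ (ev-app₂ {Γ} (proj₂ ev-append Γ (vt Γ) X (lbl ++ filterᵇ (inC R₁) L₂) lX) (ev-ν (# 0))
                (ev-app₂ {Γ} (proj₂ ev-append Γ (vt Γ) lbl (filterᵇ (inC R₁) L₂) llbl)
                  (ev-app₄ {Γ} (proj₂ (ev-capℕ _) Γ kind smalls 1 lsmalls kind-ev) (ev-ν (# 3)) (proj₂ (ev-numeral 1) Γ) (ev-ν (# 0)) (ev-ν (# 1)))
                  (ev-app₂ {Γ} (proj₂ ev-inC Γ R₁ L₂ lR₁ lL₂) (ev-ν (# 2)) (ev-ν (# 1))))) args-[])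
              (proj₂ ev-threshold Γ labelList l9 lth)) args-[])))))
            (ev-app₂ {Γ} (proj₂ ev-append Γ (vt Γ) X (filterᵇ (inC (R₁ ++ R₂)) L₂) lX) (ev-ν (# 0))
              (ev-app₂ {Γ} (proj₂ ev-inC Γ (R₁ ++ R₂) L₂ (reps< Γ X L lL) lL₂)
                (ev-app₂ {Γ} (proj₂ ev-append Γ (vt Γ) R₁ R₂ lR₁) (ev-ν (# 2))
                  (ev-app₄ {Γ} (proj₂ (ev-capℕ _) Γ kind smalls threshold lsmalls kind-ev) (ev-ν (# 3)) (ev-ν (# 4)) (ev-ν (# 0)) (ev-ν (# 1))))
                (ev-ν (# 1)))))
          (ev-ν (# 0)) (ev-ν (# 1))
          (ev-app₄ {Γ} (proj₂ (ev-capℕ _) Γ kind bigs 6 (ℕ.≤-<-trans bigs≤ lL) kind-ev)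
            (ev-app₂ {Γ} (proj₂ (ev-filter _) Γ big reps (ℕ.≤-<-trans reps≤ lL) λ u → proj₂ ev-big Γ X L u lL₂) (ev-ν (# 1)) (ev-ν (# 2)))
            (proj₂ (ev-numeral 6) Γ) (ev-ν (# 0)) (ev-ν (# 1)))
          (ev-app₂ {Γ} (proj₂ (ev-filter _) Γ (not ∘ big) reps (ℕ.≤-<-trans reps≤ lL) λ u →
            ev-if (big u) (proj₂ ev-big Γ X L u lL₂) (λ e → recast-bool (cong not (sym e)) ev-true) (λ e → recast-bool (cong not (sym e)) ev-false))
            (ev-ν (# 1)) (ev-ν (# 2))))
        (ev-ν (# 0)) (ev-ν (# 1))
        (ev-app₄ {Γ} (proj₂ (ev-capℕ _) Γ nb L₂ 1 lL₂ λ u w → proj₂ ev-nb₄ Γ u w) (ev-ν (# 1)) (proj₂ (ev-numeral 1) Γ) ev-∅ ev-∅))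
      (ev-hd _ (ev-ν (# 0)))
      (ev-app₄ {Γ} (proj₂ (ev-capℕ _) Γ twin L 2 lL λ u w → proj₂ ev-twin Γ X L u w lX) (ev-tl _ (ev-ν (# 0))) (proj₂ (ev-numeral 2) Γ) (ev-hd _ (ev-ν (# 0))) ev-∅)
    where
    reps< : ∀ Γ → let open Derived Γ in ∀ X L → length L < β → length (Ker′.R₁ Γ X L ++ Ker′.R₂ Γ X L) < β
    reps< Γ X L lt = ℕ.≤-<-trans (ℕ.≤-trans (ℕ.≤-reflexive (List.length-++ R₁)) (ℕ.≤-trans
      (ℕ.+-mono-≤ (capBy-length kind 6 bigs) (capBy-length kind threshold smalls))
      (ℕ.≤-trans (ℕ.≤-reflexive (sym (trans (Perm.↭-length (filterᵇ-complement big reps)) (List.length-++ bigs)))) (KernelLengths.reps≤ Γ X L)))) lt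
      where open Ker′ Γ X L

opaque
  ev-matrix : Σ ℕ λ j → ∀ Γ → let open Derived Γ in ∀ K → length K < β →
              (vts Γ K ∷ []) ⊢ matrixE ⇒ encodeList (map (λ u → encodeList (map (λ v → encodeBool (nb u v)) K)) K) ^ j
  ev-matrix = _ , λ Γ K lt → let open Derived Γ in
    ev-fold (vt Γ) (λ t → encodeList (map (λ u → encodeList (map (λ v → encodeBool (nb u v)) K)) t)) K lt (ev-ν (# 0)) ev-∅ λ _ u t _ →
      ev-∙ (ev-app₂ {Γ} (ev-fold (vt Γ) (λ s → encodeList (map (λ v → encodeBool (nb u v)) s)) K lt (ev-ν (# 1)) ev-∅ λ _ v _ _ →
              ev-∙ (ev-app₂ {Γ} (proj₂ ev-nb Γ u v) (ev-ν (# 3)) (ev-ν (# 1))) (ev-ν (# 0)))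
            (ev-ν (# 1)) (ev-ν (# 3))) (ev-ν (# 0))

encodeSlot : Slot → Tree
encodeSlot □ = nil
encodeSlot ● = cons nil nil
encodeSlot ○ = cons (cons nil nil) nil

is● : Slot → Bool
is● ● = true
is● _ = false

isFree : Slot → Bool
isFree □ = true
isFree _ = false

Play : ℕ → Set
Play n = List (Fin n × Slot)

moves : ∀ {n} → Slot → Play n → List (Play n)
moves c [] = []
moves c ((v , s) ∷ L) = if isFree s then ((v , c) ∷ L) ∷ map ((v , s) ∷_) (moves c L) else map ((v , s) ∷_) (moves c L)

module Value (Γ : Ctx) where
  open Ctx Γ using (n; nb)

  dominates : Fin n → Play n → Bool
  dominates v L = anyᵇ (λ (u , s) → is● s ∧ nb u v) L

  finished : Play n → Bool
  finished L = allᵇ (λ (v , _) → dominates v L) L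

  best : Player → (Play n → Bool) → Play n → List (Play n) → Bool
  best p f L [] = finished L
  best Dominator f L (M ∷ Ms) = anyᵇ f (M ∷ Ms)
  best Staller f L (M ∷ Ms) = allᵇ f (M ∷ Ms)

  value : ℕ → Player → Play n → Bool
  value zero p L = finished L
  value (suc k) p L = best p (value k (opponent p)) L (moves (mark p) L)

consAllE movesE dominatesE bruteE solveE : Expr 2
consAllE = fold (ν (# 1)) ∅ ((ν (# 3) ∙ ν (# 1)) ∙ ν (# 0))
movesE = fold (ν (# 1)) ∅ (match (hdE (ν (# 1)))
  (((ν (# 3) ∙ tlE (ν (# 1))) ∙ ν (# 2)) ∙ sub consAllE (ν (# 1) ∷ ν (# 0) ∷ []))
  (sub consAllE (ν (# 3) ∷ ν (# 2) ∷ [])))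
dominatesE = fold (ν (# 1)) ∅ (match (match (hdE (ν (# 1))) ∅ (match (ν (# 0)) trueE ∅)) (ν (# 0))
  (match (sub nbE (tlE (ν (# 3)) ∷ ν (# 5) ∷ [])) (ν (# 2)) trueE))

finishedE initialE baseE : Expr 1
finishedE = fold (ν (# 0)) trueE (match (sub dominatesE (tlE (ν (# 1)) ∷ ν (# 3) ∷ [])) ∅ (ν (# 2)))
initialE = fold (ν (# 0)) ∅ ((∅ ∙ ν (# 1)) ∙ ν (# 0))
baseE = sub finishedE (tlE (ν (# 0)) ∷ [])

recE : Expr 3
recE = match (hdE (ν (# 2)))
  (match (sub movesE ((trueE ∙ ∅) ∷ tlE (ν (# 2)) ∷ [])) (sub finishedE (tlE (ν (# 2)) ∷ []))
    (fold (ν (# 0) ∙ ν (# 1)) trueE (match (ask (trueE ∙ ν (# 1))) ∅ (ν (# 2)))))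
  (match (sub movesE (trueE ∷ tlE (ν (# 4)) ∷ [])) (sub finishedE (tlE (ν (# 4)) ∷ []))
    (fold (ν (# 0) ∙ ν (# 1)) ∅ (match (ask (∅ ∙ ν (# 1))) (ν (# 0)) trueE)))

bruteE = rec baseE recE (ν (# 1)) (ν (# 0) ∙ sub initialE (ν (# 1) ∷ []))
solveE = sub bruteE (ν (# 0) ∷ sub vertsE (ν (# 1) ∷ []) ∷ [])

encodeItem : ∀ Γ → Fin (Ctx.n Γ) × Slot → Tree
encodeItem Γ (v , s) = cons (encodeSlot s) (vt Γ v)

encodePlay : ∀ Γ → Play (Ctx.n Γ) → Tree
encodePlay Γ L = encodeList (map (encodeItem Γ) L)

encodePlays : ∀ Γ → List (Play (Ctx.n Γ)) → Tree
encodePlays Γ Ms = encodeList (map (encodePlay Γ) Ms)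

moves-length : ∀ {n} c (L : Play n) → length (moves c L) ≤ length L
moves-length c [] = z≤n
moves-length c ((v , s) ∷ L) with isFree s
... | true = s≤s (ℕ.≤-trans (ℕ.≤-reflexive (List.length-map _ (moves c L))) (moves-length c L))
... | false = ℕ.m≤n⇒m≤1+n (ℕ.≤-trans (ℕ.≤-reflexive (List.length-map _ (moves c L))) (moves-length c L))

moves-play-length : ∀ {n} c (L : Play n) {M} → M ∈ moves c L → length M ≡ length L
moves-play-length c ((v , s) ∷ L) M∈ with isFree s
moves-play-length c ((v , s) ∷ L) (here refl) | true = refl
moves-play-length c ((v , s) ∷ L) (there M∈) | true with Mem.∈-map⁻ ((v , s) ∷_) M∈
... | _ , M′∈ , refl = cong suc (moves-play-length c L M′∈)
moves-play-length c ((v , s) ∷ L) M∈ | false with Mem.∈-map⁻ ((v , s) ∷_) M∈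
... | _ , M′∈ , refl = cong suc (moves-play-length c L M′∈)

opaque
  ev-consAll : Σ ℕ λ j → ∀ Γ → let open Derived Γ in ∀ i Ms → length Ms < β →
               (encodeItem Γ i ∷ encodePlays Γ Ms ∷ []) ⊢ consAllE ⇒ encodePlays Γ (map (i ∷_) Ms) ^ j
  ev-consAll = _ , λ Γ i Ms lt → let open Derived Γ in
    ev-fold (encodePlay Γ) (λ t → encodePlays Γ (map (i ∷_) t)) Ms lt (ev-ν (# 1)) ev-∅ λ _ _ _ _ →
      ev-∙ (ev-∙ (ev-ν (# 3)) (ev-ν (# 1))) (ev-ν (# 0))

opaque
  ev-moves : Σ ℕ λ j → ∀ Γ → let open Derived Γ in ∀ c L → length L < β →
             (encodeSlot c ∷ encodePlay Γ L ∷ []) ⊢ movesE ⇒ encodePlays Γ (moves c L) ^ j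
  ev-moves = _ , λ Γ c L lt → let open Derived Γ in
    ev-fold (encodeItem Γ) (λ t → encodePlays Γ (moves c t)) L lt (ev-ν (# 1)) ev-∅ λ ys (v , s) t e →
      let lm = ℕ.≤-<-trans (ℕ.≤-trans (moves-length c t) (suffix-≤ ys e)) lt in
      ev-match (encodeSlot s) (ev-hd _ (ev-ν (# 1)))
        (λ e′ → recast (cong (λ b → encodePlays Γ (if b then ((v , c) ∷ t) ∷ map ((v , s) ∷_) (moves c t) else map ((v , s) ∷_) (moves c t))) (sym (unmarked s e′)))
          (ev-∙ (ev-∙ (ev-∙ (ev-ν (# 3)) (ev-tl _ (ev-ν (# 1)))) (ev-ν (# 2)))
            (ev-app₂ {Γ} (proj₂ ev-consAll Γ (v , s) (moves c t) lm) (ev-ν (# 1)) (ev-ν (# 0)))))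
        (λ _ _ e′ → recast (cong (λ b → encodePlays Γ (if b then ((v , c) ∷ t) ∷ map ((v , s) ∷_) (moves c t) else map ((v , s) ∷_) (moves c t))) (sym (taken s e′)))
          (ev-app₂ {Γ} (proj₂ ev-consAll Γ (v , s) (moves c t) lm) (ev-ν (# 3)) (ev-ν (# 2))))
    where
    unmarked : ∀ s → encodeSlot s ≡ nil → isFree s ≡ true
    unmarked □ _ = refl
    taken : ∀ s {y z} → encodeSlot s ≡ cons y z → isFree s ≡ false
    taken ● _ = refl
    taken ○ _ = refl

opaque
  ev-dominates : Σ ℕ λ j → ∀ Γ → let open Derived Γ in ∀ v L → length L < β →
                 (vt Γ v ∷ encodePlay Γ L ∷ []) ⊢ dominatesE ⇒ encodeBool (Value.dominates Γ v L) ^ j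
  ev-dominates = _ , λ Γ v L lt → let open Derived Γ in
    ev-fold (encodeItem Γ) (λ t → encodeBool (Value.dominates Γ v t)) L lt (ev-ν (# 1)) ev-∅ λ _ (u , s) t _ →
      ev-if (is● s)
        (ev-match (encodeSlot s) (ev-hd _ (ev-ν (# 1))) (λ e → recast-bool (sym (unmarked s e)) ev-false)
          λ y z e → ev-match y (ev-ν (# 0)) (λ e′ → recast-bool (sym (black s e e′)) ev-true) (λ _ _ e′ → recast-bool (sym (white s e e′)) ev-false))
        (λ e → recast-bool (cong (λ b → (b ∧ nb u v) ∨ Value.dominates Γ v t) (sym e)) (ev-ν (# 0)))
        (λ e → recast-bool (cong (λ b → (b ∧ nb u v) ∨ Value.dominates Γ v t) (sym e))
          (ev-if (nb u v) (ev-app₂ {Γ} (proj₂ ev-nb Γ u v) (ev-tl _ (ev-ν (# 3))) (ev-ν (# 5)))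
            (λ e′ → recast-bool (cong (_∨ Value.dominates Γ v t) (sym e′)) (ev-ν (# 2)))
            (λ e′ → recast-bool (cong (_∨ Value.dominates Γ v t) (sym e′)) ev-true)))
    where
    unmarked : ∀ s → encodeSlot s ≡ nil → is● s ≡ false
    unmarked □ _ = refl
    black : ∀ s {y z} → encodeSlot s ≡ cons y z → y ≡ nil → is● s ≡ true
    black ● _ _ = refl
    black ○ refl ()
    white : ∀ s {y z a b} → encodeSlot s ≡ cons y z → y ≡ cons a b → is● s ≡ false
    white ○ _ _ = refl
    white ● refl ()

opaque
  ev-finished : Σ ℕ λ j → ∀ Γ → let open Derived Γ in ∀ L → length L < β →
                (encodePlay Γ L ∷ []) ⊢ finishedE ⇒ encodeBool (Value.finished Γ L) ^ j
  ev-finished = _ , λ Γ L lt → let open Derived Γ in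
    ev-fold (encodeItem Γ) (λ t → encodeBool (allᵇ (λ (v , _) → Value.dominates Γ v L) t)) L lt (ev-ν (# 0)) ev-true λ _ (v , s) t _ →
      ev-if (Value.dominates Γ v L) (ev-app₂ {Γ} (proj₂ ev-dominates Γ v L lt) (ev-tl _ (ev-ν (# 1))) (ev-ν (# 3)))
        (λ e → recast-bool (cong (_∧ allᵇ (λ (v , _) → Value.dominates Γ v L) t) (sym e)) ev-false)
        (λ e → recast-bool (cong (_∧ allᵇ (λ (v , _) → Value.dominates Γ v L) t) (sym e)) (ev-ν (# 2)))

opaque
  ev-initial : Σ ℕ λ j → ∀ Γ → let open Derived Γ in ∀ vs → length vs < β →
               (vts Γ vs ∷ []) ⊢ initialE ⇒ encodePlay Γ (map (_, □) vs) ^ j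
  ev-initial = _ , λ Γ vs lt → let open Derived Γ in
    ev-fold (vt Γ) (λ t → encodePlay Γ (map (_, □) t)) vs lt (ev-ν (# 0)) ev-∅ λ _ _ _ _ → ev-∙ (ev-∙ ev-∅ (ev-ν (# 1))) (ev-ν (# 0))

-- Evaluating the game

linear-⊔ : ∀ {a b c d i} → a ≤ c + i → b ≤ d + i → a ⊔ b ≤ (c ⊔ d) + i
linear-⊔ {c = c} {d} {i} p q = ℕ.⊔-lub (ℕ.≤-trans p (ℕ.+-monoˡ-≤ i (ℕ.m≤m⊔n c d))) (ℕ.≤-trans q (ℕ.+-monoˡ-≤ i (ℕ.m≤n⊔m c d)))

linear-+ : ∀ k {a c i} → a ≤ c + i → k + a ≤ (k + c) + i
linear-+ k {c = c} {i} p = ℕ.≤-trans (ℕ.+-monoʳ-≤ k p) (ℕ.≤-reflexive (sym (ℕ.+-assoc k c i)))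

withOracle : Ctx → Tree → Ctx
withOracle Γ f = record { β = β ; n = n ; m = m ; m-sym = m-sym ; β≥3 = β≥3 ; n<β = n<β ; oracle = f }
  where open Ctx Γ

closure : Tree → Tree
closure t = cons t (cons (code baseE) (code recE))

state : ∀ Γ → Player → Play (Ctx.n Γ) → Tree
state Γ p L = cons (encodePlayer p) (encodePlay Γ L)

-- Exponents c + i, where i bounds the calls of the oracle.
module Linear (Γ : Ctx) where
  open Derived Γ

  record Evˡ {k} (e : Expr k) (ρ : Vec Tree k) (x : Tree) (c i : ℕ) : Set where
    constructor linear
    field
      unwrap : ρ ⊢ e ⇒ x ^ (c + i)
  open Evˡ public

  private
    variable
      c₁ c₂ c₃ i : ℕ
      ρ : Vec Tree k
      x : Tree

  constˡ : ∀ {e : Expr k} → ρ ⊢ e ⇒ x ^ c₁ → Evˡ e ρ x c₁ i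
  constˡ p = linear (lift-ev (ℕ.m≤m+n _ _) p)

  recastˡ : ∀ {e : Expr k} {a b} → a ≡ b → Evˡ e ρ (encodeBool a) c₁ i → Evˡ e ρ (encodeBool b) c₁ i
  recastˡ refl p = p

  matchˡ : ∀ {e : Expr k} {a b} v → Evˡ e ρ v c₁ i → (v ≡ nil → Evˡ a ρ x c₂ i) →
           (∀ y z → v ≡ cons y z → Evˡ b (y ∷ z ∷ ρ) x c₃ i) → Evˡ (match e a b) ρ x (15 + (c₁ ⊔ (c₂ ⊔ c₃))) i
  matchˡ {c₁ = c₁} {i = i} {c₂ = c₂} {c₃ = c₃} v p q r = linear (lift-ev (linear-+ 15 {c = c₁ ⊔ (c₂ ⊔ c₃)} {i} (linear-⊔ {c = c₁} ℕ.≤-refl (linear-⊔ {c = c₂} {c₃} ℕ.≤-refl ℕ.≤-refl)))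
    (ev-match v (unwrap p) (unwrap ∘ q) λ y z e → unwrap (r y z e)))

  ifˡ : ∀ {e : Expr k} {a b} v → Evˡ e ρ (encodeBool v) c₁ i → (v ≡ false → Evˡ a ρ x c₂ i) →
        (v ≡ true → Evˡ b (nil ∷ nil ∷ ρ) x c₃ i) → Evˡ (match e a b) ρ x (15 + (c₁ ⊔ (c₂ ⊔ c₃))) i
  ifˡ false p q r = matchˡ nil p (λ _ → q refl) λ _ _ ()
  ifˡ true p q r = matchˡ (cons nil nil) p (λ ()) λ { _ _ refl → r refl }

  foldˡ : ∀ {B : Set} {l z : Expr k} {s} (enc : B → Tree) (F : List B → Tree) (xs : List B) → length xs < β →
          Evˡ l ρ (encodeList (map enc xs)) c₁ i → Evˡ z ρ (F []) c₂ i →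
          (∀ ys h t → ys ++ h ∷ t ≡ xs → Evˡ s (F t ∷ enc h ∷ encodeList (map enc t) ∷ ρ) (F (h ∷ t)) c₃ i) →
          Evˡ (fold l z s) ρ (F xs) (17 + (c₁ ⊔ (c₂ ⊔ c₃))) i
  foldˡ {c₁ = c₁} {i = i} {c₂ = c₂} {c₃ = c₃} enc F xs lt p q r = linear (lift-ev (linear-+ 17 {c = c₁ ⊔ (c₂ ⊔ c₃)} {i} (linear-⊔ {c = c₁} ℕ.≤-refl (linear-⊔ {c = c₂} {c₃} ℕ.≤-refl ℕ.≤-refl)))
    (ev-fold enc F xs lt (unwrap p) (unwrap q) λ ys h t e → unwrap (r ys h t e)))

  subˡ : ∀ {l} {b : Expr l} {as : Vec (Expr k) l} {xs} → Evs β oracle as ρ xs c₁ → Evˡ b xs x c₂ i → Evˡ (sub b as) ρ x (16 + (c₁ ⊔ c₂)) i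
  subˡ {c₁ = c₁} {c₂ = c₂} {i = i} p q = linear (lift-ev (linear-+ 16 {c = c₁ ⊔ c₂} {i} (linear-⊔ {c = c₁} {c₂} (ℕ.m≤m+n c₁ i) ℕ.≤-refl)) (ev-sub p (unwrap q)))

  recˡ : ∀ {l a : Expr k} {b s y z} → ρ ⊢ l ⇒ x ^ c₁ → ρ ⊢ a ⇒ y ^ c₂ → Apply β b s x y z (c₃ + i) → Evˡ (rec b s l a) ρ z (20 + (c₁ ⊔ c₂ ⊔ c₃)) i
  recˡ {c₁ = c₁} {c₂ = c₂} {c₃ = c₃} {i = i} p q r = linear (lift-ev (linear-+ 20 {c = c₁ ⊔ c₂ ⊔ c₃} {i} (linear-⊔ {c = c₁ ⊔ c₂} {c₃} (ℕ.m≤m+n (c₁ ⊔ c₂) i) ℕ.≤-refl)) (ev-rec p q r))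

module Asking (Γ : Ctx) (t : Tree) where
  open Linear (withOracle Γ (closure t))
  open Derived (withOracle Γ (closure t))

  askˡ : ∀ {k c i} {e : Expr k} {ρ y z} → ρ ⊢ e ⇒ y ^ c → Apply β baseE recE t y z i → Evˡ (ask e) ρ z (17 + c) i
  askˡ {c = c} {i} p r = linear (lift-ev (linear-+ 17 {c = c} (ℕ.⊔-lub (ℕ.m≤m+n c i) (ℕ.m≤n+m i c))) (ev-ask {b = baseE} {s = recE} p r))

opaque
  ev-step : Σ ℕ λ c → ∀ i Γ h t k p L → length L < Ctx.β Γ →
            (∀ q M → length M ≡ length L → Apply (Ctx.β Γ) baseE recE t (state Γ q M) (encodeBool (Value.value Γ k q M)) i) →
            Ev (Ctx.β Γ) (closure t) recE (h ∷ t ∷ state Γ p L ∷ []) (encodeBool (Value.value Γ (suc k) p L)) (c + i)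
  ev-step = _ , λ i Γ h t k p L lt ih → let Δ = withOracle Γ (closure t) in let open Derived Δ in let open Linear Δ in let open Asking Γ t in
    unwrap (matchˡ (encodePlayer p) (constˡ (ev-hd _ (ev-ν (# 2))))
      (λ e → recastˡ (cong (λ q → Value.value Γ (suc k) q L) (sym (staller p e)))
        (matchˡ (encodePlays Γ (moves ○ L))
          (constˡ (ev-app₂ {Δ} (proj₂ ev-moves Δ ○ L lt) (ev-∙ ev-true ev-∅) (ev-tl _ (ev-ν (# 2)))))
          (λ e′ → recastˡ (sym (stuck Γ Staller (Value.value Γ k Dominator) L (moves ○ L) e′))
            (constˡ (ev-sub (args-∷ (ev-tl _ (ev-ν (# 2))) args-[]) (proj₂ ev-finished Δ L lt))))
          (λ y z e′ → recastˡ (sym (proceed-all Γ (Value.value Γ k Dominator) L (moves ○ L) e′))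
            (foldˡ (encodePlay Γ) (λ Ms → encodeBool (allᵇ (Value.value Γ k Dominator) Ms)) (moves ○ L) (ℕ.≤-<-trans (moves-length ○ L) lt)
              (constˡ (recast (sym e′) (ev-∙ (ev-ν (# 0)) (ev-ν (# 1))))) (constˡ ev-true) λ ys M Ms e″ →
              ifˡ (Value.value Γ k Dominator M) (askˡ (ev-∙ ev-true (ev-ν (# 1))) (ih Dominator M (played ○ L ys e″)))
                (λ e‴ → recastˡ (cong (_∧ allᵇ (Value.value Γ k Dominator) Ms) (sym e‴)) (constˡ ev-false))
                (λ e‴ → recastˡ (cong (_∧ allᵇ (Value.value Γ k Dominator) Ms) (sym e‴)) (constˡ (ev-ν (# 2))))))))
      (λ _ _ e → recastˡ (cong (λ q → Value.value Γ (suc k) q L) (sym (dominator p e)))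
        (matchˡ (encodePlays Γ (moves ● L))
          (constˡ (ev-app₂ {Δ} (proj₂ ev-moves Δ ● L lt) ev-true (ev-tl _ (ev-ν (# 4)))))
          (λ e′ → recastˡ (sym (stuck Γ Dominator (Value.value Γ k Staller) L (moves ● L) e′))
            (constˡ (ev-sub (args-∷ (ev-tl _ (ev-ν (# 4))) args-[]) (proj₂ ev-finished Δ L lt))))
          (λ y z e′ → recastˡ (sym (proceed-any Γ (Value.value Γ k Staller) L (moves ● L) e′))
            (foldˡ (encodePlay Γ) (λ Ms → encodeBool (anyᵇ (Value.value Γ k Staller) Ms)) (moves ● L) (ℕ.≤-<-trans (moves-length ● L) lt)
              (constˡ (recast (sym e′) (ev-∙ (ev-ν (# 0)) (ev-ν (# 1))))) (constˡ ev-∅) λ ys M Ms e″ →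
              ifˡ (Value.value Γ k Staller M) (askˡ (ev-∙ ev-∅ (ev-ν (# 1))) (ih Staller M (played ● L ys e″)))
                (λ e‴ → recastˡ (cong (_∨ anyᵇ (Value.value Γ k Staller) Ms) (sym e‴)) (constˡ (ev-ν (# 0))))
                (λ e‴ → recastˡ (cong (_∨ anyᵇ (Value.value Γ k Staller) Ms) (sym e‴)) (constˡ ev-true)))))))
    where
    staller : ∀ p → encodePlayer p ≡ nil → p ≡ Staller
    staller Staller _ = refl
    dominator : ∀ p {y z} → encodePlayer p ≡ cons y z → p ≡ Dominator
    dominator Dominator _ = refl
    stuck : ∀ Γ p f L Ms → encodePlays Γ Ms ≡ nil → Value.best Γ p f L Ms ≡ Value.finished Γ L
    stuck Γ p f L [] _ = refl
    proceed-all : ∀ Γ f L Ms {y z} → encodePlays Γ Ms ≡ cons y z → Value.best Γ Staller f L Ms ≡ allᵇ f Ms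
    proceed-all Γ f L (_ ∷ _) _ = refl
    proceed-any : ∀ Γ f L Ms {y z} → encodePlays Γ Ms ≡ cons y z → Value.best Γ Dominator f L Ms ≡ anyᵇ f Ms
    proceed-any Γ f L (_ ∷ _) _ = refl
    played : ∀ {n} c (L : Play n) ys {M Ms} → ys ++ M ∷ Ms ≡ moves c L → length M ≡ length L
    played c L ys e = moves-play-length c L (subst (_ ∈_) e (Mem.∈-++⁺ʳ ys (here refl)))

perStep : ℕ
perStep = 10 + proj₁ ev-step

opaque
  ev-value : Σ ℕ λ a → ∀ Γ p L (fs : List Tree) → length L < Ctx.β Γ →
             Apply (Ctx.β Γ) baseE recE (encodeList fs) (state Γ p L) (encodeBool (Value.value Γ (length fs) p L)) (a + length fs * perStep)
  ev-value = _ , λ Γ p L fs lt → go Γ p L fs lt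
    where
    base : Σ ℕ λ a → ∀ Γ p L → length L < Ctx.β Γ → Apply (Ctx.β Γ) baseE recE nil (state Γ p L) (encodeBool (Value.finished Γ L)) a
    base = _ , λ Γ p L lt → let open Derived (withOracle Γ nil) in
      apply-nil {b = baseE} {s = recE} (ev-sub (args-∷ (ev-tl _ (ev-ν (# 0))) args-[]) (proj₂ ev-finished (withOracle Γ nil) L lt))
    rearrange : ∀ s b l → 10 + (s + (b + l)) ≡ b + ((10 + s) + l)
    rearrange = solve-∀
    go : ∀ Γ p L (fs : List Tree) → length L < Ctx.β Γ →
         Apply (Ctx.β Γ) baseE recE (encodeList fs) (state Γ p L) (encodeBool (Value.value Γ (length fs) p L)) (proj₁ base + length fs * perStep)
    go Γ p L [] lt = Rules.lift (Ctx.β≥3 Γ) (ℕ.m≤m+n (proj₁ base) 0) (proj₂ base Γ p L lt)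
    go Γ p L (h ∷ fs) lt = Rules.lift (Ctx.β≥3 Γ) (ℕ.≤-reflexive (rearrange (proj₁ ev-step) (proj₁ base) (length fs * perStep)))
      (Rules.apply-cons (Ctx.β≥3 Γ) {b = baseE} (proj₂ ev-step (proj₁ base + length fs * perStep) Γ h (encodeList fs) (length fs) p L lt
        λ q M e → go Γ q M fs (subst (_< Ctx.β Γ) (sym e) lt)))

start-play : ∀ Γ → Play (Ctx.n Γ)
start-play Γ = map (_, □) (allFin (Ctx.n Γ))

opaque
  ev-solve : Σ ℕ λ c → ∀ Γ p → let open Derived Γ in
             Linear.Evˡ Γ solveE (encodePlayer p ∷ encodeList rows ∷ []) (encodeBool (Value.value Γ n p (start-play Γ))) c (n * perStep)
  ev-solve = _ , λ Γ p → let open Derived Γ in let open Linear Γ in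
    subˡ (args-∷ (ev-ν (# 0)) (args-∷ (ev-sub (args-∷ (ev-ν (# 1)) args-[]) (proj₂ ev-verts Γ)) args-[]))
      (recˡ {i = n * perStep} (ev-ν (# 1))
        (ev-∙ (ev-ν (# 0)) (ev-sub (args-∷ (ev-ν (# 1)) args-[]) (proj₂ ev-initial Γ (allFin n) (subst (_< β) (sym (length-allFin n)) n<β))))
        (subst (λ k → Apply β baseE recE (vts Γ (allFin n)) (state Γ p (start-play Γ)) (encodeBool (Value.value Γ k p (start-play Γ))) (proj₁ ev-value + k * perStep))
          (trans (List.length-map (vt Γ) (allFin n)) (length-allFin n))
          (proj₂ ev-value Γ p (start-play Γ) (map (vt Γ) (allFin n))
            (subst (_< β) (sym (trans (List.length-map (_, □) (allFin n)) (length-allFin n))) n<β))))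

module ValueCorrect (Γ : Ctx) where
  open Ctx Γ using (n; nb; nb-refl; nb-sym)
  open Value Γ
  open Named nb nb-refl nb-sym

  toPosition : Play n → Position (Fin n)
  toPosition = map λ (v , s) → one s v

  moves-sound : ∀ {c} L {M} → M ∈ moves c L → Move c (toPosition L) (toPosition M)
  moves-sound ((v , □) ∷ L) (here refl) = here fst
  moves-sound ((v , □) ∷ L) (there i) with Mem.∈-map⁻ ((v , □) ∷_) i
  ... | _ , j , refl = there (moves-sound L j)
  moves-sound ((v , ●) ∷ L) i with Mem.∈-map⁻ ((v , ●) ∷_) i
  ... | _ , j , refl = there (moves-sound L j)
  moves-sound ((v , ○) ∷ L) i with Mem.∈-map⁻ ((v , ○) ∷_) i
  ... | _ , j , refl = there (moves-sound L j)

  moves-complete : ∀ {c} L {N} → Move c (toPosition L) N → ∃[ M ] M ∈ moves c L × N ≡ toPosition M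
  moves-complete ((v , □) ∷ L) (here fst) = _ , here refl , refl
  moves-complete ((v , s) ∷ L) (there m) with moves-complete L m
  ... | M , i , refl = (v , s) ∷ M , later s (Mem.∈-map⁺ ((v , s) ∷_) i) , refl
    where
    later : ∀ {v c L M} s → M ∈ map ((v , s) ∷_) (moves c L) → M ∈ moves c ((v , s) ∷ L)
    later □ i = there i
    later ● i = i
    later ○ i = i

  ∈●-toPosition : ∀ {L u} → u ∈● toPosition L → (u , ●) ∈ L
  ∈●-toPosition {L} (_ , i) with Mem.∈-map⁻ (λ (v , s) → one s v) i
  ... | (v , s) , j , refl = j

  finished-sound : ∀ {L} → T (finished L) → Dominated (toPosition L)
  finished-sound {L} t v v∈ with Mem.∈-map⁻ proj₁ v∈
  ... | i , i∈ , refl with Mem.∈-map⁻ (λ (v , s) → one s v) i∈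
  ... | (v , s) , j , refl with anyᵇ⁻ L (allᵇ⁻ {P = λ (v , _) → dominates v L} t j)
  ... | (u , ●) , k , e = u , (○ , Mem.∈-map⁺ (λ (v , s) → one s v) k) , e

  finished-complete : ∀ {L} → Dominated (toPosition L) → T (finished L)
  finished-complete {L} d = allᵇ⁺ L λ {(v , s)} i →
    let u , u∈ , e = d v (Mem.∈-map⁺ proj₁ (Mem.∈-map⁺ (λ (v , s) → one s v) i)) in anyᵇ⁺ (∈●-toPosition {L} u∈) e

  no-moves : ∀ {c} L → moves c L ≡ [] → Full (toPosition L)
  no-moves {c} L e with full⊎move (toPosition L)
  ... | inj₁ f = f
  ... | inj₂ m with moves-complete L (proj₂ (m c))
  ... | _ , i , _ with () ← subst (_ ∈_) e i

  full-0 : ∀ (L : Position (Fin n)) → free L ≤ 0 → Full L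
  full-0 L le with full⊎move L
  ... | inj₁ f = f
  ... | inj₂ m with () ← ℕ.≤-trans (ℕ.≤-reflexive (sym (free-move ● (proj₂ (m ●))))) le

  fewer : ∀ {c k} {L N : Position (Fin n)} → Claimed c → free L ≤ suc k → Move c L N → free N ≤ k
  fewer cl le m = s≤s⁻¹ (ℕ.≤-trans (ℕ.≤-reflexive (sym (free-move cl m))) le)

  value-sound : ∀ k p L → free (toPosition L) ≤ k → T (value k p L) → W Dominated p (toPosition L)
  value-sound zero p L le t = over (full-0 _ le) (finished-sound t)
  value-sound (suc k) Dominator L le t with moves ● L in e
  ... | [] = over (no-moves L e) (finished-sound t)
  ... | M₀ ∷ Ms with anyᵇ⁻ (M₀ ∷ Ms) t
  ... | M , i , v = dom m (value-sound k Staller M (fewer ● le m) v)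
    where
    m : Move ● (toPosition L) (toPosition M)
    m = moves-sound L (subst (M ∈_) (sym e) i)
  value-sound (suc k) Staller L le t with moves ○ L in e
  ... | [] = over (no-moves L e) (finished-sound t)
  ... | M₀ ∷ Ms = sta (_ , moves-sound L (subst (M₀ ∈_) (sym e) (here refl))) λ m → case moves-complete L m of λ
    { (M , i , refl) → value-sound k Dominator M (fewer ○ le m) (allᵇ⁻ {P = value k Dominator} t (subst (M ∈_) e i)) }

  value-complete : ∀ k p L → free (toPosition L) ≤ k → W Dominated p (toPosition L) → T (value k p L)
  value-complete zero p L le w = finished-complete (W-full (full-0 _ le) w)
  value-complete (suc k) Dominator L le w with moves ● L in e
  ... | [] = finished-complete (W-full (no-moves L e) w)
  value-complete (suc k) Dominator L le (over f _) | M₀ ∷ Ms = ⊥-elim (full-stuck f (moves-sound L (subst (M₀ ∈_) (sym e) (here refl))))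
  value-complete (suc k) Dominator L le (dom m w) | M₀ ∷ Ms with moves-complete L m
  ... | M , i , refl = anyᵇ⁺ (subst (M ∈_) e i) (value-complete k Staller M (fewer ● le m) w)
  value-complete (suc k) Staller L le w with moves ○ L in e
  ... | [] = finished-complete (W-full (no-moves L e) w)
  value-complete (suc k) Staller L le (over f _) | M₀ ∷ Ms = ⊥-elim (full-stuck f (moves-sound L (subst (M₀ ∈_) (sym e) (here refl))))
  value-complete (suc k) Staller L le (sta _ g) | M₀ ∷ Ms = allᵇ⁺ (M₀ ∷ Ms) λ {M} i →
    let m = moves-sound L (subst (M ∈_) (sym e) i) in value-complete k Dominator M (fewer ○ le m) (g m)

  start-free : free (toPosition (start-play Γ)) ≡ n
  start-free = trans (go (allFin n)) (length-allFin n)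
    where
    go : ∀ l → free (toPosition (map (_, □) l)) ≡ length l
    go [] = refl
    go (v ∷ l) = cong suc (go l)

  start-all□ : toPosition (start-play Γ) ≡ all□ (allFin n)
  start-all□ = sym (List.map-∘ (allFin n))

  value-correct : ∀ p → T (value n p (start-play Γ)) ⟷ Game p (allFin n)
  value-correct p =
    (λ t → subst (W Dominated p) start-all□ (value-sound n p (start-play Γ) (ℕ.≤-reflexive start-free) t)) ,
    (λ w → value-complete n p (start-play Γ) (ℕ.≤-reflexive start-free) (subst (W Dominated p) (sym start-all□) w))

-- The kernel as a graph

module Rename {V U : Set} (nb : V → V → Bool) (nb-refl : ∀ v → T (nb v v)) (nb-sym : ∀ u v → nb u v ≡ nb v u)
              (nb′ : U → U → Bool) (nb′-refl : ∀ v → T (nb′ v v)) (nb′-sym : ∀ u v → nb′ u v ≡ nb′ v u)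
              (f : V → U) (f-nb : ∀ u v → nb u v ≡ nb′ (f u) (f v)) where

  private
    module Src = Named nb nb-refl nb-sym
    module Tgt = Named nb′ nb′-refl nb′-sym

  renameItem : Item V → Item U
  renameItem (v , x , y) = f v , x , y

  rename : Position V → Position U
  rename = map renameItem

  rename-move⁺ : Move c L M → Move c (rename L) (rename M)
  rename-move⁺ (here fst) = here fst
  rename-move⁺ (here snd) = here snd
  rename-move⁺ (there m) = there (rename-move⁺ m)

  rename-move⁻ : ∀ L {N} → Move c (rename L) N → ∃[ M ] Move c L M × rename M ≡ N
  rename-move⁻ ((v , □ , y) ∷ L) (here fst) = _ , here fst , refl
  rename-move⁻ ((v , x , □) ∷ L) (here snd) = _ , here snd , refl
  rename-move⁻ (_ ∷ L) (there m) with rename-move⁻ L m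
  ... | _ , m′ , refl = _ , there m′ , refl

  renaming-transfer : Transfer (λ L M → rename L ≡ M)
  renaming-transfer = record
    { forth = λ { refl m → _ , rename-move⁺ m , refl }
    ; back  = λ { {L = L} refl m → rename-move⁻ L m } }

  dominated-rename⁺ : Src.Dominated L → Tgt.Dominated (rename L)
  dominated-rename⁺ d w w∈ with Mem.∈-map⁻ proj₁ w∈
  ... | _ , i , refl with Mem.∈-map⁻ renameItem i
  ... | _ , j , refl with d _ (Mem.∈-map⁺ proj₁ j)
  ... | u , (y , k) , e = f u , (y , Mem.∈-map⁺ renameItem k) , subst T (f-nb u _) e

  dominated-rename⁻ : Tgt.Dominated (rename L) → Src.Dominated L
  dominated-rename⁻ d v v∈ with Mem.∈-map⁻ proj₁ v∈
  ... | _ , i , refl with d _ (Mem.∈-map⁺ proj₁ (Mem.∈-map⁺ renameItem i))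
  ... | _ , (_ , k) , e with Mem.∈-map⁻ renameItem k
  ... | (u , _) , j , refl = u , (_ , j) , subst T (sym (f-nb u v)) e

  Game-rename : ∀ K → Src.Game p K ⟷ Tgt.Game p (map f K)
  Game-rename K =
    transfer renaming-transfer (λ { refl _ → dominated-rename⁺ }) start′ ,
    transfer (transfer-flip renaming-transfer) (λ { refl _ → dominated-rename⁻ }) start′
    where
    start′ : rename (Src.all□ K) ≡ Tgt.all□ (map f K)
    start′ = trans (sym (List.map-∘ K)) (List.map-∘ K)

map-lookup : (xs : List A) → map (List.lookup xs) (allFin (length xs)) ≡ xs
map-lookup xs = trans (List.map-tabulate id (List.lookup xs)) (List.tabulate-lookup xs)

module KernelGraph (Γ : Ctx) (K : List (Fin (Ctx.n Γ))) where
  open Ctx Γ using (nb; nb-refl; nb-sym)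

  Γᴷ : Ctx
  Γᴷ = record
    { β = 3 + length K ; n = length K ; m = λ i j → nb (List.lookup K i) (List.lookup K j)
    ; m-sym = λ i j → nb-sym (List.lookup K i) (List.lookup K j)
    ; β≥3 = ℕ.m≤m+n 3 (length K) ; n<β = ℕ.m≤n+m (suc (length K)) 2 ; oracle = nil }

  lookup-nb : ∀ i j → Ctx.nb Γᴷ i j ≡ nb (List.lookup K i) (List.lookup K j)
  lookup-nb i j with i Fin.≟ j
  ... | yes refl = T-ext (λ _ → nb-refl (List.lookup K i)) (λ _ → tt)
  ... | no _ = refl

  matrix-rows : encodeList (map (λ u → encodeList (map (λ v → encodeBool (nb u v)) K)) K) ≡ encodeList (Ctx.rows Γᴷ)
  matrix-rows = cong encodeList (trans (by-index λ u → encodeList (map (λ v → encodeBool (nb u v)) K))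
    (List.map-cong (λ i → cong encodeList (by-index λ v → encodeBool (nb (List.lookup K i) v))) (allFin (length K))))
    where
    by-index : (g : Fin (Ctx.n Γ) → Tree) → map g K ≡ map (g ∘ List.lookup K) (allFin (length K))
    by-index g = trans (cong (map g) (sym (map-lookup K))) (sym (List.map-∘ (allFin (length K))))

  kernel-value : ∀ p → T (Value.value Γᴷ (Ctx.n Γᴷ) p (start-play Γᴷ)) ⟷ Named.Game nb nb-refl nb-sym p K
  kernel-value p = ⟷-trans (ValueCorrect.value-correct Γᴷ p)
    (subst (λ K′ → Named.Game (Ctx.nb Γᴷ) (Ctx.nb-refl Γᴷ) (Ctx.nb-sym Γᴷ) p (allFin (length K)) ⟷ Named.Game nb nb-refl nb-sym p K′)
      (map-lookup K)
      (Rename.Game-rename (Ctx.nb Γᴷ) (Ctx.nb-refl Γᴷ) (Ctx.nb-sym Γᴷ) nb nb-refl nb-sym (List.lookup K) lookup-nb (allFin (length K))))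

module GraphKernel (G : Graph) where

  open Packing (Fin._≟_ {order G}) (ClosedNb G) (closedNb-refl G) (closedNb-sym G) using (pack; pack-↭; pack-transitive; pack-bound; conflict)

  Xᴳ Lᴳ : List (Vertex G)
  Xᴳ = proj₁ (pack (allFin (order G)))
  Lᴳ = proj₂ (pack (allFin (order G)))

  open Kernel Fin._≟_ (ClosedNb G) (closedNb-refl G) (closedNb-sym G) Xᴳ Lᴳ public using (threshold; K)

  private
    L-trans : ∀ {u v w} → u ∈ Lᴳ → v ∈ Lᴳ → w ∈ Lᴳ → T (ClosedNb G u v) → T (ClosedNb G v w) → T (ClosedNb G u w)
    L-trans = pack-transitive (allFin (order G))

  split : Xᴳ ++ Lᴳ ↭ allFin (order G)
  split = pack-↭ (Uniq.allFin⁺ (order G))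

  sizes : length Xᴳ + length Lᴳ ≡ order G
  sizes = trans (sym (List.length-++ Xᴳ)) (trans (Perm.↭-length split) (length-allFin (order G)))

  open Named (ClosedNb G) (closedNb-refl G) (closedNb-sym G) using (Game; Game-↭)

  Game-kernel : ∀ p → Game p (allFin (order G)) ⟷ Game p K
  Game-kernel p = ⟷-trans (Game-↭ (↭-sym split) , Game-↭ split)
    (SmallCliques.kernel-correct Fin._≟_ (ClosedNb G) (closedNb-refl G) (closedNb-sym G) Xᴳ Lᴳ L-trans)

  module KernelSizes = Sizes Fin._≟_ (ClosedNb G) (closedNb-refl G) (closedNb-sym G) Xᴳ Lᴳ L-trans

  no-conflict : ∀ {Y} → ClusterAfterDeleting G Y → ∀ {u v w} → u Sub.∉ Y → v Sub.∉ Y → w Sub.∉ Y → ¬ T (conflict u v w)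
  no-conflict {Y} (_ , part , h) {u} {v} {w} u∉ v∉ w∉ t =
    [ no-path u∉ v∉ w∉ , no-path v∉ u∉ w∉ ]′ (T-∨⁻ {ClosedNb G u v ∧ (ClosedNb G u w ∧ not (ClosedNb G v w))} t)
    where
    together : ∀ {a b} → a Sub.∉ Y → b Sub.∉ Y → T (ClosedNb G a b) → part a ≡ part b
    together {a} {b} a∉ b∉ e with a Fin.≟ b
    ... | yes refl = refl
    ... | no ne = Equivalence.to (h a b a∉ b∉ ne) e
    close : ∀ {a b} → a Sub.∉ Y → b Sub.∉ Y → part a ≡ part b → T (ClosedNb G a b)
    close {a} {b} a∉ b∉ e with a Fin.≟ b
    ... | yes _ = tt
    ... | no ne = Equivalence.from (h a b a∉ b∉ ne) e
    no-path : ∀ {a b d} → a Sub.∉ Y → b Sub.∉ Y → d Sub.∉ Y → ¬ T (ClosedNb G a b ∧ (ClosedNb G a d ∧ not (ClosedNb G b d)))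
    no-path {a} {b} {d} a∉ b∉ d∉ t =
      let ab , t′ = T-∧⁻ {ClosedNb G a b} t ; ad , bd = T-∧⁻ {ClosedNb G a d} t′ in
      T-not⁻ bd (close b∉ d∉ (trans (sym (together a∉ b∉ ab)) (together a∉ d∉ ad)))

  X-bound : ∀ {k} → DistanceToCluster G k → length Xᴳ ≤ 3 * k
  X-bound ((Y , cluster , refl) , _) = ℕ.≤-trans
    (pack-bound (lookup Y) (λ u v w → no-conflict cluster (outside u) (outside v) (outside w)) (allFin (order G)))
    (ℕ.*-monoʳ-≤ 3 (ℕ.≤-trans inside-X (ℕ.≤-reflexive (cardinality Y id λ _ → refl))))
    where
    outside : ∀ {v} → ¬ T (lookup Y v) → v Sub.∉ Y
    outside ne i = ne (subst T (sym (Vec.[]=⇒lookup i)) tt)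
    cardinality : ∀ {n} (Y : Sub.Subset n) (g : Fin n → Vertex G) {P} → (∀ i → P (g i) ≡ lookup Y i) →
                  length (filterᵇ P (tabulate g)) ≡ Sub.∣ Y ∣
    cardinality [] g e = refl
    cardinality (b ∷ Y) g {P} e with P (g zero) | e zero
    cardinality (true ∷ Y) g e | .true | refl = cong suc (cardinality Y (g ∘ suc) (e ∘ suc))
    cardinality (false ∷ Y) g e | .false | refl = cardinality Y (g ∘ suc) (e ∘ suc)
    inside-X : length (filterᵇ (lookup Y) Xᴳ) ≤ length (filterᵇ (lookup Y) (allFin (order G)))
    inside-X = ℕ.≤-trans (ℕ.m≤m+n _ _) (ℕ.≤-reflexive (trans (sym (List.length-++ (filterᵇ (lookup Y) Xᴳ)))
      (trans (cong length (sym (List.filter-++ (Bool.T? ∘ lookup Y) Xᴳ Lᴳ))) (Perm.↭-length (filterᵇ-↭ (lookup Y) split)))))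

-- Computable bounds

data Arith : Set where
  var         : Arith
  const       : ℕ → Arith
  _⊕_ _⊗_ _↑_ : Arith → Arith → Arith

infixl 6 _⊕_
infixl 7 _⊗_
infixr 8 _↑_

-- The base of a power is increased by one, which keeps it positive.
⟦_⟧ : Arith → ℕ → ℕ
⟦ var ⟧ k = k
⟦ const a ⟧ k = a
⟦ a ⊕ b ⟧ k = ⟦ a ⟧ k + ⟦ b ⟧ k
⟦ a ⊗ b ⟧ k = ⟦ a ⟧ k * ⟦ b ⟧ k
⟦ a ↑ b ⟧ k = suc (⟦ a ⟧ k) ^ ⟦ b ⟧ k

compile : Arith → Expr 1
compile var = ν (# 0)
compile (const a) = numeralE a
compile (a ⊕ b) = sub addE (compile a ∷ compile b ∷ [])
compile (a ⊗ b) = sub mulE (compile a ∷ compile b ∷ [])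
compile (a ↑ b) = sub powE ((∅ ∙ compile a) ∷ compile b ∷ [])

peak : Arith → ℕ → ℕ
peak var k = k
peak (const a) k = a
peak (a ⊕ b) k = ⟦ a ⊕ b ⟧ k + (peak a k + peak b k)
peak (a ⊗ b) k = ⟦ a ⊗ b ⟧ k + (peak a k + peak b k)
peak (a ↑ b) k = ⟦ a ↑ b ⟧ k + (suc (peak a k) + peak b k)

⟦⟧≤peak : ∀ a k → ⟦ a ⟧ k ≤ peak a k
⟦⟧≤peak var k = ℕ.≤-refl
⟦⟧≤peak (const a) k = ℕ.≤-refl
⟦⟧≤peak (a ⊕ b) k = ℕ.m≤m+n _ _
⟦⟧≤peak (a ⊗ b) k = ℕ.m≤m+n _ _
⟦⟧≤peak (a ↑ b) k = ℕ.m≤m+n _ _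

opaque
  ev-arith : ∀ a → Σ ℕ λ j → ∀ Γ → let open Derived Γ in ∀ k → peak a k < β → (encodeℕ k ∷ []) ⊢ compile a ⇒ encodeℕ (⟦ a ⟧ k) ^ j
  ev-arith var = _ , λ Γ k lt → let open Derived Γ in ev-ν (# 0)
  ev-arith (const a) = _ , λ Γ k lt → let open Derived Γ in proj₂ (ev-numeral a) Γ
  ev-arith (a ⊕ b) = _ , λ Γ k lt → let open Derived Γ ; lab = ℕ.≤-<-trans (ℕ.m≤n+m _ (⟦ a ⊕ b ⟧ k)) lt in
    let la = ℕ.≤-<-trans (ℕ.m≤m+n (peak a k) _) lab ; lb = ℕ.≤-<-trans (ℕ.m≤n+m (peak b k) (peak a k)) lab in
    ev-app₂ {Γ} (proj₂ ev-add Γ (⟦ a ⟧ k) (⟦ b ⟧ k) (ℕ.≤-<-trans (⟦⟧≤peak a k) la))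
      (proj₂ (ev-arith a) Γ k la) (proj₂ (ev-arith b) Γ k lb)
  ev-arith (a ⊗ b) = _ , λ Γ k lt → let open Derived Γ ; lab = ℕ.≤-<-trans (ℕ.m≤n+m _ (⟦ a ⊗ b ⟧ k)) lt in
    let la = ℕ.≤-<-trans (ℕ.m≤m+n (peak a k) _) lab ; lb = ℕ.≤-<-trans (ℕ.m≤n+m (peak b k) (peak a k)) lab in
    ev-app₂ {Γ} (proj₂ ev-mulℕ Γ (⟦ a ⟧ k) (⟦ b ⟧ k) (ℕ.≤-<-trans (⟦⟧≤peak a k) la) (ℕ.≤-<-trans (⟦⟧≤peak b k) lb))
      (proj₂ (ev-arith a) Γ k la) (proj₂ (ev-arith b) Γ k lb)
  ev-arith (a ↑ b) = _ , λ Γ k lt → let open Derived Γ ; lab = ℕ.≤-<-trans (ℕ.m≤n+m _ (⟦ a ↑ b ⟧ k)) lt in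
    let la = ℕ.≤-<-trans (ℕ.m≤m+n (suc (peak a k)) _) lab ; lb = ℕ.≤-<-trans (ℕ.m≤n+m (peak b k) (suc (peak a k))) lab in
    ev-app₂ {Γ} (proj₂ ev-pow Γ (suc (⟦ a ⟧ k)) (⟦ b ⟧ k) (ℕ.≤-<-trans (s≤s (⟦⟧≤peak a k)) la) (ℕ.≤-<-trans (⟦⟧≤peak b k) lb)
        (ℕ.≤-<-trans (⟦⟧≤peak (a ↑ b) k) lt) (s≤s z≤n))
      (ev-∙ ev-∅ (proj₂ (ev-arith a) Γ k (ℕ.<-trans (ℕ.n<1+n _) la))) (proj₂ (ev-arith b) Γ k lb)

⌜_⌝ : ∀ {m n} → Tree → Exp m n
⌜ nil ⌝ = nil
⌜ cons x y ⌝ = cons ⌜ x ⌝ ⌜ y ⌝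

size : Tree → ℕ
size nil = 1
size (cons x y) = suc (size x + size y)

quote-⇓ : ∀ {m n} {bs : Vec (Exp m 1) m} {ρ : Vec Tree n} x → bs , ρ ⊢ ⌜ x ⌝ ⇓ x [ size x ]
quote-⇓ nil = nil⇓
quote-⇓ (cons x y) = cons⇓ (quote-⇓ x) (quote-⇓ y)

interpret : ∀ {n} → Expr 1 → Exp 4 (suc n)
interpret e = call (# 0) (cons ⌜ code e ⌝ (cons (cons (var (# 0)) nil) nil))

interpret-⇓ : ∀ {n N x y j} {ρ : Vec Tree n} e → Ev N nil e (x ∷ []) y j →
              ∃[ t ] table , x ∷ ρ ⊢ interpret e ⇓ y [ size (code e) + 7 + t ] × t ≤ N ^ j
interpret-⇓ {x = x} {y} {ρ = ρ} e (ev (within {t} le d)) = t ,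
  subst (λ s → table , x ∷ ρ ⊢ interpret e ⇓ y [ s ]) (count (size (code e)) t)
    (call⇓ (cons⇓ (quote-⇓ (code e)) (cons⇓ (cons⇓ (var⇓ _) nil⇓) nil⇓)) d) , le
  where
  count : ∀ s t → suc (suc (s + 5) + t) ≡ s + 7 + t
  count = solve-∀

computable : ∀ a → Computable ⟦ a ⟧
computable a = record { bodies = table ; main = interpret (compile a) } , λ k →
  let _ , d , _ = interpret-⇓ (compile a) (proj₂ (ev-arith a) (Γ₀ k) k (ℕ.m≤n+m (suc (peak a k)) 2)) in _ , d
  where
  Γ₀ : ℕ → Ctx
  Γ₀ k = record { β = 3 + peak a k ; n = 0 ; m = λ () ; m-sym = λ () ; β≥3 = ℕ.m≤m+n 3 _ ; n<β = s≤s z≤n ; oracle = nil }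

matrixOfKernelE : Expr 1
matrixOfKernelE = sub matrixE (sub kernelE (sub packE (sub vertsE (tlE (ν (# 0)) ∷ []) ∷ []) ∷ []) ∷ [])

module Reduction (G : Graph) where
  open GraphKernel G public

  scale : ℕ
  scale = (20 + threshold) * (1 ⊔ order G)

  20≤scale : 20 ≤ scale
  20≤scale = ℕ.≤-trans (ℕ.m≤m+n 20 threshold) (ℕ.m≤m*n (20 + threshold) (1 ⊔ order G) {{Data.Nat.>-nonZero (ℕ.m≤m⊔n 1 (order G))}})

  threshold<scale : threshold < scale
  threshold<scale = ℕ.≤-trans (ℕ.+-monoˡ-≤ threshold (ℕ.m≤m+n 1 19))
      (ℕ.m≤m*n (20 + threshold) (1 ⊔ order G) {{Data.Nat.>-nonZero (ℕ.m≤m⊔n 1 (order G))}})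

  order<scale : order G < scale
  order<scale = ℕ.≤-trans (ℕ.≤-trans (s≤s (ℕ.m≤n⊔m 1 (order G))) (ℕ.≤-trans (ℕ.+-monoˡ-≤ (1 ⊔ order G) (ℕ.m≤m⊔n 1 (order G)))
      (ℕ.+-monoʳ-≤ (1 ⊔ order G) (ℕ.m≤m+n (1 ⊔ order G) _)))) (ℕ.*-monoˡ-≤ (1 ⊔ order G) (ℕ.m≤m+n 20 threshold))

  X<scale : length Xᴳ < scale
  X<scale = ℕ.≤-<-trans (ℕ.≤-trans (ℕ.m≤m+n _ _) (ℕ.≤-reflexive sizes)) order<scale

  L<scale : length Lᴳ < scale
  L<scale = ℕ.≤-<-trans (ℕ.≤-trans (ℕ.m≤n+m _ (length Xᴳ)) (ℕ.≤-reflexive sizes)) order<scale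

  9<scale : 9 < scale
  9<scale = ℕ.≤-trans (ℕ.m≤m+n 10 10) 20≤scale

  Γᴳ : Ctx
  Γᴳ = record { β = scale ; n = order G ; m = adjacent G ; m-sym = symmetric G ; β≥3 = ℕ.≤-trans (ℕ.m≤m+n 3 17) 20≤scale
              ; n<β = order<scale ; oracle = nil }

  open KernelGraph Γᴳ K public

  input-rows : encodeGraph G ≡ encodeList (Ctx.rows Γᴳ)
  input-rows = cong encodeList (sym (trans (List.map-tabulate id (Ctx.row Γᴳ))
    (List.tabulate-cong λ u → cong encodeList (List.map-tabulate id (encodeBool ∘ adjacent G u)))))

  length-K : length K ≤ order G
  length-K = ℕ.≤-trans (ℕ.≤-reflexive (List.length-++ Xᴳ)) (ℕ.≤-trans
    (ℕ.+-monoʳ-≤ (length Xᴳ) (ℕ.≤-trans (filterᵇ-length _ (Ker′.L₂ Γᴳ Xᴳ Lᴳ)) (KernelLengths.L₂≤ Γᴳ Xᴳ Lᴳ))) (ℕ.≤-reflexive sizes))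

opaque
  ev-matrixOfKernel : Σ ℕ λ j → ∀ G x → let open Reduction G in
                      Ev scale nil matrixOfKernelE (cons x (encodeGraph G) ∷ []) (encodeList (Ctx.rows Γᴷ)) j
  ev-matrixOfKernel = _ , λ G x → let open Reduction G in let open Derived Γᴳ in
    recast matrix-rows
      (ev-sub (args-∷ (ev-sub (args-∷ (ev-sub (args-∷ (ev-sub (args-∷
          (recast input-rows (ev-tl _ (ev-ν (# 0)))) args-[])
        (proj₂ ev-verts Γᴳ)) args-[])
        (proj₂ ev-pack Γᴳ (allFin (order G)) (subst (_< scale) (sym (length-allFin (order G))) order<scale))) args-[])
        (proj₂ ev-kernel Γᴳ Xᴳ Lᴳ X<scale L<scale 9<scale threshold<scale)) args-[])
        (proj₂ ev-matrix Γᴳ K (ℕ.≤-<-trans length-K order<scale)))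

pipeline : Expr 1 → Expr 2 → Exp 4 1
pipeline e₁ e₂ = call (# 0) (cons ⌜ code e₂ ⌝ (cons (cons (case (var (# 0)) nil (var (# 0))) (cons (interpret e₁) nil)) nil))

opaque
  pipeline-⇓ : ∀ e₁ e₂ → Σ ℕ λ a → ∀ {N₁ N₂ i j x g y z} →
               Ev N₁ nil e₁ (cons x g ∷ []) y i → Ev N₂ nil e₂ (x ∷ y ∷ []) z j →
               ∃[ t ] table , cons x g ∷ [] ⊢ pipeline e₁ e₂ ⇓ z [ t ] × t ≤ a + (N₁ ^ i + N₂ ^ j)
  pipeline-⇓ e₁ e₂ = size (code e₂) + size (code e₁) + 17 , go
    where
    count : ∀ s₁ s₂ t₁ t₂ → suc (suc (s₁ + suc (suc (3 + suc (s₂ + 7 + t₁ + 1)) + 1)) + t₂) ≡ s₁ + s₂ + 17 + (t₁ + t₂)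
    count = solve-∀
    go : ∀ {N₁ N₂ i j x g y z} → Ev N₁ nil e₁ (cons x g ∷ []) y i → Ev N₂ nil e₂ (x ∷ y ∷ []) z j →
         ∃[ t ] table , cons x g ∷ [] ⊢ pipeline e₁ e₂ ⇓ z [ t ] × t ≤ size (code e₂) + size (code e₁) + 17 + (N₁ ^ i + N₂ ^ j)
    go p (ev (within {t₂} le₂ d₂)) with interpret-⇓ e₁ p
    ... | t₁ , d₁ , le₁ = _ ,
      call⇓ (cons⇓ (quote-⇓ (code e₂)) (cons⇓ (cons⇓ (case-cons⇓ (var⇓ _) (var⇓ _)) (cons⇓ d₁ nil⇓)) nil⇓)) d₂ ,
      ℕ.≤-trans (ℕ.≤-reflexive (count (size (code e₂)) (size (code e₁)) t₁ t₂)) (ℕ.+-monoʳ-≤ (size (code e₂) + size (code e₁) + 17) (ℕ.+-mono-≤ le₁ le₂))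

program : Program
program = record { bodies = table ; main = pipeline matrixOfKernelE solveE }

opaque
  program-runs : Σ ℕ λ a → Σ ℕ λ b → Σ ℕ λ d → ∀ G p → let open Reduction G in let open Ctx Γᴷ in
                 ∃[ t ] Runs program (cons (encodePlayer p) (encodeGraph G)) (encodeBool (Value.value Γᴷ n p (start-play Γᴷ))) t ×
                        t ≤ a + (scale ^ b + β ^ (d + n * perStep))
  program-runs = proj₁ (pipeline-⇓ matrixOfKernelE solveE) , proj₁ ev-matrixOfKernel , proj₁ ev-solve , λ G p →
    proj₂ (pipeline-⇓ matrixOfKernelE solveE) (proj₂ ev-matrixOfKernel G (encodePlayer p)) (Linear.Evˡ.unwrap (proj₂ ev-solve (Reduction.Γᴷ G) p))

-- Correctness and running time

winner : Bool → Player
winner true = Dominator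
winner false = Staller

encode-winner : ∀ b → encodePlayer (winner b) ≡ encodeBool b
encode-winner true = refl
encode-winner false = refl

winner-wins : ∀ G p b → T b ⟷ Named.Game (ClosedNb G) (closedNb-refl G) (closedNb-sym G) p (allFin (order G)) → MBDomGame G p (winner b)
winner-wins G p true (sound , _) = Strategies.dominator-strategy G p (sound tt)
winner-wins G p false (_ , complete) with determined (Strategies.dominated? G p) p (Named.all□ (ClosedNb G) (closedNb-refl G) (closedNb-sym G) (allFin (order G)))
... | inj₁ w = ⊥-elim (complete w)
... | inj₂ s = Strategies.staller-strategy G p s

cliqueA kindA labelA thresholdA kernelA : Arith → Arith
cliqueA a = const 1 ↑ a ⊗ const 2
kindA a = const 2 ↑ (const 1 ↑ a)
labelA a = a ⊕ (kindA a ⊕ (kindA a ⊗ const 6) ⊗ cliqueA a)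
thresholdA a = const 3 ⊕ const 2 ↑ (labelA a ⊗ const 9) ⊗ const 2
kernelA a = a ⊕ (kindA a ⊗ const 6 ⊕ kindA a ⊗ thresholdA a) ⊗ cliqueA a

module _ {x y} (x≤y : x ≤ y) where

  private
    clique-mono : cliqueBound x ≤ cliqueBound y
    clique-mono = ℕ.*-monoˡ-≤ 2 (ℕ.^-monoʳ-≤ 2 x≤y)

    kind-mono : kindBound x ≤ kindBound y
    kind-mono = ℕ.^-monoʳ-≤ 3 (ℕ.^-monoʳ-≤ 2 x≤y)

  thresholdBound-mono : thresholdBound x ≤ thresholdBound y
  thresholdBound-mono = ℕ.+-monoʳ-≤ 3 (ℕ.*-monoˡ-≤ 2 (ℕ.^-monoʳ-≤ 3 (ℕ.*-monoˡ-≤ 9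
    (ℕ.+-mono-≤ x≤y (ℕ.+-mono-≤ kind-mono (ℕ.*-mono-≤ (ℕ.*-monoˡ-≤ 6 kind-mono) clique-mono))))))

  kernelBound-mono : kernelBound x ≤ kernelBound y
  kernelBound-mono = ℕ.+-mono-≤ x≤y (ℕ.*-mono-≤ (ℕ.+-mono-≤ (ℕ.*-monoˡ-≤ 6 kind-mono) (ℕ.*-mono-≤ kind-mono thresholdBound-mono)) clique-mono)

startup degree solveDegree : ℕ
startup = proj₁ program-runs
degree = proj₁ (proj₂ program-runs)
solveDegree = proj₁ (proj₂ (proj₂ program-runs))

-- A set of k vertices whose deletion leaves a cluster leads to a packing of at
-- most k paths, that is, to 3k vertices outside the cliques.
timeA : Arith
timeA = const startup ⊕ ((const 19 ⊕ thresholdA (const 3 ⊗ var)) ↑ const degree ⊕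
  (const 2 ⊕ kernelA (const 3 ⊗ var)) ↑ (const solveDegree ⊕ kernelA (const 3 ⊗ var) ⊗ const perStep))

spread : ∀ {a b b′ d d′ e} → b ≤ b′ → d ≤ d′ → 1 ≤ e → a + (b * e + d) ≤ (a + (b′ + d′)) * e
spread {a} {b} {b′} {d} {d′} {e} p q r = ℕ.≤-trans
  (ℕ.+-mono-≤ (ℕ.m≤m*n a e {{Data.Nat.>-nonZero r}}) (ℕ.+-mono-≤ (ℕ.*-monoˡ-≤ e p) (ℕ.≤-trans q (ℕ.m≤m*n d′ e {{Data.Nat.>-nonZero r}}))))
  (ℕ.≤-reflexive (factor a b′ d′ e))
  where
  factor : ∀ a b d e → a * e + (b * e + d * e) ≡ (a + (b + d)) * e
  factor = solve-∀

^-distribʳ-* : ∀ e a b → (a * b) ^ e ≡ a ^ e * b ^ e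
^-distribʳ-* zero a b = refl
^-distribʳ-* (suc e) a b = trans (cong (a * b *_) (^-distribʳ-* e a b)) (interchange a b (a ^ e) (b ^ e))
  where
  interchange : ∀ a b x y → a * b * (x * y) ≡ a * x * (b * y)
  interchange = solve-∀

time-bound : ∀ G {k t} → DistanceToCluster G k → let open Reduction G in
             t ≤ startup + (scale ^ degree + Ctx.β Γᴷ ^ (solveDegree + Ctx.n Γᴷ * perStep)) → t ≤ ⟦ timeA ⟧ k * (1 ⊔ order G) ^ degree
time-bound G {k} dist le = ℕ.≤-trans le (ℕ.≤-trans
  (ℕ.≤-reflexive (cong (λ s → startup + (s + Ctx.β Γᴷ ^ (solveDegree + Ctx.n Γᴷ * perStep))) (^-distribʳ-* degree (20 + threshold) (1 ⊔ order G))))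
  (spread {a = startup} (ℕ.^-monoˡ-≤ degree (ℕ.+-monoʳ-≤ 20 threshold≤))
    (ℕ.≤-trans (ℕ.^-monoˡ-≤ (solveDegree + Ctx.n Γᴷ * perStep) (ℕ.+-monoʳ-≤ 3 K≤))
      (ℕ.^-monoʳ-≤ (3 + kernelBound (3 * k)) (ℕ.+-monoʳ-≤ solveDegree (ℕ.*-monoˡ-≤ perStep K≤))))
    (ℕ.m^n>0 (1 ⊔ order G) {{Data.Nat.>-nonZero (ℕ.m≤m⊔n 1 (order G))}} degree)))
  where
  open Reduction G
  threshold≤ : threshold ≤ thresholdBound (3 * k)
  threshold≤ = ℕ.≤-trans KernelSizes.threshold-bound (thresholdBound-mono (X-bound dist))
  K≤ : length K ≤ kernelBound (3 * k)
  K≤ = ℕ.≤-trans KernelSizes.kernel-bound (kernelBound-mono (X-bound dist))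

theorem5p2 : FixedParameterTractable MBDomGame DistanceToCluster
theorem5p2 = program , ⟦ timeA ⟧ , degree , computable timeA , λ G first →
  let open Reduction G
      b = Value.value Γᴷ (Ctx.n Γᴷ) first (start-play Γᴷ)
      t , run , le = proj₂ (proj₂ (proj₂ program-runs)) G first in
  winner b , t ,
  subst (λ x → Runs program (cons (encodePlayer first) (encodeGraph G)) x t) (sym (encode-winner b)) run ,
  winner-wins G first b (⟷-trans (kernel-value first) (⟷-sym (Game-kernel first))) ,
  λ k dist → time-bound G dist le
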